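{- Let $r$ and $d\geq2$ be positive integers and $0<\delta<1$ real. Let $P$ be an intersective integer polynomial of degree $d$ satisfying $1\leq P(x)<P(y)$ for all real $1\leq x<y$. Let $s\geq1$, $t\geq0$ be integers with $s+t\geq s_0(d)$. Let $L_1(\mathbf{x})\in\mathbb{Z}[x_1,\ldots,x_s]$ be a non-degenerate linear form with $L_1(1,\ldots,1)=0$ and let $L_2(\mathbf{y})\in\mathbb{Z}[y_1,\ldots,y_t]$ be a non-degenerate linear form. Then there is a constant $c>0$ depending only on $L_1,L_2,P,r,\delta$ (and not on $D$) such that the following holds. Let $D,Z\in\mathbb{N}$ with $Z\geq Z_0(D,r,\delta,L_1,L_2,P)$ for a suitable threshold $Z_0$, and set $N=P_D(Z)$. If $[Z]=\mathcal{C}_1\cup\cdots\cup\mathcal{C}_r$, then there exists $k\in[r]$ such that for all $\mathcal{A}\subseteq[N]$ with $|\mathcal{A}|\geq\delta N$, $$\#\{(\mathbf{n},\mathbf{z})\in\mathcal{A}^s\times\mathcal{C}_k^t: L_1(\mathbf{n})=L_2(P_D(\mathbf{z}))\}\geq cN^{s-1}Z^t.$$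
   Context: $[X]=\{1,\ldots,X\}$. A polynomial is intersective if for every positive integer $n$ it has an integer zero modulo $n$. A linear form $b_1x_1+\cdots+b_tx_t$ is non-degenerate if all $b_j$ are non-zero integers; if $t=0$, $L_2$ is taken to be $0$. $T(d)$ is the least positive integer $T$ such that for every integer polynomial $P$ of degree $d$ and every $\varepsilon>0$, the number of $\mathbf{x}\in[X]^{2T}$ with $P(x_1)+\cdots+P(x_T)=P(x_{T+1})+\cdots+P(x_{2T})$ is $O_{P,\varepsilon}(X^{2T-d+\varepsilon})$; $s_0(d)=2T(d)+1$. Auxiliary polynomial: for each prime $p$ fix $z_p\in\mathbb{Z}_p$ with $P(z_p)=0$, with multiplicity $m_p$; $\lambda(D)=\prod_p p^{m_p\mathrm{ord}_p(D)}$; $r_D$ is the unique integer in $(-D,0]$ with $r_D\equiv z_p\pmod{p^{\mathrm{ord}_p(D)}\mathbb{Z}_p}$ for all $p$; $P_D(x)=P(r_D+Dx)/\lambda(D)\in\mathbb{Z}[x]$, and $P_D(\mathbf{z})=(P_D(z_1),\ldots,P_D(z_t))$. -}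

module Defs where

open import Data.Nat as ℕ using (ℕ; zero; suc; _∸_; NonZero)
open import Data.Nat.Divisibility as ℕD using (_∣?_)
open import Data.Nat.Primality using (Prime; prime?)
import Data.Nat.Combinatorics as Comb
open import Data.Integer as ℤ using (ℤ; +_; 0ℤ; 1ℤ)
open import Data.Integer.Divisibility as ℤD using ()
open import Data.Rational as ℚ using (ℚ; 0ℚ; 1ℚ)
open import Data.List using (List; []; _∷_; length; last; map; concatMap; cartesianProduct; foldr; applyUpTo)
open import Data.Vec as Vec using (Vec)
open import Data.Fin using (Fin)
open import Data.Maybe using (just)
open import Data.Bool using (Bool; true; false; if_then_else_; _∧_)
open import Data.Product using (Σ; ∃; ∃-syntax; _×_; _,_; proj₁; proj₂)
open import Relation.Nullary using (¬_; does)
open import Relation.Binary.PropositionalEquality using (_≡_; _≢_)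

-- Integer polynomials as coefficient lists  a₀ ∷ a₁ ∷ … ∷ a_d  (low → high)

Poly : Set
Poly = List ℤ

eval : Poly → ℤ → ℤ
eval P x = foldr (λ a acc → a ℤ.+ x ℤ.* acc) 0ℤ P

evalℚ : Poly → ℚ → ℚ
evalℚ P x = foldr (λ a acc → (a ℚ./ 1) ℚ.+ x ℚ.* acc) 0ℚ P

HasDegree : Poly → ℕ → Set
HasDegree P d = (length P ≡ suc d) × (∀ a → last P ≡ just a → a ≢ 0ℤ)

Intersective : Poly → Set
Intersective P = ∀ (n : ℕ) → 1 ℕ.≤ n → ∃[ x ] ((+ n) ℤD.∣ eval P x)

Increasing : Poly → Set
Increasing P = ∀ (x y : ℚ) → 1ℚ ℚ.≤ x → x ℚ.< y →
  (1ℚ ℚ.≤ evalℚ P x) × (evalℚ P x ℚ.< evalℚ P y)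

-- j-th Hasse derivative P^{(j)}/j! (integer coefficients)
hasse : ℕ → Poly → Poly
hasse j P = go 0 (dropL j P)
  where
  dropL : ℕ → Poly → Poly
  dropL zero    as       = as
  dropL (suc k) []       = []
  dropL (suc k) (_ ∷ as) = dropL k as
  go : ℕ → Poly → Poly
  go i []       = []
  go i (a ∷ as) = (+ ((i ℕ.+ j) Comb.C j)) ℤ.* a ∷ go (suc i) as

-- p-adic integers as compatible sequences of approximations:
-- zp k is an integer, and zp (k+1) ≡ zp k (mod p^k).

IsPAdic : ℕ → (ℕ → ℤ) → Set
IsPAdic p zp = ∀ k → (+ (p ℕ.^ k)) ℤD.∣ (zp (suc k) ℤ.- zp k)

VanishesAt : ℕ → Poly → (ℕ → ℤ) → Set
VanishesAt p Q zp = ∀ k → (+ (p ℕ.^ k)) ℤD.∣ eval Q (zp k)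

IsRootOfMult : ℕ → Poly → (ℕ → ℤ) → ℕ → Set
IsRootOfMult p P zp m =
  (∀ j → j ℕ.< m → VanishesAt p (hasse j P) zp) × ¬ VanishesAt p (hasse m P) zp

IsRootChoice : Poly → (ℕ → ℕ → ℤ) → (ℕ → ℕ) → Set
IsRootChoice P z m = ∀ p → Prime p →
  IsPAdic p (z p) × VanishesAt p P (z p) × IsRootOfMult p P (z p) (m p)

-- p-adic valuation ord_p(n) (with fuel n; ord_p 0 is set to 0, unused)

ordF : ℕ → ℕ → ℕ → ℕ
ordF zero    _             _       = 0
ordF (suc f) (suc (suc q)) (suc n) with suc (suc q) ∣? suc n
... | Relation.Nullary.yes _ = suc (ordF f (suc (suc q)) (suc n ℕ./ suc (suc q)))
... | Relation.Nullary.no  _ = 0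
ordF (suc f) _ _ = 0

ord : ℕ → ℕ → ℕ
ord p n = ordF n p n

-- λ(D) = ∏_p p^{m_p ord_p D}  (only primes p ≤ D can contribute)
lam : (ℕ → ℕ) → ℕ → ℕ
lam m D = foldr ℕ._*_ 1 (applyUpTo factor (suc D))
  where
  factor : ℕ → ℕ
  factor p = if does (prime? p) then p ℕ.^ (m p ℕ.* ord p D) else 1

IsRD : (ℕ → ℕ → ℤ) → ℕ → ℤ → Set
IsRD z D r = (ℤ.- (+ D) ℤ.< r) × (r ℤ.≤ 0ℤ) ×
  (∀ p → Prime p → (+ (p ℕ.^ ord p D)) ℤD.∣ (r ℤ.- z p (ord p D)))

IsPD : Poly → (ℕ → ℕ) → ℕ → ℤ → (ℤ → ℤ) → Set
IsPD P m D r Q = ∀ x → (+ lam m D) ℤ.* Q x ≡ eval P (r ℤ.+ (+ D) ℤ.* x)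

countB : {A : Set} → (A → Bool) → List A → ℕ
countB f []       = 0
countB f (a ∷ as) = if f a then suc (countB f as) else countB f as

range : ℕ → List ℕ
range X = applyUpTo suc X

vecs : List ℕ → (n : ℕ) → List (Vec ℕ n)
vecs L zero    = Vec.[] ∷ []
vecs L (suc n) = concatMap (λ a → map (a Vec.∷_) (vecs L n)) L

allB : {n : ℕ} → (ℕ → Bool) → Vec ℕ n → Bool
allB f Vec.[]       = true
allB f (x Vec.∷ xs) = f x ∧ allB f xs

sumP : {n : ℕ} → Poly → Vec ℕ n → ℤ
sumP P Vec.[]       = 0ℤ
sumP P (x Vec.∷ xs) = eval P (+ x) ℤ.+ sumP P xs

energy : Poly → ℕ → ℕ → ℕ
energy P T X = countB (λ uv → does (sumP P (proj₁ uv) ℤ.≟ sumP P (proj₂ uv)))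
                      (cartesianProduct (vecs (range X) T) (vecs (range X) T))

-- for every P of degree d and every ε = a/b > 0:
-- energy ≪ X^{2T-d+ε}, written without negative/fractional exponents as
-- energy^b · X^{bd} ≤ C · X^{2Tb + a}  for X ≥ X₀
GoodT : ℕ → ℕ → Set
GoodT d T = ∀ (P : Poly) → HasDegree P d → ∀ (a b : ℕ) → 1 ℕ.≤ a → 1 ℕ.≤ b →
  ∃[ K ] ∃[ X₀ ] ∀ X → X₀ ℕ.≤ X →
    (energy P T X ℕ.^ b) ℕ.* (X ℕ.^ (b ℕ.* d)) ℕ.≤ K ℕ.* X ℕ.^ (b ℕ.* (2 ℕ.* T) ℕ.+ a)

IsT : ℕ → ℕ → Set
IsT d T = (1 ℕ.≤ T) × GoodT d T × (∀ T′ → 1 ℕ.≤ T′ → T′ ℕ.< T → ¬ GoodT d T′)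

S0Le : ℕ → ℕ → Set
S0Le d n = ∃[ T ] (IsT d T × (2 ℕ.* T ℕ.+ 1 ℕ.≤ n))

NonDegenerate : {n : ℕ} → Vec ℤ n → Set
NonDegenerate {n} b = ∀ (i : Fin n) → Vec.lookup b i ≢ 0ℤ

linForm : {n : ℕ} → Vec ℤ n → Vec ℤ n → ℤ
linForm Vec.[]       Vec.[]       = 0ℤ
linForm (b Vec.∷ bs) (x Vec.∷ xs) = b ℤ.* x ℤ.+ linForm bs xs

solCount : {s t : ℕ} → Vec ℤ s → Vec ℤ t → (ℤ → ℤ) → ℤ → ℕ →
           (ℕ → Bool) → (ℕ → Bool) → ℕ
solCount {s} {t} L₁ L₂ Q N Z A Cs =
  countB (λ nz → allB A (proj₁ nz) ∧ allB Cs (proj₂ nz) ∧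
                 does (linForm L₁ (Vec.map +_ (proj₁ nz)) ℤ.≟
                       linForm L₂ (Vec.map (λ z → Q (+ z)) (proj₂ nz))))
         (cartesianProduct (vecs (range (ℤ.∣ N ∣)) s) (vecs (range Z) t))

SubsetUpTo : (ℕ → Bool) → ℤ → Set
SubsetUpTo A N = ∀ n → A n ≡ true → (1 ℕ.≤ n) × ((+ n) ℤ.≤ N)

card : (ℕ → Bool) → ℤ → ℕ
card A N = countB A (range (ℤ.∣ N ∣))

IsCover : (r Z : ℕ) → (Fin r → ℕ → Bool) → Set
IsCover r Z Cs = (∀ k n → Cs k n ≡ true → (1 ℕ.≤ n) × (n ℕ.≤ Z)) ×
                (∀ n → 1 ℕ.≤ n → n ℕ.≤ Z → ∃[ k ] (Cs k n ≡ true))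

{-# OPTIONS --safe #-}
-- Embed [N] in ℤ/M, where M exceeds both sides of the equation by a bounded factor and M − 1 is a multiple of λ(D) and of
-- the coefficients of L₁.  These become units, and since L₁(1,…,1) = 0 the equation reads n₀ = v + Σ αᵢnᵢ with Σ αᵢ = 1,
-- where v is linear in the values P(r_D + Dz).  An energy increment with Croot–Sisask almost periods gives, for every dense A,
-- a dense F such that each v has at least about (F ∗ −F)(v) solutions in A, uniformly in M.
-- If each colour k had an exceptional set A_k, let F_k be attached to it.  Polynomial multiple recurrence in a product system,
-- for rt variables at once, makes all these correlations simultaneously large on average; by pigeonhole t of the variables
-- have the same colour k, so A_k was not exceptional.
-- The recurrence follows from Weyl differencing and an energy increment for averaging operators.  It only needs the
-- polynomial to have roots modulo every Q, which for P_D follows from the compatible p-adic roots by the Chinese remainder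
-- theorem.
module Submission where

open import Defs
open import Level using (0ℓ)
open import Data.Nat as ℕ using (ℕ; zero; suc; _!)
import Data.Nat.Properties as ℕP
import Data.Nat.Divisibility as ℕD
open import Data.Integer as ℤ using (ℤ; +_; -[1+_])
import Data.Integer.Properties as ℤP
open import Data.Rational as ℚ using (ℚ; 0ℚ; 1ℚ; _≤_; _<_)
import Data.Rational.Properties as ℚP
open import Data.Fin as Fin using (Fin; zero; suc; toℕ)
import Data.Fin.Properties as FinP
open import Data.Vec as Vec using (Vec; []; _∷_; replicate)
open import Data.List as List using (List; []; _∷_)
open import Data.Bool as Bool using (Bool; true; false; if_then_else_; _∧_; not)
open import Data.Product using (Σ; ∃-syntax; _×_; _,_; proj₁; proj₂)
open import Data.Sum using (_⊎_; inj₁; inj₂)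
open import Data.Empty using (⊥-elim)
open import Data.Unit using (⊤; tt)
open import Function using (_∘_)
open import Relation.Nullary using (¬_; Dec; yes; no; does)
open import Relation.Nullary.Decidable using (dec⇒maybe; dec-true; decidable-stable; _→-dec_; ¬?)
open import Relation.Binary.PropositionalEquality using (_≡_; _≢_; refl; sym; trans; cong; cong₂; subst; subst₂)
open import Tactic.RingSolver using (solve-∀)
open import Tactic.RingSolver.Core.AlmostCommutativeRing using (AlmostCommutativeRing; fromCommutativeRing)
import Data.Rational.Unnormalised as ℚᵘ
import Data.Rational.Unnormalised.Properties as ℚᵘP
import Data.Integer.Divisibility.Signed as ℤS
import Data.Nat.DivMod as ℕDM
import Data.Nat.Tactic.RingSolver as ℕR
open import Algebra.Structures using (IsCommutativeRing)
open import Algebra.Bundles using (CommutativeRing)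
import Algebra.Solver.Ring as RingSolver
import Algebra.Solver.Ring.AlmostCommutativeRing as ACR
open import Data.Maybe as Maybe using (Maybe; just)
open import Data.Vec.Relation.Unary.All as All using (All; []; _∷_)
open import Data.List.Relation.Unary.Any using (here; there)
open import Data.List.Membership.Propositional using (_∈_)
import Data.List.Membership.Propositional.Properties as Mem
import Data.Nat.Coprimality as ℕCop
open import Data.Nat.GCD using (module Bézout)
open import Data.Nat.Primality using (Prime; prime⇒irreducible; prime⇒nonZero; prime⇒nonTrivial)
open import Data.Nat.Primality.Factorisation using (factorise; module PrimeFactorisation)
open import Data.Nat.Induction using (<-rec)
import Data.List.Relation.Unary.All as LAll
open import Data.Nat.ListAction using (product)
import Data.Integer.DivMod as ℤDM
open import Algebra.Bundles using (CommutativeMonoid)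
import Algebra.Properties.CommutativeMonoid.Sum as MonoidSum
import Data.Fin.Permutation as Perm
import Data.Fin.Subset.Properties as SubsetP

-- Rational arithmetic and finite averages

-- The constant must not see D, whereas the coefficients of P(r_D + Dx) vary with D. Every estimate
-- for c₀ + c₁x + ... + c_d x^d is therefore uniform in the coefficients: shifts are measured in
-- multiples of Q·c_l, averages run over boxes with sides Q·c_l·[0, ξ^l), and the constants depend
-- on the degree, the error and the moduli Q, which are chosen before the c_l. D influences only the
-- threshold for Z and the modulus M. The recurrence concerns P(r_D + Dx) = λ(D)·P_D(x), and λ(D) is
-- divided out inside ℤ/M. Almost invariance is a bound on operators, valid for every function and
-- every measure-preserving action. Averages along a commuting action commute and contract, so one
-- function F can be treated one variable at a time. All arithmetic is rational: norms appear
-- squared, the triangle inequality becomes ‖a + b‖² ≤ 2‖a‖² + 2‖b‖², and inner products are bounded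
-- by Young's inequality with st = 1. The colour is chosen before A, so for each colour a finite
-- search either confirms every A or exhibits an exceptional one.

ℚ-ring : AlmostCommutativeRing 0ℓ 0ℓ
ℚ-ring = fromCommutativeRing ℚP.+-*-commutativeRing (λ x → dec⇒maybe (0ℚ ℚ.≟ x))

ℤ-ring : AlmostCommutativeRing 0ℓ 0ℓ
ℤ-ring = fromCommutativeRing ℤP.+-*-commutativeRing (λ x → dec⇒maybe (ℤ.0ℤ ℤ.≟ x))

-- The operations of ℚ are made opaque because their unfoldings are large;
-- ring identities are proved in blocks where they are transparent.
infixl 6 _⊕_ _⊝_
infixl 7 _⊗_
infix 8 ⊖_

opaque
  _⊕_ _⊗_ _⊝_ : ℚ → ℚ → ℚ
  _⊕_ = ℚ._+_
  _⊗_ = ℚ._*_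
  x ⊝ y = x ℚ.+ (ℚ.- y)
  ⊖_ : ℚ → ℚ
  ⊖_ = ℚ.-_

  int : ℤ → ℚ
  int i = i ℚ./ 1

  inv : ℕ → ℚ
  inv n = + 1 ℚ./ suc n

nat : ℕ → ℚ
nat n = int (+ n)

2# 4# 8# : ℚ
2# = + 2 ℚ./ 1
4# = + 4 ℚ./ 1
8# = + 8 ℚ./ 1

opaque
  unfolding _⊕_

  ⊕-≡ : ∀ x y → x ⊕ y ≡ x ℚ.+ y
  ⊕-≡ _ _ = refl

  ⊗-≡ : ∀ x y → x ⊗ y ≡ x ℚ.* y
  ⊗-≡ _ _ = refl

  int-≡ : ∀ i → int i ≡ i ℚ./ 1
  int-≡ _ = refl

  ⊕-comm : ∀ x y → x ⊕ y ≡ y ⊕ x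
  ⊕-comm = ℚP.+-comm

  ⊕-assoc : ∀ x y z → x ⊕ y ⊕ z ≡ x ⊕ (y ⊕ z)
  ⊕-assoc = ℚP.+-assoc

  ⊕-idˡ : ∀ x → 0ℚ ⊕ x ≡ x
  ⊕-idˡ = ℚP.+-identityˡ

  ⊕-idʳ : ∀ x → x ⊕ 0ℚ ≡ x
  ⊕-idʳ = ℚP.+-identityʳ

  ⊗-comm : ∀ x y → x ⊗ y ≡ y ⊗ x
  ⊗-comm = ℚP.*-comm

  ⊗-assoc : ∀ x y z → x ⊗ y ⊗ z ≡ x ⊗ (y ⊗ z)
  ⊗-assoc = ℚP.*-assoc

  ⊗-idˡ : ∀ x → 1ℚ ⊗ x ≡ x
  ⊗-idˡ = ℚP.*-identityˡ

  ⊗-idʳ : ∀ x → x ⊗ 1ℚ ≡ x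
  ⊗-idʳ = ℚP.*-identityʳ

  ⊗-zeroˡ : ∀ x → 0ℚ ⊗ x ≡ 0ℚ
  ⊗-zeroˡ = ℚP.*-zeroˡ

  ⊗-zeroʳ : ∀ x → x ⊗ 0ℚ ≡ 0ℚ
  ⊗-zeroʳ = ℚP.*-zeroʳ

  ⊗-distribˡ : ∀ x y z → x ⊗ (y ⊕ z) ≡ x ⊗ y ⊕ x ⊗ z
  ⊗-distribˡ = ℚP.*-distribˡ-+

  ⊗-distribʳ : ∀ x y z → (y ⊕ z) ⊗ x ≡ y ⊗ x ⊕ z ⊗ x
  ⊗-distribʳ = ℚP.*-distribʳ-+

  ⊕-cancel-⊝ : ∀ x y → x ⊕ (y ⊝ x) ≡ y
  ⊕-cancel-⊝ = solve-∀ ℚ-ring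

  ⊝-self : ∀ x → x ⊝ x ≡ 0ℚ
  ⊝-self = solve-∀ ℚ-ring

  ⊝-def : ∀ x y → x ⊝ y ≡ x ⊕ ⊖ 1ℚ ⊗ y
  ⊝-def = solve-∀ ℚ-ring

  +-interchange : ∀ a b c d → (a ⊕ b) ⊕ (c ⊕ d) ≡ (a ⊕ c) ⊕ (b ⊕ d)
  +-interchange = solve-∀ ℚ-ring

  ⊗-left-comm : ∀ a b c → a ⊗ (b ⊗ c) ≡ b ⊗ (a ⊗ c)
  ⊗-left-comm = solve-∀ ℚ-ring

  ⊕-mono : ∀ {a b c d} → a ≤ b → c ≤ d → a ⊕ c ≤ b ⊕ d
  ⊕-mono = ℚP.+-mono-≤

  ⊗-monoˡ : ∀ {a b} c → 0ℚ ≤ c → a ≤ b → c ⊗ a ≤ c ⊗ b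
  ⊗-monoˡ c 0≤c = ℚP.*-monoˡ-≤-nonNeg c ⦃ ℚ.nonNegative 0≤c ⦄

  ⊗-monoʳ : ∀ {a b} c → 0ℚ ≤ c → a ≤ b → a ⊗ c ≤ b ⊗ c
  ⊗-monoʳ c 0≤c = ℚP.*-monoʳ-≤-nonNeg c ⦃ ℚ.nonNegative 0≤c ⦄

  ⊗-pos : ∀ {a b} → 0ℚ < a → 0ℚ < b → 0ℚ < a ⊗ b
  ⊗-pos {a} {b} 0<a 0<b = subst (_< a ℚ.* b) (ℚP.*-zeroʳ a)
    (ℚP.*-monoʳ-<-pos a ⦃ ℚ.positive 0<a ⦄ 0<b)

  ⊝-nonneg : ∀ {a b} → a ≤ b → 0ℚ ≤ b ⊝ a
  ⊝-nonneg {a} {b} a≤b = subst (_≤ b ℚ.- a) (ℚP.+-inverseʳ a) (ℚP.+-monoˡ-≤ (ℚ.- a) a≤b)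

  square-nonneg : ∀ x → 0ℚ ≤ x ⊗ x
  square-nonneg x with ℚP.≤-total 0ℚ x
  ... | inj₁ p = subst (_≤ x ℚ.* x) (ℚP.*-zeroʳ x) (ℚP.*-monoˡ-≤-nonNeg x ⦃ ℚ.nonNegative p ⦄ p)
  ... | inj₂ p = subst (_≤ x ℚ.* x) (ℚP.*-zeroʳ x) (ℚP.*-monoˡ-≤-nonPos x ⦃ ℚ.nonPositive p ⦄ p)

  private
    toℚᵘ-int : ∀ i → ℚ.toℚᵘ (int i) ℚᵘ.≃ ℚᵘ.mkℚᵘ i 0
    toℚᵘ-int i = ℚP.toℚᵘ-fromℚᵘ (ℚᵘ.mkℚᵘ i 0)

    add1 : ∀ i j → (i ℤ.+ j) ℤ.* + 1 ≡ (i ℤ.* + 1 ℤ.+ j ℤ.* + 1) ℤ.* + 1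
    add1 = solve-∀ ℤ-ring

  int-+ : ∀ i j → int (i ℤ.+ j) ≡ int i ⊕ int j
  int-+ i j = ℚP.toℚᵘ-injective (ℚᵘP.≃-trans (toℚᵘ-int (i ℤ.+ j))
    (ℚᵘP.≃-trans (ℚᵘ.*≡* (add1 i j))
      (ℚᵘP.≃-sym (ℚᵘP.≃-trans (ℚP.toℚᵘ-homo-+ (int i) (int j)) (ℚᵘP.+-cong (toℚᵘ-int i) (toℚᵘ-int j))))))

  int-* : ∀ i j → int (i ℤ.* j) ≡ int i ⊗ int j
  int-* i j = ℚP.toℚᵘ-injective (ℚᵘP.≃-trans (toℚᵘ-int (i ℤ.* j))
    (ℚᵘP.≃-trans (ℚᵘ.*≡* refl)
      (ℚᵘP.≃-sym (ℚᵘP.≃-trans (ℚP.toℚᵘ-homo-* (int i) (int j)) (ℚᵘP.*-cong (toℚᵘ-int i) (toℚᵘ-int j))))))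

  int-0 : int (+ 0) ≡ 0ℚ
  int-0 = refl

  int-1 : int (+ 1) ≡ 1ℚ
  int-1 = refl

  int-mono : ∀ {i j} → i ℤ.≤ j → int i ≤ int j
  int-mono {i} {j} i≤j = ℚP.toℚᵘ-cancel-≤ (ℚᵘP.≤-respˡ-≃ (ℚᵘP.≃-sym (toℚᵘ-int i))
    (ℚᵘP.≤-respʳ-≃ (ℚᵘP.≃-sym (toℚᵘ-int j)) (ℚᵘ.*≤* (ℤP.*-monoʳ-≤-nonNeg (+ 1) i≤j))))

  int-cancel-≤ : ∀ {i j} → int i ≤ int j → i ℤ.≤ j
  int-cancel-≤ {i} {j} p with ℚᵘP.≤-respˡ-≃ (toℚᵘ-int i) (ℚᵘP.≤-respʳ-≃ (toℚᵘ-int j) (ℚP.toℚᵘ-mono-≤ p))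
  ... | ℚᵘ.*≤* q = ℤP.*-cancelʳ-≤-pos i j (+ 1) q

  int-mono-< : ∀ {i j} → i ℤ.< j → int i < int j
  int-mono-< {i} {j} i<j = ℚP.≰⇒> (λ p → ℤP.<⇒≱ i<j (int-cancel-≤ p))

  nat-inv : ∀ n → nat (suc n) ⊗ inv n ≡ 1ℚ
  nat-inv n = ℚP.toℚᵘ-injective (ℚᵘP.≃-trans (ℚP.toℚᵘ-homo-* (nat (suc n)) (inv n))
    (ℚᵘP.≃-trans (ℚᵘP.*-cong (toℚᵘ-int (+ suc n)) (ℚP.toℚᵘ-fromℚᵘ (ℚᵘ.mkℚᵘ (+ 1) n)))
      (ℚᵘP.*-inverseʳ (ℚᵘ.mkℚᵘ (+ suc n) 0))))

  inv-pos : ∀ n → 0ℚ < inv n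
  inv-pos n = ℚP.positive⁻¹ (inv n) ⦃ ℚP.normalize-pos 1 (suc n) ⦄

  recip : ∀ x → 0ℚ < x → ∃[ y ] (0ℚ < y × x ⊗ y ≡ 1ℚ)
  recip x 0<x = ℚ.1/ x , ℚP.positive⁻¹ (ℚ.1/ x) ⦃ ℚP.1/pos⇒pos x ⦄ , ℚP.*-inverseʳ x
    where instance
      pos : ℚ.Positive x
      pos = ℚ.positive 0<x
      nonZero : ℚ.NonZero x
      nonZero = ℚP.pos⇒nonZero x

  archimedean : ∀ x → ∃[ n ] x ≤ nat n
  archimedean x@(ℚ.mkℚ a b-1 _) = ℤ.∣ a ∣ ,
    ℚP.toℚᵘ-cancel-≤ (ℚᵘP.≤-respʳ-≃ (ℚᵘP.≃-sym (toℚᵘ-int (+ ℤ.∣ a ∣))) (ℚᵘ.*≤*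
      (ℤP.≤-trans (ℤP.*-monoʳ-≤-nonNeg (+ 1) (i≤∣i∣ a))
        (ℤP.*-monoˡ-≤-nonNeg (+ ℤ.∣ a ∣) {+ 1} {+ suc b-1} (ℤ.+≤+ (ℕ.s≤s ℕ.z≤n))))))
    where
    i≤∣i∣ : ∀ i → i ℤ.≤ + ℤ.∣ i ∣
    i≤∣i∣ (+ n) = ℤP.≤-refl
    i≤∣i∣ -[1+ n ] = ℤ.-≤+

nat-+ : ∀ m n → nat (m ℕ.+ n) ≡ nat m ⊕ nat n
nat-+ m n = int-+ (+ m) (+ n)

nat-* : ∀ m n → nat (m ℕ.* n) ≡ nat m ⊗ nat n
nat-* m n = trans (cong int (ℤP.pos-* m n)) (int-* (+ m) (+ n))

nat-0 : nat 0 ≡ 0ℚ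
nat-0 = int-0

nat-1 : nat 1 ≡ 1ℚ
nat-1 = int-1

nat-mono : ∀ {m n} → m ℕ.≤ n → nat m ≤ nat n
nat-mono p = int-mono (ℤ.+≤+ p)

nat-suc : ∀ n → nat (suc n) ≡ 1ℚ ⊕ nat n
nat-suc n = trans (nat-+ 1 n) (cong (_⊕ nat n) nat-1)

nat-nonneg : ∀ n → 0ℚ ≤ nat n
nat-nonneg n = subst (_≤ nat n) nat-0 (nat-mono ℕ.z≤n)

0≤1 : 0ℚ ≤ 1ℚ
0≤1 = subst (0ℚ ≤_) nat-1 (nat-nonneg 1)

≤-refl : ∀ {x} → x ≤ x
≤-refl = ℚP.≤-refl

≤-trans : ∀ {x y z} → x ≤ y → y ≤ z → x ≤ z
≤-trans = ℚP.≤-trans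

≡⇒≤ : ∀ {x y} → x ≡ y → x ≤ y
≡⇒≤ refl = ℚP.≤-refl

⊕-nonneg : ∀ {a b} → 0ℚ ≤ a → 0ℚ ≤ b → 0ℚ ≤ a ⊕ b
⊕-nonneg {a} {b} p q = subst (_≤ a ⊕ b) (⊕-idˡ 0ℚ) (⊕-mono p q)

⊗-nonneg : ∀ {a b} → 0ℚ ≤ a → 0ℚ ≤ b → 0ℚ ≤ a ⊗ b
⊗-nonneg {a} {b} p q = subst (_≤ a ⊗ b) (⊗-zeroʳ a) (⊗-monoˡ a p q)

⊗-mono : ∀ {a b c d} → 0ℚ ≤ a → 0ℚ ≤ d → a ≤ b → c ≤ d → a ⊗ c ≤ b ⊗ d
⊗-mono {a} {b} {c} {d} 0≤a 0≤d p q = ≤-trans (⊗-monoˡ a 0≤a q) (⊗-monoʳ d 0≤d p)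

≤-by : ∀ {a b} e → 0ℚ ≤ e → a ⊕ e ≡ b → a ≤ b
≤-by {a} e 0≤e refl = subst (_≤ a ⊕ e) (⊕-idʳ a) (⊕-mono ≤-refl 0≤e)

≤-⊕ʳ : ∀ {a b} → 0ℚ ≤ b → a ≤ a ⊕ b
≤-⊕ʳ {a} {b} p = ≤-by b p refl

≤-⊕ˡ : ∀ {a b} → 0ℚ ≤ b → a ≤ b ⊕ a
≤-⊕ˡ {a} {b} p = ≤-by b p (⊕-comm a b)

from-⊝-nonneg : ∀ {a b} → 0ℚ ≤ b ⊝ a → a ≤ b
from-⊝-nonneg {a} {b} p = ≤-by (b ⊝ a) p (⊕-cancel-⊝ a b)

<⇒≤ : ∀ {a b} → a < b → a ≤ b
<⇒≤ = ℚP.<⇒≤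

inv-nonneg : ∀ n → 0ℚ ≤ inv n
inv-nonneg n = <⇒≤ (inv-pos n)

small : ∀ x ε → 0ℚ < ε → ∃[ n ] x ⊗ inv n ≤ ε
small x ε 0<ε with recip ε 0<ε
... | y , 0<y , εy≡1 with archimedean (x ⊗ y)
... | n , xy≤n = n , subst₂ _≤_ eq₁ eq₂
      (⊗-monoˡ ε (<⇒≤ 0<ε) (⊗-monoʳ (inv n) (inv-nonneg n) (≤-trans xy≤n (nat-mono (ℕP.n≤1+n n)))))
  where
  eq₁ : ε ⊗ ((x ⊗ y) ⊗ inv n) ≡ x ⊗ inv n
  eq₁ = trans (sym (⊗-assoc ε (x ⊗ y) (inv n))) (cong (_⊗ inv n)
    (trans (⊗-left-comm ε x y) (trans (cong (x ⊗_) εy≡1) (⊗-idʳ x))))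
  eq₂ : ε ⊗ (nat (suc n) ⊗ inv n) ≡ ε
  eq₂ = trans (cong (ε ⊗_) (nat-inv n)) (⊗-idʳ ε)

inv-antitone : ∀ {m n} → m ℕ.≤ n → inv n ≤ inv m
inv-antitone {m} {n} m≤n = subst₂ _≤_ eq₁ eq₂
  (⊗-monoˡ (inv m ⊗ inv n) (⊗-nonneg (inv-nonneg m) (inv-nonneg n)) (nat-mono (ℕ.s≤s m≤n)))
  where
  eq₁ : inv m ⊗ inv n ⊗ nat (suc m) ≡ inv n
  eq₁ = trans (⊗-comm _ _) (trans (sym (⊗-assoc _ _ _)) (trans (cong (_⊗ inv n) (nat-inv m)) (⊗-idˡ _)))
  eq₂ : inv m ⊗ inv n ⊗ nat (suc n) ≡ inv m
  eq₂ = trans (⊗-assoc _ _ _) (trans (cong (inv m ⊗_) (trans (⊗-comm _ _) (nat-inv n))) (⊗-idʳ _))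

∑ : (n : ℕ) → (Fin n → ℚ) → ℚ
∑ zero f = 0ℚ
∑ (suc n) f = f zero ⊕ ∑ n (f ∘ suc)

∑-cong : ∀ n {f g : Fin n → ℚ} → (∀ i → f i ≡ g i) → ∑ n f ≡ ∑ n g
∑-cong zero p = refl
∑-cong (suc n) p = cong₂ _⊕_ (p zero) (∑-cong n (p ∘ suc))

∑-⊕ : ∀ n (f g : Fin n → ℚ) → ∑ n (λ i → f i ⊕ g i) ≡ ∑ n f ⊕ ∑ n g
∑-⊕ zero f g = sym (⊕-idˡ 0ℚ)
∑-⊕ (suc n) f g = trans (cong (f zero ⊕ g zero ⊕_) (∑-⊕ n (f ∘ suc) (g ∘ suc))) (+-interchange _ _ _ _)

∑-⊗ : ∀ n c (f : Fin n → ℚ) → ∑ n (λ i → c ⊗ f i) ≡ c ⊗ ∑ n f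
∑-⊗ zero c f = sym (⊗-zeroʳ c)
∑-⊗ (suc n) c f = trans (cong (c ⊗ f zero ⊕_) (∑-⊗ n c (f ∘ suc))) (sym (⊗-distribˡ c _ _))

∑-mono : ∀ n {f g : Fin n → ℚ} → (∀ i → f i ≤ g i) → ∑ n f ≤ ∑ n g
∑-mono zero p = ≤-refl
∑-mono (suc n) p = ⊕-mono (p zero) (∑-mono n (p ∘ suc))

∑-const : ∀ n c → ∑ n (λ _ → c) ≡ nat n ⊗ c
∑-const zero c = sym (trans (cong (_⊗ c) nat-0) (⊗-zeroˡ c))
∑-const (suc n) c = trans (cong₂ _⊕_ (sym (⊗-idˡ c)) (∑-const n c))
  (trans (sym (⊗-distribʳ c 1ℚ (nat n))) (cong (_⊗ c) (sym (nat-suc n))))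

-- Without function extensionality, respect for pointwise equality has to be a field of its own.
record Linear {B : Set} (L : (B → ℚ) → ℚ) : Set where
  field
    cng : ∀ {f g : B → ℚ} → (∀ b → f b ≡ g b) → L f ≡ L g
    add : ∀ (f g : B → ℚ) → L (λ b → f b ⊕ g b) ≡ L f ⊕ L g
    scl : ∀ c (f : B → ℚ) → L (λ b → c ⊗ f b) ≡ c ⊗ L f

  zer : L (λ _ → 0ℚ) ≡ 0ℚ
  zer = trans (cng (λ _ → sym (⊗-zeroˡ 0ℚ))) (trans (scl 0ℚ (λ _ → 0ℚ)) (⊗-zeroˡ _))

  sclʳ : ∀ c (f : B → ℚ) → L (λ b → f b ⊗ c) ≡ L f ⊗ c
  sclʳ c f = trans (cng (λ b → ⊗-comm (f b) c)) (trans (scl c f) (⊗-comm c _))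

  sub : ∀ (f g : B → ℚ) → L (λ b → f b ⊝ g b) ≡ L f ⊝ L g
  sub f g = trans (cng (λ b → ⊝-def (f b) (g b)))
    (trans (add f _) (trans (cong (L f ⊕_) (scl (⊖ 1ℚ) g)) (sym (⊝-def _ _))))

open Linear

∑-swap : ∀ n {B : Set} {L : (B → ℚ) → ℚ} → Linear L → (f : Fin n → B → ℚ) →
  ∑ n (λ i → L (f i)) ≡ L (λ b → ∑ n (λ i → f i b))
∑-swap zero lin f = sym (zer lin)
∑-swap (suc n) {L = L} lin f = trans (cong (L (f zero) ⊕_) (∑-swap n lin (f ∘ suc))) (sym (add lin _ _))

∑-pick : ∀ n (f : Fin (suc n) → ℚ) c → ∑ (suc n) f ≤ nat (suc n) ⊗ c → ∃[ i ] f i ≤ c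
∑-pick n f c p with FinP.any? (λ i → f i ℚ.≤? c)
... | yes q = q
... | no ¬q = ⊥-elim (ℚP.<-irrefl refl (ℚP.<-≤-trans (big n f (λ i → ℚP.≰⇒> (λ le → ¬q (i , le)))) p))
  where
  big : ∀ n (f : Fin (suc n) → ℚ) → (∀ i → c < f i) → nat (suc n) ⊗ c < ∑ (suc n) f
  big zero f h = subst₂ _<_ (sym (trans (cong (_⊗ c) nat-1) (⊗-idˡ c))) (sym (⊕-idʳ (f zero))) (h zero)
  big (suc n) f h = subst (_< ∑ (suc (suc n)) f)
    (sym (trans (cong (_⊗ c) (nat-suc (suc n))) (trans (⊗-distribʳ c 1ℚ (nat (suc n))) (cong (_⊕ nat (suc n) ⊗ c) (⊗-idˡ c)))))
    (subst₂ _<_ (sym (⊕-≡ c _)) (sym (⊕-≡ (f zero) _)) (ℚP.+-mono-< (h zero) (big n (f ∘ suc) (h ∘ suc))))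

-- An abstract average over finitely many points; `swap` is Fubini against an
-- arbitrary linear functional.
record Mean (A : Set) : Set₁ where
  field
    E : (A → ℚ) → ℚ
    lin : Linear E
    mono : ∀ {f g : A → ℚ} → (∀ a → f a ≤ g a) → E f ≤ E g
    one : ∀ c → E (λ _ → c) ≡ c
    swap : ∀ {B : Set} {L : (B → ℚ) → ℚ} → Linear L → (f : A → B → ℚ) →
      E (λ a → L (f a)) ≡ L (λ b → E (λ a → f a b))

  open Linear lin public

  nonneg : ∀ {f : A → ℚ} → (∀ a → 0ℚ ≤ f a) → 0ℚ ≤ E f
  nonneg {f} p = subst (_≤ E f) (one 0ℚ) (mono p)

  bound : ∀ {f : A → ℚ} {c} → (∀ a → f a ≤ c) → E f ≤ c
  bound {f} {c} p = subst (E f ≤_) (one c) (mono p)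

open Mean public using (E)

-- first-moment principle
Picks : ∀ {A : Set} → Mean A → Set
Picks {A} m = ∀ (f : A → ℚ) c → E m f ≤ c → ∃[ a ] f a ≤ c

fubini : ∀ {A B : Set} (m : Mean A) (n : Mean B) (f : A → B → ℚ) →
  E m (λ a → E n (f a)) ≡ E n (λ b → E m (λ a → f a b))
fubini m n f = Mean.swap m (Mean.lin n) f

-- Products, convolutions, push-forwards and the measures Δ*Δ are all obtained from `bind` and
-- `point`, so Fubini holds for each of them with no further work.
bind : ∀ {A B : Set} → Mean A → (A → Mean B) → Mean B
bind m k = record
  { E = λ f → E m (λ a → E (k a) f)
  ; lin = record
    { cng = λ p → Mean.cng m (λ a → Mean.cng (k a) p)
    ; add = λ f g → trans (Mean.cng m (λ a → Mean.add (k a) f g)) (Mean.add m _ _)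
    ; scl = λ c f → trans (Mean.cng m (λ a → Mean.scl (k a) c f)) (Mean.scl m c _)
    }
  ; mono = λ p → Mean.mono m (λ a → Mean.mono (k a) p)
  ; one = λ c → trans (Mean.cng m (λ a → Mean.one (k a) c)) (Mean.one m c)
  ; swap = λ l f → trans (Mean.cng m (λ a → Mean.swap (k a) l f)) (Mean.swap m l _)
  }

point : ∀ {A : Set} → A → Mean A
point a = record
  { E = λ f → f a
  ; lin = record { cng = λ p → p a ; add = λ _ _ → refl ; scl = λ _ _ → refl }
  ; mono = λ p → p a
  ; one = λ _ → refl
  ; swap = λ _ _ → refl
  }

picks-point : ∀ {A : Set} {a : A} → Picks (point a)
picks-point {a = a} f c p = a , p

push : ∀ {A B : Set} → (A → B) → Mean A → Mean B
push h m = bind m (λ a → point (h a))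

opaque
  uniform : (n : ℕ) → Mean (Fin (suc n))
  uniform n = record
    { E = λ f → inv n ⊗ ∑ (suc n) f
    ; lin = record
      { cng = λ p → cong (inv n ⊗_) (∑-cong (suc n) p)
      ; add = λ f g → trans (cong (inv n ⊗_) (∑-⊕ (suc n) f g)) (⊗-distribˡ _ _ _)
      ; scl = λ c f → trans (cong (inv n ⊗_) (∑-⊗ (suc n) c f)) (⊗-left-comm _ _ _)
      }
    ; mono = λ p → ⊗-monoˡ (inv n) (inv-nonneg n) (∑-mono (suc n) p)
    ; one = λ c → trans (cong (inv n ⊗_) (∑-const (suc n) c)) (inv-cancel c)
    ; swap = λ l f → trans (cong (inv n ⊗_) (∑-swap (suc n) l f)) (sym (scl l _ _))
    }
    where
    cancel-inv : ∀ x → nat (suc n) ⊗ (inv n ⊗ x) ≡ x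
    cancel-inv x = trans (sym (⊗-assoc _ _ _)) (trans (cong (_⊗ x) (nat-inv n)) (⊗-idˡ x))
    inv-cancel : ∀ x → inv n ⊗ (nat (suc n) ⊗ x) ≡ x
    inv-cancel x = trans (⊗-left-comm _ _ _) (cancel-inv x)

  E-uniform : ∀ n f → E (uniform n) f ≡ inv n ⊗ ∑ (suc n) f
  E-uniform n f = refl

  picks-uniform : ∀ n → Picks (uniform n)
  picks-uniform n f c p = ∑-pick n f c (subst (_≤ nat (suc n) ⊗ c) cancel (⊗-monoˡ (nat (suc n)) (nat-nonneg (suc n)) p))
    where
    cancel : nat (suc n) ⊗ (inv n ⊗ ∑ (suc n) f) ≡ ∑ (suc n) f
    cancel = trans (sym (⊗-assoc _ _ _)) (trans (cong (_⊗ ∑ (suc n) f) (nat-inv n)) (⊗-idˡ _))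

either : ∀ {a b} {A : Set a} {B : Set b} → Dec A → (A → B) → (¬ A → B) → B
either (yes p) f g = f p
either (no ¬p) f g = g ¬p

-- Averaging operators of a group action

record Grp : Set₁ where
  infixl 6 _+ᵍ_
  field
    Λ : Set
    _+ᵍ_ : Λ → Λ → Λ
    0ᵍ : Λ
    -ᵍ_ : Λ → Λ
    +ᵍ-assoc : ∀ u v w → (u +ᵍ v) +ᵍ w ≡ u +ᵍ (v +ᵍ w)
    +ᵍ-comm : ∀ u v → u +ᵍ v ≡ v +ᵍ u
    +ᵍ-idʳ : ∀ u → u +ᵍ 0ᵍ ≡ u
    +ᵍ-invʳ : ∀ u → u +ᵍ (-ᵍ u) ≡ 0ᵍ

-- `μ` stands for an invariant probability measure. The polynomial estimates quantify over all
-- ℤ-systems, so that they can later be applied to one system restricted to each coordinate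
-- direction in turn.
record Sys (G : Grp) : Set₁ where
  open Grp G
  field
    Y : Set
    μ : Mean Y
    act : Λ → Y → Y
    act-+ : ∀ u v y → act (u +ᵍ v) y ≡ act u (act v y)
    act-0 : ∀ y → act 0ᵍ y ≡ y
    invariant : ∀ u (f : Y → ℚ) → E μ (f ∘ act u) ≡ E μ f

opaque
  unfolding _⊕_

  sq-var : ∀ x e → (x ⊝ e) ⊗ (x ⊝ e) ≡ (x ⊗ x ⊝ (2# ⊗ e) ⊗ x) ⊕ e ⊗ e
  sq-var = solve-∀ ℚ-ring

  var-eq : ∀ s e → (s ⊝ (2# ⊗ e) ⊗ e) ⊕ e ⊗ e ≡ s ⊝ e ⊗ e
  var-eq = solve-∀ ℚ-ring

  sq-sum : ∀ a b → (a ⊕ b) ⊗ (a ⊕ b) ⊕ (a ⊝ b) ⊗ (a ⊝ b) ≡ 2# ⊗ (a ⊗ a) ⊕ 2# ⊗ (b ⊗ b)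
  sq-sum = solve-∀ ℚ-ring

  sq-diff : ∀ a b → (a ⊝ b) ⊗ (a ⊝ b) ⊕ (a ⊕ b) ⊗ (a ⊕ b) ≡ 2# ⊗ (a ⊗ a) ⊕ 2# ⊗ (b ⊗ b)
  sq-diff = solve-∀ ℚ-ring

  young-eq : ∀ s t a b → 2# ⊗ (a ⊗ b) ⊗ (s ⊗ t) ⊕ s ⊗ ((a ⊝ t ⊗ b) ⊗ (a ⊝ t ⊗ b)) ≡ s ⊗ (a ⊗ a) ⊕ (s ⊗ t) ⊗ t ⊗ (b ⊗ b)
  young-eq = solve-∀ ℚ-ring

  sq-scale : ∀ c x → (c ⊗ x) ⊗ (c ⊗ x) ≡ (c ⊗ c) ⊗ (x ⊗ x)
  sq-scale = solve-∀ ℚ-ring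

  δ-split : ∀ a b c → a ⊝ c ≡ (a ⊝ b) ⊕ (b ⊝ c)
  δ-split = solve-∀ ℚ-ring

  sq-flip : ∀ a b → (a ⊝ b) ⊗ (a ⊝ b) ≡ (b ⊝ a) ⊗ (b ⊝ a)
  sq-flip = solve-∀ ℚ-ring

  double : ∀ a → 2# ⊗ a ≡ a ⊕ a
  double = solve-∀ ℚ-ring

  0≤2 : 0ℚ ≤ 2#
  0≤2 = ℚP.nonNegative⁻¹ 2#

  0≤4 : 0ℚ ≤ 4#
  0≤4 = ℚP.nonNegative⁻¹ 4#

  4≡ : 2# ⊗ 1ℚ ⊕ 2# ⊗ 1ℚ ≡ 4#
  4≡ = refl

module _ {A : Set} (m : Mean A) where
  private module M = Mean m

  jensen : ∀ f → E m f ⊗ E m f ≤ E m (λ a → f a ⊗ f a)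
  jensen f = from-⊝-nonneg (subst (0ℚ ≤_) eq (M.nonneg (λ a → square-nonneg (f a ⊝ e))))
    where
    e = E m f
    eq : E m (λ a → (f a ⊝ e) ⊗ (f a ⊝ e)) ≡ E m (λ a → f a ⊗ f a) ⊝ e ⊗ e
    eq = trans (M.cng (λ a → sq-var (f a) e))
      (trans (M.add _ _) (trans (cong₂ _⊕_ (trans (M.sub _ _) (cong (E m (λ a → f a ⊗ f a) ⊝_) (M.scl (2# ⊗ e) f))) (M.one _))
        (var-eq _ e)))

module Theory (G : Grp) (S : Sys G) where
  open Grp G
  open Sys S
  private module Y = Mean μ

  Fun : Set
  Fun = Y → ℚ

  infixl 6 _+ᶠ_ _-ᶠ_
  _+ᶠ_ _-ᶠ_ : Fun → Fun → Fun
  (f +ᶠ g) y = f y ⊕ g y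
  (f -ᶠ g) y = f y ⊝ g y

  ⟨_,_⟩ : Fun → Fun → ℚ
  ⟨ f , g ⟩ = E μ (λ y → f y ⊗ g y)

  -- The squared L² norm; staying with squares keeps everything in ℚ.
  N : Fun → ℚ
  N f = ⟨ f , f ⟩

  op : Mean Λ → Fun → Fun
  op m f y = E m (λ u → f (act u y))

  δ : Λ → Fun → Fun
  δ u f y = f y ⊝ f (act u y)

  N-nonneg : ∀ f → 0ℚ ≤ N f
  N-nonneg f = Y.nonneg (λ y → square-nonneg (f y))

  N-cong : ∀ {f g} → (∀ y → f y ≡ g y) → N f ≡ N g
  N-cong p = Y.cng (λ y → cong₂ _⊗_ (p y) (p y))

  N-act : ∀ u f → N (f ∘ act u) ≡ N f
  N-act u f = invariant u (λ y → f y ⊗ f y)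

  inner-act : ∀ u f g → ⟨ f ∘ act u , g ∘ act u ⟩ ≡ ⟨ f , g ⟩
  inner-act u f g = invariant u (λ y → f y ⊗ g y)

  inner-sym : ∀ f g → ⟨ f , g ⟩ ≡ ⟨ g , f ⟩
  inner-sym f g = Y.cng (λ y → ⊗-comm _ _)

  N-+ : ∀ f g → N (f +ᶠ g) ≤ 2# ⊗ N f ⊕ 2# ⊗ N g
  N-+ f g = ≤-by (N (f -ᶠ g)) (N-nonneg _) (trans (sym (Y.add _ _)) (trans (Y.cng (λ y → sq-sum (f y) (g y)))
    (trans (Y.add _ _) (cong₂ _⊕_ (Y.scl _ _) (Y.scl _ _)))))

  N-- : ∀ f g → N (f -ᶠ g) ≤ 2# ⊗ N f ⊕ 2# ⊗ N g
  N-- f g = ≤-by (N (f +ᶠ g)) (N-nonneg _) (trans (sym (Y.add _ _)) (trans (Y.cng (λ y → sq-diff (f y) (g y)))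
    (trans (Y.add _ _) (cong₂ _⊕_ (Y.scl _ _) (Y.scl _ _)))))

  N-flip : ∀ f g → N (f -ᶠ g) ≡ N (g -ᶠ f)
  N-flip f g = Y.cng (λ y → sq-flip (f y) (g y))

  N-tri : ∀ f g h {a b} → N (f -ᶠ g) ≤ a → N (g -ᶠ h) ≤ b → N (f -ᶠ h) ≤ 2# ⊗ a ⊕ 2# ⊗ b
  N-tri f g h p q = ≤-trans (≡⇒≤ (N-cong (λ y → δ-split (f y) (g y) (h y))))
    (≤-trans (N-+ (f -ᶠ g) (g -ᶠ h)) (⊕-mono (⊗-monoˡ 2# 0≤2 p) (⊗-monoˡ 2# 0≤2 q)))

  N-via : ∀ f g {a b} → N (f -ᶠ g) ≤ a → N g ≤ b → N f ≤ 2# ⊗ a ⊕ 2# ⊗ b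
  N-via f g p q = ≤-trans (≡⇒≤ (N-cong (λ y → sym (trans (⊕-comm _ _) (⊕-cancel-⊝ (g y) (f y))))))
    (≤-trans (N-+ (f -ᶠ g) g) (⊕-mono (⊗-monoˡ 2# 0≤2 p) (⊗-monoˡ 2# 0≤2 q)))

  N-scale : ∀ c f → N (λ y → c ⊗ f y) ≡ (c ⊗ c) ⊗ N f
  N-scale c f = trans (Y.cng (λ y → sq-scale c (f y))) (Y.scl _ _)

  -- Expand s‖f - tg‖² ≥ 0. With s large and t small this stands in for Cauchy-Schwarz, whose square
  -- roots are not rational.
  young : ∀ f g s t → 0ℚ ≤ s → s ⊗ t ≡ 1ℚ → 2# ⊗ ⟨ f , g ⟩ ≤ s ⊗ N f ⊕ t ⊗ N g
  young f g s t 0≤s st≡1 = ≤-by _ (⊗-nonneg 0≤s (N-nonneg (λ y → f y ⊝ t ⊗ g y)))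
    (trans (cong₂ _⊕_ (sym (trans (Y.cng (λ y → trans (cong (2# ⊗ (f y ⊗ g y) ⊗_) st≡1) (⊗-idʳ _))) (Y.scl _ _))) (sym (Y.scl s _)))
    (trans (sym (Y.add _ _)) (trans (Y.cng (λ y → trans (young-eq s t (f y) (g y))
      (cong (λ z → s ⊗ (f y ⊗ f y) ⊕ z ⊗ t ⊗ (g y ⊗ g y)) st≡1)))
    (trans (Y.add _ _) (cong₂ _⊕_ (Y.scl _ _) (trans (Y.scl _ _) (cong (_⊗ N g) (⊗-idˡ t))))))))

  N-avg : ∀ {A : Set} (m : Mean A) (F : A → Fun) → N (λ y → E m (λ a → F a y)) ≤ E m (λ a → N (F a))
  N-avg m F = ≤-trans (Y.mono (λ y → jensen m (λ a → F a y))) (≡⇒≤ (fubini μ m _))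

  N-avg-bound : ∀ {A : Set} (m : Mean A) (F : A → Fun) {c} → (∀ a → N (F a) ≤ c) → N (λ y → E m (λ a → F a y)) ≤ c
  N-avg-bound m F p = ≤-trans (N-avg m F) (Mean.bound m p)

  op-contract : ∀ m f → N (op m f) ≤ N f
  op-contract m f = N-avg-bound m (λ u → f ∘ act u) (λ u → ≡⇒≤ (N-act u f))

  act-comm : ∀ u v y → act u (act v y) ≡ act v (act u y)
  act-comm u v y = trans (sym (act-+ u v y)) (trans (cong (λ w → act w y) (+ᵍ-comm u v)) (act-+ v u y))

  act-neg : ∀ u y → act u (act (-ᵍ u) y) ≡ y
  act-neg u y = trans (sym (act-+ _ _ y)) (trans (cong (λ w → act w y) (+ᵍ-invʳ u)) (act-0 y))

  act-neg′ : ∀ u y → act (-ᵍ u) (act u y) ≡ y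
  act-neg′ u y = trans (act-comm _ _ y) (act-neg u y)

  op-cong : ∀ m {f g : Fun} → (∀ y → f y ≡ g y) → ∀ y → op m f y ≡ op m g y
  op-cong m p y = Mean.cng m (λ u → p (act u y))

  op-act : ∀ m u f y → op m (f ∘ act u) y ≡ op m f (act u y)
  op-act m u f y = Mean.cng m (λ v → cong f (act-comm u v y))

  op-- : ∀ m f g y → op m (f -ᶠ g) y ≡ op m f y ⊝ op m g y
  op-- m f g y = Mean.sub m _ _

  op-comm : ∀ m n f y → op m (op n f) y ≡ op n (op m f) y
  op-comm m n f y = trans (fubini m n _) (Mean.cng n (λ v → Mean.cng m (λ u → cong f (act-comm v u y))))

  op-avg : ∀ {A : Set} m (n : Mean A) (F : A → Fun) y → op m (λ y → E n (λ a → F a y)) y ≡ E n (λ a → op m (F a) y)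
  op-avg m n F y = fubini m n _

  -- Each translation preserves `μ`, so its adjoint is its inverse; averaging gives the reflected
  -- measure.
  inner-op : ∀ m f g → ⟨ op m f , g ⟩ ≡ ⟨ f , op (push -ᵍ_ m) g ⟩
  inner-op m f g = trans (Y.cng (λ y → sym (Mean.sclʳ m (g y) _)))
    (trans (fubini μ m _)
    (trans (Mean.cng m (λ u → trans (sym (invariant (-ᵍ u) _)) (Y.cng (λ y → cong (λ w → f w ⊗ g (act (-ᵍ u) y)) (act-neg u y)))))
    (trans (fubini m μ _) (Y.cng (λ y → Mean.scl m (f y) _)))))

  -- in operator norm, averaging along m almost absorbs the shift u
  record Inv (m : Mean Λ) (u : Λ) (ε : ℚ) : Set where
    constructor mkInv
    field app : ∀ f → N (op m (δ u f)) ≤ ε ⊗ N f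
  open Inv public

  Inv-weaken : ∀ {m u ε ε′} → ε ≤ ε′ → Inv m u ε → Inv m u ε′
  Inv-weaken p h .app f = ≤-trans (app h f) (⊗-monoʳ (N f) (N-nonneg f) p)

  -- Telescoping: `δ (u +ᵍ v) f` is `δ v f` plus the translate by v of `δ u f`, and `op m` commutes
  -- with that isometry.
  Inv-+ : ∀ {m u v a b} → Inv m u a → Inv m v b → Inv m (u +ᵍ v) (2# ⊗ b ⊕ 2# ⊗ a)
  Inv-+ {m} {u} {v} {a} {b} hu hv .app f = ≤-trans (≡⇒≤ (N-cong eq))
    (≤-trans (N-+ (op m (δ v f)) (op m (δ u f) ∘ act v))
    (≤-trans (⊕-mono (⊗-monoˡ 2# 0≤2 (app hv f)) (⊗-monoˡ 2# 0≤2 (≤-trans (≡⇒≤ (N-act v _)) (app hu f))))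
      (≡⇒≤ (trans (cong₂ _⊕_ (sym (⊗-assoc _ _ _)) (sym (⊗-assoc _ _ _))) (sym (⊗-distribʳ _ _ _))))))
    where
    eq : ∀ y → op m (δ (u +ᵍ v) f) y ≡ op m (δ v f) y ⊕ op m (δ u f) (act v y)
    eq y = trans (op-cong m (λ y → trans (cong (λ w → f y ⊝ f w) (act-+ u v y)) (δ-split (f y) (f (act v y)) _)) y)
      (trans (Mean.add m _ _) (cong (op m (δ v f) y ⊕_) (op-act m v (δ u f) y)))

  Inv-neg : ∀ {m u ε} → Inv m u ε → Inv m (-ᵍ u) ε
  Inv-neg {m} {u} h .app f = ≤-trans (≡⇒≤ (trans (N-cong (λ y → op-- m f (f ∘ act (-ᵍ u)) y))
      (trans (N-flip (op m f) (op m (f ∘ act (-ᵍ u))))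
        (trans (N-cong (λ y → trans (sym (op-- m (f ∘ act (-ᵍ u)) f y)) (op-cong m (λ y → cong (f (act (-ᵍ u) y) ⊝_) (cong f (sym (act-neg′ u y)))) y))) refl))))
    (≤-trans (app h (f ∘ act (-ᵍ u))) (≡⇒≤ (cong (_ ⊗_) (N-act _ f))))

  Inv-0 : ∀ {m} → Inv m 0ᵍ 0ℚ
  Inv-0 {m} .app f = ≡⇒≤ (trans (Y.cng (λ y → trans (cong (_⊗ op m (δ 0ᵍ f) y) (trans (Mean.cng m (λ u → trans (cong (λ w → f (act u y) ⊝ f w) (act-0 (act u y))) (⊝-self _))) (Mean.one m 0ℚ))) (⊗-zeroˡ _)))
    (trans (Y.one 0ℚ) (sym (⊗-zeroˡ _))))

  -- The function f minus its average is the average of the differences `δ (val a) f`, and N is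
  -- convex.
  Inv-avg : ∀ {A : Set} m (n : Mean A) (val : A → Λ) {ε} → (∀ a → Inv m (val a) ε) → ∀ f →
    N (op m (f -ᶠ op (push val n) f)) ≤ ε ⊗ N f
  Inv-avg m n val h f = ≤-trans (≡⇒≤ (N-cong eq)) (N-avg-bound n (λ a → op m (δ (val a) f)) (λ a → app (h a) f))
    where
    eq : ∀ y → op m (f -ᶠ op (push val n) f) y ≡ E n (λ a → op m (δ (val a) f) y)
    eq y = trans (op-cong m (λ y → trans (cong (_⊝ op (push val n) f y) (sym (Mean.one n (f y)))) (sym (Mean.sub n _ _))) y)
      (op-avg m n (λ a → δ (val a) f) y)

  Inv-conv : ∀ {m} n {u ε} → Inv m u ε → ∀ f → N (op m (op n (δ u f))) ≤ ε ⊗ N f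
  Inv-conv {m} n {u} h f = ≤-trans (≡⇒≤ (N-cong (op-comm m n (δ u f)))) (≤-trans (op-contract n _) (app h f))

  N-δ : ∀ u f → N (δ u f) ≤ 4# ⊗ N f
  N-δ u f = ≤-trans (N-- f (f ∘ act u)) (≡⇒≤ (trans (cong (λ z → 2# ⊗ N f ⊕ 2# ⊗ z) (N-act u f))
    (trans (sym (⊗-distribʳ _ _ _)) (cong (_⊗ N f) (trans (cong₂ _⊕_ (sym (⊗-idʳ 2#)) (sym (⊗-idʳ 2#))) 4≡)))))

-- Van der Corput's inequality and Weyl differencing

ℤG : Grp
ℤG = record
  { Λ = ℤ ; _+ᵍ_ = ℤ._+_ ; 0ᵍ = + 0 ; -ᵍ_ = ℤ.-_
  ; +ᵍ-assoc = ℤP.+-assoc ; +ᵍ-comm = ℤP.+-comm ; +ᵍ-idʳ = ℤP.+-identityʳ ; +ᵍ-invʳ = ℤP.+-inverseʳ }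

∑-split : ∀ m n (f : ℕ → ℚ) →
  ∑ (m ℕ.+ n) (f ∘ toℕ) ≡ ∑ m (f ∘ toℕ) ⊕ ∑ n (λ i → f (m ℕ.+ toℕ i))
∑-split zero n f = sym (⊕-idˡ _)
∑-split (suc m) n f = trans (cong (f 0 ⊕_) (∑-split m n (f ∘ suc))) (sym (⊕-assoc _ _ _))

∑-shift : ∀ X k (f : ℕ → ℚ) →
  ∑ X (f ∘ toℕ) ⊕ ∑ k (λ i → f (X ℕ.+ toℕ i)) ≡ ∑ k (f ∘ toℕ) ⊕ ∑ X (λ i → f (k ℕ.+ toℕ i))
∑-shift X k f = trans (sym (∑-split X k f)) (trans (cong (λ n → ∑ n (f ∘ toℕ)) (ℕP.+-comm X k)) (∑-split k X f))

opaque
  unfolding _⊕_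

  shift-eq : ∀ c a b a′ b′ n j → n ⊗ j ≡ 1ℚ → a ⊕ b ≡ b′ ⊕ a′ →
    c ⊗ a ⊝ c ⊗ a′ ≡ (n ⊗ c) ⊗ (j ⊗ b′ ⊝ j ⊗ b)
  shift-eq c a b a′ b′ n j p q = trans (l₁ c a b a′) (trans (cong (λ z → c ⊗ (z ⊝ b ⊝ a′)) q) (trans (l₂ c a′ b b′)
    (trans (cong (_⊗ (c ⊗ (b′ ⊝ b))) (sym p)) (l₃ c b b′ n j))))
    where
    l₁ : ∀ c a b a′ → c ⊗ a ⊝ c ⊗ a′ ≡ c ⊗ (a ⊕ b ⊝ b ⊝ a′)
    l₁ = solve-∀ ℚ-ring
    l₂ : ∀ c a′ b b′ → c ⊗ (b′ ⊕ a′ ⊝ b ⊝ a′) ≡ 1ℚ ⊗ (c ⊗ (b′ ⊝ b))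
    l₂ = solve-∀ ℚ-ring
    l₃ : ∀ c b b′ n j → (n ⊗ j) ⊗ (c ⊗ (b′ ⊝ b)) ≡ (n ⊗ c) ⊗ (j ⊗ b′ ⊝ j ⊗ b)
    l₃ = solve-∀ ℚ-ring

  quad : ∀ b → 2# ⊗ b ⊕ 2# ⊗ b ≡ 4# ⊗ b
  quad = solve-∀ ℚ-ring

  vdc-const : ∀ j b → 2# ⊗ (j ⊗ (4# ⊗ (4# ⊗ b))) ≡ ((+ 32 ℚ./ 1) ⊗ j) ⊗ b
  vdc-const = solve-∀ ℚ-ring

  young-const : ∀ s t b → s ⊗ ((t ⊗ t) ⊗ b) ⊕ t ⊗ (4# ⊗ b) ≡ (s ⊗ t) ⊗ (t ⊗ b) ⊕ t ⊗ (4# ⊗ b)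
  young-const = solve-∀ ℚ-ring

  young-const′ : ∀ t b → 1ℚ ⊗ (t ⊗ b) ⊕ t ⊗ (4# ⊗ b) ≡ ((+ 5 ℚ./ 1) ⊗ t) ⊗ b
  young-const′ = solve-∀ ℚ-ring

  two-four : ∀ b → 2# ⊗ (4# ⊗ b) ≡ 8# ⊗ b
  two-four = solve-∀ ℚ-ring

  thirds : ∀ e → e ⊗ inv 2 ⊕ (e ⊗ inv 2 ⊕ e ⊗ inv 2) ≡ e
  thirds = solve-∀ ℚ-ring

  quarters : ∀ e → 2# ⊗ (e ⊗ inv 3) ⊕ 2# ⊗ (e ⊗ inv 3) ≡ e
  quarters = solve-∀ ℚ-ring

scale-small : ∀ {k K X} → suc K ℕ.* k ℕ.≤ suc X → nat k ⊗ inv X ≤ inv K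
scale-small {k} {K} {X} p = subst₂ _≤_ eq₁ eq₂ (⊗-monoˡ (inv K ⊗ inv X) (⊗-nonneg (inv-nonneg K) (inv-nonneg X)) (nat-mono p))
  where
  eq₁ : inv K ⊗ inv X ⊗ nat (suc K ℕ.* k) ≡ nat k ⊗ inv X
  eq₁ = trans (cong (inv K ⊗ inv X ⊗_) (nat-* (suc K) k)) (trans (⊗-comm _ _)
    (trans (⊗-assoc _ _ _) (trans (⊗-left-comm _ _ _) (trans (cong (nat k ⊗_) (trans (sym (⊗-assoc _ _ _)) (cong (_⊗ inv X) (nat-inv K)))) (cong (nat k ⊗_) (⊗-idˡ _))))))
  eq₂ : inv K ⊗ inv X ⊗ nat (suc X) ≡ inv K
  eq₂ = trans (⊗-assoc _ _ _) (trans (cong (inv K ⊗_) (trans (⊗-comm _ _) (nat-inv X))) (⊗-idʳ _))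

inv-≤1 : ∀ n → inv n ≤ 1ℚ
inv-≤1 n = subst (inv n ≤_) (trans (trans (sym (⊗-idˡ (inv 0))) (cong (_⊗ inv 0) (sym nat-1))) (nat-inv 0)) (inv-antitone ℕ.z≤n)

module Averages (G : Grp) (S : Sys G) where
  open Grp G
  open Sys S
  open Theory G S

  -- All but k terms at either end cancel, so the difference is k/(X+1) times a difference of two
  -- k-term averages. Its squared norm is at most (k/(X+1))²·4B, and one of the two small factors
  -- suffices.
  shift-small : ∀ (v : ℕ → Fun) B → (∀ x → N (v x) ≤ B) → ∀ X K k → suc K ℕ.* k ℕ.≤ suc X →
    N (λ y → E (uniform X) (λ i → v (toℕ i) y) ⊝ E (uniform X) (λ i → v (k ℕ.+ toℕ i) y)) ≤ inv K ⊗ (4# ⊗ B)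
  shift-small v B h X K zero p = ≤-trans (≡⇒≤ (trans (N-cong {g = λ _ → 0ℚ} (λ y → ⊝-self _))
      (trans (Mean.cng μ (λ _ → ⊗-zeroˡ 0ℚ)) (Mean.one μ 0ℚ))))
    (⊗-nonneg (inv-nonneg K) (⊗-nonneg 0≤4 (≤-trans (N-nonneg (v 0)) (h 0))))
  shift-small v B h X K (suc k) p = ≤-trans (≡⇒≤ (trans (N-cong eq) (N-scale c D)))
    (≤-trans (⊗-mono (square-nonneg c) (⊗-nonneg 0≤4 B≥0) cc≤ ND≤) (≡⇒≤ refl))
    where
    B≥0 = ≤-trans (N-nonneg (v 0)) (h 0)
    c = nat (suc k) ⊗ inv X
    D₁ D₂ D : Fun
    D₁ y = E (uniform k) (λ i → v (toℕ i) y)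
    D₂ y = E (uniform k) (λ i → v (suc X ℕ.+ toℕ i) y)
    D = D₁ -ᶠ D₂
    eq : ∀ y → _ ≡ c ⊗ D y
    eq y = trans (cong₂ _⊝_ (E-uniform X _) (E-uniform X _)) (trans
      (shift-eq (inv X) _ _ _ _ (nat (suc k)) (inv k) (nat-inv k) (∑-shift (suc X) (suc k) (λ x → v x y)))
      (cong (c ⊗_) (sym (cong₂ _⊝_ (E-uniform k _) (E-uniform k _)))))
    c≤ : c ≤ inv K
    c≤ = scale-small p
    c≥0 : 0ℚ ≤ c
    c≥0 = ⊗-nonneg (nat-nonneg (suc k)) (inv-nonneg X)
    cc≤ : c ⊗ c ≤ inv K
    cc≤ = ≤-trans (⊗-mono c≥0 0≤1 c≤ (≤-trans c≤ (inv-≤1 K))) (≡⇒≤ (⊗-idʳ _))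
    ND≤ : N D ≤ 4# ⊗ B
    ND≤ = ≤-trans (N-- D₁ D₂) (≤-trans (⊕-mono
      (⊗-monoˡ 2# 0≤2 (N-avg-bound (uniform k) (λ i → v (toℕ i)) (λ i → h _)))
      (⊗-monoˡ 2# 0≤2 (N-avg-bound (uniform k) (λ i → v (suc X ℕ.+ toℕ i)) (λ i → h _)))) (≡⇒≤ (quad B)))

  -- A long average becomes an average of averages over short progressions of step `L`. Both van der
  -- Corput's inequality and the lowering of the degree in `PeelStep` rest on this.
  regroup : ∀ (v : ℕ → Fun) B → (∀ x → N (v x) ≤ B) → ∀ X K H L → suc K ℕ.* (H ℕ.* L) ℕ.≤ suc X →
    N (λ y → E (uniform X) (λ i → v (toℕ i) y) ⊝
      E (uniform X) (λ i → E (uniform H) (λ k → v (toℕ k ℕ.* L ℕ.+ toℕ i) y))) ≤ inv K ⊗ (4# ⊗ B)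
  regroup v B h X K H L p =
    ≤-trans (≡⇒≤ (N-cong (λ y → trans (cong₂ _⊝_ (sym (Mean.one uH _)) (fubini uX uH _)) (sym (Mean.sub uH _ _)))))
      (N-avg-bound uH (λ k y → E uX (λ i → v (toℕ i) y) ⊝ E uX (λ i → v (toℕ k ℕ.* L ℕ.+ toℕ i) y))
        (λ k → shift-small v B h X K (toℕ k ℕ.* L)
          (ℕP.≤-trans (ℕP.*-monoʳ-≤ (suc K) (ℕP.*-monoˡ-≤ L (ℕP.≤-pred (FinP.toℕ<n k)))) p)))
    where
    uX = uniform X
    uH = uniform H

  -- Convexity is used in the starting point of the short progression; the square of the inner
  -- average is then expanded into correlations of pairs of its points.
  vanDerCorput : ∀ (v : ℕ → Fun) B → (∀ x → N (v x) ≤ B) → ∀ X K H L → suc K ℕ.* (H ℕ.* L) ℕ.≤ suc X →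
    N (λ y → E (uniform X) (λ i → v (toℕ i) y)) ≤
      2# ⊗ (inv K ⊗ (4# ⊗ B)) ⊕
      2# ⊗ E (uniform H) (λ k → E (uniform H) (λ k′ → E (uniform X) (λ i →
        ⟨ v (toℕ k ℕ.* L ℕ.+ toℕ i) , v (toℕ k′ ℕ.* L ℕ.+ toℕ i) ⟩)))
  vanDerCorput v B h X K H L p = N-via _ w (regroup v B h X K H L p) step
    where
    uX = uniform X
    uH = uniform H
    w : Fun
    w y = E uX (λ i → E uH (λ k → v (toℕ k ℕ.* L ℕ.+ toℕ i) y))
    step : N w ≤ _
    step = ≤-trans (N-avg uX (λ i y → E uH (λ k → v (toℕ k ℕ.* L ℕ.+ toℕ i) y))) (≡⇒≤
      (trans (Mean.cng uX (λ i → trans (Mean.cng μ (λ y → trans (sym (Mean.sclʳ uH _ _)) (Mean.cng uH (λ k → sym (Mean.scl uH _ _)))))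
        (trans (fubini μ uH _) (Mean.cng uH (λ k → fubini μ uH _)))))
      (trans (fubini uX uH _) (Mean.cng uH (λ k → fubini uX uH _)))))

-- p has degree at most d and constant d-fold differences: Δ_{h₁}⋯Δ_{h_d} p = c·h₁⋯h_d
IsPoly : ℕ → (ℤ → ℤ) → ℤ → Set
IsPoly zero p c = ∀ x → p x ≡ c
IsPoly (suc d) p c = ∀ a b → IsPoly d (λ x → p (x ℤ.+ a) ℤ.- p (x ℤ.+ b)) (c ℤ.* (a ℤ.- b))

polyMean : (ℤ → ℤ) → ℕ → Mean ℤ
polyMean p X = push (λ i → p (+ toℕ i)) (uniform X)

-- The multiplier `h` and the ratio `K` are chosen before p and c. Measuring the absorbed shift in
-- units of c, which is d! times the leading coefficient, makes the estimate uniform in the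
-- polynomial.
Weyl : ℕ → Set₁
Weyl d = ∀ ε → 0ℚ < ε → Σ ℕ λ h → Σ ℕ λ K → 1 ℕ.≤ h ×
  (∀ p c → IsPoly d p c → ∀ X ξ → 1 ℕ.≤ ξ → K ℕ.* ξ ℕ.≤ suc X → ∀ (S : Sys ℤG) e → ℤ.∣ e ∣ ℕ.≤ ξ ℕ.^ d →
    Theory.Inv ℤG S (polyMean p X) (c ℤ.* + h ℤ.* e) ε)

neg-*ʳ : ∀ a n → a ℤ.* (ℤ.- n) ≡ ℤ.- (a ℤ.* n)
neg-*ʳ = solve-∀ ℤ-ring

-- It suffices to treat nonnegative e.
Inv-signed : ∀ (S : Sys ℤG) {m ε} a b → (∀ n → n ℕ.≤ b → Theory.Inv ℤG S m (a ℤ.* + n) ε) →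
  ∀ e → ℤ.∣ e ∣ ℕ.≤ b → Theory.Inv ℤG S m (a ℤ.* e) ε
Inv-signed S a b h (+ n) p = h n p
Inv-signed S {m} {ε} a b h -[1+ n ] p =
  subst (λ u → Theory.Inv ℤG S m u ε) (sym (neg-*ʳ a (+ suc n))) (Theory.Inv-neg ℤG S (h (suc n) p))

-- For linear p, adding c·n to the value is the same as moving the argument by n, so the shift
-- merely slides the interval.
linear-Inv : ∀ p c → IsPoly 1 p c → ∀ S K n X → suc K ℕ.* n ℕ.≤ suc X → ∀ e → ℤ.∣ e ∣ ℕ.≤ n →
  Theory.Inv ℤG S (polyMean p X) (c ℤ.* e) (4# ⊗ inv K)
linear-Inv p c isP S K b X Kb≤ = Inv-signed S {polyMean p X} c b (λ n n≤b → mkInv (λ f →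
    ≤-trans (≡⇒≤ (N-cong (λ y → trans (Mean.sub (uniform X) _ _) (cong (E (uniform X) (λ i → f (act (p (+ toℕ i)) y)) ⊝_)
      (Mean.cng (uniform X) (λ i → cong f (trans (sym (act-+ (c ℤ.* + n) (p (+ toℕ i)) y)) (cong (λ u → act u y) (lin-eq n (toℕ i))))))))))
    (≤-trans (shift-small (λ x → f ∘ act (p (+ x))) (N f) (λ x → ≡⇒≤ (N-act _ f)) X K n (ℕP.≤-trans (ℕP.*-monoʳ-≤ (suc K) n≤b) Kb≤))
      (≡⇒≤ (trans (sym (⊗-assoc _ _ _)) (cong (_⊗ N f) (⊗-comm _ _)))))))
  where
  open Theory ℤG S
  open Sys S
  open Averages ℤG S
  l : ∀ c n q → c ℤ.* n ℤ.+ q ≡ (c ℤ.* (n ℤ.- + 0)) ℤ.+ q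
  l = solve-∀ ℤ-ring
  l′ : ∀ a b → (a ℤ.- b) ℤ.+ b ≡ a
  l′ = solve-∀ ℤ-ring
  lin-eq : ∀ n x → c ℤ.* + n ℤ.+ p (+ x) ≡ p (+ (n ℕ.+ x))
  lin-eq n x = trans (l c (+ n) (p (+ x))) (trans (cong (ℤ._+ p (+ x)) (sym (isP (+ n) (+ 0) (+ x))))
    (trans (cong (λ z → (p (+ x ℤ.+ + n) ℤ.- p z) ℤ.+ p (+ x)) (ℤP.+-identityʳ (+ x)))
    (trans (l′ _ _) (cong p (ℤP.+-comm (+ x) (+ n))))))

weyl-1 : Weyl 1
weyl-1 ε 0<ε with small 4# ε 0<ε
... | K , K≤ = 1 , suc K , ℕ.s≤s ℕ.z≤n , λ p c isP X ξ 1≤ξ Kξ≤ S e e≤ →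
  subst (λ a → Theory.Inv ℤG S (polyMean p X) (a ℤ.* e) ε) (sym (ℤP.*-identityʳ c))
    (Theory.Inv-weaken ℤG S K≤ (linear-Inv p c isP S K ξ X Kξ≤ e (subst (ℤ.∣ e ∣ ℕ.≤_) (ℕP.*-identityʳ ξ) e≤)))

indicator : Bool → ℚ
indicator b = if b then 1ℚ else 0ℚ

∑-zero : ∀ n → ∑ n (λ _ → 0ℚ) ≡ 0ℚ
∑-zero n = trans (∑-const n 0ℚ) (⊗-zeroʳ _)

∑-single : ∀ n (k : Fin n) → ∑ n (λ i → indicator (does (k Fin.≟ i))) ≡ 1ℚ
∑-single (suc n) zero = trans (cong (1ℚ ⊕_) (∑-zero n)) (⊕-idʳ 1ℚ)
∑-single (suc n) (suc k) = trans (⊕-idˡ _) (trans (∑-cong n (λ i → refl)) (∑-single n k))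

E-single : ∀ n k → E (uniform n) (λ i → indicator (does (k Fin.≟ i))) ≡ inv n
E-single n k = trans (E-uniform n _) (trans (cong (inv n ⊗_) (∑-single (suc n) k)) (⊗-idʳ _))

-- Differencing with steps k and k′ multiplies the leading coefficient by k - k′. Passing to
-- multiples of H! lets a single multiplier serve all pairs at once.
factorial-multiple : ∀ H k k′ → k ℕ.≤ H → k′ ℕ.≤ H → k ≢ k′ →
  ∃[ w ] (+ (H !) ≡ (+ k ℤ.- + k′) ℤ.* w × ℤ.∣ w ∣ ℕ.≤ H !)
factorial-multiple H k k′ k≤ k′≤ k≢ = w , eq , ∣w∣≤
  where
  z = + k ℤ.- + k′
  n≤H : ℤ.∣ z ∣ ℕ.≤ H
  n≤H = ℕP.≤-trans (ℕP.≤-reflexive (cong ℤ.∣_∣ (ℤP.m-n≡m⊖n k k′))) (ℕP.≤-trans (ℤP.∣m⊝n∣≤m⊔n k k′) (ℕP.⊔-lub k≤ k′≤))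
  n≢0 : ℤ.∣ z ∣ ≢ 0
  n≢0 e = k≢ (ℤP.+-injective (ℤP.i-j≡0⇒i≡j (+ k) (+ k′) (ℤP.∣i∣≡0⇒i≡0 e)))
  go : ∀ n → n ≢ 0 → n ℕ.≤ H → n ℕD.∣ H !
  go zero n≢0 _ = ⊥-elim (n≢0 refl)
  go (suc n) _ le = ℕD.∣-trans (ℕD.m∣m*n (n !)) (ℕD.m≤n⇒m!∣n! le)
  d : z ℤS.∣ + (H !)
  d = ℤS.∣ᵤ⇒∣ (go ℤ.∣ z ∣ n≢0 n≤H)
  w = ℤS._∣_.quotient d
  eq : + (H !) ≡ z ℤ.* w
  eq = trans (ℤS._∣_.equality d) (ℤP.*-comm w z)
  ∣w∣≤ : ℤ.∣ w ∣ ℕ.≤ H !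
  ∣w∣≤ = subst (ℤ.∣ w ∣ ℕ.≤_) (sym (trans (cong ℤ.∣_∣ eq) (ℤP.abs-* z w)))
    (ℕP.m≤n*m ℤ.∣ w ∣ ℤ.∣ z ∣ ⦃ ℕ.≢-nonZero n≢0 ⦄)

mul-^ : ∀ a b n → 1 ℕ.≤ a → a ℕ.* b ℕ.^ suc n ℕ.≤ (a ℕ.* b) ℕ.^ suc n
mul-^ a b zero _ = ℕP.≤-reflexive (trans (cong (a ℕ.*_) (ℕP.*-identityʳ b)) (sym (ℕP.*-identityʳ (a ℕ.* b))))
mul-^ a b (suc n) 1≤a = ℕP.≤-trans (ℕP.≤-reflexive (sym (ℕP.*-assoc a b _)))
  (ℕP.*-monoʳ-≤ (a ℕ.* b) (ℕP.≤-trans (ℕP.m≤n*m (b ℕ.^ suc n) a ⦃ ℕ.>-nonZero 1≤a ⦄) (mul-^ a b n 1≤a)))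

-- Van der Corput produces correlations of g = `δ u f` with its average along a differenced
-- polynomial, one degree lower. Off the diagonal that average absorbs u by the induction
-- hypothesis; the diagonal pairs form a proportion 1/(H+1).
weyl-step : ∀ d → Weyl (suc d) → Weyl (suc (suc d))
weyl-step d ih ε 0<ε = h , K , 1≤h , main
  where
  ε₁ third : ℚ
  ε₁ = ε ⊗ inv 3
  third = ε₁ ⊗ inv 2
  third-pos : 0ℚ < third
  third-pos = ⊗-pos (⊗-pos 0<ε (inv-pos 3)) (inv-pos 2)
  s₀ = small (+ 32 ℚ./ 1) third third-pos
  s₁ = small (+ 5 ℚ./ 1) third third-pos
  s₂ = small 8# third third-pos
  K₀ = proj₁ s₀
  n = proj₁ s₁
  H = proj₁ s₂
  τ = inv n
  -- The square compensates the factor 1/τ of Young's inequality: τ²/τ from the average and 4τ from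
  -- g add up to 5τ.
  IH = ih (τ ⊗ τ) (⊗-pos (inv-pos n) (inv-pos n))
  h₀ = proj₁ IH
  K₁ = proj₁ (proj₂ IH)
  h = h₀ ℕ.* H !
  K = suc K₀ ℕ.* H ℕ.+ K₁ ℕ.* H !
  1≤h : 1 ℕ.≤ h
  1≤h = ℕP.*-mono-≤ (proj₁ (proj₂ (proj₂ IH))) (ℕP.1≤n! H)

  module _ (p : ℤ → ℤ) (c : ℤ) (isP : IsPoly (suc (suc d)) p c) (X ξ : ℕ) (1≤ξ : 1 ℕ.≤ ξ)
           (Kξ≤ : K ℕ.* ξ ℕ.≤ suc X) (S : Sys ℤG) where
    open Sys S
    open Theory ℤG S
    open Averages ℤG S

    β : Mean ℤ
    β = polyMean p X

    -- The step L of van der Corput enters the absorbed shift as a factor. The steps 1 and ξ supply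
    -- the two digits that reach the next power of ξ.
    atScale : ∀ L → L ℕ.≤ ξ → ∀ e → ℤ.∣ e ∣ ℕ.≤ ξ ℕ.^ suc d → Inv β (c ℤ.* + L ℤ.* + h ℤ.* e) ε₁
    atScale L L≤ξ e e≤ = mkInv bound
      where
      u = c ℤ.* + L ℤ.* + h ℤ.* e
      bound : ∀ f → N (op β (δ u f)) ≤ ε₁ ⊗ N f
      bound f = ≤-trans (vanDerCorput v (4# ⊗ N f) (λ x → ≤-trans (≡⇒≤ (N-act _ g)) (N-δ u f)) X K₀ H L len)
        (≤-trans (⊕-mono (≤-trans (≡⇒≤ (vdc-const (inv K₀) (N f))) (scaled (proj₂ s₀))) offdiag)
          (≡⇒≤ (trans (sym (trans (⊗-distribʳ (N f) third (third ⊕ third)) (cong (third ⊗ N f ⊕_) (⊗-distribʳ (N f) third third)))) (cong (_⊗ N f) (thirds ε₁)))))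
        where
        g = δ u f
        v : ℕ → Fun
        v x = g ∘ act (p (+ x))
        scaled : ∀ {a} → a ≤ third → a ⊗ N f ≤ third ⊗ N f
        scaled = ⊗-monoʳ (N f) (N-nonneg f)
        len : suc K₀ ℕ.* (H ℕ.* L) ℕ.≤ suc X
        len = ℕP.≤-trans (ℕP.≤-reflexive (sym (ℕP.*-assoc (suc K₀) H L)))
          (ℕP.≤-trans (ℕP.*-mono-≤ (ℕP.m≤m+n (suc K₀ ℕ.* H) (K₁ ℕ.* H !)) L≤ξ) Kξ≤)
        q : ℕ → ℕ → ℤ → ℤ
        q k k′ x = p (x ℤ.+ + (k ℕ.* L)) ℤ.- p (x ℤ.+ + (k′ ℕ.* L))
        pair : ∀ k k′ → E (uniform X) (λ i → ⟨ v (k ℕ.* L ℕ.+ toℕ i) , v (k′ ℕ.* L ℕ.+ toℕ i) ⟩) ≡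
          ⟨ op (polyMean (q k k′) X) g , g ⟩
        pair k k′ = trans (Mean.cng (uniform X) (λ i → trans (Mean.cng μ (λ y →
            cong₂ _⊗_ (cong g (trans (cong (λ w → act w y) (shift-eq′ i)) (act-+ _ _ y))) refl)) (inner-act (p (+ (k′ ℕ.* L ℕ.+ toℕ i))) (g ∘ act (q k k′ (+ toℕ i))) g)))
          (trans (fubini (uniform X) μ _) (Mean.cng μ (λ y → Mean.sclʳ (uniform X) (g y) _)))
          where
          cancel : ∀ a b → a ≡ (a ℤ.- b) ℤ.+ b
          cancel = solve-∀ ℤ-ring
          shift-eq′ : ∀ i → p (+ (k ℕ.* L ℕ.+ toℕ i)) ≡ q k k′ (+ toℕ i) ℤ.+ p (+ (k′ ℕ.* L ℕ.+ toℕ i))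
          shift-eq′ i = trans (cancel _ (p (+ (k′ ℕ.* L ℕ.+ toℕ i)))) (cong₂ (λ a b → p a ℤ.- p b ℤ.+ p (+ (k′ ℕ.* L ℕ.+ toℕ i)))
            (ℤP.+-comm (+ (k ℕ.* L)) (+ toℕ i)) (ℤP.+-comm (+ (k′ ℕ.* L)) (+ toℕ i)))
        near : Fin (suc H) → Fin (suc H) → ℚ
        near k k′ = ((+ 5 ℚ./ 1) ⊗ τ) ⊗ N f ⊕ (8# ⊗ N f) ⊗ indicator (does (k Fin.≟ k′))
        each : ∀ k k′ → 2# ⊗ ⟨ op (polyMean (q (toℕ k) (toℕ k′)) X) g , g ⟩ ≤ near k k′
        each k k′ = at k k′ (k Fin.≟ k′)
          where
          at : ∀ k k′ (d : Dec (k ≡ k′)) → 2# ⊗ ⟨ op (polyMean (q (toℕ k) (toℕ k′)) X) g , g ⟩ ≤ ((+ 5 ℚ./ 1) ⊗ τ) ⊗ N f ⊕ (8# ⊗ N f) ⊗ indicator (does d)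
          at k .k (yes refl) = ≤-trans (≤-trans (≡⇒≤ (cong (2# ⊗_) (Mean.cng μ (λ y → cong (_⊗ g y)
                  (trans (Mean.cng (uniform X) (λ i → cong g (trans (cong (λ w → act w y) (ℤP.+-inverseʳ (p _))) (act-0 y)))) (Mean.one (uniform X) _))))))
                  (⊗-monoˡ 2# 0≤2 (N-δ u f)))
                (≤-trans (≡⇒≤ (trans (two-four (N f)) (sym (⊗-idʳ _)))) (≤-⊕ˡ (⊗-nonneg (⊗-nonneg 0≤5 (inv-nonneg n)) (N-nonneg f))))
            where 0≤5 = ℚP.nonNegative⁻¹ (+ 5 ℚ./ 1)
          at k k′ (no k≢k′) = ≤-trans (young (op β′ g) g (nat (suc n)) τ (nat-nonneg (suc n)) (nat-inv n))
                (≤-trans (⊕-mono (⊗-monoˡ (nat (suc n)) (nat-nonneg (suc n)) (app (subst (λ w → Inv β′ w (τ ⊗ τ)) (sym u-eq)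
                    (proj₂ (proj₂ (proj₂ IH)) (q (toℕ k) (toℕ k′)) (c ℤ.* (+ (toℕ k ℕ.* L) ℤ.- + (toℕ k′ ℕ.* L))) (isP _ _) X (H ! ℕ.* ξ) 1≤ξ′ K₁ξ′≤ S e′ e′≤)) f))
                    (⊗-monoˡ τ (inv-nonneg n) (N-δ u f)))
                (≤-trans (≡⇒≤ (trans (young-const (nat (suc n)) τ (N f)) (trans (cong (λ z → z ⊗ (τ ⊗ N f) ⊕ τ ⊗ (4# ⊗ N f)) (nat-inv n)) (young-const′ τ (N f)))))
                  (≡⇒≤ (sym (trans (cong (((+ 5 ℚ./ 1) ⊗ τ) ⊗ N f ⊕_) (⊗-zeroʳ _)) (⊕-idʳ _))))))
            where
            β′ = polyMean (q (toℕ k) (toℕ k′)) X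
            fm = factorial-multiple H (toℕ k) (toℕ k′) (ℕP.≤-pred (FinP.toℕ<n k)) (ℕP.≤-pred (FinP.toℕ<n k′)) (k≢k′ ∘ FinP.toℕ-injective)
            w = proj₁ fm
            e′ = w ℤ.* e
            alg : ∀ c L a b h w e → c ℤ.* L ℤ.* (h ℤ.* ((a ℤ.- b) ℤ.* w)) ℤ.* e ≡ c ℤ.* (a ℤ.* L ℤ.- b ℤ.* L) ℤ.* h ℤ.* (w ℤ.* e)
            alg = solve-∀ ℤ-ring
            u-eq : u ≡ c ℤ.* (+ (toℕ k ℕ.* L) ℤ.- + (toℕ k′ ℕ.* L)) ℤ.* + h₀ ℤ.* e′
            u-eq = trans (cong (λ z → c ℤ.* + L ℤ.* z ℤ.* e) (trans (ℤP.pos-* h₀ (H !)) (cong ((+ h₀) ℤ.*_) (proj₁ (proj₂ fm)))))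
              (trans (alg c (+ L) (+ toℕ k) (+ toℕ k′) (+ h₀) w e)
                (cong₂ (λ a b → c ℤ.* (a ℤ.- b) ℤ.* + h₀ ℤ.* e′) (sym (ℤP.pos-* (toℕ k) L)) (sym (ℤP.pos-* (toℕ k′) L))))
            1≤ξ′ : 1 ℕ.≤ H ! ℕ.* ξ
            1≤ξ′ = ℕP.*-mono-≤ (ℕP.1≤n! H) 1≤ξ
            K₁ξ′≤ : K₁ ℕ.* (H ! ℕ.* ξ) ℕ.≤ suc X
            K₁ξ′≤ = ℕP.≤-trans (ℕP.≤-reflexive (sym (ℕP.*-assoc K₁ (H !) ξ)))
              (ℕP.≤-trans (ℕP.*-monoˡ-≤ ξ (ℕP.m≤n+m (K₁ ℕ.* H !) (suc K₀ ℕ.* H))) Kξ≤)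
            e′≤ : ℤ.∣ e′ ∣ ℕ.≤ (H ! ℕ.* ξ) ℕ.^ suc d
            e′≤ = ℕP.≤-trans (ℕP.≤-reflexive (ℤP.abs-* w e)) (ℕP.≤-trans (ℕP.*-mono-≤ (proj₂ (proj₂ fm)) e≤) (mul-^ (H !) ξ d (ℕP.1≤n! H)))
        uH = uniform H
        offdiag : 2# ⊗ E uH (λ k → E uH (λ k′ → E (uniform X) (λ i → ⟨ v (toℕ k ℕ.* L ℕ.+ toℕ i) , v (toℕ k′ ℕ.* L ℕ.+ toℕ i) ⟩)))
          ≤ third ⊗ N f ⊕ third ⊗ N f
        offdiag = ≤-trans (≡⇒≤ (trans (sym (Mean.scl uH 2# _)) (Mean.cng uH (λ k → trans (sym (Mean.scl uH 2# _))
            (Mean.cng uH (λ k′ → cong (2# ⊗_) (pair (toℕ k) (toℕ k′))))))))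
          (≤-trans (Mean.mono uH (λ k → Mean.mono uH (λ k′ → each k k′)))
          (≤-trans (≡⇒≤ (trans (Mean.cng uH (λ k → trans (Mean.add uH _ _) (cong₂ _⊕_ (Mean.one uH _)
              (trans (Mean.scl uH _ _) (cong ((8# ⊗ N f) ⊗_) (E-single H k)))))) (Mean.one uH _)))
            (⊕-mono (scaled (proj₂ s₁)) (≤-trans (≡⇒≤ (trans (⊗-assoc _ _ _) (trans (cong (8# ⊗_) (⊗-comm _ _)) (sym (⊗-assoc _ _ _))))) (scaled (proj₂ s₂))))))

    -- digits in base ξ: e = r + k ξ
    main′ : ∀ e → e ℕ.≤ ξ ℕ.^ suc (suc d) → Inv β (c ℤ.* + h ℤ.* + e) ε
    main′ e e≤ = subst₂ (Inv β) u-eq (quarters ε)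
      (Inv-+ (atScale 1 1≤ξ (+ r) r≤) (atScale ξ ℕP.≤-refl (+ k) k≤))
      where
      instance
        ξ≢0 : ℕ.NonZero ξ
        ξ≢0 = ℕ.>-nonZero 1≤ξ
      r = e ℕDM.% ξ
      k = e ℕDM./ ξ
      r≤ : r ℕ.≤ ξ ℕ.^ suc d
      r≤ = ℕP.≤-trans (ℕP.<⇒≤ (ℕDM.m%n<n e ξ)) (ℕP.m≤m*n ξ (ξ ℕ.^ d) ⦃ ℕP.m^n≢0 ξ d ⦄)
      k≤ : k ℕ.≤ ξ ℕ.^ suc d
      k≤ = ℕP.≤-trans (ℕDM./-monoˡ-≤ ξ e≤) (ℕP.≤-reflexive (trans (cong (ℕDM._/ ξ) (ℕP.*-comm ξ (ξ ℕ.^ suc d))) (ℕDM.m*n/n≡m (ξ ℕ.^ suc d) ξ)))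
      alg : ∀ c h r k ξ → c ℤ.* + 1 ℤ.* h ℤ.* r ℤ.+ c ℤ.* ξ ℤ.* h ℤ.* k ≡ c ℤ.* h ℤ.* (r ℤ.+ k ℤ.* ξ)
      alg = solve-∀ ℤ-ring
      u-eq : c ℤ.* + 1 ℤ.* + h ℤ.* + r ℤ.+ c ℤ.* + ξ ℤ.* + h ℤ.* + k ≡ c ℤ.* + h ℤ.* + e
      u-eq = trans (alg c (+ h) (+ r) (+ k) (+ ξ)) (cong (c ℤ.* (+ h) ℤ.*_)
        (trans (cong (λ z → + r ℤ.+ z) (sym (ℤP.pos-* k ξ))) (cong +_ (sym (ℕDM.m≡m%n+[m/n]*n e ξ)))))

  main : ∀ p c → IsPoly (suc (suc d)) p c → ∀ X ξ → 1 ℕ.≤ ξ → K ℕ.* ξ ℕ.≤ suc X → ∀ S e →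
    ℤ.∣ e ∣ ℕ.≤ ξ ℕ.^ suc (suc d) → Theory.Inv ℤG S (polyMean p X) (c ℤ.* + h ℤ.* e) ε
  main p c isP X ξ 1≤ξ Kξ≤ S = Inv-signed S (c ℤ.* + h) (ξ ℕ.^ suc (suc d)) (main′ p c isP X ξ 1≤ξ Kξ≤ S)

weyl : ∀ d → Weyl (suc d)
weyl zero = weyl-1
weyl (suc d) = weyl-step d (weyl d)

-- Polynomials described by their iterated differences

IsPoly-cong : ∀ d {p q c} → (∀ x → p x ≡ q x) → IsPoly d p c → IsPoly d q c
IsPoly-cong zero e h x = trans (sym (e x)) (h x)
IsPoly-cong (suc d) e h a b = IsPoly-cong d (λ x → cong₂ ℤ._-_ (e _) (e _)) (h a b)

IsPoly-+ : ∀ d {p q c c′} → IsPoly d p c → IsPoly d q c′ → IsPoly d (λ x → p x ℤ.+ q x) (c ℤ.+ c′)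
IsPoly-+ zero h h′ x = cong₂ ℤ._+_ (h x) (h′ x)
IsPoly-+ (suc d) {p} {q} {c} {c′} h h′ a b =
  subst (IsPoly d _) (sym (ℤP.*-distribʳ-+ (a ℤ.- b) c c′))
    (IsPoly-cong d (λ x → l (p (x ℤ.+ a)) (p (x ℤ.+ b)) (q (x ℤ.+ a)) (q (x ℤ.+ b))) (IsPoly-+ d (h a b) (h′ a b)))
  where
  l : ∀ a b c d → (a ℤ.- b) ℤ.+ (c ℤ.- d) ≡ (a ℤ.+ c) ℤ.- (b ℤ.+ d)
  l = solve-∀ ℤ-ring

IsPoly-scale : ∀ d {p c} k → IsPoly d p c → IsPoly d (λ x → k ℤ.* p x) (k ℤ.* c)
IsPoly-scale zero k h x = cong (k ℤ.*_) (h x)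
IsPoly-scale (suc d) {p} {c} k h a b = subst (IsPoly d _) (sym (ℤP.*-assoc k c _))
  (IsPoly-cong d (λ x → l k (p (x ℤ.+ a)) (p (x ℤ.+ b))) (IsPoly-scale d k (h a b)))
  where
  l : ∀ k a b → k ℤ.* (a ℤ.- b) ≡ k ℤ.* a ℤ.- k ℤ.* b
  l = solve-∀ ℤ-ring

IsPoly-raise : ∀ d {p c} → IsPoly d p c → IsPoly (suc d) p (+ 0)
IsPoly-raise zero {p} {c} h a b x = trans (cong₂ ℤ._-_ (h _) (h _)) (ℤP.+-inverseʳ c)
IsPoly-raise (suc d) h a b = IsPoly-raise d (h a b)

IsPoly-shift : ∀ d {p c} a → IsPoly d p c → IsPoly d (λ x → p (x ℤ.+ a)) c
IsPoly-shift zero a h x = h _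
IsPoly-shift (suc d) {p} {c} s h a b = IsPoly-cong d
  (λ x → cong₂ ℤ._-_ (cong p (l x s a)) (cong p (l x s b))) (IsPoly-shift d s (h a b))
  where
  l : ∀ x s a → x ℤ.+ s ℤ.+ a ≡ x ℤ.+ a ℤ.+ s
  l = solve-∀ ℤ-ring

IsPoly-affine : ∀ d {p c} a w → IsPoly d p c → IsPoly d (λ x → p (a ℤ.+ w ℤ.* x)) (c ℤ.* w ℤ.^ d)
IsPoly-affine zero {p} {c} a w h x = trans (h _) (sym (ℤP.*-identityʳ c))
IsPoly-affine (suc d) {p} {c} a w h s t = subst (IsPoly d _) (l c w s t (w ℤ.^ d))
  (IsPoly-cong d (λ x → cong₂ ℤ._-_ (cong p (l′ a w x s)) (cong p (l′ a w x t))) (IsPoly-affine d a w (h (w ℤ.* s) (w ℤ.* t))))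
  where
  l : ∀ c w s t v → c ℤ.* (w ℤ.* s ℤ.- w ℤ.* t) ℤ.* v ≡ c ℤ.* (w ℤ.* v) ℤ.* (s ℤ.- t)
  l = solve-∀ ℤ-ring
  l′ : ∀ a w x s → a ℤ.+ w ℤ.* x ℤ.+ w ℤ.* s ≡ a ℤ.+ w ℤ.* (x ℤ.+ s)
  l′ = solve-∀ ℤ-ring

-- Leibniz rule: a difference of x·p is x times a difference of p plus a combination of two
-- translates of p. The factor d + 1 counts which of the differences falls on x.
IsPoly-x* : ∀ d {p c} → IsPoly d p c → IsPoly (suc d) (λ x → x ℤ.* p x) (+ suc d ℤ.* c)
IsPoly-x* zero {p} {c} h a b x = trans (cong₂ (λ u v → (x ℤ.+ a) ℤ.* u ℤ.- (x ℤ.+ b) ℤ.* v) (h _) (h _)) (l x a b c)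
  where
  l : ∀ x a b c → (x ℤ.+ a) ℤ.* c ℤ.- (x ℤ.+ b) ℤ.* c ≡ + 1 ℤ.* c ℤ.* (a ℤ.- b)
  l = solve-∀ ℤ-ring
IsPoly-x* (suc d) {p} {c} h a b = subst (IsPoly (suc d) (λ x → (x ℤ.+ a) ℤ.* p (x ℤ.+ a) ℤ.- (x ℤ.+ b) ℤ.* p (x ℤ.+ b))) (l₂ c a b (+ suc d))
  (IsPoly-cong (suc d) {c = + suc d ℤ.* (c ℤ.* (a ℤ.- b)) ℤ.+ (a ℤ.* c ℤ.+ (ℤ.- b) ℤ.* c)} (λ x → l₁ x a b (p (x ℤ.+ a)) (p (x ℤ.+ b)))
    (IsPoly-+ (suc d) {λ x → x ℤ.* (p (x ℤ.+ a) ℤ.- p (x ℤ.+ b))} {λ x → a ℤ.* p (x ℤ.+ a) ℤ.+ (ℤ.- b) ℤ.* p (x ℤ.+ b)} {c = + suc d ℤ.* (c ℤ.* (a ℤ.- b))} {c′ = a ℤ.* c ℤ.+ (ℤ.- b) ℤ.* c} (IsPoly-x* d (h a b))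
      (IsPoly-+ (suc d) {λ x → a ℤ.* p (x ℤ.+ a)} {λ x → (ℤ.- b) ℤ.* p (x ℤ.+ b)} {a ℤ.* c} {(ℤ.- b) ℤ.* c}
        (IsPoly-scale (suc d) {λ x → p (x ℤ.+ a)} {c} a (IsPoly-shift (suc d) {p} {c} a h))
        (IsPoly-scale (suc d) {λ x → p (x ℤ.+ b)} {c} (ℤ.- b) (IsPoly-shift (suc d) {p} {c} b h)))))
  where
  l₁ : ∀ x a b u v → x ℤ.* (u ℤ.- v) ℤ.+ (a ℤ.* u ℤ.+ (ℤ.- b) ℤ.* v) ≡ (x ℤ.+ a) ℤ.* u ℤ.- (x ℤ.+ b) ℤ.* v
  l₁ = solve-∀ ℤ-ring
  l₂ : ∀ c a b m → m ℤ.* (c ℤ.* (a ℤ.- b)) ℤ.+ (a ℤ.* c ℤ.+ (ℤ.- b) ℤ.* c) ≡ (+ 1 ℤ.+ m) ℤ.* c ℤ.* (a ℤ.- b)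
  l₂ = solve-∀ ℤ-ring

IsPoly-^ : ∀ n → IsPoly n (ℤ._^ n) (+ (n !))
IsPoly-^ zero x = refl
IsPoly-^ (suc n) = subst (IsPoly (suc n) (ℤ._^ suc n)) (sym (ℤP.pos-* (suc n) (n !))) (IsPoly-x* n {ℤ._^ n} {+ (n !)} (IsPoly-^ n))

polyEval : (ℕ → ℤ) → ℕ → ℤ → ℤ
polyEval c zero z = c 0
polyEval c (suc n) z = polyEval c n z ℤ.+ c (suc n) ℤ.* z ℤ.^ suc n

IsPoly-polyEval : ∀ c n → IsPoly n (polyEval c n) (c n ℤ.* + (n !))
IsPoly-polyEval c zero x = sym (ℤP.*-identityʳ (c 0))
IsPoly-polyEval c (suc n) = subst (IsPoly (suc n) (polyEval c (suc n))) (ℤP.+-identityˡ top)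
  (IsPoly-+ (suc n) {polyEval c n} {λ z → c (suc n) ℤ.* z ℤ.^ suc n} {+ 0} {top}
    (IsPoly-raise n (IsPoly-polyEval c n)) (IsPoly-scale (suc n) {ℤ._^ suc n} {+ (suc n !)} (c (suc n)) (IsPoly-^ (suc n))))
  where top = c (suc n) ℤ.* + (suc n !)

-- Absorbing the multiples of every coefficient

pos-^ : ∀ a n → + (a ℕ.^ n) ≡ (+ a) ℤ.^ n
pos-^ a zero = refl
pos-^ a (suc n) = trans (ℤP.pos-* a (a ℕ.^ n)) (cong (λ z → + a ℤ.* z) (pos-^ a n))

-- The cofactor g is returned together with its size, because the bound on g controls how far the
-- top monomial moves along a short progression.
power-difference : ∀ y t n → ∃[ g ] ((y ℕ.+ t) ℕ.^ suc n ≡ y ℕ.^ suc n ℕ.+ t ℕ.* g × g ℕ.≤ suc n ℕ.* (y ℕ.+ t) ℕ.^ n)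
power-difference y t zero = 1 , l y t , ℕP.≤-refl
  where
  l : ∀ y t → (y ℕ.+ t) ℕ.* 1 ≡ y ℕ.* 1 ℕ.+ t ℕ.* 1
  l y t = ℕP.*-distribʳ-+ 1 y t
power-difference y t (suc n) with power-difference y t n
... | g , eq , g≤ = y ℕ.^ suc n ℕ.+ (y ℕ.+ t) ℕ.* g ,
    trans (cong ((y ℕ.+ t) ℕ.*_) eq) (l y t (y ℕ.^ suc n) g) ,
    ℕP.+-mono-≤ (ℕP.^-monoˡ-≤ (suc n) (ℕP.m≤m+n y t))
      (ℕP.≤-trans (ℕP.*-monoʳ-≤ (y ℕ.+ t) g≤) (ℕP.≤-reflexive (l′ (y ℕ.+ t) (suc n) ((y ℕ.+ t) ℕ.^ n))))
  where
  l : ∀ y t p g → (y ℕ.+ t) ℕ.* (p ℕ.+ t ℕ.* g) ≡ y ℕ.* p ℕ.+ t ℕ.* (p ℕ.+ (y ℕ.+ t) ℕ.* g)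
  l = ℕR.solve-∀
  l′ : ∀ a b c → a ℕ.* (b ℕ.* c) ≡ b ℕ.* (a ℕ.* c)
  l′ = ℕR.solve-∀

^-distrib-* : ∀ n a b → (a ℕ.* b) ℕ.^ n ≡ a ℕ.^ n ℕ.* b ℕ.^ n
^-distrib-* zero a b = refl
^-distrib-* (suc n) a b = trans (cong (a ℕ.* b ℕ.*_) (^-distrib-* n a b)) (l a b (a ℕ.^ n) (b ℕ.^ n))
  where
  l : ∀ a b x y → a ℕ.* b ℕ.* (x ℕ.* y) ≡ a ℕ.* x ℕ.* (b ℕ.* y)
  l = ℕR.solve-∀

opaque
  unfolding _⊕_

  peel-total : ∀ e₁ j₄ j₅ e₃ n →
    2# ⊗ (e₁ ⊗ (4# ⊗ n)) ⊕ 2# ⊗ (2# ⊗ (j₄ ⊗ (4# ⊗ (4# ⊗ n))) ⊕ 2# ⊗ (2# ⊗ ((4# ⊗ j₅) ⊗ (4# ⊗ n)) ⊕ 2# ⊗ (e₃ ⊗ n)))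
      ≡ ((8# ⊗ e₁ ⊕ (+ 64 ℚ./ 1) ⊗ j₄) ⊕ ((+ 128 ℚ./ 1) ⊗ j₅ ⊕ 8# ⊗ e₃)) ⊗ n
  peel-total = solve-∀ ℚ-ring

  four-quarters : ∀ e → (e ⊗ inv 3 ⊕ e ⊗ inv 3) ⊕ (e ⊗ inv 3 ⊕ e ⊗ inv 3) ≡ e
  four-quarters = solve-∀ ℚ-ring

  eighth : ∀ e → 8# ⊗ (e ⊗ inv 7) ≡ e
  eighth = solve-∀ ℚ-ring

-- averaging over the values of R(a + W·) absorbs multiples of every coefficient c_l, l ≥ 1
Peel : ℕ → Set₁
Peel n = ∀ ε → 0ℚ < ε → ∀ A W → 1 ℕ.≤ W → Σ ℕ λ Q → Σ ℕ λ K → 1 ℕ.≤ Q × 1 ℕ.≤ K ×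
  (∀ c ξ → 1 ℕ.≤ ξ → ∀ X → suc X ≡ K ℕ.* ξ → ∀ a → a ℕ.≤ A ℕ.* (K ℕ.* ξ) → ∀ (S : Sys ℤG) l → l ℕ.< n →
    ∀ e → ℤ.∣ e ∣ ℕ.≤ ξ ℕ.^ suc l →
    Theory.Inv ℤG S (polyMean (λ x → polyEval c n (+ a ℤ.+ + W ℤ.* x)) X) (c (suc l) ℤ.* + Q ℤ.* e) ε)

-- The top coefficient is handled by Weyl's inequality.  After smoothing along it, the top monomial
-- is almost constant on short progressions of step W·Q₁, which lowers the degree.
module PeelStep (n : ℕ) (ih : Peel n) (ε : ℚ) (0<ε : 0ℚ < ε) (A W : ℕ) (1≤W : 1 ℕ.≤ W) where
  q ε₁ : ℚ
  q = ε ⊗ inv 3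
  q-pos : 0ℚ < q
  q-pos = ⊗-pos 0<ε (inv-pos 3)
  ε₁ = q ⊗ inv 7
  ε₁-pos : 0ℚ < ε₁
  ε₁-pos = ⊗-pos q-pos (inv-pos 7)
  sm₄ = small (+ 64 ℚ./ 1) q q-pos
  sm₅ = small (+ 128 ℚ./ 1) q q-pos
  K₄ K₅ : ℕ
  K₄ = proj₁ sm₄
  K₅ = proj₁ sm₅
  wl = weyl n ε₁ ε₁-pos
  h K₁ Q₁ M₀ D₀ C M A′ : ℕ
  h = proj₁ wl
  K₁ = proj₁ (proj₂ wl)
  -- Along arguments a + Wx the (n+1)-st difference is (n+1)!·W^(n+1) times the top coefficient; h
  -- is the multiplier from Weyl's inequality.
  Q₁ = (suc n !) ℕ.* W ℕ.^ suc n ℕ.* h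
  1≤Q₁ : 1 ℕ.≤ Q₁
  1≤Q₁ = ℕP.*-mono-≤ (ℕP.*-mono-≤ (ℕP.1≤n! (suc n)) (ℕP.m^n>0 W ⦃ ℕ.>-nonZero 1≤W ⦄ (suc n))) (proj₁ (proj₂ (proj₂ wl)))
  -- With X + 1 = M₀·X₁, the summand K₁ leaves room for Weyl's inequality at scale X₁, and (K₄+1)·Q₁
  -- for regrouping along the step Q₁. All arguments that then occur are at most D₀·X₁.
  M₀ = K₁ ℕ.+ suc K₄ ℕ.* Q₁
  D₀ = (A ℕ.+ W) ℕ.* M₀ ℕ.+ W ℕ.* Q₁
  -- Short progressions have X₂ = X₁/C terms. In units of Q₁ times the top coefficient, the top
  -- monomial moves along them by at most W·X₂·(n+1)·(D₀X₁)^n = X₁^(n+1)/(K₅+1), a small part of the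
  -- progression γ.
  C = suc K₅ ℕ.* (W ℕ.* (suc n ℕ.* D₀ ℕ.^ n))
  M = M₀ ℕ.* C
  A′ = (A ℕ.+ W) ℕ.* M
  IH = ih ε₁ ε₁-pos A′ (W ℕ.* Q₁) (ℕP.*-mono-≤ 1≤W 1≤Q₁)
  Q₃ K₃ Q scale K : ℕ
  Q₃ = proj₁ IH
  K₃ = proj₁ (proj₂ IH)
  1≤Q₃ : 1 ℕ.≤ Q₃
  1≤Q₃ = proj₁ (proj₂ (proj₂ IH))
  1≤K₃ : 1 ℕ.≤ K₃
  1≤K₃ = proj₁ (proj₂ (proj₂ (proj₂ IH)))
  Q = Q₁ ℕ.* Q₃
  scale = Q₁ ℕ.* (Q₃ ℕ.* suc K₁)
  K = M ℕ.* (K₃ ℕ.* scale)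
  1≤D₀ : 1 ℕ.≤ D₀
  1≤D₀ = ℕP.≤-trans (ℕP.*-mono-≤ 1≤W 1≤Q₁) (ℕP.m≤n+m (W ℕ.* Q₁) ((A ℕ.+ W) ℕ.* M₀))
  1≤C : 1 ℕ.≤ C
  1≤C = ℕP.*-mono-≤ {1} {suc K₅} (ℕ.s≤s ℕ.z≤n) (ℕP.*-mono-≤ 1≤W (ℕP.*-mono-≤ {1} {suc n} (ℕ.s≤s ℕ.z≤n) (ℕP.m^n>0 D₀ ⦃ ℕ.>-nonZero 1≤D₀ ⦄ n)))
  1≤M₀ : 1 ℕ.≤ M₀
  1≤M₀ = ℕP.≤-trans (ℕP.*-mono-≤ {1} {suc K₄} (ℕ.s≤s ℕ.z≤n) 1≤Q₁) (ℕP.m≤n+m (suc K₄ ℕ.* Q₁) K₁)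
  1≤M : 1 ℕ.≤ M
  1≤M = ℕP.*-mono-≤ 1≤M₀ 1≤C
  1≤scale : 1 ℕ.≤ scale
  1≤scale = ℕP.*-mono-≤ 1≤Q₁ (ℕP.*-mono-≤ {1} {Q₃} 1≤Q₃ (ℕ.s≤s ℕ.z≤n))
  1≤Q : 1 ℕ.≤ Q
  1≤Q = ℕP.*-mono-≤ 1≤Q₁ 1≤Q₃
  1≤K : 1 ℕ.≤ K
  1≤K = ℕP.*-mono-≤ 1≤M (ℕP.*-mono-≤ 1≤K₃ 1≤scale)

  module _ (c : ℕ → ℤ) (ξ : ℕ) (1≤ξ : 1 ℕ.≤ ξ) (X : ℕ) (X≡ : suc X ≡ K ℕ.* ξ) (a : ℕ) (a≤ : a ℕ.≤ A ℕ.* (K ℕ.* ξ)) (S : Sys ℤG) where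
    open Sys S
    open Theory ℤG S
    open Averages ℤG S

    ξ₃ X₂ X₁ : ℕ
    ξ₃ = scale ℕ.* ξ
    X₂ = K₃ ℕ.* ξ₃
    X₁ = C ℕ.* X₂
    1≤ξ₃ : 1 ℕ.≤ ξ₃
    1≤ξ₃ = ℕP.*-mono-≤ 1≤scale 1≤ξ
    1≤X₂ : 1 ℕ.≤ X₂
    1≤X₂ = ℕP.*-mono-≤ 1≤K₃ 1≤ξ₃
    1≤X₁ : 1 ℕ.≤ X₁
    1≤X₁ = ℕP.*-mono-≤ 1≤C 1≤X₂
    H : ℕ
    H = ℕ.pred X₂
    sucH : suc H ≡ X₂
    sucH = ℕP.suc-pred X₂ ⦃ ℕ.>-nonZero 1≤X₂ ⦄
    X≡M₀X₁ : suc X ≡ M₀ ℕ.* X₁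
    X≡M₀X₁ = trans X≡ (l M₀ C K₃ scale ξ)
      where
      l : ∀ m c k s x → m ℕ.* c ℕ.* (k ℕ.* s) ℕ.* x ≡ m ℕ.* (c ℕ.* (k ℕ.* (s ℕ.* x)))
      l = ℕR.solve-∀

    p : ℤ → ℤ
    p x = polyEval c (suc n) (+ a ℤ.+ + W ℤ.* x)
    β : Mean ℤ
    β = polyMean p X
    ct : ℤ
    ct = c (suc n)

    weyl-Inv : ∀ ξ′ → 1 ℕ.≤ ξ′ → K₁ ℕ.* ξ′ ℕ.≤ suc X → ∀ e → ℤ.∣ e ∣ ℕ.≤ ξ′ ℕ.^ suc n → Inv β (ct ℤ.* + Q₁ ℤ.* e) ε₁
    weyl-Inv ξ′ 1≤ξ′ le e e≤ = subst (λ u → Inv β u ε₁) eq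
      (proj₂ (proj₂ (proj₂ wl)) p (ct ℤ.* + (suc n !) ℤ.* (+ W) ℤ.^ suc n) (IsPoly-affine (suc n) {polyEval c (suc n)} {ct ℤ.* + (suc n !)} (+ a) (+ W) (IsPoly-polyEval c (suc n))) X ξ′ 1≤ξ′ le S e e≤)
      where
      assoc : ∀ a b c d e → a ℤ.* b ℤ.* c ℤ.* d ℤ.* e ≡ a ℤ.* (b ℤ.* c ℤ.* d) ℤ.* e
      assoc = solve-∀ ℤ-ring
      eq : ct ℤ.* + (suc n !) ℤ.* (+ W) ℤ.^ suc n ℤ.* + h ℤ.* e ≡ ct ℤ.* + Q₁ ℤ.* e
      eq = trans (assoc ct _ _ (+ h) e) (cong (λ z → ct ℤ.* z ℤ.* e)
        (sym (trans (ℤP.pos-* ((suc n !) ℕ.* W ℕ.^ suc n) h) (cong (ℤ._* + h) (trans (ℤP.pos-* (suc n !) (W ℕ.^ suc n)) (cong (λ z → + (suc n !) ℤ.* z) (pos-^ W (suc n))))))))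

    Ebox : ℕ
    Ebox = ℕ.pred (X₁ ℕ.^ suc n)
    sucE : suc Ebox ≡ X₁ ℕ.^ suc n
    sucE = ℕP.suc-pred (X₁ ℕ.^ suc n) ⦃ ℕP.m^n≢0 X₁ (suc n) ⦃ ℕ.>-nonZero 1≤X₁ ⦄ ⦄
    step : ℤ → ℤ
    step x = ct ℤ.* + Q₁ ℤ.* x
    γ : Mean ℤ
    γ = polyMean step Ebox
    step-poly : IsPoly 1 step (ct ℤ.* + Q₁)
    step-poly a b x = l (ct ℤ.* + Q₁) x a b
      where
      l : ∀ k x a b → k ℤ.* (x ℤ.+ a) ℤ.- k ℤ.* (x ℤ.+ b) ≡ k ℤ.* (a ℤ.- b)
      l = solve-∀ ℤ-ring
    K₁X₁≤ : K₁ ℕ.* X₁ ℕ.≤ suc X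
    K₁X₁≤ = ℕP.≤-trans (ℕP.*-monoˡ-≤ X₁ (ℕP.m≤m+n K₁ _)) (ℕP.≤-reflexive (sym X≡M₀X₁))

    β-γ : ∀ f → N (op β (f -ᶠ op γ f)) ≤ ε₁ ⊗ N f
    β-γ = Inv-avg β (uniform Ebox) (λ i → step (+ toℕ i))
      (λ i → weyl-Inv X₁ 1≤X₁ K₁X₁≤ (+ toℕ i) (ℕP.≤-trans (ℕP.≤-pred (FinP.toℕ<n i)) (ℕP.≤-trans (ℕP.n≤1+n Ebox) (ℕP.≤-reflexive sucE))))

    γ-Inv : ∀ f → suc K₅ ℕ.* f ℕ.≤ X₁ ℕ.^ suc n → Inv γ (step (+ f)) (4# ⊗ inv K₅)
    γ-Inv f le = linear-Inv step (ct ℤ.* + Q₁) step-poly S K₅ f Ebox (ℕP.≤-trans le (ℕP.≤-reflexive (sym sucE))) (+ f) ℕP.≤-refl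

    lower : ∀ l → l ℕ.< n → ∀ e → ℤ.∣ e ∣ ℕ.≤ ξ ℕ.^ suc l → Inv β (c (suc l) ℤ.* + Q ℤ.* e) ε
    lower l l<n e e≤ = mkInv bound
      where
      u : ℤ
      u = c (suc l) ℤ.* + Q ℤ.* e
      module _ (f : Fun) where
        F′ G : Fun
        F′ = δ u f
        G = op γ F′
        NF′ : N F′ ≤ 4# ⊗ N f
        NF′ = N-δ u f
        NG : N G ≤ 4# ⊗ N f
        NG = ≤-trans (op-contract γ F′) NF′
        v : ℕ → Fun
        v x = G ∘ act (p (+ x))
        w : Fun
        w y = E (uniform X) (λ i → E (uniform H) (λ k → v (toℕ k ℕ.* Q₁ ℕ.+ toℕ i) y))
        fits : suc K₄ ℕ.* (H ℕ.* Q₁) ℕ.≤ suc X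
        fits = ℕP.≤-trans (ℕP.*-monoʳ-≤ (suc K₄) (ℕP.*-monoˡ-≤ Q₁ (ℕP.≤-trans (ℕP.n≤1+n H) (ℕP.≤-reflexive sucH))))
          (ℕP.≤-trans (ℕP.≤-reflexive (l₁ (suc K₄) X₂ Q₁)) (ℕP.≤-trans (ℕP.*-mono-≤ (ℕP.m≤n+m (suc K₄ ℕ.* Q₁) K₁) (ℕP.m≤n*m X₂ C ⦃ ℕ.>-nonZero 1≤C ⦄)) (ℕP.≤-reflexive (sym X≡M₀X₁))))
          where
          l₁ : ∀ a b c → a ℕ.* (b ℕ.* c) ≡ a ℕ.* c ℕ.* b
          l₁ = ℕR.solve-∀
        grouped : N (op β G -ᶠ w) ≤ inv K₄ ⊗ (4# ⊗ (4# ⊗ N f))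
        grouped = regroup v (4# ⊗ N f) (λ x → ≤-trans (≡⇒≤ (N-act _ G)) NG) X K₄ H Q₁ fits

        module _ (x : ℕ) (x≤ : x ℕ.≤ X) where
          a′ : ℕ
          a′ = a ℕ.+ W ℕ.* x
          z : ℕ → ℕ
          z k = a′ ℕ.+ (W ℕ.* Q₁) ℕ.* k
          arg-eq : ∀ k → + a ℤ.+ + W ℤ.* + (k ℕ.* Q₁ ℕ.+ x) ≡ + z k
          arg-eq k = trans (cong (λ t → + a ℤ.+ t) (sym (ℤP.pos-* W _))) (cong +_ (l₁ a W Q₁ k x))
            where
            l₁ : ∀ a w q k x → a ℕ.+ w ℕ.* (k ℕ.* q ℕ.+ x) ≡ a ℕ.+ w ℕ.* x ℕ.+ (w ℕ.* q) ℕ.* k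
            l₁ = ℕR.solve-∀
          r s : ℕ → ℤ
          r k = polyEval c n (+ z k)
          s k = ct ℤ.* (+ z k) ℤ.^ suc n
          s₀ : ℤ
          s₀ = ct ℤ.* (+ a′) ℤ.^ suc n
          inner main : Fun
          inner y = E (uniform H) (λ k → v (toℕ k ℕ.* Q₁ ℕ.+ x) y)
          main y = E (uniform H) (λ k → G (act s₀ (act (r (toℕ k)) y)))
          a′≤ : a′ ℕ.≤ (A ℕ.+ W) ℕ.* suc X
          a′≤ = ℕP.≤-trans (ℕP.+-mono-≤ (ℕP.≤-trans a≤ (ℕP.≤-reflexive (cong (A ℕ.*_) (sym X≡)))) (ℕP.*-monoʳ-≤ W (ℕP.≤-trans x≤ (ℕP.n≤1+n X))))
            (ℕP.≤-reflexive (sym (ℕP.*-distribʳ-+ (suc X) A W)))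
          z≤ : ∀ k → k ℕ.≤ H → z k ℕ.≤ D₀ ℕ.* X₁
          z≤ k k≤ = ℕP.≤-trans (ℕP.+-mono-≤ (ℕP.≤-trans a′≤ (ℕP.≤-reflexive (trans (cong ((A ℕ.+ W) ℕ.*_) X≡M₀X₁) (sym (ℕP.*-assoc (A ℕ.+ W) M₀ X₁)))))
              (ℕP.*-monoʳ-≤ (W ℕ.* Q₁) (ℕP.≤-trans k≤X₂ (ℕP.m≤n*m X₂ C ⦃ ℕ.>-nonZero 1≤C ⦄))))
            (ℕP.≤-reflexive (sym (ℕP.*-distribʳ-+ X₁ ((A ℕ.+ W) ℕ.* M₀) (W ℕ.* Q₁))))
            where k≤X₂ = ℕP.≤-trans k≤ (ℕP.≤-trans (ℕP.n≤1+n H) (ℕP.≤-reflexive sucH))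
          pd : ∀ k → _
          pd k = power-difference a′ ((W ℕ.* Q₁) ℕ.* k) n
          fk : ℕ → ℕ
          fk k = W ℕ.* k ℕ.* proj₁ (pd k)
          s-eq : ∀ k → s k ≡ step (+ fk k) ℤ.+ s₀
          s-eq k = trans (cong (ct ℤ.*_) (trans (sym (pos-^ (z k) (suc n))) (trans (cong +_ (trans (proj₁ (proj₂ (pd k))) (cong (a′ ℕ.^ suc n ℕ.+_) (l₂ W Q₁ k (proj₁ (pd k))))))
              (cong₂ (λ α β′ → α ℤ.+ β′) (pos-^ a′ (suc n)) (ℤP.pos-* Q₁ (fk k))))))
            (l₁ ct ((+ a′) ℤ.^ suc n) (+ Q₁) (+ fk k))
            where
            l₁ : ∀ c b q f → c ℤ.* (b ℤ.+ q ℤ.* f) ≡ c ℤ.* q ℤ.* f ℤ.+ c ℤ.* b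
            l₁ = solve-∀ ℤ-ring
            l₂ : ∀ w q k g → w ℕ.* q ℕ.* k ℕ.* g ≡ q ℕ.* (w ℕ.* k ℕ.* g)
            l₂ = ℕR.solve-∀
          fk≤ : ∀ k → k ℕ.≤ H → suc K₅ ℕ.* fk k ℕ.≤ X₁ ℕ.^ suc n
          fk≤ k k≤ = ℕP.≤-trans (ℕP.*-monoʳ-≤ (suc K₅) (ℕP.*-mono-≤ (ℕP.*-monoʳ-≤ W k≤X₂)
              (ℕP.≤-trans (proj₂ (proj₂ (pd k))) (ℕP.*-monoʳ-≤ (suc n) (ℕP.≤-trans (ℕP.^-monoˡ-≤ n (z≤ k k≤)) (ℕP.≤-reflexive (^-distrib-* n D₀ X₁)))))))
            (ℕP.≤-reflexive (l₁ (suc K₅) W X₂ (suc n) (D₀ ℕ.^ n) (X₁ ℕ.^ n)))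
            where
            k≤X₂ = ℕP.≤-trans k≤ (ℕP.≤-trans (ℕP.n≤1+n H) (ℕP.≤-reflexive sucH))
            l₁ : ∀ k w x m d y → k ℕ.* (w ℕ.* x ℕ.* (m ℕ.* (d ℕ.* y))) ≡ k ℕ.* (w ℕ.* (m ℕ.* d)) ℕ.* x ℕ.* y
            l₁ = ℕR.solve-∀
          -- The function `G` is already averaged along γ, which absorbs `step (+ fk k)`. The top
          -- monomial may therefore be frozen at its initial value `s₀`.
          close : N (inner -ᶠ main) ≤ (4# ⊗ inv K₅) ⊗ (4# ⊗ N f)
          close = ≤-trans (≡⇒≤ (N-cong (λ y → sym (Mean.sub (uniform H) _ _))))
            (N-avg-bound (uniform H) (λ k y → v (toℕ k ℕ.* Q₁ ℕ.+ x) y ⊝ G (act s₀ (act (r (toℕ k)) y))) (λ k → each (toℕ k) (ℕP.≤-pred (FinP.toℕ<n k))))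
            where
            moved : ℕ → Fun
            moved k y = G (act (step (+ fk k)) y) ⊝ G y
            each : ∀ k → k ℕ.≤ H → N (λ y → v (k ℕ.* Q₁ ℕ.+ x) y ⊝ G (act s₀ (act (r k) y))) ≤ (4# ⊗ inv K₅) ⊗ (4# ⊗ N f)
            each k k≤ = ≤-trans (≡⇒≤ (trans (N-cong {g = moved k ∘ act s₀ ∘ act (r k)} (λ y →
                  cong (_⊝ G (act s₀ (act (r k) y))) (cong G (trans (cong (λ t → act t y) (trans (cong (polyEval c (suc n)) (arg-eq k)) (trans (ℤP.+-comm (r k) (s k)) (cong (ℤ._+ r k) (s-eq k)))))
                    (trans (act-+ _ (r k) y) (act-+ _ s₀ _))))))
                (trans (N-act (r k) (moved k ∘ act s₀)) (trans (N-act s₀ (moved k)) (trans (N-flip (G ∘ act (step (+ fk k))) G) (N-cong (λ y → sym (trans (op-- γ F′ (F′ ∘ act (step (+ fk k))) y) (cong (G y ⊝_) (op-act γ (step (+ fk k)) F′ y)))))))))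
              ) (≤-trans (app (γ-Inv (fk k) (fk≤ k k≤)) F′) (⊗-monoˡ _ (⊗-nonneg 0≤4 (inv-nonneg K₅)) NF′))
          e′ : ℤ
          e′ = + Q₁ ℤ.* e
          u-eq : c (suc l) ℤ.* + Q₃ ℤ.* e′ ≡ u
          u-eq = trans (l₁ (c (suc l)) (+ Q₃) (+ Q₁) e) (cong (λ t → c (suc l) ℤ.* t ℤ.* e) (sym (ℤP.pos-* Q₁ Q₃)))
            where
            l₁ : ∀ c q p e → c ℤ.* q ℤ.* (p ℤ.* e) ≡ c ℤ.* (p ℤ.* q) ℤ.* e
            l₁ = solve-∀ ℤ-ring
          e′≤ : ℤ.∣ e′ ∣ ℕ.≤ ξ₃ ℕ.^ suc l
          e′≤ = ℕP.≤-trans (ℕP.≤-reflexive (ℤP.abs-* (+ Q₁) e)) (ℕP.≤-trans (ℕP.*-monoʳ-≤ Q₁ e≤) (ℕP.≤-trans (mul-^ Q₁ ξ l 1≤Q₁)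
            (ℕP.^-monoˡ-≤ (suc l) (ℕP.*-monoˡ-≤ ξ (ℕP.m≤m*n Q₁ (Q₃ ℕ.* suc K₁) ⦃ ℕ.>-nonZero (ℕP.*-mono-≤ {1} {Q₃} {1} {suc K₁} 1≤Q₃ (ℕ.s≤s ℕ.z≤n)) ⦄)))))
          β₂ : Mean ℤ
          β₂ = polyMean (λ t → polyEval c n (+ a′ ℤ.+ + (W ℕ.* Q₁) ℤ.* t)) H
          a′-bound : a′ ℕ.≤ A′ ℕ.* (K₃ ℕ.* ξ₃)
          a′-bound = ℕP.≤-trans a′≤ (ℕP.≤-reflexive (trans (cong ((A ℕ.+ W) ℕ.*_) (trans X≡M₀X₁ (sym (ℕP.*-assoc M₀ C X₂)))) (sym (ℕP.*-assoc (A ℕ.+ W) M X₂))))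
          β₂-Inv : Inv β₂ u ε₁
          β₂-Inv = subst (λ t → Inv β₂ t ε₁) u-eq (proj₂ (proj₂ (proj₂ (proj₂ IH))) c ξ₃ 1≤ξ₃ H sucH a′ a′-bound S l l<n e′ e′≤)
          main≤ : N main ≤ ε₁ ⊗ N f
          main≤ = ≤-trans (≡⇒≤ (trans (N-cong {g = op β₂ (op γ F′) ∘ act s₀} (λ y → Mean.cng (uniform H) (λ k → cong G (trans (act-comm s₀ _ y)
              (cong (λ t → act t (act s₀ y)) (cong (polyEval c n) (trans (cong (λ t → + a′ ℤ.+ t) (ℤP.pos-* (W ℕ.* Q₁) (toℕ k))) refl)))))))
              (N-act s₀ _))) (Inv-conv γ β₂-Inv f)
          inner≤ : N inner ≤ 2# ⊗ ((4# ⊗ inv K₅) ⊗ (4# ⊗ N f)) ⊕ 2# ⊗ (ε₁ ⊗ N f)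
          inner≤ = N-via inner main close main≤

        w≤ : N w ≤ 2# ⊗ ((4# ⊗ inv K₅) ⊗ (4# ⊗ N f)) ⊕ 2# ⊗ (ε₁ ⊗ N f)
        w≤ = N-avg-bound (uniform X) (λ i → inner (toℕ i) (ℕP.≤-pred (FinP.toℕ<n i))) (λ i → inner≤ (toℕ i) (ℕP.≤-pred (FinP.toℕ<n i)))

        bound : N (op β F′) ≤ ε ⊗ N f
        bound = ≤-trans (N-via (op β F′) (op β G)
            (≤-trans (≡⇒≤ (N-cong (λ y → sym (op-- β F′ G y)))) (≤-trans (β-γ F′) (⊗-monoˡ ε₁ (<⇒≤ ε₁-pos) NF′)))
            (N-via (op β G) w grouped w≤))
          (≤-trans (≡⇒≤ (peel-total ε₁ (inv K₄) (inv K₅) ε₁ (N f))) (⊗-monoʳ (N f) (N-nonneg f)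
            (≤-trans (⊕-mono (⊕-mono (≡⇒≤ (eighth q)) (proj₂ sm₄)) (⊕-mono (proj₂ sm₅) (≡⇒≤ (eighth q)))) (≡⇒≤ (four-quarters ε)))))

    top : ∀ e → ℤ.∣ e ∣ ℕ.≤ ξ ℕ.^ suc n → Inv β (c (suc n) ℤ.* + Q ℤ.* e) ε
    top e e≤ = subst (λ t → Inv β t ε) u-eq (Inv-weaken ε₁≤ (weyl-Inv ξ₃ 1≤ξ₃ le e′ e′≤))
      where
      e′ : ℤ
      e′ = + Q₃ ℤ.* e
      u-eq : ct ℤ.* + Q₁ ℤ.* e′ ≡ ct ℤ.* + Q ℤ.* e
      u-eq = trans (l₁ ct (+ Q₁) (+ Q₃) e) (cong (λ t → ct ℤ.* t ℤ.* e) (sym (ℤP.pos-* Q₁ Q₃)))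
        where
        l₁ : ∀ c p q e → c ℤ.* p ℤ.* (q ℤ.* e) ≡ c ℤ.* (p ℤ.* q) ℤ.* e
        l₁ = solve-∀ ℤ-ring
      ε₁≤ : ε₁ ≤ ε
      ε₁≤ = ≤-trans (⊗-monoˡ q (<⇒≤ q-pos) (inv-≤1 7)) (≤-trans (≡⇒≤ (⊗-idʳ q)) (≤-trans (⊗-monoˡ ε (<⇒≤ 0<ε) (inv-≤1 3)) (≡⇒≤ (⊗-idʳ ε))))
      le : K₁ ℕ.* ξ₃ ℕ.≤ suc X
      le = ℕP.≤-trans (ℕP.*-mono-≤ (ℕP.m≤m+n K₁ (suc K₄ ℕ.* Q₁)) (ℕP.≤-trans (ℕP.m≤n*m ξ₃ K₃ ⦃ ℕ.>-nonZero 1≤K₃ ⦄) (ℕP.m≤n*m X₂ C ⦃ ℕ.>-nonZero 1≤C ⦄)))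
        (ℕP.≤-reflexive (sym X≡M₀X₁))
      e′≤ : ℤ.∣ e′ ∣ ℕ.≤ ξ₃ ℕ.^ suc n
      e′≤ = ℕP.≤-trans (ℕP.≤-reflexive (ℤP.abs-* (+ Q₃) e)) (ℕP.≤-trans (ℕP.*-monoʳ-≤ Q₃ e≤) (ℕP.≤-trans (mul-^ Q₃ ξ n 1≤Q₃)
        (ℕP.^-monoˡ-≤ (suc n) (ℕP.*-monoˡ-≤ ξ (ℕP.≤-trans (ℕP.m≤m*n Q₃ (suc K₁)) (ℕP.m≤n*m (Q₃ ℕ.* suc K₁) Q₁ ⦃ ℕ.>-nonZero 1≤Q₁ ⦄))))))

    both : ∀ l → l ℕ.< suc n → ∀ e → ℤ.∣ e ∣ ℕ.≤ ξ ℕ.^ suc l → Inv β (c (suc l) ℤ.* + Q ℤ.* e) ε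
    both l l<1+n e e≤ = either (l ℕ.≟ n) (λ { refl → top e e≤ }) (λ l≢n → lower l (ℕP.≤∧≢⇒< (ℕP.≤-pred l<1+n) l≢n) e e≤)

peel : ∀ n → Peel n
peel zero ε 0<ε A W 1≤W = 1 , 1 , ℕP.≤-refl , ℕP.≤-refl , λ c ξ 1≤ξ X X≡ a a≤ S l ()
peel (suc n) ε 0<ε A W 1≤W = P.Q , P.K , P.1≤Q , P.1≤K , P.both
  where module P = PeelStep n (peel n) ε 0<ε A W 1≤W

-- Energy of averaging operators

opaque
  unfolding _⊕_

  sq-diff′ : ∀ a b → (a ⊝ b) ⊗ (a ⊝ b) ≡ (a ⊗ a ⊕ b ⊗ b) ⊝ 2# ⊗ (b ⊗ a)
  sq-diff′ = solve-∀ ℚ-ring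

  energy-split : ∀ i a a′ → (a′ ⊕ a ⊝ 2# ⊗ i) ≡ ((a′ ⊝ a) ⊕ 2# ⊗ (a ⊝ i))
  energy-split = solve-∀ ℚ-ring

  ⊝-⊗ : ∀ a b f → (a ⊝ b) ⊗ f ≡ a ⊗ f ⊝ b ⊗ f
  ⊝-⊗ = solve-∀ ℚ-ring

  ⊝-mono : ∀ {a b} c → a ≤ b → a ⊝ c ≤ b ⊝ c
  ⊝-mono c p = ℚP.+-monoˡ-≤ (ℚ.- c) p

  ⊝-nonneg-anti : ∀ {a b} → 0ℚ ≤ b → a ⊝ b ≤ a
  ⊝-nonneg-anti {a} {b} p = from-⊝-nonneg (subst (0ℚ ≤_) (l a b) p)
    where
    l : ∀ a b → b ≡ a ⊝ (a ⊝ b)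
    l = solve-∀ ℚ-ring

module Energy (G : Grp) (S : Sys G) where
  open Grp G
  open Sys S
  open Theory G S

  -- the measure of v − u with u, v independent of law Δ; op (gram Δ) is Δ*Δ
  gram : Mean Λ → Mean Λ
  gram Δ = bind Δ (λ u → push (λ v → v +ᵍ (-ᵍ u)) Δ)

  op-gram : ∀ Δ f y → op (gram Δ) f y ≡ op (push -ᵍ_ Δ) (op Δ f) y
  op-gram Δ f y = Mean.cng Δ (λ u → Mean.cng Δ (λ v → cong f (act-+ v (-ᵍ u) y)))

  inner-gram : ∀ Δ f g → ⟨ g , op (gram Δ) f ⟩ ≡ ⟨ op Δ g , op Δ f ⟩
  inner-gram Δ f g = trans (Mean.cng μ (λ y → cong (g y ⊗_) (op-gram Δ f y))) (sym (inner-op Δ g (op Δ f)))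

  N-gram : ∀ Δ f → N (op (gram Δ) f) ≤ N (op Δ f)
  N-gram Δ f = ≤-trans (≡⇒≤ (N-cong (op-gram Δ f))) (op-contract (push -ᵍ_ Δ) (op Δ f))

  Inv-gram : ∀ {Δ u ε} → Inv Δ u ε → Inv (gram Δ) u ε
  Inv-gram {Δ} {u} h = mkInv (λ f → ≤-trans (N-gram Δ (δ u f)) (app h f))

  -- If Γ = Δ*Δ almost absorbs Γ′ = Δ′*Δ′, the energies ‖ΔF‖² ≤ ‖Δ′F‖² control ‖Γ′F − ΓF‖².
  energy-close : ∀ Δ Δ′ F s t η → N F ≤ 1ℚ → 0ℚ ≤ s → s ⊗ t ≡ 1ℚ → 0ℚ ≤ t →
    N (op (gram Δ) (F -ᶠ op (gram Δ′) F)) ≤ η →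
    N (op (gram Δ′) F -ᶠ op (gram Δ) F) ≤ (N (op Δ′ F) ⊝ N (op Δ F)) ⊕ (s ⊗ η ⊕ t)
  energy-close Δ Δ′ F s t η NF≤1 0≤s st≡1 0≤t absorbed =
    ≤-trans (≡⇒≤ (trans (Mean.cng μ (λ y → sq-diff′ (Γ′F y) (ΓF y)))
        (trans (Mean.sub μ _ _) (cong₂ _⊝_ (Mean.add μ _ _) (Mean.scl μ _ _)))))
      (≤-trans (⊝-mono (2# ⊗ i) (⊕-mono (N-gram Δ′ F) (N-gram Δ F)))
      (≤-trans (≡⇒≤ (energy-split i a a′)) (⊕-mono (≤-refl {a′ ⊝ a})
        (≤-trans (≡⇒≤ (cong (2# ⊗_) a-i)) (≤-trans (young h F s t 0≤s st≡1)
          (⊕-mono (⊗-monoˡ s 0≤s absorbed) (≤-trans (⊗-monoˡ t 0≤t NF≤1) (≡⇒≤ (⊗-idʳ t)))))))))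
    where
    ΓF Γ′F h : Fun
    ΓF = op (gram Δ) F
    Γ′F = op (gram Δ′) F
    h = op (gram Δ) (F -ᶠ Γ′F)
    a a′ i : ℚ
    a = N (op Δ F)
    a′ = N (op Δ′ F)
    i = ⟨ ΓF , Γ′F ⟩
    ⟨ΓΓ′F,F⟩ : ⟨ op (gram Δ) Γ′F , F ⟩ ≡ i
    ⟨ΓΓ′F,F⟩ = trans (Mean.cng μ (λ y → cong (_⊗ F y) (op-comm (gram Δ) (gram Δ′) F y)))
      (trans (inner-sym (op (gram Δ′) ΓF) F) (trans (inner-gram Δ′ ΓF F) (trans (inner-sym (op Δ′ F) (op Δ′ ΓF)) (sym (inner-gram Δ′ F ΓF)))))
    -- Here Γ = Δ*Δ and Γ′ = Δ′*Δ′ commute and are self-adjoint, so ⟨ΓΓ′F, F⟩ = ⟨ΓF, Γ′F⟩.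
    a-i : a ⊝ i ≡ ⟨ h , F ⟩
    a-i = sym (trans (Mean.cng μ (λ y → trans (cong (_⊗ F y) (op-- (gram Δ) F Γ′F y)) (⊝-⊗ (ΓF y) (op (gram Δ) Γ′F y) (F y))))
      (trans (Mean.sub μ _ _) (cong₂ _⊝_ (trans (inner-sym ΓF F) (inner-gram Δ F F)) ⟨ΓΓ′F,F⟩)))

-- Boxes spanned by multiples of the coefficients

comb : (ℕ → ℤ) → (ℕ → ℤ) → ℕ → ℤ
comb c e zero = + 0
comb c e (suc n) = comb c e n ℤ.+ c (suc n) ℤ.* e n

-- The law of a sum of independent uniform points of the progressions c_l·Q·[0, ξ^l), 1 ≤ l ≤ n.
-- Each side is as long as the monomial it accompanies when the variable has size ξ, in units of its
-- own coefficient.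
box : (ℕ → ℤ) → ℤ → ℕ → ℕ → Mean ℤ
box c Q ξ zero = point (+ 0)
box c Q ξ (suc n) = bind (box c Q ξ n) (λ u → push (λ i → u ℤ.+ c (suc n) ℤ.* Q ℤ.* + toℕ i) (uniform (ℕ.pred (ξ ℕ.^ suc n))))

box-neg : ∀ c Q ξ n f → E (box c (ℤ.- Q) ξ n) f ≡ E (push ℤ.-_ (box c Q ξ n)) f
box-neg c Q ξ zero f = refl
box-neg c Q ξ (suc n) f = trans (box-neg c Q ξ n _) (Mean.cng (box c Q ξ n) (λ u →
  Mean.cng (uniform (ℕ.pred (ξ ℕ.^ suc n))) (λ i → cong f (l u (c (suc n)) Q (+ toℕ i)))))
  where
  l : ∀ u c q i → ℤ.- u ℤ.+ c ℤ.* (ℤ.- q) ℤ.* i ≡ ℤ.- (u ℤ.+ c ℤ.* q ℤ.* i)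
  l = solve-∀ ℤ-ring

-- Losses from n successive uses of ‖a + b‖² ≤ 2‖a‖² + 2‖b‖². `absorbConst` reappears wherever n
-- approximations are chained; `boxConst` starts from the error 4/(K+1) of one side.
absorbConst boxConst : ℕ → ℚ
absorbConst zero = 0ℚ
absorbConst (suc n) = 2# ⊗ absorbConst n ⊕ 2#
boxConst zero = 0ℚ
boxConst (suc n) = 2# ⊗ 4# ⊕ 2# ⊗ boxConst n

module Boxes (S : Sys ℤG) (c : ℕ → ℤ) where
  open Sys S
  open Theory ℤG S
  open Energy ℤG S

  side : ℤ → ℕ → ℕ → Mean ℤ
  side Q ξ n = polyMean (λ x → c (suc n) ℤ.* Q ℤ.* x) (ℕ.pred (ξ ℕ.^ suc n))

  op-box : ∀ Q ξ n f y → op (box c Q ξ (suc n)) f y ≡ op (box c Q ξ n) (op (side Q ξ n) f) y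
  op-box Q ξ n f y = Mean.cng (box c Q ξ n) (λ u → Mean.cng (uniform (ℕ.pred (ξ ℕ.^ suc n)))
    (λ i → cong f (trans (act-+ u (c (suc n) ℤ.* Q ℤ.* + toℕ i) y) (act-comm u (c (suc n) ℤ.* Q ℤ.* + toℕ i) y))))

  suc-side : ∀ ξ n → 1 ℕ.≤ ξ → suc (ℕ.pred (ξ ℕ.^ suc n)) ≡ ξ ℕ.^ suc n
  suc-side ξ n 1≤ξ = ℕP.suc-pred (ξ ℕ.^ suc n) ⦃ ℕP.m^n≢0 ξ (suc n) ⦃ ℕ.>-nonZero 1≤ξ ⦄ ⦄

  -- The side belonging to c_{l+1} absorbs shifts up to a (K+1)-th of its length; the averages over
  -- the other sides commute with it and contract.
  box-Inv₁ : ∀ Q ξ K n l → 1 ℕ.≤ ξ → l ℕ.< n → ∀ e → suc K ℕ.* ℤ.∣ e ∣ ℕ.≤ ξ ℕ.^ suc l →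
    Inv (box c Q ξ n) (c (suc l) ℤ.* Q ℤ.* e) (4# ⊗ inv K)
  box-Inv₁ Q ξ K (suc n) l 1≤ξ l<1+n e e≤ = mkInv (λ f → ≤-trans (≡⇒≤ (N-cong (op-box Q ξ n (δ u f)))) (go f))
    where
    u = c (suc l) ℤ.* Q ℤ.* e
    step-poly : ∀ k → IsPoly 1 (λ x → k ℤ.* x) k
    step-poly k a b x = lem k x a b
      where
      lem : ∀ k x a b → k ℤ.* (x ℤ.+ a) ℤ.- k ℤ.* (x ℤ.+ b) ≡ k ℤ.* (a ℤ.- b)
      lem = solve-∀ ℤ-ring
    go : ∀ f → N (op (box c Q ξ n) (op (side Q ξ n) (δ u f))) ≤ (4# ⊗ inv K) ⊗ N f
    go f with l ℕ.≟ n
    ... | yes refl = ≤-trans (op-contract (box c Q ξ n) (op (side Q ξ n) (δ u f))) (app (linear-Inv (λ x → c (suc n) ℤ.* Q ℤ.* x) (c (suc n) ℤ.* Q) (step-poly (c (suc n) ℤ.* Q)) S K ℤ.∣ e ∣ _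
        (ℕP.≤-trans e≤ (ℕP.≤-reflexive (sym (suc-side ξ n 1≤ξ)))) e ℕP.≤-refl) f)
    ... | no l≢n = Inv-conv (side Q ξ n) (box-Inv₁ Q ξ K n l 1≤ξ (ℕP.≤∧≢⇒< (ℕP.≤-pred l<1+n) l≢n) e e≤) f

  box-Inv : ∀ Q ξ K n m → 1 ℕ.≤ ξ → m ℕ.≤ n → ∀ e → (∀ l → l ℕ.< m → suc K ℕ.* ℤ.∣ e l ∣ ℕ.≤ ξ ℕ.^ suc l) →
    Inv (box c Q ξ n) (Q ℤ.* comb c e m) (boxConst m ⊗ inv K)
  box-Inv Q ξ K n zero 1≤ξ m≤n e h = subst₂ (Inv (box c Q ξ n)) (sym (ℤP.*-zeroʳ Q)) (sym (⊗-zeroˡ _)) Inv-0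
  box-Inv Q ξ K n (suc m) 1≤ξ m<n e h = subst₂ (Inv (box c Q ξ n)) (l Q (comb c e m) (c (suc m)) (e m)) eq
    (Inv-+ (box-Inv Q ξ K n m 1≤ξ (ℕP.<⇒≤ m<n) e (λ l l<m → h l (ℕP.m<n⇒m<1+n l<m))) (box-Inv₁ Q ξ K n m 1≤ξ m<n (e m) (h m ℕP.≤-refl)))
    where
    l : ∀ q a c e → q ℤ.* a ℤ.+ c ℤ.* q ℤ.* e ≡ q ℤ.* (a ℤ.+ c ℤ.* e)
    l = solve-∀ ℤ-ring
    opaque
      unfolding _⊕_
      lem : ∀ j b → 2# ⊗ (4# ⊗ j) ⊕ 2# ⊗ (b ⊗ j) ≡ (2# ⊗ 4# ⊕ 2# ⊗ b) ⊗ j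
      lem = solve-∀ ℚ-ring
    eq : 2# ⊗ (4# ⊗ inv K) ⊕ 2# ⊗ (boxConst m ⊗ inv K) ≡ boxConst (suc m) ⊗ inv K
    eq = lem (inv K) (boxConst m)

  -- β absorbs m: averaging first along m changes an average along β by little
  Absorbs : Mean ℤ → Mean ℤ → ℚ → Set
  Absorbs β m η = ∀ f → N (op β (f -ᶠ op m f)) ≤ η ⊗ N f

  -- Write f - m m′f = (f - m′f) + m′(f - mf); the outer m′ commutes with β and contracts.
  absorb-step : ∀ {β m m′ η η′} → Absorbs β m η → Absorbs β m′ η′ → ∀ f →
    N (op β (f -ᶠ op m (op m′ f))) ≤ (2# ⊗ η′ ⊕ 2# ⊗ η) ⊗ N f
  absorb-step {β} {m} {m′} {η} {η′} h h′ f = ≤-trans (≡⇒≤ (N-cong eq))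
    (≤-trans (N-+ (op β (f -ᶠ op m′ f)) (op m′ (op β (f -ᶠ op m f))))
    (≤-trans (⊕-mono (⊗-monoˡ 2# 0≤2 (h′ f)) (⊗-monoˡ 2# 0≤2 (≤-trans (op-contract m′ (op β (f -ᶠ op m f))) (h f))))
      (≡⇒≤ (trans (cong₂ _⊕_ (sym (⊗-assoc _ _ _)) (sym (⊗-assoc _ _ _))) (sym (⊗-distribʳ _ _ _))))))
    where
    eq : ∀ y → op β (f -ᶠ op m (op m′ f)) y ≡ op β (f -ᶠ op m′ f) y ⊕ op m′ (op β (f -ᶠ op m f)) y
    eq y = trans (op-cong β {f -ᶠ op m (op m′ f)} {λ y → (f -ᶠ op m′ f) y ⊕ op m′ (f -ᶠ op m f) y}
        (λ y → trans (δ-split (f y) (op m′ f y) _) (cong ((f y ⊝ op m′ f y) ⊕_)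
          (trans (cong (op m′ f y ⊝_) (op-comm m m′ f y)) (sym (op-- m′ f (op m f) y))))) y)
      (trans (Mean.add β _ _) (cong (op β (f -ᶠ op m′ f) y ⊕_) (op-comm β m′ (f -ᶠ op m f) y)))

  Absorbs-0 : ∀ β → Absorbs β (point (+ 0)) 0ℚ
  Absorbs-0 β f = app (Inv-0 {β}) f

  absorb-box : ∀ {β ε} Q ξ n → 1 ℕ.≤ ξ → 0ℚ ≤ ε →
    (∀ l → l ℕ.< n → ∀ e → ℤ.∣ e ∣ ℕ.≤ ξ ℕ.^ suc l → Inv β (c (suc l) ℤ.* Q ℤ.* e) ε) →
    Absorbs β (box c Q ξ n) (absorbConst n ⊗ ε)
  absorb-box {β} {ε} Q ξ zero 1≤ξ 0≤ε h f = ≤-trans (Absorbs-0 β f) (≡⇒≤ (cong (_⊗ N f) (sym (⊗-zeroˡ ε))))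
  absorb-box {β} {ε} Q ξ (suc n) 1≤ξ 0≤ε h f =
    ≤-trans (≡⇒≤ (N-cong (op-cong β {f -ᶠ op (box c Q ξ (suc n)) f} {f -ᶠ op (box c Q ξ n) (op (side Q ξ n) f)} (λ y → cong (f y ⊝_) (op-box Q ξ n f y)))))
      (≤-trans (absorb-step {β} {box c Q ξ n} {side Q ξ n} (absorb-box Q ξ n 1≤ξ 0≤ε (λ l l<n → h l (ℕP.m<n⇒m<1+n l<n)))
          (Inv-avg β (uniform (ℕ.pred (ξ ℕ.^ suc n))) (λ i → c (suc n) ℤ.* Q ℤ.* + toℕ i) (λ i → h n ℕP.≤-refl (+ toℕ i)
            (ℕP.≤-trans (ℕP.≤-pred (FinP.toℕ<n i)) ℕP.pred[n]≤n))) f)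
        (≡⇒≤ (cong (_⊗ N f) (lem ε (absorbConst n)))))
    where
    opaque
      unfolding _⊕_
      lem : ∀ e a → 2# ⊗ e ⊕ 2# ⊗ (a ⊗ e) ≡ (2# ⊗ a ⊕ 2#) ⊗ e
      lem = solve-∀ ℚ-ring

  -- The measure Δ*Δ is the box composed with its reflection, and the reflection is the box for -Q,
  -- whose sides are absorbed equally well.
  absorb-gram-box : ∀ {β ε} Q ξ n → 1 ℕ.≤ ξ → 0ℚ ≤ ε →
    (∀ l → l ℕ.< n → ∀ e → ℤ.∣ e ∣ ℕ.≤ ξ ℕ.^ suc l → Inv β (c (suc l) ℤ.* Q ℤ.* e) ε) →
    Absorbs β (gram (box c Q ξ n)) (4# ⊗ (absorbConst n ⊗ ε))
  absorb-gram-box {β} {ε} Q ξ n 1≤ξ 0≤ε h f =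
    ≤-trans (≡⇒≤ (N-cong (op-cong β {f -ᶠ op (gram Δ) f} {f -ᶠ op Δ⁻ (op Δ f)} (λ y → cong (f y ⊝_) (op-gram Δ f y)))))
      (≤-trans (absorb-step {β} {Δ⁻} {Δ} neg (absorb-box Q ξ n 1≤ξ 0≤ε h) f) (≡⇒≤ (cong (_⊗ N f) (quad (absorbConst n ⊗ ε)))))
    where
    Δ Δ⁻ : Mean ℤ
    Δ = box c Q ξ n
    Δ⁻ = push ℤ.-_ Δ
    flip : ∀ a q e → a ℤ.* q ℤ.* (ℤ.- e) ≡ a ℤ.* (ℤ.- q) ℤ.* e
    flip = solve-∀ ℤ-ring
    neg : Absorbs β Δ⁻ (absorbConst n ⊗ ε)
    neg f = ≤-trans (≡⇒≤ (N-cong (op-cong β {f -ᶠ op Δ⁻ f} {f -ᶠ op (box c (ℤ.- Q) ξ n) f} (λ y → cong (f y ⊝_) (sym (box-neg c Q ξ n (λ u → f (act u y))))))))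
      (absorb-box (ℤ.- Q) ξ n 1≤ξ 0≤ε (λ l l<n e e≤ → subst (λ u → Inv β u ε) (flip (c (suc l)) Q e)
        (h l l<n (ℤ.- e) (subst (ℕ._≤ ξ ℕ.^ suc l) (sym (ℤP.∣-i∣≡∣i∣ e)) e≤))) f)

opaque
  unfolding _⊕_

  rec-total : ∀ e a t → a ≡ e ⊗ inv 1 → t ≡ e ⊗ inv 31 → a ⊕ 2# ⊗ (2# ⊗ (t ⊕ (t ⊕ t)) ⊕ 2# ⊗ t) ≡ e
  rec-total e a t refl refl = l e
    where
    l : ∀ e → e ⊗ inv 1 ⊕ 2# ⊗ (2# ⊗ (e ⊗ inv 31 ⊕ (e ⊗ inv 31 ⊕ e ⊗ inv 31)) ⊕ 2# ⊗ (e ⊗ inv 31)) ≡ e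
    l = solve-∀ ℚ-ring

  rec-η₁ : ∀ a p → 2# ⊗ (4# ⊗ (a ⊗ p)) ≡ (8# ⊗ a) ⊗ p
  rec-η₁ = solve-∀ ℚ-ring

  rec-η₂ : ∀ s a j → s ⊗ (4# ⊗ (a ⊗ (4# ⊗ j))) ≡ (s ⊗ ((+ 16 ℚ./ 1) ⊗ a)) ⊗ j
  rec-η₂ = solve-∀ ℚ-ring

  ⊝-≤ : ∀ {a b t} → a ≤ b ⊕ t → a ⊝ b ≤ t
  ⊝-≤ {a} {b} {t} p = subst (a ⊝ b ≤_) (l b t) (⊝-mono b p)
    where
    l : ∀ b t → (b ⊕ t) ⊝ b ≡ t
    l = solve-∀ ℚ-ring

absorbConst-nonneg : ∀ n → 0ℚ ≤ absorbConst n
absorbConst-nonneg zero = ≤-refl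
absorbConst-nonneg (suc n) = ⊕-nonneg (⊗-nonneg 0≤2 (absorbConst-nonneg n)) 0≤2

boxConst-nonneg : ∀ n → 0ℚ ≤ boxConst n
boxConst-nonneg zero = ≤-refl
boxConst-nonneg (suc n) = ⊕-nonneg (⊗-nonneg 0≤2 0≤4) (⊗-nonneg 0≤2 (boxConst-nonneg n))

-- modulo every Q, the polynomial takes a value in the lattice spanned by Q·c₁, …, Q·c_d
Solvable : (ℕ → ℤ) → ℕ → Set
Solvable c d = ∀ Q → 1 ℕ.≤ Q → ∃[ y ] ∃[ e ] (1 ℕ.≤ y × y ℕ.≤ Q × polyEval c d (+ y) ≡ + Q ℤ.* comb c e d)

comb-+ : ∀ c e g n → comb c (λ l → e l ℤ.+ g l) n ≡ comb c e n ℤ.+ comb c g n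
comb-+ c e g zero = refl
comb-+ c e g (suc n) = trans (cong (ℤ._+ c (suc n) ℤ.* (e n ℤ.+ g n)) (comb-+ c e g n)) (l (comb c e n) (comb c g n) (c (suc n)) (e n) (g n))
  where
  l : ∀ a b k e g → (a ℤ.+ b) ℤ.+ k ℤ.* (e ℤ.+ g) ≡ (a ℤ.+ k ℤ.* e) ℤ.+ (b ℤ.+ k ℤ.* g)
  l = solve-∀ ℤ-ring

polyEval-difference : ∀ c n (y z Q : ℤ) g → (∀ l → z ℤ.^ suc l ≡ y ℤ.^ suc l ℤ.+ Q ℤ.* g l) →
  polyEval c n z ≡ polyEval c n y ℤ.+ Q ℤ.* comb c g n
polyEval-difference c zero y z Q g h = sym (trans (cong (λ t → c 0 ℤ.+ t) (ℤP.*-zeroʳ Q)) (ℤP.+-identityʳ _))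
polyEval-difference c (suc n) y z Q g h = trans (cong₂ (λ a b → a ℤ.+ c (suc n) ℤ.* b) (polyEval-difference c n y z Q g h) (h n))
  (l (polyEval c n y) Q (comb c g n) (c (suc n)) (y ℤ.^ suc n) (g n))
  where
  l : ∀ p q a c y g → (p ℤ.+ q ℤ.* a) ℤ.+ c ℤ.* (y ℤ.+ q ℤ.* g) ≡ (p ℤ.+ c ℤ.* y) ℤ.+ q ℤ.* (a ℤ.+ c ℤ.* g)
  l = solve-∀ ℤ-ring

sumAbs : (ℕ → ℤ) → ℕ → ℕ
sumAbs e zero = 0
sumAbs e (suc n) = sumAbs e n ℕ.+ ℤ.∣ e n ∣

≤-sumAbs : ∀ e n l → l ℕ.< n → ℤ.∣ e l ∣ ℕ.≤ sumAbs e n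
≤-sumAbs e (suc n) l l<1+n with l ℕ.≟ n
... | yes refl = ℕP.m≤n+m ℤ.∣ e n ∣ (sumAbs e n)
... | no l≢n = ℕP.≤-trans (≤-sumAbs e n l (ℕP.≤∧≢⇒< (ℕP.≤-pred l<1+n) l≢n)) (ℕP.m≤m+n (sumAbs e n) ℤ.∣ e n ∣)

polyOn : (ℕ → ℤ) → ℕ → ℕ → ℕ → ℕ → Mean ℤ
polyOn c d y W X = polyMean (λ x → polyEval c d (+ y ℤ.+ + W ℤ.* x)) X

-- along some progression in [1, Z], averaging S^{R(z)} F is close to Δ*ΔF
record Concentrates (d : ℕ) (c : ℕ → ℤ) (ε : ℚ) (S : Sys ℤG) (F : Sys.Y S → ℚ) (ξ Z : ℕ) : Set₁ where
  field
    y W X : ℕ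
    1≤y : 1 ℕ.≤ y
    1≤W : 1 ℕ.≤ W
    ξ≤X : ξ ℕ.≤ suc X
    inside : y ℕ.+ W ℕ.* X ℕ.≤ Z
    Δ : Mean ℤ
    close : Theory.N ℤG S (Theory._-ᶠ_ ℤG S (Theory.op ℤG S (polyOn c d y W X) F) (Theory.op ℤG S (Energy.gram ℤG S Δ) F)) ≤ ε

module Chain (d : ℕ) (ε : ℚ) (0<ε : 0ℚ < ε) where
  θ s : ℚ
  -- Two triangle inequalities leave ε/2 for the first error and a weight of 16θ on the others, so θ
  -- = ε/32.
  θ = ε ⊗ inv 31
  θ-pos : 0ℚ < θ
  θ-pos = ⊗-pos 0<ε (inv-pos 31)
  rc = recip θ θ-pos
  s = proj₁ rc
  s-nonneg : 0ℚ ≤ s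
  s-nonneg = <⇒≤ (proj₁ (proj₂ rc))
  sθ≡1 : s ⊗ θ ≡ 1ℚ
  sθ≡1 = trans (⊗-comm s θ) (proj₂ (proj₂ rc))
  sp = small (8# ⊗ absorbConst d) (ε ⊗ inv 1) (⊗-pos 0<ε (inv-pos 1))
  sa = small (s ⊗ ((+ 16 ℚ./ 1) ⊗ absorbConst d)) θ θ-pos
  sb = small (boxConst d) θ θ-pos
  np Ka : ℕ
  np = proj₁ sp
  Ka = proj₁ sa ℕ.+ proj₁ sb

  -- One refinement from modulus Q to Q₁ = Qq. With Γ = Δ*Δ for the Q-box and Γ′ for the Q₁-box, βF
  -- ≈ βΓ′F because β absorbs the Q₁-box, βΓ′F ≈ βΓF if the energies differ by at most θ, and βΓF ≈
  -- ΓF because y is a root modulo Q, so that all values of the polynomial lie in the lattice of the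
  -- Q-box.
  module Stage (Q : ℕ) (1≤Q : 1 ℕ.≤ Q) where
    pl = peel d (inv np) (inv-pos np) Q Q 1≤Q
    q Kp Q₁ Z₁ κ₀ : ℕ
    q = proj₁ pl
    Kp = proj₁ (proj₂ pl)
    1≤q : 1 ℕ.≤ q
    1≤q = proj₁ (proj₂ (proj₂ pl))
    1≤Kp : 1 ℕ.≤ Kp
    1≤Kp = proj₁ (proj₂ (proj₂ (proj₂ pl)))
    Q₁ = Q ℕ.* q
    Z₁ = Q ℕ.* (Kp ℕ.* Q)
    -- The Q-box must dwarf both the values at y + Qx and the sides of the Q₁-box: Ka + 1 is the
    -- precision, q the ratio of the moduli, Z₁·ξ bounds the arguments, and 2 accounts for the
    -- summands `e l` and `g l`.
    κ₀ = (2 ℕ.* (suc Ka ℕ.* q)) ℕ.* Z₁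
    1≤Q₁ : 1 ℕ.≤ Q₁
    1≤Q₁ = ℕP.*-mono-≤ 1≤Q 1≤q
    1≤Z₁ : 1 ℕ.≤ Z₁
    1≤Z₁ = ℕP.*-mono-≤ 1≤Q (ℕP.*-mono-≤ 1≤Kp 1≤Q)
    1≤2Kq : 1 ℕ.≤ 2 ℕ.* (suc Ka ℕ.* q)
    1≤2Kq = ℕP.*-mono-≤ {1} {2} (ℕ.s≤s ℕ.z≤n) (ℕP.*-mono-≤ {1} {suc Ka} (ℕ.s≤s ℕ.z≤n) 1≤q)
    1≤κ₀ : 1 ℕ.≤ κ₀
    1≤κ₀ = ℕP.*-mono-≤ 1≤2Kq 1≤Z₁

    module _ (c : ℕ → ℤ) (y : ℕ) (e : ℕ → ℤ) (1≤y : 1 ℕ.≤ y) (y≤Q : y ℕ.≤ Q) (Ry : polyEval c d (+ y) ≡ + Q ℤ.* comb c e d)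
             (ξ : ℕ) (e≤ξ : sumAbs e d ℕ.≤ ξ) (1≤ξ : 1 ℕ.≤ ξ) (S : Sys ℤG) (F : Sys.Y S → ℚ)
             (NF≤1 : Theory.N ℤG S F ≤ 1ℚ) where
      open Sys S
      open Theory ℤG S
      open Energy ℤG S
      open Boxes S c

      ξ⁺ X : ℕ
      ξ⁺ = κ₀ ℕ.* ξ
      1≤ξ⁺ : 1 ℕ.≤ ξ⁺
      1≤ξ⁺ = ℕP.*-mono-≤ 1≤κ₀ 1≤ξ
      X = ℕ.pred (Kp ℕ.* (Q ℕ.* ξ))
      sucX : suc X ≡ Kp ℕ.* (Q ℕ.* ξ)
      sucX = ℕP.suc-pred (Kp ℕ.* (Q ℕ.* ξ)) ⦃ ℕ.>-nonZero (ℕP.*-mono-≤ 1≤Kp (ℕP.*-mono-≤ 1≤Q 1≤ξ)) ⦄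
      Δ Δ′ β : Mean ℤ
      Δ = box c (+ Q) ξ⁺ d
      Δ′ = box c (+ Q₁) ξ d
      β = polyOn c d y Q X

      z : ℕ → ℕ
      z x = y ℕ.+ Q ℕ.* x
      z≤ : ∀ x → x ℕ.≤ X → z x ℕ.≤ Z₁ ℕ.* ξ
      z≤ x x≤ = ℕP.≤-trans (ℕP.+-mono-≤ y≤Q (ℕP.*-monoʳ-≤ Q x≤)) (ℕP.≤-reflexive (trans (sym (ℕP.*-suc Q X)) (trans (cong (Q ℕ.*_) sucX) (l Q Kp ξ))))
        where
        l : ∀ q k x → q ℕ.* (k ℕ.* (q ℕ.* x)) ≡ q ℕ.* (k ℕ.* q) ℕ.* x
        l = ℕR.solve-∀
      ξ⁺-eq : ξ⁺ ≡ (2 ℕ.* (suc Ka ℕ.* q)) ℕ.* (Z₁ ℕ.* ξ)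
      ξ⁺-eq = ℕP.*-assoc (2 ℕ.* (suc Ka ℕ.* q)) Z₁ ξ
      fits : ∀ a l → a ℕ.≤ 2 ℕ.* (q ℕ.* (Z₁ ℕ.* ξ) ℕ.^ suc l) → suc Ka ℕ.* a ℕ.≤ ξ⁺ ℕ.^ suc l
      fits a l a≤ = ℕP.≤-trans (ℕP.*-monoʳ-≤ (suc Ka) a≤) (ℕP.≤-trans (ℕP.≤-reflexive (lem (suc Ka) q ((Z₁ ℕ.* ξ) ℕ.^ suc l)))
        (ℕP.≤-trans (mul-^ (2 ℕ.* (suc Ka ℕ.* q)) (Z₁ ℕ.* ξ) l 1≤2Kq) (ℕP.≤-reflexive (cong (ℕ._^ suc l) (sym ξ⁺-eq)))))
        where
        lem : ∀ k q x → k ℕ.* (2 ℕ.* (q ℕ.* x)) ≡ 2 ℕ.* (k ℕ.* q) ℕ.* x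
        lem = ℕR.solve-∀
      inside : y ℕ.+ Q ℕ.* X ℕ.≤ ξ⁺
      inside = ℕP.≤-trans (z≤ X ℕP.≤-refl) (ℕP.≤-trans (ℕP.m≤n*m (Z₁ ℕ.* ξ) (2 ℕ.* (suc Ka ℕ.* q)) ⦃ ℕ.>-nonZero 1≤2Kq ⦄) (ℕP.≤-reflexive (sym ξ⁺-eq)))

      -- The value at y is Q times a lattice point by solvability, and the increment from y to y +
      -- Qx is another; the box absorbs their sum coordinate by coordinate.
      value-Inv : ∀ x → x ℕ.≤ X → Inv (gram Δ) (polyEval c d (+ y ℤ.+ + Q ℤ.* + x)) (boxConst d ⊗ inv Ka)
      value-Inv x x≤ = subst (λ u → Inv (gram Δ) u (boxConst d ⊗ inv Ka)) (sym value)
        (Inv-gram (box-Inv (+ Q) ξ⁺ Ka d d 1≤ξ⁺ ℕP.≤-refl eg (λ l l<d → fits ℤ.∣ eg l ∣ l (eg≤ l l<d))))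
        where
        pd : ∀ l → _
        pd l = power-difference y (Q ℕ.* x) l
        g : ℕ → ℕ
        g l = x ℕ.* proj₁ (pd l)
        eg : ℕ → ℤ
        eg l = e l ℤ.+ + g l
        g-eq : ∀ l → z x ℕ.^ suc l ≡ y ℕ.^ suc l ℕ.+ Q ℕ.* g l
        g-eq l = trans (proj₁ (proj₂ (pd l))) (cong (y ℕ.^ suc l ℕ.+_) (ℕP.*-assoc Q x _))
        g≤ : ∀ l → g l ℕ.≤ (Z₁ ℕ.* ξ) ℕ.^ suc l
        g≤ l = ℕP.≤-trans (ℕP.m≤n*m (g l) Q ⦃ ℕ.>-nonZero 1≤Q ⦄) (ℕP.≤-trans (ℕP.m≤n+m (Q ℕ.* g l) (y ℕ.^ suc l))
          (ℕP.≤-trans (ℕP.≤-reflexive (sym (g-eq l))) (ℕP.^-monoˡ-≤ (suc l) (z≤ x x≤))))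
        e≤ : ∀ l → l ℕ.< d → ℤ.∣ e l ∣ ℕ.≤ (Z₁ ℕ.* ξ) ℕ.^ suc l
        e≤ l l<d = ℕP.≤-trans (≤-sumAbs e d l l<d) (ℕP.≤-trans e≤ξ (ℕP.≤-trans (ℕP.m≤n*m ξ Z₁ ⦃ ℕ.>-nonZero 1≤Z₁ ⦄)
          (ℕP.m≤m*n (Z₁ ℕ.* ξ) ((Z₁ ℕ.* ξ) ℕ.^ l) ⦃ ℕP.m^n≢0 (Z₁ ℕ.* ξ) l ⦃ ℕ.>-nonZero (ℕP.*-mono-≤ 1≤Z₁ 1≤ξ) ⦄ ⦄)))
        eg≤ : ∀ l → l ℕ.< d → ℤ.∣ eg l ∣ ℕ.≤ 2 ℕ.* (q ℕ.* (Z₁ ℕ.* ξ) ℕ.^ suc l)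
        eg≤ l l<d = ℕP.≤-trans (ℤP.∣i+j∣≤∣i∣+∣j∣ (e l) (+ g l)) (ℕP.≤-trans (ℕP.+-mono-≤ (e≤ l l<d) (g≤ l))
          (ℕP.≤-trans (ℕP.≤-reflexive (cong (P ℕ.+_) (sym (ℕP.+-identityʳ P)))) (ℕP.*-monoʳ-≤ 2 (ℕP.m≤n*m P q ⦃ ℕ.>-nonZero 1≤q ⦄))))
          where P = (Z₁ ℕ.* ξ) ℕ.^ suc l
        arg : + y ℤ.+ + Q ℤ.* + x ≡ + z x
        arg = cong (λ t → + y ℤ.+ t) (sym (ℤP.pos-* Q x))
        power-eq : ∀ l → (+ z x) ℤ.^ suc l ≡ (+ y) ℤ.^ suc l ℤ.+ + Q ℤ.* + g l
        power-eq l = trans (sym (pos-^ (z x) (suc l))) (trans (cong +_ (g-eq l)) (cong₂ (λ a b → a ℤ.+ b) (pos-^ y (suc l)) (ℤP.pos-* Q (g l))))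
        value : polyEval c d (+ y ℤ.+ + Q ℤ.* + x) ≡ + Q ℤ.* comb c eg d
        value = trans (cong (polyEval c d) arg) (trans (polyEval-difference c d (+ y) (+ z x) (+ Q) (λ l → + g l) power-eq)
          (trans (cong (λ t → t ℤ.+ + Q ℤ.* comb c (λ l → + g l) d) Ry) (trans (sym (ℤP.*-distribˡ-+ (+ Q) (comb c e d) (comb c (λ l → + g l) d)))
            (cong (λ t → + Q ℤ.* t) (sym (comb-+ c e (λ l → + g l) d))))))

      -- `peel` is used at scale Q·ξ. It absorbs multiples of c_l·q, among them c_l·q·(Qe) =
      -- c_l·Q₁·e.
      β-absorbs : Absorbs β (gram Δ′) (4# ⊗ (absorbConst d ⊗ inv np))
      β-absorbs = absorb-gram-box (+ Q₁) ξ d 1≤ξ (inv-nonneg np) (λ l l<d e e≤ → subst (λ u → Inv β u (inv np)) (lem (c (suc l)) e)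
          (proj₂ (proj₂ (proj₂ (proj₂ pl))) c (Q ℕ.* ξ) (ℕP.*-mono-≤ 1≤Q 1≤ξ) X sucX y y≤ S l l<d (+ Q ℤ.* e)
            (ℕP.≤-trans (ℕP.≤-reflexive (ℤP.abs-* (+ Q) e)) (ℕP.≤-trans (ℕP.*-monoʳ-≤ Q e≤) (mul-^ Q ξ l 1≤Q)))))
        where
        y≤ : y ℕ.≤ Q ℕ.* (Kp ℕ.* (Q ℕ.* ξ))
        y≤ = ℕP.≤-trans y≤Q (ℕP.m≤m*n Q (Kp ℕ.* (Q ℕ.* ξ)) ⦃ ℕ.>-nonZero (ℕP.*-mono-≤ 1≤Kp (ℕP.*-mono-≤ 1≤Q 1≤ξ)) ⦄)
        alg : ∀ c q Q e → c ℤ.* q ℤ.* (Q ℤ.* e) ≡ c ℤ.* (Q ℤ.* q) ℤ.* e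
        alg = solve-∀ ℤ-ring
        lem : ∀ cl e → cl ℤ.* + q ℤ.* (+ Q ℤ.* e) ≡ cl ℤ.* + Q₁ ℤ.* e
        lem cl e = trans (alg cl (+ q) (+ Q) e) (cong (λ t → cl ℤ.* t ℤ.* e) (sym (ℤP.pos-* Q q)))

      Γ-absorbs : Absorbs (gram Δ) (gram Δ′) (4# ⊗ (absorbConst d ⊗ (4# ⊗ inv Ka)))
      Γ-absorbs = absorb-gram-box (+ Q₁) ξ d 1≤ξ (⊗-nonneg 0≤4 (inv-nonneg Ka)) (λ l l<d e e≤ →
          subst (λ u → Inv (gram Δ) u (4# ⊗ inv Ka)) (lem (c (suc l)) e)
            (Inv-gram (box-Inv₁ (+ Q) ξ⁺ Ka d l 1≤ξ⁺ l<d (+ q ℤ.* e) (fits ℤ.∣ + q ℤ.* e ∣ l (bound l e e≤)))))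
        where
        alg : ∀ c q Q e → c ℤ.* Q ℤ.* (q ℤ.* e) ≡ c ℤ.* (Q ℤ.* q) ℤ.* e
        alg = solve-∀ ℤ-ring
        lem : ∀ cl e → cl ℤ.* + Q ℤ.* (+ q ℤ.* e) ≡ cl ℤ.* + Q₁ ℤ.* e
        lem cl e = trans (alg cl (+ q) (+ Q) e) (cong (λ t → cl ℤ.* t ℤ.* e) (sym (ℤP.pos-* Q q)))
        bound : ∀ l e → ℤ.∣ e ∣ ℕ.≤ ξ ℕ.^ suc l → ℤ.∣ + q ℤ.* e ∣ ℕ.≤ 2 ℕ.* (q ℕ.* (Z₁ ℕ.* ξ) ℕ.^ suc l)
        bound l e e≤ = ℕP.≤-trans (ℕP.≤-reflexive (ℤP.abs-* (+ q) e)) (ℕP.≤-trans (ℕP.*-monoʳ-≤ q (ℕP.≤-trans e≤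
          (ℕP.^-monoˡ-≤ (suc l) (ℕP.m≤n*m ξ Z₁ ⦃ ℕ.>-nonZero 1≤Z₁ ⦄)))) (ℕP.m≤n*m (q ℕ.* (Z₁ ℕ.* ξ) ℕ.^ suc l) 2))

      unit : ∀ {a b} → 0ℚ ≤ a → a ≤ b → a ⊗ N F ≤ b
      unit {a} 0≤a a≤b = ≤-trans (⊗-monoˡ a 0≤a NF≤1) (≤-trans (≡⇒≤ (⊗-idʳ a)) a≤b)

      conclude : N (op Δ′ F) ≤ N (op Δ F) ⊕ θ → Concentrates d c ε S F ξ ξ⁺
      conclude gap = record { y = y ; W = Q ; X = X ; 1≤y = 1≤y ; 1≤W = 1≤Q ; ξ≤X = ξ≤X ; inside = inside ; Δ = Δ ; close = close }
        where
        ξ≤X : ξ ℕ.≤ suc X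
        ξ≤X = ℕP.≤-trans (ℕP.m≤n*m ξ Q ⦃ ℕ.>-nonZero 1≤Q ⦄) (ℕP.≤-trans (ℕP.m≤n*m (Q ℕ.* ξ) Kp ⦃ ℕ.>-nonZero 1≤Kp ⦄) (ℕP.≤-reflexive (sym sucX)))
        ΓF Γ′F : Fun
        ΓF = op (gram Δ) F
        Γ′F = op (gram Δ′) F
        η₁ η₂ : ℚ
        η₁ = 4# ⊗ (absorbConst d ⊗ inv np)
        η₂ = 4# ⊗ (absorbConst d ⊗ (4# ⊗ inv Ka))
        d≥0 : 0ℚ ≤ absorbConst d
        d≥0 = absorbConst-nonneg d
        d₁ : N (op β F -ᶠ op β Γ′F) ≤ η₁
        d₁ = ≤-trans (≡⇒≤ (N-cong (λ y → sym (op-- β F Γ′F y)))) (≤-trans (β-absorbs F) (unit (⊗-nonneg 0≤4 (⊗-nonneg d≥0 (inv-nonneg np))) ≤-refl))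
        sη₂ : s ⊗ η₂ ≤ θ
        sη₂ = ≤-trans (≡⇒≤ (rec-η₂ s (absorbConst d) (inv Ka)))
          (≤-trans (⊗-monoˡ _ (⊗-nonneg s-nonneg (⊗-nonneg (ℚP.nonNegative⁻¹ (+ 16 ℚ./ 1)) d≥0)) (inv-antitone (ℕP.m≤m+n (proj₁ sa) (proj₁ sb)))) (proj₂ sa))
        d₂ : N (op β Γ′F -ᶠ op β ΓF) ≤ θ ⊕ (θ ⊕ θ)
        d₂ = ≤-trans (≡⇒≤ (N-cong (λ y → sym (op-- β Γ′F ΓF y)))) (≤-trans (op-contract β (Γ′F -ᶠ ΓF))
          (≤-trans (energy-close Δ Δ′ F s θ η₂ NF≤1 s-nonneg sθ≡1 (<⇒≤ θ-pos)
              (≤-trans (Γ-absorbs F) (unit (⊗-nonneg 0≤4 (⊗-nonneg d≥0 (⊗-nonneg 0≤4 (inv-nonneg Ka)))) ≤-refl)))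
            (⊕-mono (⊝-≤ gap) (⊕-mono sη₂ ≤-refl))))
        d₃ : N (op β ΓF -ᶠ ΓF) ≤ θ
        d₃ = ≤-trans (≡⇒≤ (trans (N-flip (op β ΓF) ΓF) (N-cong (λ y → trans (cong (ΓF y ⊝_) (op-comm β (gram Δ) F y)) (sym (op-- (gram Δ) F (op β F) y))))))
          (≤-trans (Inv-avg (gram Δ) (uniform X) (λ i → polyEval c d (+ y ℤ.+ + Q ℤ.* + toℕ i)) (λ i → value-Inv (toℕ i) (ℕP.≤-pred (FinP.toℕ<n i))) F)
            (unit (⊗-nonneg (boxConst-nonneg d) (inv-nonneg Ka)) (≤-trans (⊗-monoˡ (boxConst d) (boxConst-nonneg d) (inv-antitone (ℕP.m≤n+m (proj₁ sb) (proj₁ sa)))) (proj₂ sb))))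
        close : N (op β F -ᶠ ΓF) ≤ ε
        close = ≤-trans (N-tri (op β F) (op β Γ′F) ΓF d₁ (N-tri (op β Γ′F) (op β ΓF) ΓF d₂ d₃))
          (≤-trans (⊕-mono (≤-trans (≡⇒≤ (rec-η₁ (absorbConst d) (inv np))) (proj₂ sp)) ≤-refl) (≡⇒≤ (rec-total ε (ε ⊗ inv 1) θ refl refl)))

  -- The number j bounds the increments that the energy can still make. κ is fixed before c and F:
  -- whichever stage concludes, its progression lies in [1, κξ] and has at least ξ terms.
  ChainFrom : ℕ → ℕ → Set₁
  ChainFrom j Q = Σ ℕ λ κ → 1 ℕ.≤ κ × (∀ c → Solvable c d → Σ ℕ λ ξ₀ → ∀ ξ → ξ₀ ℕ.≤ ξ → 1 ℕ.≤ ξ → ∀ (S : Sys ℤG) F →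
    Theory.N ℤG S F ≤ 1ℚ → 1ℚ ≤ Theory.N ℤG S (Theory.op ℤG S (box c (+ Q) (κ ℕ.* ξ) d) F) ⊕ nat j ⊗ θ →
    Concentrates d c ε S F ξ (κ ℕ.* ξ))

  -- The energy ‖ΔF‖² ≤ 1 increases by θ at each refinement that does not already conclude.
  chain : ∀ j Q → 1 ℕ.≤ Q → ChainFrom j Q
  chain zero Q 1≤Q = L.κ₀ , L.1≤κ₀ , λ c sol → let (y , e , 1≤y , y≤Q , Ry) = sol Q 1≤Q in
    sumAbs e d , λ ξ ξ₀≤ξ 1≤ξ S F NF≤1 energy →
      L.conclude c y e 1≤y y≤Q Ry ξ ξ₀≤ξ 1≤ξ S F NF≤1
        (≤-trans (≤-trans (Theory.op-contract ℤG S (box c (+ L.Q₁) ξ d) F) NF≤1) (≤-trans energy (⊕-mono (≤-refl {Theory.N ℤG S (Theory.op ℤG S (box c (+ Q) (L.κ₀ ℕ.* ξ) d) F)})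
          (≤-trans (≡⇒≤ (trans (cong (_⊗ θ) nat-0) (⊗-zeroˡ θ))) (<⇒≤ θ-pos)))))
    where module L = Stage Q 1≤Q
  chain (suc j) Q 1≤Q = L.κ₀ ℕ.* κ₁ , ℕP.*-mono-≤ L.1≤κ₀ 1≤κ₁ , λ c sol → let (y , e , 1≤y , y≤Q , Ry) = sol Q 1≤Q in
    sumAbs e d ℕ.+ proj₁ (next c sol) , λ ξ ξ₀≤ξ 1≤ξ S F NF≤1 energy → go c sol y e 1≤y y≤Q Ry ξ ξ₀≤ξ 1≤ξ S F NF≤1 energy
    where
    module L = Stage Q 1≤Q
    rest = chain j L.Q₁ L.1≤Q₁
    κ₁ = proj₁ rest
    1≤κ₁ : 1 ℕ.≤ κ₁
    1≤κ₁ = proj₁ (proj₂ rest)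
    next = proj₂ (proj₂ rest)
    module _ (c : ℕ → ℤ) (sol : Solvable c d) (y : ℕ) (e : ℕ → ℤ) (1≤y : 1 ℕ.≤ y) (y≤Q : y ℕ.≤ Q) (Ry : polyEval c d (+ y) ≡ + Q ℤ.* comb c e d)
             (ξ : ℕ) (ξ₀≤ξ : sumAbs e d ℕ.+ proj₁ (next c sol) ℕ.≤ ξ) (1≤ξ : 1 ℕ.≤ ξ) (S : Sys ℤG) (F : Sys.Y S → ℚ)
             (NF≤1 : Theory.N ℤG S F ≤ 1ℚ) where
      open Theory ℤG S
      ξ₁ : ℕ
      ξ₁ = κ₁ ℕ.* ξ
      ξ≤ξ₁ : ξ ℕ.≤ ξ₁
      ξ≤ξ₁ = ℕP.m≤n*m ξ κ₁ ⦃ ℕ.>-nonZero 1≤κ₁ ⦄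
      assoc : L.κ₀ ℕ.* κ₁ ℕ.* ξ ≡ L.κ₀ ℕ.* ξ₁
      assoc = ℕP.*-assoc L.κ₀ κ₁ ξ
      a a′ : ℚ
      a = N (op (box c (+ Q) (L.κ₀ ℕ.* ξ₁) d) F)
      a′ = N (op (box c (+ L.Q₁) ξ₁ d) F)
      stop : a′ ≤ a ⊕ θ → Concentrates d c ε S F ξ (L.κ₀ ℕ.* κ₁ ℕ.* ξ)
      stop gap = record { Concentrates con ; ξ≤X = ℕP.≤-trans ξ≤ξ₁ (Concentrates.ξ≤X con)
                        ; inside = ℕP.≤-trans (Concentrates.inside con) (ℕP.≤-reflexive (sym assoc)) }
        where
        con : Concentrates d c ε S F ξ₁ (L.κ₀ ℕ.* ξ₁)
        con = L.conclude c y e 1≤y y≤Q Ry ξ₁ (ℕP.≤-trans (ℕP.m≤m+n (sumAbs e d) _) (ℕP.≤-trans ξ₀≤ξ ξ≤ξ₁)) (ℕP.≤-trans 1≤ξ ξ≤ξ₁) S F NF≤1 gap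
      refine : 1ℚ ≤ N (op (box c (+ Q) (L.κ₀ ℕ.* κ₁ ℕ.* ξ) d) F) ⊕ nat (suc j) ⊗ θ → ¬ (a′ ≤ a ⊕ θ) → Concentrates d c ε S F ξ (L.κ₀ ℕ.* κ₁ ℕ.* ξ)
      refine energy ¬gap = record { Concentrates con ; inside = ℕP.≤-trans (Concentrates.inside con)
              (ℕP.≤-trans (ℕP.m≤n*m ξ₁ L.κ₀ ⦃ ℕ.>-nonZero L.1≤κ₀ ⦄) (ℕP.≤-reflexive (sym assoc))) }
        where
        energy′ : 1ℚ ≤ a′ ⊕ nat j ⊗ θ
        energy′ = ≤-trans (subst (λ n → 1ℚ ≤ N (op (box c (+ Q) n d) F) ⊕ nat (suc j) ⊗ θ) assoc energy)
          (≤-trans (≡⇒≤ (trans (cong (λ t → a ⊕ t ⊗ θ) (nat-suc j)) (trans (cong (a ⊕_) (trans (⊗-distribʳ θ 1ℚ (nat j)) (cong (_⊕ nat j ⊗ θ) (⊗-idˡ θ)))) (sym (⊕-assoc a θ (nat j ⊗ θ))))))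
            (⊕-mono (<⇒≤ (ℚP.≰⇒> ¬gap)) ≤-refl))
        con : Concentrates d c ε S F ξ ξ₁
        con = proj₂ (next c sol) ξ (ℕP.≤-trans (ℕP.m≤n+m (proj₁ (next c sol)) (sumAbs e d)) ξ₀≤ξ) 1≤ξ S F NF≤1 energy′
      go : 1ℚ ≤ N (op (box c (+ Q) (L.κ₀ ℕ.* κ₁ ℕ.* ξ) d) F) ⊕ nat (suc j) ⊗ θ → Concentrates d c ε S F ξ (L.κ₀ ℕ.* κ₁ ℕ.* ξ)
      go energy = either (a′ ℚ.≤? (a ⊕ θ)) stop (refine energy)

-- Polynomial multiple recurrence

concentrate : ∀ d ε → 0ℚ < ε → Σ ℕ λ κ → 1 ℕ.≤ κ × (∀ c → Solvable c d → Σ ℕ λ ξ₀ → ∀ ξ → ξ₀ ℕ.≤ ξ → 1 ℕ.≤ ξ →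
  ∀ (S : Sys ℤG) F → Theory.N ℤG S F ≤ 1ℚ → Concentrates d c ε S F ξ (κ ℕ.* ξ))
concentrate d ε 0<ε = κ , proj₁ (proj₂ ch) , λ c sol → let (ξ₀ , h) = proj₂ (proj₂ ch) c sol in
  ξ₀ , λ ξ ξ₀≤ 1≤ξ S F NF≤1 → h ξ ξ₀≤ 1≤ξ S F NF≤1 (≤-trans enough (≤-⊕ˡ (Theory.N-nonneg ℤG S _)))
  where
  open Chain d ε 0<ε
  ar = archimedean s
  j = proj₁ ar
  enough : 1ℚ ≤ nat j ⊗ θ
  enough = ≤-trans (≡⇒≤ (sym sθ≡1)) (⊗-monoʳ θ (<⇒≤ θ-pos) (proj₂ ar))
  ch = chain j 1 ℕP.≤-refl
  κ = proj₁ ch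

∑-nonneg : ∀ n {f : Fin n → ℚ} → (∀ i → 0ℚ ≤ f i) → 0ℚ ≤ ∑ n f
∑-nonneg zero h = ≤-refl
∑-nonneg (suc n) h = ⊕-nonneg (h zero) (∑-nonneg n (h ∘ suc))

∑-progression : ∀ n y W Z (g : ℕ → ℚ) → (∀ x → 0ℚ ≤ g x) → 1 ℕ.≤ W → y ℕ.+ W ℕ.* n ℕ.< Z →
  ∑ (suc n) (λ i → g (y ℕ.+ W ℕ.* toℕ i)) ≤ ∑ Z (g ∘ toℕ)
∑-progression n y W@(suc W′) Z g g≥0 1≤W lt = ≤-trans step (≡⇒≤ (cong (λ z → ∑ z (g ∘ toℕ)) Z-eq))
  where
  R = Z ℕ.∸ suc y
  y<Z : y ℕ.< Z
  y<Z = ℕP.≤-trans (ℕ.s≤s (ℕP.m≤m+n y (W ℕ.* n))) lt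
  Z-eq : y ℕ.+ suc R ≡ Z
  Z-eq = trans (ℕP.+-suc y R) (ℕP.m+[n∸m]≡n y<Z)
  rest : ∀ n → y ℕ.+ W ℕ.* n ℕ.< Z → ∑ n (λ i → g (y ℕ.+ W ℕ.* suc (toℕ i))) ≤ ∑ R (λ i → g (y ℕ.+ suc (toℕ i)))
  rest zero _ = ∑-nonneg R (λ i → g≥0 _)
  rest (suc n) lt = ≤-trans (≡⇒≤ (∑-cong (suc n) (λ i → cong g (l y W′ (toℕ i))))) (∑-progression n W′ W R (λ x → g (y ℕ.+ suc x)) (λ x → g≥0 _) 1≤W
      (ℕP.+-cancelˡ-< (suc y) _ _ (ℕP.≤-trans (ℕP.≤-reflexive (cong suc (l′ y W′ n))) (ℕP.≤-trans lt (ℕP.≤-reflexive (trans (sym Z-eq) (ℕP.+-suc y R)))))))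
    where
    l : ∀ y w i → y ℕ.+ suc w ℕ.* suc i ≡ y ℕ.+ suc (w ℕ.+ suc w ℕ.* i)
    l = ℕR.solve-∀
    l′ : ∀ y w n → suc (y ℕ.+ (w ℕ.+ suc w ℕ.* n)) ≡ y ℕ.+ suc w ℕ.* suc n
    l′ = ℕR.solve-∀
  step : ∑ (suc n) (λ i → g (y ℕ.+ W ℕ.* toℕ i)) ≤ ∑ (y ℕ.+ suc R) (g ∘ toℕ)
  step = ≤-trans (⊕-mono (≡⇒≤ (cong g (trans (cong (y ℕ.+_) (ℕP.*-zeroʳ W)) refl))) (rest n lt))
    (≤-trans (≤-⊕ˡ (∑-nonneg y (λ i → g≥0 (toℕ i)))) (≡⇒≤ (sym (∑-split y (suc R) g))))

scale-large : ∀ {ξ K Z} → suc Z ℕ.≤ suc K ℕ.* ξ → inv K ≤ nat ξ ⊗ inv Z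
scale-large {ξ} {K} {Z} p = subst₂ _≤_ eq₁ eq₂ (⊗-monoˡ (inv K ⊗ inv Z) (⊗-nonneg (inv-nonneg K) (inv-nonneg Z)) (nat-mono p))
  where
  eq₂ : inv K ⊗ inv Z ⊗ nat (suc K ℕ.* ξ) ≡ nat ξ ⊗ inv Z
  eq₂ = trans (cong (inv K ⊗ inv Z ⊗_) (nat-* (suc K) ξ)) (trans (⊗-comm _ _)
    (trans (⊗-assoc _ _ _) (trans (⊗-left-comm _ _ _) (trans (cong (nat ξ ⊗_) (trans (sym (⊗-assoc _ _ _)) (cong (_⊗ inv Z) (nat-inv K)))) (cong (nat ξ ⊗_) (⊗-idˡ _))))))
  eq₁ : inv K ⊗ inv Z ⊗ nat (suc Z) ≡ inv K
  eq₁ = trans (⊗-assoc _ _ _) (trans (cong (inv K ⊗_) (trans (⊗-comm _ _) (nat-inv Z))) (⊗-idʳ _))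

-- uniform measure on {1, …, Z+1}
interval : ℕ → Mean ℕ
interval Z = push (suc ∘ toℕ) (uniform Z)

-- By nonnegativity all points off the progression may be dropped, which leaves the average along it
-- times its share (X+1)/(Z+1) ≥ 1/(K+1).
progression-dense : ∀ {ξ K} y W X Z (g : ℕ → ℚ) → (∀ x → 0ℚ ≤ g x) → 1 ℕ.≤ y → 1 ℕ.≤ W → y ℕ.+ W ℕ.* X ℕ.≤ suc Z →
  ξ ℕ.≤ suc X → suc Z ℕ.≤ suc K ℕ.* ξ → inv K ⊗ E (uniform X) (λ i → g (y ℕ.+ W ℕ.* toℕ i)) ≤ E (interval Z) g
progression-dense {ξ} {K} (suc y) W X Z g g≥0 _ 1≤W inside ξ≤X dense = ≤-trans
  (⊗-monoʳ _ (Mean.nonneg (uniform X) (λ i → g≥0 _)) (≤-trans (scale-large {ξ} {K} {Z} dense) (⊗-monoʳ (inv Z) (inv-nonneg Z) (nat-mono ξ≤X))))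
  (≤-trans (≡⇒≤ eq) (≤-trans (⊗-monoˡ (inv Z) (inv-nonneg Z) (∑-progression X y W (suc Z) (g ∘ suc) (λ x → g≥0 _) 1≤W inside)) (≡⇒≤ (sym (E-uniform Z _)))))
  where
  a = ∑ (suc X) (λ i → g (suc y ℕ.+ W ℕ.* toℕ i))
  eq : nat (suc X) ⊗ inv Z ⊗ E (uniform X) (λ i → g (suc y ℕ.+ W ℕ.* toℕ i)) ≡ inv Z ⊗ a
  eq = trans (cong (nat (suc X) ⊗ inv Z ⊗_) (E-uniform X _)) (trans (cong (_⊗ (inv X ⊗ a)) (⊗-comm _ _))
    (trans (⊗-assoc _ _ _) (cong (inv Z ⊗_) (trans (sym (⊗-assoc _ _ _)) (trans (cong (_⊗ a) (nat-inv X)) (⊗-idˡ a))))))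

vecMean : ∀ {A : Set} → Mean A → (m : ℕ) → Mean (Vec A m)
vecMean μ zero = point []
vecMean μ (suc m) = bind μ (λ a → push (a ∷_) (vecMean μ m))

vecG : ℕ → Grp
vecG m = record
  { Λ = Vec ℤ m ; _+ᵍ_ = Vec.zipWith ℤ._+_ ; 0ᵍ = replicate m (+ 0) ; -ᵍ_ = Vec.map (λ a → ℤ.- a)
  ; +ᵍ-assoc = assoc ; +ᵍ-comm = comm ; +ᵍ-idʳ = idʳ ; +ᵍ-invʳ = invʳ }
  where
  assoc : ∀ {m} (u v w : Vec ℤ m) → Vec.zipWith ℤ._+_ (Vec.zipWith ℤ._+_ u v) w ≡ Vec.zipWith ℤ._+_ u (Vec.zipWith ℤ._+_ v w)
  assoc [] [] [] = refl
  assoc (a ∷ u) (b ∷ v) (c ∷ w) = cong₂ _∷_ (ℤP.+-assoc a b c) (assoc u v w)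
  comm : ∀ {m} (u v : Vec ℤ m) → Vec.zipWith ℤ._+_ u v ≡ Vec.zipWith ℤ._+_ v u
  comm [] [] = refl
  comm (a ∷ u) (b ∷ v) = cong₂ _∷_ (ℤP.+-comm a b) (comm u v)
  idʳ : ∀ {m} (u : Vec ℤ m) → Vec.zipWith ℤ._+_ u (replicate m (+ 0)) ≡ u
  idʳ [] = refl
  idʳ (a ∷ u) = cong₂ _∷_ (ℤP.+-identityʳ a) (idʳ u)
  invʳ : ∀ {m} (u : Vec ℤ m) → Vec.zipWith ℤ._+_ u (Vec.map (λ a → ℤ.- a) u) ≡ replicate m (+ 0)
  invʳ [] = refl
  invʳ (a ∷ u) = cong₂ _∷_ (ℤP.+-inverseʳ a) (invʳ u)

record Hom (G H : Grp) : Set where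
  private
    module G = Grp G
    module H = Grp H
  field
    fun : G.Λ → H.Λ
    hom-+ : ∀ u v → fun (u G.+ᵍ v) ≡ fun u H.+ᵍ fun v
    hom-0 : fun G.0ᵍ ≡ H.0ᵍ
open Hom public

_∘ʰ_ : ∀ {G H K} → Hom H K → Hom G H → Hom G K
(h ∘ʰ g) .fun = h .fun ∘ g .fun
(h ∘ʰ g) .hom-+ u v = trans (cong (h .fun) (g .hom-+ u v)) (h .hom-+ _ _)
(h ∘ʰ g) .hom-0 = trans (cong (h .fun) (g .hom-0)) (h .hom-0)

headHom : ∀ m → Hom ℤG (vecG (suc m))
headHom m .fun u = u ∷ replicate m (+ 0)
headHom m .hom-+ u v = cong (u ℤ.+ v ∷_) (sym (Grp.+ᵍ-idʳ (vecG m) _))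
headHom m .hom-0 = refl

tailHom : ∀ m → Hom (vecG m) (vecG (suc m))
tailHom m .fun us = + 0 ∷ us
tailHom m .hom-+ us vs = refl
tailHom m .hom-0 = refl

restrict : ∀ {G H} → Hom G H → Sys H → Sys G
restrict {G} {H} h S = record
  { Y = Sys.Y S ; μ = Sys.μ S ; act = λ u → Sys.act S (h .fun u)
  ; act-+ = λ u v y → trans (cong (λ w → Sys.act S w y) (h .hom-+ u v)) (Sys.act-+ S _ _ y)
  ; act-0 = λ y → trans (cong (λ w → Sys.act S w y) (h .hom-0)) (Sys.act-0 S y)
  ; invariant = λ u → Sys.invariant S (h .fun u) }

0<1 : 0ℚ < 1ℚ
0<1 = subst₂ _<_ nat-0 nat-1 (int-mono-< (ℤ.+<+ (ℕ.s≤s ℕ.z≤n)))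

power : ℚ → ℕ → ℚ
power x zero = 1ℚ
power x (suc n) = x ⊗ power x n

power-pos : ∀ {x} n → 0ℚ < x → 0ℚ < power x n
power-pos zero _ = 0<1
power-pos (suc n) p = ⊗-pos p (power-pos n p)

module Recurrence (d : ℕ) (c : ℕ → ℤ) (ε : ℚ) (K ξ Z : ℕ) (conc : ∀ (S : Sys ℤG) F → Theory.N ℤG S F ≤ 1ℚ → Concentrates d c ε S F ξ (suc Z))
                  (dense : suc Z ℕ.≤ suc K ℕ.* ξ) (G : Grp) (S : Sys G) (F : Sys.Y S → ℚ) (NF≤1 : Theory.N G S F ≤ 1ℚ) where
  open Grp G
  open Sys S
  open Theory G S

  values : ∀ {m} → Vec ℕ m → Vec ℤ m
  values = Vec.map (λ z → polyEval c d (+ z))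

  -- Γ dominates the projection to constants
  Positive : Mean Λ → Set
  Positive Γ = ∀ g → E μ g ⊗ E μ g ≤ ⟨ g , op Γ g ⟩

  record Approximation (m : ℕ) (ι : Hom (vecG m) G) : Set₁ where
    field
      b : Mean (Vec ℕ m)
      Γ : Mean Λ
      positive : Positive Γ
      near : N (op (push (ι .fun ∘ values) b) F -ᶠ op Γ F) ≤ absorbConst m ⊗ ε
      spread : ∀ (g : Vec ℕ m → ℚ) → (∀ z → 0ℚ ≤ g z) → power (inv K) m ⊗ E b g ≤ E (vecMean (interval Z) m) g

  -- Every variable is concentrated for the same `F`, on the system restricted to that coordinate.
  -- Commutation moves the operator under replacement next to `F`, and the remaining operators only
  -- contract, so the errors add up without interacting.
  approximate : ∀ m ι → Approximation m ι
  approximate zero ι = record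
    { b = point [] ; Γ = point 0ᵍ
    ; positive = λ g → ≤-trans (jensen μ g) (≡⇒≤ (Mean.cng μ (λ y → cong (g y ⊗_) (cong g (sym (act-0 y))))))
    ; near = ≡⇒≤ (trans (trans (N-cong {g = λ _ → 0ℚ} (λ y → trans (cong (λ u → F (act u y) ⊝ F (act 0ᵍ y)) (ι .hom-0)) (⊝-self _)))
        (trans (Mean.cng μ (λ _ → ⊗-zeroˡ 0ℚ)) (Mean.one μ 0ℚ))) (sym (⊗-zeroˡ ε)))
    ; spread = λ g g≥0 → ≡⇒≤ (⊗-idˡ _) }
  approximate (suc m) ι = record
    { b = b′ ; Γ = Γ′ ; positive = positive′ ; near = near′ ; spread = spread′ }
    where
    A = approximate m (ι ∘ʰ tailHom m)
    module A = Approximation A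
    h : Hom ℤG G
    h = ι ∘ʰ headHom m
    S₁ : Sys ℤG
    S₁ = restrict h S
    module T₁ = Theory ℤG S₁
    module E₁ = Energy ℤG S₁
    con = conc S₁ F NF≤1
    module C = Concentrates con
    z : Fin (suc C.X) → ℕ
    z i = C.y ℕ.+ C.W ℕ.* toℕ i
    b′ : Mean (Vec ℕ (suc m))
    b′ = bind (uniform C.X) (λ i → push (z i ∷_) A.b)
    γ β : Mean Λ
    γ = push (h .fun) (E₁.gram C.Δ)
    β = push (h .fun) (polyOn c d C.y C.W C.X)
    β′ : Mean Λ
    β′ = push ((ι ∘ʰ tailHom m) .fun ∘ values) A.b
    Γ′ : Mean Λ
    Γ′ = bind γ (λ u → push (λ v → v +ᵍ u) A.Γ)
    op-Γ′ : ∀ f y → op Γ′ f y ≡ op γ (op A.Γ f) y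
    op-Γ′ f y = Mean.cng γ (λ u → Mean.cng A.Γ (λ v → cong f (act-+ v u y)))
    -- Since Γ′ = ΓΔ*Δ, the form ⟨g, Γ′g⟩ equals ⟨Δg, ΓΔg⟩, and Δ preserves the mean of g.
    positive′ : Positive Γ′
    positive′ g = ≤-trans (≡⇒≤ (cong₂ _⊗_ (sym mean-eq) (sym mean-eq))) (≤-trans (A.positive g₁)
        (≡⇒≤ (trans (Mean.cng μ (λ y → cong (g₁ y ⊗_) (op-comm A.Γ (push (h .fun) C.Δ) g y)))
          (trans (sym (E₁.inner-gram C.Δ (op A.Γ g) g)) (Mean.cng μ (λ y → cong (g y ⊗_) (sym (op-Γ′ g y))))))))
      where
      g₁ : Fun
      g₁ = op (push (h .fun) C.Δ) g
      mean-eq : E μ g₁ ≡ E μ g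
      mean-eq = trans (fubini μ C.Δ (λ y u → g (act (h .fun u) y))) (trans (Mean.cng C.Δ (λ u → invariant (h .fun u) g)) (Mean.one C.Δ _))
    op-b′ : ∀ f y → op (push (ι .fun ∘ values) b′) f y ≡ op β (op β′ f) y
    op-b′ f y = Mean.cng (uniform C.X) (λ i → Mean.cng A.b (λ zs → cong f (trans (cong (λ u → act u y) (split (z i) (point-eq i) zs)) (act-+ _ _ y))))
      where
      point-eq : ∀ i → + (z i) ≡ + C.y ℤ.+ + C.W ℤ.* + toℕ i
      point-eq i = cong (λ t → + C.y ℤ.+ t) (ℤP.pos-* C.W (toℕ i))
      split : ∀ x {x′} → + x ≡ x′ → ∀ zs → ι .fun (values (x ∷ zs)) ≡ (ι ∘ʰ tailHom m) .fun (values zs) +ᵍ h .fun (polyEval c d x′)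
      split x refl zs = trans (cong (ι .fun) (cong₂ _∷_ (sym (ℤP.+-identityˡ (polyEval c d (+ x)))) (sym (Grp.+ᵍ-idʳ (vecG m) (values zs))))) (ι .hom-+ _ _)
    near′ : N (op (push (ι .fun ∘ values) b′) F -ᶠ op Γ′ F) ≤ absorbConst (suc m) ⊗ ε
    near′ = ≤-trans (≡⇒≤ (N-cong (λ y → cong₂ _⊝_ (op-b′ F y) (op-Γ′ F y))))
      (≤-trans (N-tri (op β (op β′ F)) (op β (op A.Γ F)) (op γ (op A.Γ F))
          (≤-trans (≡⇒≤ (N-cong (λ y → sym (op-- β (op β′ F) (op A.Γ F) y)))) (≤-trans (op-contract β _) A.near))
          (≤-trans (≡⇒≤ (N-cong (λ y → trans (cong₂ _⊝_ (op-comm β A.Γ F y) (op-comm γ A.Γ F y)) (sym (op-- A.Γ (op β F) (op γ F) y)))))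
            (≤-trans (op-contract A.Γ _) C.close)))
        (≡⇒≤ (lem ε (absorbConst m))))
      where
      opaque
        unfolding _⊕_
        lem : ∀ e a → 2# ⊗ (a ⊗ e) ⊕ 2# ⊗ e ≡ (2# ⊗ a ⊕ 2#) ⊗ e
        lem = solve-∀ ℚ-ring
    spread′ : ∀ (g : Vec ℕ (suc m) → ℚ) → (∀ z → 0ℚ ≤ g z) → power (inv K) (suc m) ⊗ E b′ g ≤ E (vecMean (interval Z) (suc m)) g
    spread′ g g≥0 = ≤-trans (≡⇒≤ (trans (⊗-assoc _ _ _) (cong (inv K ⊗_) (sym (Mean.scl (uniform C.X) _ _)))))
      (≤-trans (⊗-monoˡ (inv K) (inv-nonneg K) (Mean.mono (uniform C.X) (λ i → A.spread (g ∘ (z i ∷_)) (λ zs → g≥0 _))))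
        (progression-dense {ξ} {K} C.y C.W C.X Z (λ x → E (vecMean (interval Z) m) (g ∘ (x ∷_)))
          (λ x → Mean.nonneg (vecMean (interval Z) m) (λ zs → g≥0 _)) C.1≤y C.1≤W C.inside C.ξ≤X dense))

opaque
  unfolding _⊕_

  halves : ∀ x → x ⊗ inv 1 ⊕ x ⊗ inv 1 ≡ x
  halves = solve-∀ ℚ-ring

  halve : ∀ x → (2# ⊗ x) ⊗ inv 1 ≡ x
  halve = solve-∀ ℚ-ring

  cancel-difference : ∀ f a b → f ⊗ a ≡ f ⊗ b ⊝ (b ⊝ a) ⊗ f
  cancel-difference = solve-∀ ℚ-ring

  ⊝-anti : ∀ {a b c d} → a ≤ b → d ≤ c → a ⊝ c ≤ b ⊝ d
  ⊝-anti p q = ℚP.+-mono-≤ p (ℚP.neg-antimono-≤ q)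

  drop-half : ∀ t → (t ⊕ t) ⊝ t ≡ t
  drop-half = solve-∀ ℚ-ring

halve-≤ : ∀ {x t} → 2# ⊗ x ≤ t ⊕ t → x ≤ t
halve-≤ {x} {t} p = subst₂ _≤_ (halve x) (trans (cong (_⊗ inv 1) (sym (double t))) (halve t)) (⊗-monoʳ (inv 1) (inv-nonneg 1) p)

-- With B the average over the chosen product of progressions, ⟨F, BF⟩ = ⟨F, ΓF⟩ - ⟨(Γ - B)F, F⟩ ≥
-- δ² - δ²/2. These progressions fill a fixed proportion of [1, Z+1]^m, and the integrand is
-- nonnegative.
multiRecurrence : ∀ m d δ → 0ℚ < δ → Σ ℚ λ ρ → 0ℚ < ρ × (∀ c → Solvable c d → Σ ℕ λ Z₀ → ∀ Z → Z₀ ℕ.≤ Z →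
  ∀ G (S : Sys G) (ι : Hom (vecG m) G) (F : Sys.Y S → ℚ) → (∀ y → 0ℚ ≤ F y) → (∀ y → F y ≤ 1ℚ) → δ ≤ E (Sys.μ S) F →
  ρ ≤ E (vecMean (interval Z) m) (λ z → Theory.⟨_,_⟩ G S F (F ∘ Sys.act S (ι .fun (Vec.map (λ z → polyEval c d (+ z)) z)))))
multiRecurrence m d δ 0<δ = power (inv K) m ⊗ t , ⊗-pos (power-pos m (inv-pos K)) 0<t , λ c sol → Z₀ c sol , main c sol
  where
  t = (δ ⊗ δ) ⊗ inv 1
  0<t : 0ℚ < t
  0<t = ⊗-pos (⊗-pos 0<δ 0<δ) (inv-pos 1)
  rc = recip t 0<t
  s = proj₁ rc
  0≤s : 0ℚ ≤ s
  0≤s = <⇒≤ (proj₁ (proj₂ rc))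
  st≡1 : s ⊗ t ≡ 1ℚ
  st≡1 = trans (⊗-comm s t) (proj₂ (proj₂ rc))
  sm = small (s ⊗ absorbConst m) t 0<t
  ε = inv (proj₁ sm)
  co = concentrate d ε (inv-pos (proj₁ sm))
  κ = proj₁ co
  1≤κ : 1 ℕ.≤ κ
  1≤κ = proj₁ (proj₂ co)
  -- For ξ = ⌊(Z+1)/κ⌋ ≥ 1 the remainder is below κ ≤ κξ, whence Z + 1 ≤ 2κξ.
  K = 2 ℕ.* κ
  Z₀ : ∀ c → Solvable c d → ℕ
  Z₀ c sol = κ ℕ.* suc (proj₁ (proj₂ (proj₂ co) c sol))
  module _ (c : ℕ → ℤ) (sol : Solvable c d) (Z : ℕ) (Z₀≤Z : Z₀ c sol ℕ.≤ Z) (G : Grp) (S : Sys G) (ι : Hom (vecG m) G)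
           (F : Sys.Y S → ℚ) (F≥0 : ∀ y → 0ℚ ≤ F y) (F≤1 : ∀ y → F y ≤ 1ℚ) (δ≤ : δ ≤ E (Sys.μ S) F) where
    open Sys S
    open Theory G S hiding (δ)
    instance
      κ≢0 : ℕ.NonZero κ
      κ≢0 = ℕ.>-nonZero 1≤κ
    ξ₀ ξ : ℕ
    ξ₀ = proj₁ (proj₂ (proj₂ co) c sol)
    ξ = suc Z ℕDM./ κ
    ξ₀<ξ : suc ξ₀ ℕ.≤ ξ
    ξ₀<ξ = ℕP.≤-trans (ℕP.≤-reflexive (sym (trans (cong (ℕDM._/ κ) (ℕP.*-comm κ (suc ξ₀))) (ℕDM.m*n/n≡m (suc ξ₀) κ))))
      (ℕDM./-monoˡ-≤ κ (ℕP.≤-trans Z₀≤Z (ℕP.n≤1+n Z)))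
    κξ≤Z : κ ℕ.* ξ ℕ.≤ suc Z
    κξ≤Z = ℕP.≤-trans (ℕP.≤-reflexive (ℕP.*-comm κ ξ)) (ℕDM.m/n*n≤m (suc Z) κ)
    dense : suc Z ℕ.≤ suc K ℕ.* ξ
    dense = ℕP.≤-trans (ℕP.≤-reflexive (ℕDM.m≡m%n+[m/n]*n (suc Z) κ))
      (ℕP.≤-trans (ℕP.+-mono-≤ (ℕP.≤-trans (ℕP.<⇒≤ (ℕDM.m%n<n (suc Z) κ)) (ℕP.m≤n*m κ ξ ⦃ ℕ.>-nonZero (ℕP.≤-trans (ℕ.s≤s ℕ.z≤n) ξ₀<ξ) ⦄)) ℕP.≤-refl)
        (ℕP.≤-trans (ℕP.m≤n+m (ξ ℕ.* κ ℕ.+ ξ ℕ.* κ) ξ) (ℕP.≤-reflexive (l ξ κ))))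
      where
      l : ∀ x k → x ℕ.+ (x ℕ.* k ℕ.+ x ℕ.* k) ≡ suc (2 ℕ.* k) ℕ.* x
      l = ℕR.solve-∀
    conc : ∀ (S : Sys ℤG) F → Theory.N ℤG S F ≤ 1ℚ → Concentrates d c ε S F ξ (suc Z)
    conc S F NF≤1 = record { Concentrates con ; inside = ℕP.≤-trans (Concentrates.inside con) κξ≤Z }
      where con = proj₂ (proj₂ (proj₂ co) c sol) ξ (ℕP.≤-trans (ℕP.n≤1+n ξ₀) ξ₀<ξ) (ℕP.≤-trans (ℕ.s≤s ℕ.z≤n) ξ₀<ξ) S F NF≤1
    NF≤1 : N F ≤ 1ℚ
    NF≤1 = Mean.bound μ (λ y → ≤-trans (⊗-mono (F≥0 y) 0≤1 (F≤1 y) (F≤1 y)) (≡⇒≤ (⊗-idʳ 1ℚ)))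
    open Recurrence d c ε K ξ Z conc dense G S F NF≤1
    ap = approximate m ι
    module A = Approximation ap
    φ : Vec ℕ m → ℚ
    φ z = ⟨ F , F ∘ act (ι .fun (values z)) ⟩
    B : Mean (Grp.Λ G)
    B = push (ι .fun ∘ values) A.b
    h : Fun
    h = op A.Γ F -ᶠ op B F
    E-φ : E A.b φ ≡ ⟨ F , op A.Γ F ⟩ ⊝ ⟨ h , F ⟩
    E-φ = trans (fubini A.b μ _) (trans (Mean.cng μ (λ y → trans (Mean.scl A.b (F y) _) (cancel-difference (F y) (op B F y) (op A.Γ F y)))) (Mean.sub μ _ _))
    h≤ : ⟨ h , F ⟩ ≤ t
    h≤ = halve-≤ (≤-trans (young h F s t 0≤s st≡1) (⊕-mono
      (≤-trans (⊗-monoˡ s 0≤s (≤-trans (≡⇒≤ (N-flip (op A.Γ F) (op B F))) A.near)) (≤-trans (≡⇒≤ (sym (⊗-assoc s (absorbConst m) ε))) (proj₂ sm)))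
      (≤-trans (⊗-monoˡ t (<⇒≤ 0<t) NF≤1) (≡⇒≤ (⊗-idʳ t)))))
    main : power (inv K) m ⊗ t ≤ E (vecMean (interval Z) m) φ
    main = ≤-trans (⊗-monoˡ (power (inv K) m) (<⇒≤ (power-pos m (inv-pos K))) t≤) (A.spread φ (λ z → Mean.nonneg μ (λ y → ⊗-nonneg (F≥0 y) (F≥0 _))))
      where
      t≤ : t ≤ E A.b φ
      t≤ = ≤-trans (≡⇒≤ (sym (trans (cong (_⊝ t) (sym (halves (δ ⊗ δ)))) (drop-half t)))) (≤-trans
        (⊝-anti (≤-trans (⊗-mono (<⇒≤ 0<δ) (≤-trans (<⇒≤ 0<δ) δ≤) δ≤ δ≤) (A.positive F)) h≤) (≡⇒≤ (sym E-φ)))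

-- Almost periods

ifTrue : (b : Bool) → (b ≡ true → ℚ) → ℚ
ifTrue true g = g refl
ifTrue false g = 0ℚ

density : ∀ {W : Set} → Mean W → (W → Bool) → ℚ
density m U = E m (indicator ∘ U)

indicator-nonneg : ∀ b → 0ℚ ≤ indicator b
indicator-nonneg true = 0≤1
indicator-nonneg false = ≤-refl

indicator-≤1 : ∀ b → indicator b ≤ 1ℚ
indicator-≤1 true = ≤-refl
indicator-≤1 false = 0≤1

module _ {W : Set} (m : Mean W) (U : W → Bool) (y : ℚ) (0≤y : 0ℚ ≤ y) (ρy≡1 : density m U ⊗ y ≡ 1ℚ) where
  private
    module M = Mean m
    S : Set
    S = Σ W (λ w → U w ≡ true)
    ext : (S → ℚ) → W → ℚ
    ext f w = ifTrue (U w) (λ e → f (w , e))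
    ifTrue-cong : ∀ b {g h : b ≡ true → ℚ} → (∀ e → g e ≡ h e) → ifTrue b g ≡ ifTrue b h
    ifTrue-cong true p = p refl
    ifTrue-cong false p = refl
    ifTrue-add : ∀ b (g h : b ≡ true → ℚ) → ifTrue b (λ e → g e ⊕ h e) ≡ ifTrue b g ⊕ ifTrue b h
    ifTrue-add true g h = refl
    ifTrue-add false g h = sym (⊕-idˡ 0ℚ)
    ifTrue-scl : ∀ b c (g : b ≡ true → ℚ) → ifTrue b (λ e → c ⊗ g e) ≡ c ⊗ ifTrue b g
    ifTrue-scl true c g = refl
    ifTrue-scl false c g = sym (⊗-zeroʳ c)
    ifTrue-mono : ∀ b {g h : b ≡ true → ℚ} → (∀ e → g e ≤ h e) → ifTrue b g ≤ ifTrue b h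
    ifTrue-mono true p = p refl
    ifTrue-mono false p = ≤-refl
    ifTrue-const : ∀ b c → ifTrue b (λ _ → c) ≡ indicator b ⊗ c
    ifTrue-const true c = sym (⊗-idˡ c)
    ifTrue-const false c = sym (⊗-zeroˡ c)
    ifTrue-linear : ∀ b {B : Set} {L : (B → ℚ) → ℚ} → Linear L → (g : b ≡ true → B → ℚ) →
      ifTrue b (λ e → L (g e)) ≡ L (λ x → ifTrue b (λ e → g e x))
    ifTrue-linear true l g = refl
    ifTrue-linear false l g = sym (Linear.zer l)

  -- Functions are extended by zero off U and the average is rescaled. The points carry their proof
  -- of membership, so that hypotheses about members of U can be used under the average.
  conditional : Mean S
  conditional = record
    { E = λ f → y ⊗ E m (ext f)
    ; lin = record
      { cng = λ {f} {g} p → cong (y ⊗_) (M.cng (λ w → ifTrue-cong (U w) (λ e → p (w , e))))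
      ; add = λ f g → trans (cong (y ⊗_) (trans (M.cng (λ w → ifTrue-add (U w) (λ e → f (w , e)) (λ e → g (w , e)))) (M.add (ext f) (ext g)))) (⊗-distribˡ _ _ _)
      ; scl = λ c f → trans (cong (y ⊗_) (trans (M.cng (λ w → ifTrue-scl (U w) c (λ e → f (w , e)))) (M.scl c (ext f)))) (⊗-left-comm _ _ _)
      }
    ; mono = λ {f} {g} p → ⊗-monoˡ y 0≤y (M.mono (λ w → ifTrue-mono (U w) (λ e → p (w , e))))
    ; one = λ c → trans (cong (y ⊗_) (trans (M.cng (λ w → ifTrue-const (U w) c)) (M.sclʳ c (indicator ∘ U))))
        (trans (sym (⊗-assoc _ _ _)) (trans (cong (_⊗ c) (trans (⊗-comm y _) ρy≡1)) (⊗-idˡ c)))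
    ; swap = λ {B} {L} l f → trans (cong (y ⊗_) (trans (M.cng (λ w → ifTrue-linear (U w) l (λ e → f (w , e))))
        (M.swap l (λ w x → ifTrue (U w) (λ e → f (w , e) x))))) (sym (Linear.scl l y _))
    }

  E-conditional : ∀ (f : W → ℚ) → E conditional (λ s → f (proj₁ s)) ≡ y ⊗ E m (λ w → indicator (U w) ⊗ f w)
  E-conditional f = cong (y ⊗_) (M.cng (λ w → ifTrue-const (U w) (f w)))

picks-vecMean : ∀ {A : Set} {m : Mean A} → Picks m → ∀ n → Picks (vecMean m n)
picks-vecMean {m = m} p zero = picks-point
picks-vecMean {m = m} p (suc n) f c q = 
  let a , r = p (λ a → E (vecMean m n) (λ as → f (a ∷ as))) c q
      as , r′ = picks-vecMean {m = m} p n (λ as → f (a ∷ as)) c r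
  in a ∷ as , r′

opaque
  unfolding _⊕_

  sq-add : ∀ a b → (a ⊕ b) ⊗ (a ⊕ b) ≡ a ⊗ a ⊕ ((2# ⊗ a) ⊗ b ⊕ b ⊗ b)
  sq-add = solve-∀ ℚ-ring

  sq-swap-sign : ∀ n t a b → (n ⊗ n) ⊗ ((a ⊝ b) ⊗ (a ⊝ b)) ≡ ((t ⊝ n ⊗ b) ⊝ (t ⊝ n ⊗ a)) ⊗ ((t ⊝ n ⊗ b) ⊝ (t ⊝ n ⊗ a))
  sq-swap-sign = solve-∀ ℚ-ring

  interval-square : ∀ a g → 1ℚ ⊝ (a ⊝ g) ⊗ (a ⊝ g) ≡ (1ℚ ⊝ (a ⊝ g)) ⊗ (1ℚ ⊕ (a ⊝ g))
  interval-square = solve-∀ ℚ-ring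

  1-diff : ∀ a g → 1ℚ ⊝ (a ⊝ g) ≡ (1ℚ ⊝ a) ⊕ g
  1-diff = solve-∀ ℚ-ring

  1+diff : ∀ a g → 1ℚ ⊕ (a ⊝ g) ≡ (1ℚ ⊝ g) ⊕ a
  1+diff = solve-∀ ℚ-ring

  peel-sample : ∀ n t a g → (a ⊕ t) ⊝ (1ℚ ⊕ n) ⊗ g ≡ (a ⊝ g) ⊕ (t ⊝ n ⊗ g)
  peel-sample = solve-∀ ℚ-ring

  zero-times : ∀ g → 0ℚ ⊝ 0ℚ ⊗ g ≡ 0ℚ
  zero-times = solve-∀ ℚ-ring

  four-split : ∀ x → 2# ⊗ x ⊕ 2# ⊗ x ≡ 4# ⊗ x
  four-split = solve-∀ ℚ-ring

sq-≤1 : ∀ a g → 0ℚ ≤ a → a ≤ 1ℚ → 0ℚ ≤ g → g ≤ 1ℚ → (a ⊝ g) ⊗ (a ⊝ g) ≤ 1ℚ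
sq-≤1 a g 0≤a a≤1 0≤g g≤1 = from-⊝-nonneg (subst (0ℚ ≤_) (sym (interval-square a g)) (⊗-nonneg
  (subst (0ℚ ≤_) (sym (1-diff a g)) (⊕-nonneg (⊝-nonneg a≤1) 0≤g)) (subst (0ℚ ≤_) (sym (1+diff a g)) (⊕-nonneg (⊝-nonneg g≤1) 0≤a))))

-- Almost periodicity by sampling: E_y a(x,y) b(y,w) is approximated, for most w, by the average over a few
-- sample points y; so it is nearly determined by the few bits b(y,w).
module Sampling {X Y W : Set} (mX : Mean X) (mY : Mean Y) (mW : Mean W) (pY : Picks mY)
                (a : X → Y → ℚ) (a≥0 : ∀ x y → 0ℚ ≤ a x y) (a≤1 : ∀ x y → a x y ≤ 1ℚ) (b : Y → W → Bool) where
  term : X → W → Y → ℚ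
  term x w y = a x y ⊗ indicator (b y w)

  g : W → X → ℚ
  g w x = E mY (term x w)

  total : ∀ {n} → X → W → Vec Y n → ℚ
  total x w [] = 0ℚ
  total x w (y ∷ ys) = term x w y ⊕ total x w ys

  deviation : ∀ n → X → W → Vec Y n → ℚ
  deviation n x w ys = total x w ys ⊝ nat n ⊗ g w x

  term≥0 : ∀ x w y → 0ℚ ≤ term x w y
  term≥0 x w y = ⊗-nonneg (a≥0 x y) (indicator-nonneg (b y w))

  term≤1 : ∀ x w y → term x w y ≤ 1ℚ
  term≤1 x w y = ≤-trans (⊗-mono (a≥0 x y) 0≤1 (a≤1 x y) (indicator-≤1 (b y w))) (≡⇒≤ (⊗-idʳ 1ℚ))

  -- The samples are independent and centred, so the cross terms vanish and the second moment grows
  -- like n instead of n².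
  variance : ∀ n x w → E (vecMean mY n) (λ ys → deviation n x w ys ⊗ deviation n x w ys) ≤ nat n
  variance zero x w = ≡⇒≤ (trans (cong (λ z → z ⊗ z) (trans (cong (λ z → 0ℚ ⊝ z ⊗ g w x) nat-0) (zero-times (g w x)))) (trans (⊗-zeroˡ 0ℚ) (sym nat-0)))
  variance (suc n) x w = ≤-trans (≡⇒≤ (trans (Mean.cng mY (λ y → trans (Mean.cng V (λ ys → trans (cong (λ z → z ⊗ z) (split y ys)) (sq-add (ξ y) (D ys))))
        (trans (Mean.add V _ _) (cong₂ _⊕_ (Mean.one V _) (trans (Mean.add V _ _) (cong₂ _⊕_ (Mean.scl V _ _) refl))))))
      (trans (Mean.add mY _ _) (trans (cong (E mY (λ y → ξ y ⊗ ξ y) ⊕_) (trans (Mean.add mY _ _) (cong₂ _⊕_ cross (Mean.one mY _))))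
        (cong (E mY (λ y → ξ y ⊗ ξ y) ⊕_) (⊕-idˡ _))))))
    (≤-trans (⊕-mono (Mean.bound mY (λ y → sq-≤1 _ _ (term≥0 x w y) (term≤1 x w y) (Mean.nonneg mY (term≥0 x w)) (Mean.bound mY (term≤1 x w)))) (variance n x w))
      (≡⇒≤ (sym (nat-suc n))))
    where
    V = vecMean mY n
    D : Vec Y n → ℚ
    D = deviation n x w
    ξ : Y → ℚ
    ξ y = term x w y ⊝ g w x
    split : ∀ y ys → deviation (suc n) x w (y ∷ ys) ≡ ξ y ⊕ D ys
    split y ys = trans (cong (λ z → (term x w y ⊕ total x w ys) ⊝ z ⊗ g w x) (nat-suc n)) (peel-sample (nat n) (total x w ys) (term x w y) (g w x))
    cross : E mY (λ y → (2# ⊗ ξ y) ⊗ E V D) ≡ 0ℚ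
    cross = trans (Mean.sclʳ mY _ _) (trans (cong (_⊗ E V D) (trans (Mean.scl mY 2# ξ) (cong (2# ⊗_)
      (trans (Mean.sub mY _ _) (trans (cong (g w x ⊝_) (Mean.one mY (g w x))) (⊝-self _)))))) (trans (cong (_⊗ E V D) (⊗-zeroʳ 2#)) (⊗-zeroˡ _)))

  error : ∀ n → Vec Y n → W → ℚ
  error n ys w = E mX (λ x → deviation n x w ys ⊗ deviation n x w ys)

  -- The first-moment principle extracts one explicit sample whose error, averaged over w in U, is
  -- no larger than the expected one.
  sample : ∀ n (U : W → Bool) → ∃[ ys ] E mW (λ w → indicator (U w) ⊗ error n ys w) ≤ nat n
  sample n U = picks-vecMean {m = mY} pY n (λ ys → E mW (λ w → indicator (U w) ⊗ error n ys w)) (nat n) (≤-trans (≡⇒≤ (fubini (vecMean mY n) mW _)) (Mean.bound mW (λ w →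
    ≤-trans (≡⇒≤ (trans (Mean.scl (vecMean mY n) _ _) (cong (indicator (U w) ⊗_) (fubini (vecMean mY n) mX _))))
      (≤-trans (⊗-mono (indicator-nonneg (U w)) (nat-nonneg n) (indicator-≤1 (U w)) (Mean.bound mX (λ x → variance n x w))) (≡⇒≤ (⊗-idˡ _))))))

  SameBits : ∀ {n} → Vec Y n → W → W → Set
  SameBits [] w w′ = ⊤
  SameBits (y ∷ ys) w w′ = b y w ≡ b y w′ × SameBits ys w w′

  total-same : ∀ {n} x w w′ (ys : Vec Y n) → SameBits ys w w′ → total x w ys ≡ total x w′ ys
  total-same x w w′ [] _ = refl
  total-same x w w′ (y ∷ ys) (p , q) = cong₂ _⊕_ (cong (λ z → a x y ⊗ indicator z) p) (total-same x w w′ ys q)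

  -- Equal bits make the two sums over the sample identical, so (n+1)(g w - g w′) is just a
  -- difference of two deviations.
  compare : ∀ n (ys : Vec Y (suc n)) w w′ t → SameBits ys w w′ → error (suc n) ys w ≤ t → error (suc n) ys w′ ≤ t →
    E mX (λ x → (g w x ⊝ g w′ x) ⊗ (g w x ⊝ g w′ x)) ≤ (inv n ⊗ inv n) ⊗ (4# ⊗ t)
  compare n ys w w′ t same e e′ = ≤-trans (≡⇒≤ (sym rescale)) (⊗-monoˡ (inv n ⊗ inv n) (square-nonneg (inv n))
      (≤-trans (Mean.mono mX (λ x → ≤-by _ (square-nonneg (D′ x ⊕ D x)) (sq-diff (D′ x) (D x))))
        (≤-trans (≡⇒≤ (trans (Mean.add mX _ _) (cong₂ _⊕_ (Mean.scl mX _ _) (Mean.scl mX _ _))))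
          (≤-trans (⊕-mono (⊗-monoˡ 2# 0≤2 e′) (⊗-monoˡ 2# 0≤2 e)) (≡⇒≤ (four-split t))))))
    where
    D D′ : X → ℚ
    D x = deviation (suc n) x w ys
    D′ x = deviation (suc n) x w′ ys
    d : X → ℚ
    d x = g w x ⊝ g w′ x
    N² = nat (suc n) ⊗ nat (suc n)
    scaled : ∀ x → N² ⊗ (d x ⊗ d x) ≡ (D′ x ⊝ D x) ⊗ (D′ x ⊝ D x)
    scaled x = trans (sq-swap-sign (nat (suc n)) (total x w ys) (g w x) (g w′ x))
      (cong (λ z → ((z ⊝ nat (suc n) ⊗ g w′ x) ⊝ D x) ⊗ ((z ⊝ nat (suc n) ⊗ g w′ x) ⊝ D x)) (total-same x w w′ ys same))
    unit : (inv n ⊗ inv n) ⊗ N² ≡ 1ℚ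
    unit = trans (⊗-assoc _ _ _) (trans (cong (inv n ⊗_) (trans (sym (⊗-assoc _ _ _)) (trans (cong (_⊗ nat (suc n)) (trans (⊗-comm _ _) (nat-inv n))) (⊗-idˡ _)))) (trans (⊗-comm _ _) (nat-inv n)))
    rescale : (inv n ⊗ inv n) ⊗ E mX (λ x → (D′ x ⊝ D x) ⊗ (D′ x ⊝ D x)) ≡ E mX (λ x → d x ⊗ d x)
    rescale = trans (cong ((inv n ⊗ inv n) ⊗_) (trans (Mean.cng mX (λ x → sym (scaled x))) (Mean.scl mX N² _)))
      (trans (sym (⊗-assoc _ _ _)) (trans (cong (_⊗ E mX (λ x → d x ⊗ d x)) unit) (⊗-idˡ _)))

  half-density : ∀ (U V : W → Bool) r → r ≤ density mW U → ∃[ β ] (r ⊗ inv 1 ≤ density mW (λ w → U w ∧ does (V w Bool.≟ β)))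
  half-density U V r p with (r ⊗ inv 1) ℚ.≤? density mW (λ w → U w ∧ does (V w Bool.≟ true))
  ... | yes q = true , q
  ... | no ¬q = false , from-⊝-nonneg (subst (0ℚ ≤_) (lem r A B) (⊕-nonneg (⊝-nonneg (≤-trans p (≡⇒≤ sum))) (⊝-nonneg (<⇒≤ (ℚP.≰⇒> ¬q)))))
    where
    A B : ℚ
    A = density mW (λ w → U w ∧ does (V w Bool.≟ true))
    B = density mW (λ w → U w ∧ does (V w Bool.≟ false))
    pointwise : ∀ u v → indicator u ≡ indicator (u ∧ does (v Bool.≟ true)) ⊕ indicator (u ∧ does (v Bool.≟ false))
    pointwise true true = sym (⊕-idʳ 1ℚ)
    pointwise true false = sym (⊕-idˡ 1ℚ)
    pointwise false v = sym (⊕-idˡ 0ℚ)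
    sum : density mW U ≡ A ⊕ B
    sum = trans (Mean.cng mW (λ w → pointwise (U w) (V w))) (Mean.add mW _ _)
    opaque
      unfolding _⊕_
      lem : ∀ r a b → ((a ⊕ b) ⊝ r) ⊕ (r ⊗ inv 1 ⊝ a) ≡ b ⊝ r ⊗ inv 1
      lem = solve-∀ ℚ-ring

  -- For each bit the more frequent value is kept, at the cost of half the density. Fixing the whole
  -- pattern costs 2⁻ⁿ, however large W is.
  refine : ∀ {n} (ys : Vec Y n) (U : W → Bool) r → r ≤ density mW U → ∃[ V ] ((∀ w → V w ≡ true → U w ≡ true) ×
    r ⊗ power (inv 1) n ≤ density mW V × (∀ w w′ → V w ≡ true → V w′ ≡ true → SameBits ys w w′))
  refine [] U r p = U , (λ w e → e) , ≤-trans (≡⇒≤ (⊗-idʳ r)) p , λ w w′ e e′ → tt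
  refine {suc n} (y ∷ ys) U r p with half-density U (b y) r p
  ... | β , q with refine ys (λ w → U w ∧ does (b y w Bool.≟ β)) (r ⊗ inv 1) q
  ... | V , sub , dens , same = V , (λ w e → left (U w) (sub w e)) , ≤-trans (≡⇒≤ (sym (⊗-assoc r (inv 1) _))) dens ,
      λ w w′ e e′ → trans (bit (U w) (b y w) (sub w e)) (sym (bit (U w′) (b y w′) (sub w′ e′))) , same w w′ e e′
    where
    left : ∀ u {v} → u ∧ v ≡ true → u ≡ true
    left true _ = refl
    bit : ∀ u v → u ∧ does (v Bool.≟ β) ≡ true → v ≡ β
    bit true v e with v Bool.≟ β
    ... | yes q = q

opaque
  unfolding _⊕_

  quarter-four : ∀ i n e → (i ⊗ i) ⊗ (4# ⊗ ((n ⊗ n) ⊗ (e ⊗ inv 3))) ≡ ((n ⊗ i) ⊗ (n ⊗ i)) ⊗ e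
  quarter-four = solve-∀ ℚ-ring

  one-sq : ∀ e → (1ℚ ⊗ 1ℚ) ⊗ e ≡ e
  one-sq = solve-∀ ℚ-ring

opaque
  below : ℚ → ℚ → Bool
  below x t = x ℚ.≤ᵇ t

  below-true : ∀ x t → below x t ≡ true → x ≤ t
  below-true x t e = ℚP.≤ᵇ⇒≤ (subst Bool.T (sym e) tt)

  below-false : ∀ x t → below x t ≡ false → t ≤ x
  below-false x t e = <⇒≤ (ℚP.≰⇒> (λ p → subst Bool.T e (ℚP.≤⇒≤ᵇ p)))

markov-≤ : ∀ u x t → 0ℚ ≤ x → t ⊗ indicator (u ∧ not (below x t)) ≤ indicator u ⊗ x
markov-≤ false x t 0≤x = ≡⇒≤ (trans (⊗-zeroʳ t) (sym (⊗-zeroˡ x)))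
markov-≤ true x t 0≤x with below x t in eq
... | true = ≤-trans (≡⇒≤ (⊗-zeroʳ t)) (≤-trans 0≤x (≡⇒≤ (sym (⊗-idˡ x))))
... | false = ≤-trans (≡⇒≤ (⊗-comm t 1ℚ)) (⊗-monoˡ 1ℚ 0≤1 (below-false x t eq))

record AlmostPeriodSet {X Y W : Set} (mX : Mean X) (mY : Mean Y) (mW : Mean W) (a : X → Y → ℚ) (b : Y → W → Bool)
                       (U₀ : W → Bool) (ε ρ : ℚ) : Set where
  field
    U : W → Bool
    U⊆ : ∀ w → U w ≡ true → U₀ w ≡ true
    dense : ρ ≤ density mW U
    close : ∀ w w′ → U w ≡ true → U w′ ≡ true →
      E mX (λ x → (E mY (λ y → a x y ⊗ indicator (b y w)) ⊝ E mY (λ y → a x y ⊗ indicator (b y w′))) ⊗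
                  (E mY (λ y → a x y ⊗ indicator (b y w)) ⊝ E mY (λ y → a x y ⊗ indicator (b y w′)))) ≤ ε

crootSisask : ∀ ε ρ₀ → 0ℚ < ε → 0ℚ < ρ₀ → Σ ℚ λ ρ → 0ℚ < ρ × (∀ {X Y W : Set} (mX : Mean X) (mY : Mean Y) (mW : Mean W) → Picks mY →
  ∀ a → (∀ x y → 0ℚ ≤ a x y) → (∀ x y → a x y ≤ 1ℚ) → ∀ b U₀ → ρ₀ ≤ density mW U₀ → AlmostPeriodSet mX mY mW a b U₀ ε ρ)
crootSisask ε ρ₀ 0<ε 0<ρ₀ = ρ , ⊗-pos (⊗-pos 0<ρ₀ (inv-pos 1)) (power-pos (suc n) (inv-pos 1)) , main
  where
  e₀ : ℚ
  e₀ = ε ⊗ inv 3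
  0<e₀ : 0ℚ < e₀
  0<e₀ = ⊗-pos 0<ε (inv-pos 3)
  rc = recip e₀ 0<e₀
  y = proj₁ rc
  sm = small y (ρ₀ ⊗ inv 1) (⊗-pos 0<ρ₀ (inv-pos 1))
  n = proj₁ sm
  ν = nat (suc n)
  ρ = (ρ₀ ⊗ inv 1) ⊗ power (inv 1) (suc n)
  -- Dividing by ν² leaves ε/4, and `compare` returns the factor 4. By Markov the excluded w have
  -- density at most ν/t = 1/(ν·e₀), which the choice of n makes at most ρ₀/2.
  t = (ν ⊗ ν) ⊗ e₀
  module _ {X Y W : Set} (mX : Mean X) (mY : Mean Y) (mW : Mean W) (pY : Picks mY) (a : X → Y → ℚ) (a≥0 : ∀ x y → 0ℚ ≤ a x y)
           (a≤1 : ∀ x y → a x y ≤ 1ℚ) (b : Y → W → Bool) (U₀ : W → Bool) (ρ₀≤ : ρ₀ ≤ density mW U₀) where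
    open Sampling mX mY mW pY a a≥0 a≤1 b
    sa = sample (suc n) U₀
    ys : Vec Y (suc n)
    ys = proj₁ sa
    good : W → Bool
    good w = below (error (suc n) ys w) t
    bad : W → ℚ
    bad w = indicator (U₀ w ∧ not (good w))
    markov : ∀ w → t ⊗ bad w ≤ indicator (U₀ w) ⊗ error (suc n) ys w
    markov w = markov-≤ (U₀ w) (error (suc n) ys w) t (Mean.nonneg mX (λ x → square-nonneg _))
    -- y·inv n cancels t = (n+1)²·e₀ up to a factor n+1
    bad-rare : E mW bad ≤ ρ₀ ⊗ inv 1
    bad-rare = ≤-trans (≡⇒≤ (sym cancel)) (≤-trans (⊗-monoˡ (y ⊗ (inv n ⊗ inv n)) (⊗-nonneg (<⇒≤ (proj₁ (proj₂ rc))) (square-nonneg (inv n)))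
      (≤-trans (≡⇒≤ (sym (Mean.scl mW t bad))) (≤-trans (Mean.mono mW markov) (proj₂ sa)))) (≤-trans (≡⇒≤ last) (proj₂ sm)))
      where
      opaque
        unfolding _⊕_
        l₁ : ∀ y i v e x → (y ⊗ (i ⊗ i)) ⊗ (((v ⊗ v) ⊗ e) ⊗ x) ≡ ((e ⊗ y) ⊗ ((v ⊗ i) ⊗ (v ⊗ i))) ⊗ x
        l₁ = solve-∀ ℚ-ring
        l₂ : ∀ y i v → (y ⊗ (i ⊗ i)) ⊗ v ≡ (y ⊗ i) ⊗ (v ⊗ i)
        l₂ = solve-∀ ℚ-ring
        l₃ : ∀ x → (1ℚ ⊗ (1ℚ ⊗ 1ℚ)) ⊗ x ≡ x
        l₃ = solve-∀ ℚ-ring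
      cancel : (y ⊗ (inv n ⊗ inv n)) ⊗ (t ⊗ E mW bad) ≡ E mW bad
      cancel = trans (l₁ y (inv n) ν e₀ (E mW bad)) (trans (cong₂ (λ p q → (p ⊗ (q ⊗ q)) ⊗ E mW bad) (proj₂ (proj₂ rc)) (nat-inv n)) (l₃ _))
      last : (y ⊗ (inv n ⊗ inv n)) ⊗ ν ≡ y ⊗ inv n
      last = trans (l₂ y (inv n) ν) (trans (cong ((y ⊗ inv n) ⊗_) (nat-inv n)) (⊗-idʳ _))
    U₁ : W → Bool
    U₁ w = U₀ w ∧ good w
    split : ∀ u v → indicator u ≡ indicator (u ∧ v) ⊕ indicator (u ∧ not v)
    split true true = sym (⊕-idʳ 1ℚ)
    split true false = sym (⊕-idˡ 1ℚ)
    split false v = sym (⊕-idˡ 0ℚ)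
    U₁-dense : ρ₀ ⊗ inv 1 ≤ density mW U₁
    U₁-dense = from-⊝-nonneg (subst (0ℚ ≤_) (lem ρ₀ (density mW U₁) (E mW bad)) (⊕-nonneg
        (⊝-nonneg (≤-trans ρ₀≤ (≡⇒≤ (trans (Mean.cng mW (λ w → split (U₀ w) (good w))) (Mean.add mW _ _))))) (⊝-nonneg bad-rare)))
      where
      opaque
        unfolding _⊕_
        lem : ∀ r a b → ((a ⊕ b) ⊝ r) ⊕ (r ⊗ inv 1 ⊝ b) ≡ a ⊝ r ⊗ inv 1
        lem = solve-∀ ℚ-ring
    rf = refine ys U₁ (ρ₀ ⊗ inv 1) U₁-dense
    main : AlmostPeriodSet mX mY mW a b U₀ ε ρ
    main = record
      { U = proj₁ rf
      ; U⊆ = λ w e → proj₁ (both (U₀ w) (proj₁ (proj₂ rf) w e))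
      ; dense = proj₁ (proj₂ (proj₂ rf))
      ; close = λ w w′ e e′ → ≤-trans (compare n ys w w′ t (proj₂ (proj₂ (proj₂ rf)) w w′ e e′) (fine w e) (fine w′ e′))
          (≡⇒≤ (trans (quarter-four (inv n) ν ε) (trans (cong (λ z → (z ⊗ z) ⊗ ε) (nat-inv n)) (one-sq ε)))) }
      where
      both : ∀ u {v} → u ∧ v ≡ true → u ≡ true × v ≡ true
      both true e = refl , e
      fine : ∀ w → proj₁ rf w ≡ true → error (suc n) ys w ≤ t
      fine w e = below-true (error (suc n) ys w) t (proj₂ (both (U₀ w) (proj₁ (proj₂ rf) w e)))

-- Linear equations in finite rings

-- Constants are always chosen before the ring, which makes the later bounds uniform in the modulus.
-- The map `red` also allows integer coefficients in the ring solver.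
record FinRing : Set₁ where
  infixl 6 _+ʳ_
  infixl 7 _*ʳ_
  infix 8 -ʳ_
  field
    R : Set
    _+ʳ_ _*ʳ_ : R → R → R
    -ʳ_ : R → R
    0ʳ 1ʳ : R
    isCR : IsCommutativeRing _≡_ _+ʳ_ _*ʳ_ -ʳ_ 0ʳ 1ʳ
    red : ℤ → R
    red-+ : ∀ a b → red (a ℤ.+ b) ≡ red a +ʳ red b
    red-* : ∀ a b → red (a ℤ.* b) ≡ red a *ʳ red b
    red-neg : ∀ a → red (ℤ.- a) ≡ -ʳ red a
    red-0 : red (+ 0) ≡ 0ʳ
    red-1 : red (+ 1) ≡ 1ʳ
    mean : Mean R
    translate : ∀ a f → E mean (λ x → f (x +ʳ a)) ≡ E mean f
    picks : Picks mean

module RingAverages (K : FinRing) where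
  open FinRing K public
  private module C = IsCommutativeRing isCR

  ringBundle : CommutativeRing 0ℓ 0ℓ
  ringBundle = record { isCommutativeRing = isCR }

  solverRing : ACR.AlmostCommutativeRing 0ℓ 0ℓ
  solverRing = ACR.fromCommutativeRing ringBundle

  coefficients : CommutativeRing.rawRing ℤP.+-*-commutativeRing ACR.-Raw-AlmostCommutative⟶ solverRing
  coefficients = record { ⟦_⟧ = red ; +-homo = red-+ ; *-homo = red-* ; -‿homo = red-neg ; 0-homo = red-0 ; 1-homo = red-1 }

  coefficient≟ : ∀ a b → Maybe (red a ≡ red b)
  coefficient≟ a b = Maybe.map (cong red) (dec⇒maybe (a ℤ.≟ b))

  open RingSolver (CommutativeRing.rawRing ℤP.+-*-commutativeRing) solverRing coefficients coefficient≟ public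
    using (solve; _:=_; _:+_; _:*_; :-_; con)

  additive : Grp
  additive = record
    { Λ = R ; _+ᵍ_ = _+ʳ_ ; 0ᵍ = 0ʳ ; -ᵍ_ = -ʳ_
    ; +ᵍ-assoc = C.+-assoc ; +ᵍ-comm = C.+-comm ; +ᵍ-idʳ = C.+-identityʳ ; +ᵍ-invʳ = C.-‿inverseʳ }

  translations : Sys additive
  translations = record
    { Y = R ; μ = mean ; act = λ u y → y +ʳ u
    ; act-+ = λ u v y → trans (cong (y +ʳ_) (C.+-comm u v)) (sym (C.+-assoc y v u))
    ; act-0 = C.+-identityʳ
    ; invariant = λ u f → translate u f }

  open Theory additive translations public
  open Energy additive translations public
  private module M = Mean mean

  Unit : R → Set
  Unit α = ∃[ β ] (α *ʳ β ≡ 1ʳ)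

  total : ∀ {n} → Vec R n → R
  total [] = 0ʳ
  total (α ∷ αs) = α +ʳ total αs

  In[0,1] : Fun → Set
  In[0,1] f = (∀ n → 0ℚ ≤ f n) × (∀ n → f n ≤ 1ℚ)

  T : R → Fun → Fun → Fun
  T α g h v = E mean (λ n → g n ⊗ h (v +ʳ α *ʳ n))

  -- density of solutions (n₀, n₁, …, n_k) of n₀ = v + Σ αᵢnᵢ, weighted by g at each coordinate
  form : ∀ {k} → Fun → Vec R k → Fun
  form g [] = g
  form g (α ∷ αs) = T α g (form g αs)

  In-T : ∀ {α g h} → In[0,1] g → In[0,1] h → In[0,1] (T α g h)
  In-T (g≥0 , g≤1) (h≥0 , h≤1) = (λ v → M.nonneg (λ n → ⊗-nonneg (g≥0 n) (h≥0 _))) ,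
    λ v → M.bound (λ n → ≤-trans (⊗-mono (g≥0 n) 0≤1 (g≤1 n) (h≤1 _)) (≡⇒≤ (⊗-idʳ 1ℚ)))

  In-form : ∀ {k g} (αs : Vec R k) → In[0,1] g → In[0,1] (form g αs)
  In-form [] i = i
  In-form {g = g} (α ∷ αs) i = In-T {α} {g} {form g αs} i (In-form αs i)

  infixl 6 _-ʳ_
  _-ʳ_ : R → R → R
  a -ʳ b = a +ʳ (-ʳ b)

  swap-summand : ∀ a b c → (a +ʳ b) +ʳ c ≡ (a +ʳ c) +ʳ b
  swap-summand = solve 3 (λ a b c → (a :+ b) :+ c := (a :+ c) :+ b) refl

  translate-argument : ∀ v α n x → v +ʳ α *ʳ n ≡ (v -ʳ α *ʳ x) +ʳ α *ʳ (n +ʳ x)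
  translate-argument = solve 4 (λ v α n x → v :+ α :* n := (v :+ :- (α :* x)) :+ α :* (n :+ x)) refl

  negate-difference : ∀ v β w w′ → v -ʳ β *ʳ (w -ʳ w′) ≡ v +ʳ β *ʳ (w′ -ʳ w)
  negate-difference = solve 4 (λ v β w w′ → v :+ :- (β :* (w :+ :- w′)) := v :+ β :* (w′ :+ :- w)) refl

  move-summand : ∀ a b c d → ((a +ʳ b) -ʳ c) +ʳ d ≡ ((a -ʳ c) +ʳ d) +ʳ b
  move-summand = solve 4 (λ a b c d → ((a :+ b) :+ :- c) :+ d := ((a :+ :- c) :+ d) :+ b) refl

  module Periods (U : R → Bool) (Mult : R → Set) where
    -- One-sided in form, but exchanging w and w′ gives the reverse inequality. `Mult` is present
    -- because smoothing the variable with multiplier α displaces v by multiples of α.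
    AP : Fun → ℚ → Set
    AP h τ = ∀ β → Mult β → ∀ w w′ → U w ≡ true → U w′ ≡ true → ∀ v → h (v +ʳ β *ʳ (w -ʳ w′)) ≤ h v ⊕ τ

    AP-T : ∀ {α g h τ} → In[0,1] g → 0ℚ ≤ τ → AP h τ → AP (T α g h) τ
    AP-T {α} {g} {h} {τ} (g≥0 , g≤1) 0≤τ ap β mβ w w′ e e′ v =
      ≤-trans (M.mono (λ n → ≤-trans (⊗-monoˡ (g n) (g≥0 n) (≤-trans (≡⇒≤ (cong h (swap-summand v (β *ʳ (w -ʳ w′)) (α *ʳ n)))) (ap β mβ w w′ e e′ (v +ʳ α *ʳ n))))
          (≤-trans (≡⇒≤ (⊗-distribˡ (g n) (h (v +ʳ α *ʳ n)) τ)) (⊕-mono (≤-refl {g n ⊗ h (v +ʳ α *ʳ n)}) (≤-trans (⊗-monoʳ τ 0≤τ (g≤1 n)) (≡⇒≤ (⊗-idˡ τ)))))))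
        (≡⇒≤ (trans (M.add _ _) (cong (T α g h v ⊕_) (M.one τ))))

    module _ (y : ℚ) (0≤y : 0ℚ ≤ y) (ρy≡1 : density mean U ⊗ y ≡ 1ℚ) where
      private
        S : Set
        S = Σ R (λ w → U w ≡ true)
      D : Mean S
      D = conditional mean U y 0≤y ρy≡1
      ν : Mean R
      ν = push proj₁ D

      smooth : Fun → Fun
      smooth f = op (gram ν) f

      smooth-In : ∀ {f} → In[0,1] f → In[0,1] (smooth f)
      smooth-In (f≥0 , f≤1) = (λ n → Mean.nonneg (gram ν) (λ u → f≥0 (n +ʳ u))) , (λ n → Mean.bound (gram ν) (λ u → f≤1 (n +ʳ u)))

      -- Substituting n + x for n trades the smoothing of the weight for a displacement of the base
      -- point v.
      T-smooth : ∀ α f h v → T α (smooth f) h v ≡ E (gram ν) (λ x → T α f h (v -ʳ α *ʳ x))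
      T-smooth α f h v = trans (M.cng (λ n → sym (Mean.sclʳ (gram ν) (h (v +ʳ α *ʳ n)) (λ x → f (n +ʳ x)))))
        (trans (fubini mean (gram ν) (λ n x → f (n +ʳ x) ⊗ h (v +ʳ α *ʳ n))) (Mean.cng (gram ν) (λ x →
          trans (M.cng (λ n → cong (λ z → f (n +ʳ x) ⊗ h z) (translate-argument v α n x)))
            (translate x (λ n → f n ⊗ h ((v -ʳ α *ʳ x) +ʳ α *ʳ n))))))

      T-avg : ∀ α f (F : R → R → ℚ) v → T α f (λ u → E (gram ν) (F u)) v ≡ E (gram ν) (λ x → T α f (λ u → F u x) v)
      T-avg α f F v = trans (M.cng (λ n → sym (Mean.scl (gram ν) (f n) (F (v +ʳ α *ʳ n))))) (fubini mean (gram ν) (λ n x → f n ⊗ F (v +ʳ α *ʳ n) x))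

      -- averages over gram ν only involve differences of elements of U
      gram-mono : ∀ (F G : R → ℚ) → (∀ w w′ → U w ≡ true → U w′ ≡ true → F (w -ʳ w′) ≤ G (w -ʳ w′)) → E (gram ν) F ≤ E (gram ν) G
      gram-mono F G h = Mean.mono D (λ s′ → Mean.mono D (λ s → h (proj₁ s) (proj₁ s′) (proj₂ s) (proj₂ s′)))

      gram-shift : ∀ h τ β v → AP h τ → Mult β → E (gram ν) (λ x → h (v +ʳ β *ʳ x)) ≤ h v ⊕ τ
      gram-shift h τ β v ap mβ = ≤-trans (gram-mono (λ x → h (v +ʳ β *ʳ x)) (λ _ → h v ⊕ τ) (λ w w′ e e′ → ap β mβ w w′ e e′ v)) (≡⇒≤ (Mean.one (gram ν) _))

      gram-shift⁻ : ∀ h τ β v → AP h τ → Mult β → E (gram ν) (λ x → h (v -ʳ β *ʳ x)) ≤ h v ⊕ τ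
      gram-shift⁻ h τ β v ap mβ = ≤-trans (gram-mono (λ x → h (v -ʳ β *ʳ x)) (λ _ → h v ⊕ τ) (λ w w′ e e′ →
          ≤-trans (≡⇒≤ (cong h (negate-difference v β w w′))) (ap β mβ w′ w e′ e v)))
        (≡⇒≤ (Mean.one (gram ν) _))

      module _ (f : Fun) (fI : In[0,1] f) (τ : ℚ) (0≤τ : 0ℚ ≤ τ) where
        private g = smooth f

        T-mono : ∀ α h h′ κ → (∀ v → h′ v ≤ h v ⊕ κ) → 0ℚ ≤ κ → ∀ v → T α g h′ v ≤ T α g h v ⊕ κ
        T-mono α h h′ κ le 0≤κ v = ≤-trans (M.mono (λ n → ≤-trans (⊗-monoˡ (g n) (proj₁ (smooth-In fI) n) (le _))
            (≤-trans (≡⇒≤ (⊗-distribˡ (g n) _ κ)) (⊕-mono ≤-refl (≤-trans (⊗-monoʳ κ 0≤κ (proj₂ (smooth-In fI) n)) (≡⇒≤ (⊗-idˡ κ)))))))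
          (≡⇒≤ (trans (M.add _ _) (cong (T α g h v ⊕_) (M.one κ))))

        -- Smoothing the three factors displaces v by -α₁x₁, -α₂x₂ and x₀, with each x a difference
        -- of two elements of U; every displacement costs one τ.
        smooth-base : ∀ α₁ α₂ → Mult 1ʳ → Mult α₁ → Mult α₂ → AP (form f (α₁ ∷ α₂ ∷ [])) τ →
          ∀ v → form g (α₁ ∷ α₂ ∷ []) v ≤ form f (α₁ ∷ α₂ ∷ []) v ⊕ (τ ⊕ (τ ⊕ τ))
        smooth-base α₁ α₂ m1 m₁ m₂ ap v = ≤-trans (≡⇒≤ expand) (≤-trans
            (Mean.mono (gram ν) (λ x₁ → ≤-trans (Mean.mono (gram ν) (λ x₂ → step₀ ((v -ʳ α₁ *ʳ x₁) -ʳ α₂ *ʳ x₂)))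
              (≤-trans (≡⇒≤ (trans (Mean.add (gram ν) (λ x₂ → H ((v -ʳ α₁ *ʳ x₁) -ʳ α₂ *ʳ x₂)) (λ _ → τ)) (cong (E (gram ν) (λ x₂ → H ((v -ʳ α₁ *ʳ x₁) -ʳ α₂ *ʳ x₂)) ⊕_) (Mean.one (gram ν) τ))))
                (⊕-mono (gram-shift⁻ H τ α₂ (v -ʳ α₁ *ʳ x₁) ap m₂) ≤-refl))))
            (≤-trans (≡⇒≤ (trans (Mean.cng (gram ν) (λ x₁ → ⊕-assoc (H (v -ʳ α₁ *ʳ x₁)) τ τ)) (trans (Mean.add (gram ν) (λ x₁ → H (v -ʳ α₁ *ʳ x₁)) (λ _ → τ ⊕ τ)) (cong (E (gram ν) (λ x₁ → H (v -ʳ α₁ *ʳ x₁)) ⊕_) (Mean.one (gram ν) (τ ⊕ τ))))))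
              (≤-trans (⊕-mono (gram-shift⁻ H τ α₁ v ap m₁) ≤-refl) (≡⇒≤ (⊕-assoc (H v) τ (τ ⊕ τ))))))
          where
          H Ψ : Fun
          H = form f (α₁ ∷ α₂ ∷ [])
          Ψ = T α₂ f f
          step₀ : ∀ u → E (gram ν) (λ x₀ → H (u +ʳ x₀)) ≤ H u ⊕ τ
          step₀ u = ≤-trans (≡⇒≤ (Mean.cng (gram ν) (λ x₀ → cong (λ z → H (u +ʳ z)) (sym (C.*-identityˡ x₀))))) (gram-shift H τ 1ʳ u ap m1)
          inner : ∀ u → T α₂ g g u ≡ E (gram ν) (λ x₂ → E (gram ν) (λ x₀ → Ψ ((u -ʳ α₂ *ʳ x₂) +ʳ x₀)))
          inner u = trans (T-smooth α₂ f g u) (Mean.cng (gram ν) (λ x₂ → trans (T-avg α₂ f (λ u x₀ → f (u +ʳ x₀)) (u -ʳ α₂ *ʳ x₂))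
            (Mean.cng (gram ν) (λ x₀ → M.cng (λ n → cong (λ z → f n ⊗ f z) (swap-summand (u -ʳ α₂ *ʳ x₂) (α₂ *ʳ n) x₀))))))
          expand : form g (α₁ ∷ α₂ ∷ []) v ≡ E (gram ν) (λ x₁ → E (gram ν) (λ x₂ → E (gram ν) (λ x₀ → H (((v -ʳ α₁ *ʳ x₁) -ʳ α₂ *ʳ x₂) +ʳ x₀))))
          expand = trans (T-smooth α₁ f (T α₂ g g) v) (Mean.cng (gram ν) (λ x₁ → trans (M.cng (λ n → cong (f n ⊗_) (inner _)))
            (trans (T-avg α₁ f (λ u x₂ → E (gram ν) (λ x₀ → Ψ ((u -ʳ α₂ *ʳ x₂) +ʳ x₀))) (v -ʳ α₁ *ʳ x₁)) (Mean.cng (gram ν) (λ x₂ →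
              trans (T-avg α₁ f (λ u x₀ → Ψ ((u -ʳ α₂ *ʳ x₂) +ʳ x₀)) (v -ʳ α₁ *ʳ x₁)) (Mean.cng (gram ν) (λ x₀ → M.cng (λ n → cong (λ z → f n ⊗ Ψ z)
                (move-summand (v -ʳ α₁ *ʳ x₁) (α₁ *ʳ n) (α₂ *ʳ x₂) x₀)))))))))

        AP-form : ∀ {k} (αs : Vec R k) α₁ α₂ → AP (form f (α₁ ∷ α₂ ∷ [])) τ → AP (form f (αs Vec.++ α₁ ∷ α₂ ∷ [])) τ
        AP-form [] α₁ α₂ ap = ap
        AP-form (α ∷ αs) α₁ α₂ ap = AP-T {α} {f} {form f (αs Vec.++ α₁ ∷ α₂ ∷ [])} fI 0≤τ (AP-form αs α₁ α₂ ap)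

        -- Almost periodicity of the core with multipliers α₁, α₂ passes through every further
        -- averaging, so each additional variable again costs one τ.
        smooth-form : ∀ {k} (αs : Vec R k) α₁ α₂ → (∀ i → Mult (Vec.lookup αs i)) → Mult 1ʳ → Mult α₁ → Mult α₂ → AP (form f (α₁ ∷ α₂ ∷ [])) τ →
          ∀ v → form g (αs Vec.++ α₁ ∷ α₂ ∷ []) v ≤ form f (αs Vec.++ α₁ ∷ α₂ ∷ []) v ⊕ nat (3 ℕ.+ k) ⊗ τ
        smooth-form [] α₁ α₂ ms m1 m₁ m₂ ap v = ≤-trans (smooth-base α₁ α₂ m1 m₁ m₂ ap v) (≡⇒≤ (cong (form f (α₁ ∷ α₂ ∷ []) v ⊕_) (sym (trans (nat-suc-⊗ 2 τ) (cong (τ ⊕_) (trans (nat-suc-⊗ 1 τ) (cong (τ ⊕_) (trans (cong (_⊗ τ) nat-1) (⊗-idˡ τ)))))))))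
          where
          nat-suc-⊗ : ∀ n τ → nat (suc n) ⊗ τ ≡ τ ⊕ nat n ⊗ τ
          nat-suc-⊗ n τ = trans (cong (_⊗ τ) (nat-suc n)) (trans (⊗-distribʳ τ 1ℚ (nat n)) (cong (_⊕ nat n ⊗ τ) (⊗-idˡ τ)))
        smooth-form {suc k} (α ∷ αs) α₁ α₂ ms m1 m₁ m₂ ap v = ≤-trans
            (T-mono α (form f rest) (form g rest) (nat (3 ℕ.+ k) ⊗ τ) (smooth-form αs α₁ α₂ (ms ∘ suc) m1 m₁ m₂ ap) (⊗-nonneg (nat-nonneg (3 ℕ.+ k)) 0≤τ) v)
            (≤-trans (⊕-mono (≤-trans (≡⇒≤ (T-smooth α f (form f rest) v)) (gram-shift⁻ (T α f (form f rest)) τ α v (AP-form (α ∷ αs) α₁ α₂ ap) (ms zero))) ≤-refl)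
              (≡⇒≤ (trans (⊕-assoc _ τ _) (cong (form f (α ∷ rest) v ⊕_) (sym (trans (cong (_⊗ τ) (nat-suc (3 ℕ.+ k))) (trans (⊗-distribʳ τ 1ℚ (nat (3 ℕ.+ k))) (cong (_⊕ nat (3 ℕ.+ k) ⊗ τ) (⊗-idˡ τ)))))))))
          where rest = αs Vec.++ α₁ ∷ α₂ ∷ []

opaque
  unfolding _⊕_

  weighted-difference : ∀ f a b → f ⊗ a ≡ f ⊗ b ⊕ f ⊗ (a ⊝ b)
  weighted-difference = solve-∀ ℚ-ring

  sq-product : ∀ a b → (a ⊗ b) ⊗ (a ⊗ b) ≡ (a ⊗ a) ⊗ (b ⊗ b)
  sq-product = solve-∀ ℚ-ring

  tangent-step : ∀ x e p q m → p ≡ e ⊗ q → x ⊗ (p ⊕ (m ⊗ q) ⊗ (x ⊝ e)) ≡ (e ⊗ p ⊕ ((1ℚ ⊕ m) ⊗ p) ⊗ (x ⊝ e)) ⊕ (m ⊗ q) ⊗ ((x ⊝ e) ⊗ (x ⊝ e))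
  tangent-step x e p q m refl = l x e q m
    where
    l : ∀ x e q m → x ⊗ (e ⊗ q ⊕ (m ⊗ q) ⊗ (x ⊝ e)) ≡ (e ⊗ (e ⊗ q) ⊕ ((1ℚ ⊕ m) ⊗ (e ⊗ q)) ⊗ (x ⊝ e)) ⊕ (m ⊗ q) ⊗ ((x ⊝ e) ⊗ (x ⊝ e))
    l = solve-∀ ℚ-ring

  tangent-base : ∀ x e → x ⊗ 1ℚ ≡ e ⊗ 1ℚ ⊕ (1ℚ ⊗ 1ℚ) ⊗ (x ⊝ e)
  tangent-base = solve-∀ ℚ-ring

  product-step : ∀ a x p q u v → (a ⊝ (x ⊝ u)) ⊗ p ⊕ (x ⊗ (p ⊝ (q ⊝ v)) ⊕ (u ⊗ (1ℚ ⊝ p) ⊕ v ⊗ (1ℚ ⊝ x))) ≡ a ⊗ p ⊝ (x ⊗ q ⊝ (u ⊕ v))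
  product-step = solve-∀ ℚ-ring

  -- s(y − x)² + t − (x − y) = s((x − y) − t)² + (x − y)  when st = 1
  linear-vs-square : ∀ s t d → s ⊗ (d ⊗ d) ⊕ (s ⊗ t) ⊗ t ⊝ (2# ⊗ (s ⊗ t)) ⊗ d ≡ s ⊗ ((d ⊝ t) ⊗ (d ⊝ t))
  linear-vs-square = solve-∀ ℚ-ring

  ⊝-⊕-cancel : ∀ a b → (a ⊝ b) ⊕ b ≡ a
  ⊝-⊕-cancel = solve-∀ ℚ-ring

  double-one : ∀ d → (2# ⊗ 1ℚ) ⊗ d ≡ d ⊕ d
  double-one = solve-∀ ℚ-ring

  sq-neg : ∀ x y → (x ⊝ y) ⊗ (x ⊝ y) ≡ (y ⊝ x) ⊗ (y ⊝ x)
  sq-neg = solve-∀ ℚ-ring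

  ⊗-≰ : ∀ {x t} → 0ℚ ≤ t → t < x → t ⊗ t < x ⊗ x
  ⊗-≰ {x} {t} 0≤t t<x = ℚP.≤-<-trans (⊗-monoˡ t 0≤t (<⇒≤ t<x))
    (ℚP.*-monoˡ-<-pos x ⦃ ℚ.positive (ℚP.≤-<-trans 0≤t t<x) ⦄ t<x)

sqrt-≤ : ∀ {x t} → 0ℚ ≤ t → x ⊗ x ≤ t ⊗ t → x ≤ t
sqrt-≤ {x} {t} 0≤t p with x ℚ.≤? t
... | yes q = q
... | no ¬q = ⊥-elim (ℚP.<-irrefl refl (ℚP.<-≤-trans (⊗-≰ 0≤t (ℚP.≰⇒> ¬q)) p))

power-nonneg : ∀ {x} n → 0ℚ ≤ x → 0ℚ ≤ power x n
power-nonneg zero _ = 0≤1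
power-nonneg (suc n) p = ⊗-nonneg p (power-nonneg n p)

power-mono : ∀ {x y} n → 0ℚ ≤ x → x ≤ y → power x n ≤ power y n
power-mono zero _ _ = ≤-refl
power-mono (suc n) p q = ⊗-mono p (power-nonneg n (≤-trans p q)) q (power-mono n p q)

-- Convexity of powers without calculus: multiplying the tangent bound by x ≥ 0 produces the next
-- one plus a nonnegative multiple of (x - e)².
tangent : ∀ n x e → 0ℚ ≤ x → 0ℚ ≤ e → power e (suc n) ⊕ (nat (suc n) ⊗ power e n) ⊗ (x ⊝ e) ≤ power x (suc n)
tangent zero x e _ _ = ≡⇒≤ (sym (trans (tangent-base x e) (cong (λ z → e ⊗ 1ℚ ⊕ (z ⊗ 1ℚ) ⊗ (x ⊝ e)) (sym nat-1))))
tangent (suc n) x e 0≤x 0≤e = ≤-trans (≤-by ((nat (suc n) ⊗ power e n) ⊗ ((x ⊝ e) ⊗ (x ⊝ e))) (⊗-nonneg (⊗-nonneg (nat-nonneg (suc n)) (power-nonneg n 0≤e)) (square-nonneg _))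
    (trans (cong (λ z → (e ⊗ power e (suc n) ⊕ (z ⊗ power e (suc n)) ⊗ (x ⊝ e)) ⊕ (nat (suc n) ⊗ power e n) ⊗ ((x ⊝ e) ⊗ (x ⊝ e))) (nat-suc (suc n)))
      (sym (tangent-step x e (power e (suc n)) (power e n) (nat (suc n)) refl))))
  (⊗-monoˡ x 0≤x (tangent n x e 0≤x 0≤e))

power-mean : ∀ {A : Set} (m : Mean A) (f : A → ℚ) n → (∀ a → 0ℚ ≤ f a) → power (E m f) (suc n) ≤ E m (λ a → power (f a) (suc n))
power-mean m f n f≥0 = ≤-trans (≡⇒≤ (sym eq)) (Mean.mono m (λ a → tangent n (f a) e (f≥0 a) (Mean.nonneg m f≥0)))
  where
  e k : ℚ
  e = E m f
  k = nat (suc n) ⊗ power e n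
  eq : E m (λ a → power e (suc n) ⊕ k ⊗ (f a ⊝ e)) ≡ power e (suc n)
  eq = trans (Mean.add m _ _) (trans (cong₂ _⊕_ (Mean.one m _) (trans (Mean.scl m k _) (cong (k ⊗_) (trans (Mean.sub m f (λ _ → e)) (trans (cong (e ⊝_) (Mean.one m e)) (⊝-self e))))))
    (trans (cong (power e (suc n) ⊕_) (⊗-zeroʳ k)) (⊕-idʳ _)))

-- A positive d = x - y satisfies 2d ≤ sd² + t. A pointwise lower bound is thus paid for with the
-- squared difference, the only kind of error that L² closeness controls.
≤-square : ∀ s t x y → 0ℚ ≤ s → 0ℚ ≤ t → s ⊗ t ≡ 1ℚ → x ⊝ (s ⊗ ((y ⊝ x) ⊗ (y ⊝ x)) ⊕ t) ≤ y
≤-square s t x y 0≤s 0≤t st≡1 with (x ⊝ y) ℚ.≤? 0ℚ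
... | yes p = ≤-trans (⊝-nonneg-anti (⊕-nonneg (⊗-nonneg 0≤s (square-nonneg _)) 0≤t)) (≤-trans (≡⇒≤ (sym (⊝-⊕-cancel x y))) (≤-trans (⊕-mono p ≤-refl) (≡⇒≤ (⊕-idˡ y))))
... | no ¬p = ≤-trans (⊝-anti ≤-refl d≤) (≡⇒≤ (cancel x y))
  where
  d = x ⊝ y
  opaque
    unfolding _⊕_
    cancel : ∀ x y → x ⊝ (x ⊝ y) ≡ y
    cancel = solve-∀ ℚ-ring
  2d≤ : d ⊕ d ≤ s ⊗ (d ⊗ d) ⊕ t
  2d≤ = from-⊝-nonneg (subst (0ℚ ≤_) (trans (sym (linear-vs-square s t d)) (trans (cong (λ z → s ⊗ (d ⊗ d) ⊕ z ⊗ t ⊝ (2# ⊗ z) ⊗ d) st≡1)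
    (cong₂ (λ u v → s ⊗ (d ⊗ d) ⊕ u ⊝ v) (⊗-idˡ t) (double-one d)))) (⊗-nonneg 0≤s (square-nonneg (d ⊝ t))))
  d≤ : d ≤ s ⊗ ((y ⊝ x) ⊗ (y ⊝ x)) ⊕ t
  d≤ = ≤-trans (≤-⊕ʳ (<⇒≤ (ℚP.≰⇒> ¬p))) (≤-trans 2d≤ (≡⇒≤ (cong (λ z → s ⊗ z ⊕ t) (sq-neg x y))))

module RingCounting (K : FinRing) where
  open RingAverages K public
  private
    module M = Mean mean
    module C = IsCommutativeRing isCR

  square : ℚ → ℚ
  square x = x ⊗ x

  unit-mul : ∀ α α′ n z → α *ʳ α′ ≡ 1ʳ → α *ʳ (n +ʳ α′ *ʳ z) ≡ α *ʳ n +ʳ z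
  unit-mul α α′ n z e = trans (expand α α′ n z) (cong (α *ʳ n +ʳ_) (trans (cong (_*ʳ z) e) (C.*-identityˡ z)))
    where
    expand : ∀ α α′ n z → α *ʳ (n +ʳ α′ *ʳ z) ≡ α *ʳ n +ʳ (α *ʳ α′) *ʳ z
    expand = solve 4 (λ α α′ n z → α :* (n :+ α′ :* z) := α :* n :+ (α :* α′) :* z) refl

  kernel : (R → Bool) → R → R → R → R → ℚ
  kernel A α₁ α₂ n m = indicator (A (α₁ *ʳ n +ʳ α₂ *ʳ m))

  bit : (R → Bool) → R → R → R → R → Bool
  bit A α₂′ β m w = A (m -ʳ α₂′ *ʳ (β *ʳ w))

  -- Translating m by -α₂⁻¹βw moves all dependence on w into the bit A(m - α₂⁻¹βw), which is the
  -- shape required for sampling.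
  kernel-conv : ∀ A α₁ α₂ α₂′ β n w → α₂ *ʳ α₂′ ≡ 1ʳ →
    E mean (λ m → kernel A α₁ α₂ n m ⊗ indicator (bit A α₂′ β m w)) ≡ T α₂ (indicator ∘ A) (indicator ∘ A) (α₁ *ʳ n +ʳ β *ʳ w)
  kernel-conv A α₁ α₂ α₂′ β n w e = sym (trans (sym (translate (-ʳ (α₂′ *ʳ (β *ʳ w))) _)) (M.cng (λ m →
      trans (⊗-comm _ _) (cong (λ z → indicator (A z) ⊗ indicator (A (m -ʳ α₂′ *ʳ (β *ʳ w)))) (eq m)))))
    where
    expand : ∀ a b c d x → (a +ʳ b) +ʳ c *ʳ (x -ʳ d *ʳ b) ≡ (a +ʳ c *ʳ x) +ʳ (b -ʳ (c *ʳ d) *ʳ b)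
    expand = solve 5 (λ a b c d x → (a :+ b) :+ c :* (x :+ :- (d :* b)) := (a :+ c :* x) :+ (b :+ :- ((c :* d) :* b))) refl
    vanish : ∀ a b → a +ʳ (b -ʳ 1ʳ *ʳ b) ≡ a
    vanish a b = trans (cong (λ z → a +ʳ (b -ʳ z)) (C.*-identityˡ b)) (trans (cong (a +ʳ_) (C.-‿inverseʳ b)) (C.+-identityʳ a))
    eq : ∀ m → (α₁ *ʳ n +ʳ β *ʳ w) +ʳ α₂ *ʳ (m -ʳ α₂′ *ʳ (β *ʳ w)) ≡ α₁ *ʳ n +ʳ α₂ *ʳ m
    eq m = trans (expand (α₁ *ʳ n) (β *ʳ w) α₂ α₂′ m) (trans (cong (λ z → (α₁ *ʳ n +ʳ α₂ *ʳ m) +ʳ (β *ʳ w -ʳ z *ʳ (β *ʳ w))) e) (vanish _ _))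

  In-indicator : ∀ A → In[0,1] (indicator ∘ A)
  In-indicator A = (λ n → indicator-nonneg (A n)) , (λ n → indicator-≤1 (A n))

  -- Sampling yields closeness in L² only. The outer average against f ≤ 1 upgrades it to a bound
  -- uniform in v by Cauchy-Schwarz, which is why the core has two multipliers. Inverting α₁ permits
  -- a translation of n that brings the argument to α₁n + βw.
  periods-of-pair : ∀ (U : R → Bool) (Mult : R → Set) A α₁ α₁′ α₂ τ → α₁ *ʳ α₁′ ≡ 1ʳ → 0ℚ ≤ τ →
    (∀ β → Mult β → ∀ w w′ → U w ≡ true → U w′ ≡ true →
      E mean (λ n → square (T α₂ (indicator ∘ A) (indicator ∘ A) (α₁ *ʳ n +ʳ β *ʳ w) ⊝ T α₂ (indicator ∘ A) (indicator ∘ A) (α₁ *ʳ n +ʳ β *ʳ w′))) ≤ τ ⊗ τ) →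
    Periods.AP U Mult (form (indicator ∘ A) (α₁ ∷ α₂ ∷ [])) τ
  periods-of-pair U Mult A α₁ α₁′ α₂ τ unit 0≤τ close β mβ w w′ e e′ v = ≤-trans (≡⇒≤ (trans shifted (trans (M.cng (λ n → weighted-difference (f (n +ʳ a)) _ _)) (M.add _ _))))
      (⊕-mono (≡⇒≤ (sym unshifted)) (sqrt-≤ 0≤τ (≤-trans (jensen mean _) (≤-trans (M.mono (λ n → ≤-trans (≡⇒≤ (sq-product (f (n +ʳ a)) _))
        (≤-trans (⊗-monoʳ _ (square-nonneg _) (≤-trans (⊗-mono (indicator-nonneg _) 0≤1 (indicator-≤1 _) (indicator-≤1 _)) (≡⇒≤ (⊗-idʳ 1ℚ)))) (≡⇒≤ (⊗-idˡ _))))) (close β mβ w w′ e e′)))))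
    where
    f Ψ : Fun
    f = indicator ∘ A
    Ψ = T α₂ f f
    a : R
    a = α₁′ *ʳ (β *ʳ w′ -ʳ v)
    r₁ : ∀ v b w w′ x → (v +ʳ b *ʳ (w -ʳ w′)) +ʳ (x +ʳ (b *ʳ w′ -ʳ v)) ≡ x +ʳ b *ʳ w
    r₁ = solve 5 (λ v b w w′ x → (v :+ b :* (w :+ :- w′)) :+ (x :+ (b :* w′ :+ :- v)) := x :+ b :* w) refl
    r₂ : ∀ v b w′ x → v +ʳ (x +ʳ (b *ʳ w′ -ʳ v)) ≡ x +ʳ b *ʳ w′
    r₂ = solve 4 (λ v b w′ x → v :+ (x :+ (b :* w′ :+ :- v)) := x :+ b :* w′) refl
    shifted : form f (α₁ ∷ α₂ ∷ []) (v +ʳ β *ʳ (w -ʳ w′)) ≡ E mean (λ n → f (n +ʳ a) ⊗ Ψ (α₁ *ʳ n +ʳ β *ʳ w))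
    shifted = trans (sym (translate a _)) (M.cng (λ n → cong (λ z → f (n +ʳ a) ⊗ Ψ z)
      (trans (cong ((v +ʳ β *ʳ (w -ʳ w′)) +ʳ_) (unit-mul α₁ α₁′ n _ unit)) (r₁ v β w w′ (α₁ *ʳ n)))))
    unshifted : form f (α₁ ∷ α₂ ∷ []) v ≡ E mean (λ n → f (n +ʳ a) ⊗ Ψ (α₁ *ʳ n +ʳ β *ʳ w′))
    unshifted = trans (sym (translate a _)) (M.cng (λ n → cong (λ z → f (n +ʳ a) ⊗ Ψ z)
      (trans (cong (v +ʳ_) (unit-mul α₁ α₁′ n _ unit)) (r₂ v β w′ (α₁ *ʳ n)))))

  prodAt : Fun → List R → Fun
  prodAt g [] n = 1ℚ
  prodAt g (y ∷ ys) n = g (n +ʳ y) ⊗ prodAt g ys n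

  prodAt-In : ∀ {g} ys → In[0,1] g → In[0,1] (prodAt g ys)
  prodAt-In [] i = (λ n → 0≤1) , (λ n → ≤-refl)
  prodAt-In {g} (y ∷ ys) i@(g≥0 , g≤1) = (λ n → ⊗-nonneg (g≥0 (n +ʳ y)) (proj₁ (prodAt-In ys i) n)) ,
    (λ n → ≤-trans (⊗-mono (g≥0 (n +ʳ y)) 0≤1 (g≤1 (n +ʳ y)) (proj₂ (prodAt-In ys i) n)) (≡⇒≤ (⊗-idʳ 1ℚ)))

  Close : Fun → Fun → ℚ → R → Set
  Close g F ω y = E mean (λ n → square (g (n +ʳ y) ⊝ F n)) ≤ ω

  data AllClose (g F : Fun) (ω : ℚ) : List R → Set where
    [] : AllClose g F ω []
    _∷_ : ∀ {y ys} → Close g F ω y → AllClose g F ω ys → AllClose g F ω (y ∷ ys)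

  -- Each factor obeys g(n + y) ≥ F(n) - (s(g(n + y) - F(n))² + t). Since all factors lie in [0, 1],
  -- the errors add up, and each has mean at most sω + t.
  product-lower : ∀ g F s t ω → In[0,1] g → In[0,1] F → 0ℚ ≤ s → 0ℚ ≤ t → s ⊗ t ≡ 1ℚ → ∀ ys → AllClose g F ω ys →
    E mean (λ n → power (F n) (List.length ys)) ⊝ nat (List.length ys) ⊗ (s ⊗ ω ⊕ t) ≤ E mean (prodAt g ys)
  product-lower g F s t ω gI@(g≥0 , g≤1) FI@(F≥0 , F≤1) 0≤s 0≤t st≡1 ys close =
    ≤-trans (⊝-anti ≤-refl (total-err ys close)) (≤-trans (≡⇒≤ (sym (M.sub _ (err ys)))) (M.mono (pointwise ys)))
    where
    e₁ : R → Fun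
    e₁ y n = s ⊗ square (g (n +ʳ y) ⊝ F n) ⊕ t
    e₁≥0 : ∀ y n → 0ℚ ≤ e₁ y n
    e₁≥0 y n = ⊕-nonneg (⊗-nonneg 0≤s (square-nonneg _)) 0≤t
    err : List R → Fun
    err [] n = 0ℚ
    err (y ∷ ys) n = e₁ y n ⊕ err ys n
    err≥0 : ∀ ys n → 0ℚ ≤ err ys n
    err≥0 [] n = ≤-refl
    err≥0 (y ∷ ys) n = ⊕-nonneg (e₁≥0 y n) (err≥0 ys n)
    pointwise : ∀ ys n → power (F n) (List.length ys) ⊝ err ys n ≤ prodAt g ys n
    pointwise [] n = ⊝-nonneg-anti ≤-refl
    pointwise (y ∷ ys) n = from-⊝-nonneg (subst (0ℚ ≤_)
      (product-step (g (n +ʳ y)) (F n) (prodAt g ys n) (power (F n) (List.length ys)) (e₁ y n) (err ys n))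
      (⊕-nonneg (⊗-nonneg (⊝-nonneg (≤-square s t (F n) (g (n +ʳ y)) 0≤s 0≤t st≡1)) (proj₁ (prodAt-In ys gI) n))
        (⊕-nonneg (⊗-nonneg (F≥0 n) (⊝-nonneg (pointwise ys n)))
          (⊕-nonneg (⊗-nonneg (e₁≥0 y n) (⊝-nonneg (proj₂ (prodAt-In ys gI) n))) (⊗-nonneg (err≥0 ys n) (⊝-nonneg (F≤1 n)))))))
    total-err : ∀ ys → AllClose g F ω ys → E mean (err ys) ≤ nat (List.length ys) ⊗ (s ⊗ ω ⊕ t)
    total-err [] [] = ≡⇒≤ (trans (M.one 0ℚ) (sym (trans (cong (_⊗ (s ⊗ ω ⊕ t)) nat-0) (⊗-zeroˡ _))))
    total-err (y ∷ ys) (c ∷ cs) = ≤-trans (≡⇒≤ (M.add (e₁ y) (err ys))) (≤-trans (⊕-mono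
        (≤-trans (≡⇒≤ (trans (M.add _ _) (cong₂ _⊕_ (M.scl s _) (M.one t)))) (⊕-mono (⊗-monoˡ s 0≤s c) ≤-refl)) (total-err ys cs))
      (≡⇒≤ (sym (trans (cong (_⊗ (s ⊗ ω ⊕ t)) (nat-suc (List.length ys))) (trans (⊗-distribʳ _ 1ℚ _) (cong (_⊕ nat (List.length ys) ⊗ (s ⊗ ω ⊕ t)) (⊗-idˡ _)))))))

  -- Restricting nᵢ to n + (U − w₀) bounds the form from below.
  module Restricted (U : R → Bool) (w₀ : R) (g : Fun) (gI : In[0,1] g) where
    open Periods U (λ _ → ⊤) using ()
    inU : R → ℚ
    inU x = indicator (U (x +ʳ w₀))

    local : ∀ {k} → Vec R k → R → Fun
    local [] n u = g u
    local (α ∷ αs) n u = E mean (λ x → inU x ⊗ (g (n +ʳ x) ⊗ local αs n (u +ʳ α *ʳ (n +ʳ x))))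

    local≥0 : ∀ {k} (αs : Vec R k) n u → 0ℚ ≤ local αs n u
    local≥0 [] n u = proj₁ gI u
    local≥0 (α ∷ αs) n u = M.nonneg (λ x → ⊗-nonneg (indicator-nonneg (U (x +ʳ w₀))) (⊗-nonneg (proj₁ gI (n +ʳ x)) (local≥0 αs n _)))

    local≤form : ∀ {k} (αs : Vec R k) n u → local αs n u ≤ form g αs u
    local≤form [] n u = ≤-refl
    local≤form (α ∷ αs) n u = ≤-trans (M.mono (λ x → ≤-trans (⊗-monoʳ _ (⊗-nonneg (proj₁ gI (n +ʳ x)) (local≥0 αs n _)) (indicator-≤1 (U (x +ʳ w₀))))
        (≤-trans (≡⇒≤ (⊗-idˡ _)) (⊗-monoˡ (g (n +ʳ x)) (proj₁ gI (n +ʳ x)) (local≤form αs n _)))))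
      (≡⇒≤ (trans (M.cng (λ x → cong (λ z → g z ⊗ form g αs (u +ʳ α *ʳ z)) (C.+-comm n x))) (translate n (λ m → g m ⊗ form g αs (u +ʳ α *ʳ m)))))

    -- P k ys y: an invariant of partial configurations with k variables left
    local-lower : ∀ (P : ℕ → List R → R → Set) (Mult : R → Set) ρ b → 0ℚ ≤ b → 0ℚ ≤ ρ → ρ ≤ density mean U →
      (∀ ys y → P 0 ys y → b ≤ E mean (prodAt g (y ∷ ys))) →
      (∀ k ys y α x → Mult α → U (x +ʳ w₀) ≡ true → P (suc k) ys y → P k (x ∷ ys) (y +ʳ α *ʳ x)) →
      ∀ {k} (αs : Vec R k) → (∀ i → Mult (Vec.lookup αs i)) → ∀ c ys y → c +ʳ total αs ≡ 1ʳ → P k ys y →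
      power ρ k ⊗ b ≤ E mean (λ n → prodAt g ys n ⊗ local αs n (y +ʳ c *ʳ n))
    -- The coefficient c collects the multipliers already spent. Once all are spent it is 1, so the
    -- remaining factor is a translate g(n + y) like the others.
    local-lower P Mult ρ b 0≤b 0≤ρ ρ≤ leaf step [] _ c ys y sum p = ≤-trans (≡⇒≤ (⊗-idˡ b)) (≤-trans (leaf ys y p)
      (≡⇒≤ (M.cng (λ n → trans (⊗-comm _ _) (cong (λ z → prodAt g ys n ⊗ g z) (trans (C.+-comm n y) (cong (y +ʳ_) (sym (trans (cong (_*ʳ n) (trans (sym (C.+-identityʳ c)) sum)) (C.*-identityˡ n))))))))))
    local-lower P Mult ρ b 0≤b 0≤ρ ρ≤ leaf step {suc k} (α ∷ αs) ms c ys y sum p =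
      ≤-trans (≤-trans (≡⇒≤ (⊗-assoc ρ (power ρ k) b)) (⊗-monoʳ _ B≥0 ρ≤)) (≤-trans (≡⇒≤ (trans (cong (_⊗ B) (sym (translate w₀ (indicator ∘ U)))) (sym (M.sclʳ B inU))))
        (≤-trans (M.mono each) (≡⇒≤ (sym expand))))
      where
      B : ℚ
      B = power ρ k ⊗ b
      B≥0 : 0ℚ ≤ B
      B≥0 = ⊗-nonneg (power-nonneg k 0≤ρ) 0≤b
      inner : R → ℚ
      inner x = E mean (λ n → prodAt g (x ∷ ys) n ⊗ local αs n ((y +ʳ α *ʳ x) +ʳ (c +ʳ α) *ʳ n))
      arg : ∀ y c n α x → (y +ʳ c *ʳ n) +ʳ α *ʳ (n +ʳ x) ≡ (y +ʳ α *ʳ x) +ʳ (c +ʳ α) *ʳ n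
      arg = solve 5 (λ y c n α x → (y :+ c :* n) :+ α :* (n :+ x) := (y :+ α :* x) :+ (c :+ α) :* n) refl
      opaque
        unfolding _⊕_
        shuffle : ∀ p i g l → p ⊗ (i ⊗ (g ⊗ l)) ≡ i ⊗ ((g ⊗ p) ⊗ l)
        shuffle = solve-∀ ℚ-ring
      expand : E mean (λ n → prodAt g ys n ⊗ local (α ∷ αs) n (y +ʳ c *ʳ n)) ≡ E mean (λ x → inU x ⊗ inner x)
      expand = trans (M.cng (λ n → trans (sym (M.scl (prodAt g ys n) _)) (M.cng (λ x → trans (shuffle _ _ _ _)
          (cong (λ z → inU x ⊗ (prodAt g (x ∷ ys) n ⊗ local αs n z)) (arg y c n α x))))))
        (trans (fubini mean mean _) (M.cng (λ x → M.scl (inU x) _)))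
      each : ∀ x → inU x ⊗ B ≤ inU x ⊗ inner x
      each x = by-cases (U (x +ʳ w₀)) refl
        where
        by-cases : ∀ u → U (x +ʳ w₀) ≡ u → indicator u ⊗ B ≤ indicator u ⊗ inner x
        by-cases false _ = ≡⇒≤ (trans (⊗-zeroˡ B) (sym (⊗-zeroˡ _)))
        by-cases true e = ⊗-monoˡ 1ℚ 0≤1 (local-lower P Mult ρ b 0≤b 0≤ρ ρ≤ leaf step αs (ms ∘ suc) (c +ʳ α) (x ∷ ys) (y +ʳ α *ʳ x)
          (trans (C.+-assoc c α (total αs)) sum) (step k ys y α x (ms zero) e p))

opaque
  -- One set of almost periods has to serve all multipliers. Sampling is repeated for each of them
  -- inside the set found before, and closeness passes to subsets.
  csFamily : ∀ n ε ρ₀ → 0ℚ < ε → 0ℚ < ρ₀ → Σ ℚ λ ρ → 0ℚ < ρ × (∀ {X Y W : Set} (mX : Mean X) (mY : Mean Y) (mW : Mean W) → Picks mY →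
    ∀ (a : Fin n → X → Y → ℚ) → (∀ i x y → 0ℚ ≤ a i x y) → (∀ i x y → a i x y ≤ 1ℚ) → ∀ (b : Fin n → Y → W → Bool) U₀ → ρ₀ ≤ density mW U₀ →
    Σ (W → Bool) λ U → (∀ w → U w ≡ true → U₀ w ≡ true) × ρ ≤ density mW U × (∀ i w w′ → U w ≡ true → U w′ ≡ true →
      E mX (λ x → (E mY (λ y → a i x y ⊗ indicator (b i y w)) ⊝ E mY (λ y → a i x y ⊗ indicator (b i y w′))) ⊗
                  (E mY (λ y → a i x y ⊗ indicator (b i y w)) ⊝ E mY (λ y → a i x y ⊗ indicator (b i y w′)))) ≤ ε))
  csFamily zero ε ρ₀ 0<ε 0<ρ₀ = ρ₀ , 0<ρ₀ , λ mX mY mW pY a a≥0 a≤1 b U₀ d → U₀ , (λ w e → e) , d , λ ()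
  csFamily (suc n) ε ρ₀ 0<ε 0<ρ₀ =
    let cs = crootSisask ε ρ₀ 0<ε 0<ρ₀
        rest = csFamily n ε (proj₁ cs) 0<ε (proj₁ (proj₂ cs))
    in proj₁ rest , proj₁ (proj₂ rest) , λ mX mY mW pY a a≥0 a≤1 b U₀ d →
      let first = proj₂ (proj₂ cs) mX mY mW pY (a zero) (a≥0 zero) (a≤1 zero) (b zero) U₀ d
          module F = AlmostPeriodSet first
          (U , sub , dense , close) = proj₂ (proj₂ rest) mX mY mW pY (a ∘ suc) (a≥0 ∘ suc) (a≤1 ∘ suc) (b ∘ suc) F.U F.dense
      in U , (λ w e → F.U⊆ w (sub w e)) , dense , λ { zero w w′ e e′ → F.close w w′ (sub w e) (sub w′ e′) ; (suc i) → close i }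

positive-witness : ∀ {A : Set} (m : Mean A) → Picks m → ∀ (b : A → Bool) → 0ℚ < E m (indicator ∘ b) → ∃[ a ] b a ≡ true
positive-witness m pk b 0<p with pk (λ a → 1ℚ ⊝ indicator (b a)) (1ℚ ⊝ E m (indicator ∘ b)) (≡⇒≤ (trans (Mean.sub m (λ _ → 1ℚ) _) (cong (_⊝ E m (indicator ∘ b)) (Mean.one m 1ℚ))))
... | a , le = a , go (b a) le
  where
  opaque
    unfolding _⊕_
    l : ∀ p → p ≡ 1ℚ ⊝ (1ℚ ⊝ p)
    l = solve-∀ ℚ-ring
    l₀ : 1ℚ ⊝ (1ℚ ⊝ 0ℚ) ≡ 0ℚ
    l₀ = refl
  go : ∀ u → 1ℚ ⊝ indicator u ≤ 1ℚ ⊝ E m (indicator ∘ b) → u ≡ true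
  go true _ = refl
  go false le = ⊥-elim (ℚP.<-irrefl refl (ℚP.<-≤-trans 0<p (≤-trans (≡⇒≤ (l _)) (≤-trans (⊝-anti ≤-refl le) (≡⇒≤ l₀)))))

indicator-∧ : ∀ a b → indicator a ⊗ indicator b ≡ indicator (a ∧ b)
indicator-∧ true b = ⊗-idˡ _
indicator-∧ false b = ⊗-zeroˡ _

∧-true : ∀ a {b} → a ∧ b ≡ true → a ≡ true × b ≡ true
∧-true true e = refl , e

opaque
  unfolding _⊕_

  roth-t : ∀ p n i → n ⊗ i ≡ 1ℚ → p ⊝ n ⊗ ((p ⊗ inv 3) ⊗ i ⊕ (p ⊗ inv 3) ⊗ i) ≡ p ⊗ inv 1
  roth-t p n i e = trans (l p n i) (trans (cong (λ z → p ⊝ z ⊗ (p ⊗ inv 1)) e) (l′ p))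
    where
    l : ∀ p n i → p ⊝ n ⊗ ((p ⊗ inv 3) ⊗ i ⊕ (p ⊗ inv 3) ⊗ i) ≡ p ⊝ (n ⊗ i) ⊗ (p ⊗ inv 1)
    l = solve-∀ ℚ-ring
    l′ : ∀ p → p ⊝ 1ℚ ⊗ (p ⊗ inv 1) ≡ p ⊗ inv 1
    l′ = solve-∀ ℚ-ring

  roth-ω : ∀ w → 2# ⊗ (w ⊗ inv 15 ⊕ (w ⊗ inv 15 ⊕ w ⊗ inv 15)) ⊕ 2# ⊗ (w ⊗ inv 15) ≡ w ⊗ inv 1
  roth-ω = solve-∀ ℚ-ring

  roth-τ : ∀ p n i → n ⊗ i ≡ 1ℚ → p ⊝ n ⊗ ((p ⊗ inv 1) ⊗ i) ≡ p ⊗ inv 1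
  roth-τ p n i e = trans (l p n i) (trans (cong (λ z → p ⊝ z ⊗ (p ⊗ inv 1)) e) (l′ p))
    where
    l : ∀ p n i → p ⊝ n ⊗ ((p ⊗ inv 1) ⊗ i) ≡ p ⊝ (n ⊗ i) ⊗ (p ⊗ inv 1)
    l = solve-∀ ℚ-ring
    l′ : ∀ p → p ⊝ 1ℚ ⊗ (p ⊗ inv 1) ≡ p ⊗ inv 1
    l′ = solve-∀ ℚ-ring

  regroup-squares : ∀ y e r → (y ⊗ y) ⊗ (e ⊗ (r ⊗ r)) ≡ ((r ⊗ y) ⊗ (r ⊗ y)) ⊗ e
  regroup-squares = solve-∀ ℚ-ring

  absorb-next : ∀ a e → 2# ⊗ (a ⊗ e) ⊕ 2# ⊗ e ≡ (2# ⊗ a ⊕ 2#) ⊗ e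
  absorb-next = solve-∀ ℚ-ring

  factor-square : ∀ y a b → (y ⊗ a ⊝ y ⊗ b) ⊗ (y ⊗ a ⊝ y ⊗ b) ≡ (y ⊗ y) ⊗ ((a ⊝ b) ⊗ (a ⊝ b))
  factor-square = solve-∀ ℚ-ring

  ≤-from-⊝ : ∀ {a b c} → a ≤ b ⊕ c → a ⊝ c ≤ b
  ≤-from-⊝ {a} {b} {c} p = subst (a ⊝ c ≤_) (l b c) (⊝-mono c p)
    where
    l : ∀ b c → (b ⊕ c) ⊝ c ≡ b
    l = solve-∀ ℚ-ring

  zero-square : ∀ x → (x ⊝ x) ⊗ (x ⊝ x) ≡ 0ℚ
  zero-square = solve-∀ ℚ-ring

-- Energy increment over sets of almost periods

module Roth (k : ℕ) (δ₀ : ℚ) (0<δ₀ : 0ℚ < δ₀) where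
  pδ t s ω θ s₂ b₀ : ℚ
  pδ = power δ₀ (3 ℕ.+ k)
  pδ-pos : 0ℚ < pδ
  pδ-pos = power-pos (3 ℕ.+ k) 0<δ₀
  -- This is δ₀^(k+3)/(4(k+3)). As sω = t, replacing k + 3 factors loses (k+3)·2t, half of the main
  -- term δ₀^(k+3).
  t = (pδ ⊗ inv 3) ⊗ inv (2 ℕ.+ k)
  t-pos : 0ℚ < t
  t-pos = ⊗-pos (⊗-pos pδ-pos (inv-pos 3)) (inv-pos (2 ℕ.+ k))
  rt = recip t t-pos
  s = proj₁ rt
  s≥0 : 0ℚ ≤ s
  s≥0 = <⇒≤ (proj₁ (proj₂ rt))
  st≡1 : s ⊗ t ≡ 1ℚ
  st≡1 = trans (⊗-comm s t) (proj₂ (proj₂ rt))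
  ω = t ⊗ t
  ω-pos : 0ℚ < ω
  ω-pos = ⊗-pos t-pos t-pos
  sω≡t : s ⊗ ω ≡ t
  sω≡t = trans (sym (⊗-assoc s t t)) (trans (cong (_⊗ t) st≡1) (⊗-idˡ t))
  θ = ω ⊗ inv 15
  θ-pos : 0ℚ < θ
  θ-pos = ⊗-pos ω-pos (inv-pos 15)
  rθ = recip θ θ-pos
  s₂ = proj₁ rθ
  s₂≥0 : 0ℚ ≤ s₂
  s₂≥0 = <⇒≤ (proj₁ (proj₂ rθ))
  s₂θ≡1 : s₂ ⊗ θ ≡ 1ℚ
  s₂θ≡1 = trans (⊗-comm s₂ θ) (proj₂ (proj₂ rθ))
  b₀ = pδ ⊗ inv 1
  b₀-pos : 0ℚ < b₀
  b₀-pos = ⊗-pos pδ-pos (inv-pos 1)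
  q₁ = small s₂ θ θ-pos
  q₂ = small (absorbConst (2 ℕ.+ k)) θ θ-pos
  q₃ = small (absorbConst 1) θ θ-pos
  q : ℕ
  q = proj₁ q₁ ℕ.+ (proj₁ q₂ ℕ.+ proj₁ q₃)
  ε′ : ℚ
  ε′ = inv q
  ε′≥0 : 0ℚ ≤ ε′
  ε′≥0 = inv-nonneg q
  below₁ : s₂ ⊗ ε′ ≤ θ
  below₁ = ≤-trans (⊗-monoˡ s₂ s₂≥0 (inv-antitone (ℕP.m≤m+n (proj₁ q₁) _))) (proj₂ q₁)
  below₂ : absorbConst (2 ℕ.+ k) ⊗ ε′ ≤ θ
  below₂ = ≤-trans (⊗-monoˡ _ (absorbConst-nonneg (2 ℕ.+ k)) (inv-antitone (ℕP.≤-trans (ℕP.m≤m+n (proj₁ q₂) (proj₁ q₃)) (ℕP.m≤n+m _ (proj₁ q₁))))) (proj₂ q₂)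
  below₃ : absorbConst 1 ⊗ ε′ ≤ θ
  below₃ = ≤-trans (⊗-monoˡ _ (absorbConst-nonneg 1) (inv-antitone (ℕP.≤-trans (ℕP.m≤n+m (proj₁ q₃) (proj₁ q₂)) (ℕP.m≤n+m _ (proj₁ q₁))))) (proj₂ q₃)

  module Setup (K : FinRing) where
    open RingCounting K public

    multipliers : Vec R k → R → R → Vec R (3 ℕ.+ k)
    multipliers αs α₁ α₂ = 1ʳ ∷ α₁ ∷ α₂ ∷ αs

    correlation : (R → Bool) → R → ℚ
    correlation F v = E mean (λ x → indicator (F x) ⊗ indicator (F (x +ʳ v)))

    recipOf : ∀ U → 0ℚ < density mean U → Mean R
    recipOf U pos = let (y , 0<y , e) = recip (density mean U) pos in Periods.ν U (λ _ → ⊤) y (<⇒≤ 0<y) e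

    energyOf : (R → Bool) → ∀ U → 0ℚ < density mean U → ℚ
    energyOf A U pos = N (op (recipOf U pos) (indicator ∘ A))

  Conclusion : (K : FinRing) → Vec (FinRing.R K) k → FinRing.R K → FinRing.R K → (FinRing.R K → Bool) → ℚ → ℚ → Set
  Conclusion K αs α₁ α₂ A c δ₁ = Σ (R → Bool) λ F → δ₁ ≤ density mean F ×
      (∀ v → c ⊗ correlation F v ≤ form (indicator ∘ A) (αs Vec.++ α₁ ∷ α₂ ∷ []) v)
    where open Setup K

  -- The set U plays the part of a box. U′ consists of L² almost periods of f averaged over U, and
  -- U⁺ ⊆ U′ of uniform almost periods of the core form. Either averaging over U⁺ raises the energy
  -- by more than θ, or the two smoothings `g` and `F` of f are close and U′ is the dense set
  -- sought.
  module Stage (ρ : ℚ) (0<ρ : 0ℚ < ρ) where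
    εh : ℚ
    -- Conditioning on U divides by its density, at least ρ; squared errors therefore grow by up to
    -- ρ⁻².
    εh = ε′ ⊗ (ρ ⊗ ρ)
    cs₁ = csFamily (3 ℕ.+ k) εh 1ℚ (⊗-pos (inv-pos q) (⊗-pos 0<ρ 0<ρ)) 0<1
    ρ′ P τ c : ℚ
    ρ′ = proj₁ cs₁
    0<ρ′ : 0ℚ < ρ′
    0<ρ′ = proj₁ (proj₂ cs₁)
    -- Of the k + 2 variables one serves as the common base point n; the other k + 1 are confined to
    -- n + (U′ - w₀), each at the cost of a factor ρ′.
    P = power ρ′ (1 ℕ.+ k) ⊗ b₀
    0<P : 0ℚ < P
    0<P = ⊗-pos (power-pos (1 ℕ.+ k) 0<ρ′) b₀-pos
    -- The total cost (k+3)·τ of smoothing is P/2, which leaves c = P/2.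
    τ = (P ⊗ inv 1) ⊗ inv (2 ℕ.+ k)
    0<τ : 0ℚ < τ
    0<τ = ⊗-pos (⊗-pos 0<P (inv-pos 1)) (inv-pos (2 ℕ.+ k))
    c = P ⊗ inv 1
    0<c : 0ℚ < c
    0<c = ⊗-pos 0<P (inv-pos 1)
    cs₂ = csFamily (3 ℕ.+ k) (τ ⊗ τ) ρ′ (⊗-pos 0<τ 0<τ) 0<ρ′
    ρ⁺ : ℚ
    ρ⁺ = proj₁ cs₂
    0<ρ⁺ : 0ℚ < ρ⁺
    0<ρ⁺ = proj₁ (proj₂ cs₂)

    module Within (K : FinRing) (αs : Vec (FinRing.R K) k) (α₁ α₂ : FinRing.R K) (unit₁ : RingAverages.Unit K α₁) (unit₂ : RingAverages.Unit K α₂)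
                  (sum≡1 : RingAverages.total K (αs Vec.++ α₁ ∷ α₂ ∷ []) ≡ FinRing.1ʳ K)
                  (A : FinRing.R K → Bool) (δ≤A : δ₀ ≤ density (FinRing.mean K) A)
                  (U : FinRing.R K → Bool) (ρ≤U : ρ ≤ density (FinRing.mean K) U) where
      open Setup K
      private
        module M = Mean mean
        module C = IsCommutativeRing isCR

      pos : 0ℚ < density mean U
      pos = ℚP.<-≤-trans 0<ρ ρ≤U
      rU = recip (density mean U) pos
      y : ℚ
      y = proj₁ rU
      y≥0 : 0ℚ ≤ y
      y≥0 = <⇒≤ (proj₁ (proj₂ rU))
      f : Fun
      f = indicator ∘ A
      fI : In[0,1] f
      fI = In-indicator A
      ν : Mean R
      ν = recipOf U pos
      h F : Fun
      h = op ν f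
      F = op (gram ν) f

      Mult : R → Set
      Mult β = ∃[ i ] β ≡ Vec.lookup (multipliers αs α₁ α₂) i

      h-eq : ∀ β n w → h (n +ʳ β *ʳ w) ≡ y ⊗ E mean (λ x → f (n +ʳ x) ⊗ indicator (U (x -ʳ β *ʳ w)))
      h-eq β n w = trans (E-conditional mean U y y≥0 (proj₂ (proj₂ rU)) (λ x → f ((n +ʳ β *ʳ w) +ʳ x))) (cong (y ⊗_)
        (trans (sym (translate (-ʳ (β *ʳ w)) _)) (M.cng (λ x → trans (⊗-comm _ _) (cong (λ z → f z ⊗ indicator (U (x -ʳ β *ʳ w))) (r n (β *ʳ w) x))))))
        where
        r : ∀ n b x → (n +ʳ b) +ʳ (x -ʳ b) ≡ n +ʳ x
        r = solve 3 (λ n b x → (n :+ b) :+ (x :+ :- b) := n :+ x) refl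

      everything : R → Bool
      everything _ = true
      hSet = proj₂ (proj₂ cs₁) mean mean mean picks (λ _ n x → f (n +ʳ x)) (λ _ n x → proj₁ fI (n +ʳ x)) (λ _ n x → proj₂ fI (n +ʳ x))
        (λ i x w → U (x -ʳ Vec.lookup (multipliers αs α₁ α₂) i *ʳ w)) everything (≡⇒≤ (sym (M.one 1ℚ)))
      U′ : R → Bool
      U′ = proj₁ hSet
      ρ′≤U′ : ρ′ ≤ density mean U′
      ρ′≤U′ = proj₁ (proj₂ (proj₂ hSet))

      h-close : ∀ β → Mult β → ∀ w w′ → U′ w ≡ true → U′ w′ ≡ true → E mean (λ n → square (h (n +ʳ β *ʳ w) ⊝ h (n +ʳ β *ʳ w′))) ≤ ε′
      h-close β (i , refl) w w′ e e′ = ≤-trans (≡⇒≤ (trans (M.cng (λ n → trans (cong₂ (λ a b → square (a ⊝ b)) (h-eq β n w) (h-eq β n w′)) (factor-square y _ _))) (M.scl (y ⊗ y) _)))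
        (≤-trans (⊗-monoˡ (y ⊗ y) (square-nonneg y) (proj₂ (proj₂ (proj₂ hSet)) i w w′ e e′)) (≤-trans (≡⇒≤ (regroup-squares y ε′ ρ))
          (≤-trans (⊗-monoʳ ε′ ε′≥0 (≤-trans (⊗-mono ρy≥0 0≤1 ρy≤1 ρy≤1) (≡⇒≤ (⊗-idˡ 1ℚ)))) (≡⇒≤ (⊗-idˡ ε′)))))
        where
        ρy≥0 : 0ℚ ≤ ρ ⊗ y
        ρy≥0 = ⊗-nonneg (<⇒≤ 0<ρ) y≥0
        ρy≤1 : ρ ⊗ y ≤ 1ℚ
        ρy≤1 = ≤-trans (⊗-monoʳ y y≥0 ρ≤U) (≡⇒≤ (proj₂ (proj₂ rU)))

      shiftF : R → Fun
      shiftF z n = F (n +ʳ z)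

      -- `F` arises from `h` by averaging along the reflected law of U. This contracts, so the
      -- almost periods of `h` are inherited.
      F-close : ∀ β → Mult β → ∀ w w′ → U′ w ≡ true → U′ w′ ≡ true → N (shiftF (β *ʳ (w -ʳ w′)) -ᶠ F) ≤ ε′
      F-close β mβ w w′ e e′ = ≤-trans (≡⇒≤ (N-cong eq)) (≤-trans (op-contract (push -ʳ_ ν) (λ n → h (n +ʳ z) ⊝ h n))
          (≤-trans (≡⇒≤ (trans (sym (translate (β *ʳ w′) (λ n → square (h (n +ʳ z) ⊝ h n)))) (M.cng (λ n → cong (λ a → square (h a ⊝ h (n +ʳ β *ʳ w′))) (r n β w w′))))) (h-close β mβ w w′ e e′)))
        where
        z : R
        z = β *ʳ (w -ʳ w′)
        r : ∀ n β w w′ → (n +ʳ β *ʳ w′) +ʳ β *ʳ (w -ʳ w′) ≡ n +ʳ β *ʳ w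
        r = solve 4 (λ n β w w′ → (n :+ β :* w′) :+ β :* (w :+ :- w′) := n :+ β :* w) refl
        eq : ∀ n → F (n +ʳ z) ⊝ F n ≡ op (push -ʳ_ ν) (λ n → h (n +ʳ z) ⊝ h n) n
        eq n = trans (cong₂ _⊝_ (trans (op-gram ν f (n +ʳ z)) (Mean.cng ν (λ u → cong h (swap-summand n z (-ʳ u))))) (op-gram ν f n))
          (sym (Mean.sub (push -ʳ_ ν) (λ u → h ((n +ʳ u) +ʳ z)) (λ u → h (n +ʳ u))))

      α₁′ α₂′ : R
      α₁′ = proj₁ unit₁
      α₂′ = proj₁ unit₂
      ΨSet = proj₂ (proj₂ cs₂) mean mean mean picks (λ _ → kernel A α₁ α₂) (λ _ n m → proj₁ fI _) (λ _ n m → proj₂ fI _)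
        (λ i → bit A α₂′ (Vec.lookup (multipliers αs α₁ α₂) i)) U′ ρ′≤U′
      U⁺ : R → Bool
      U⁺ = proj₁ ΨSet
      U⁺⊆ : ∀ w → U⁺ w ≡ true → U′ w ≡ true
      U⁺⊆ = proj₁ (proj₂ ΨSet)
      ρ⁺≤U⁺ : ρ⁺ ≤ density mean U⁺
      ρ⁺≤U⁺ = proj₁ (proj₂ (proj₂ ΨSet))
      pos⁺ : 0ℚ < density mean U⁺
      pos⁺ = ℚP.<-≤-trans 0<ρ⁺ ρ⁺≤U⁺

      base-periods : Periods.AP U⁺ Mult (form f (α₁ ∷ α₂ ∷ [])) τ
      base-periods = periods-of-pair U⁺ Mult A α₁ α₁′ α₂ τ (proj₂ unit₁) (<⇒≤ 0<τ) (λ { β (i , refl) w w′ e e′ →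
        ≤-trans (≡⇒≤ (M.cng (λ n → sym (cong₂ (λ a b → square (a ⊝ b)) (kernel-conv A α₁ α₂ α₂′ β n w (proj₂ unit₂)) (kernel-conv A α₁ α₂ α₂′ β n w′ (proj₂ unit₂))))))
          (proj₂ (proj₂ (proj₂ ΨSet)) i w w′ e e′) })

      ν⁺ : Mean R
      ν⁺ = recipOf U⁺ pos⁺
      g : Fun
      g = op (gram ν⁺) f
      gI : In[0,1] g
      gI = (λ n → Mean.nonneg (gram ν⁺) (λ u → proj₁ fI (n +ʳ u))) , (λ n → Mean.bound (gram ν⁺) (λ u → proj₂ fI (n +ʳ u)))
      FI : In[0,1] F
      FI = (λ n → Mean.nonneg (gram ν) (λ u → proj₁ fI (n +ʳ u))) , (λ n → Mean.bound (gram ν) (λ u → proj₂ fI (n +ʳ u)))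

      lookup-++ : ∀ i → Mult (Vec.lookup (αs Vec.++ α₁ ∷ α₂ ∷ []) i)
      lookup-++ i = go αs (λ j → suc (suc (suc j)) , refl) i
        where
        go : ∀ {j} (βs : Vec R j) → (∀ l → Mult (Vec.lookup βs l)) → ∀ i → Mult (Vec.lookup (βs Vec.++ α₁ ∷ α₂ ∷ []) i)
        go [] h zero = suc zero , refl
        go [] h (suc zero) = suc (suc zero) , refl
        go (β ∷ βs) h zero = h zero
        go (β ∷ βs) h (suc i) = go βs (h ∘ suc) i

      smoothing : ∀ v → form g (αs Vec.++ α₁ ∷ α₂ ∷ []) v ≤ form f (αs Vec.++ α₁ ∷ α₂ ∷ []) v ⊕ nat (3 ℕ.+ k) ⊗ τ
      smoothing = Periods.smooth-form U⁺ Mult (proj₁ r⁺) (<⇒≤ (proj₁ (proj₂ r⁺))) (proj₂ (proj₂ r⁺)) f fI τ (<⇒≤ 0<τ) αs α₁ α₂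
          (λ i → suc (suc (suc i)) , refl) (zero , refl) (suc zero , refl) (suc (suc zero) , refl) base-periods
        where r⁺ = recip (density mean U⁺) pos⁺

      Nf≤1 : N f ≤ 1ℚ
      Nf≤1 = M.bound (λ n → ≤-trans (⊗-mono (proj₁ fI n) 0≤1 (proj₂ fI n) (proj₂ fI n)) (≡⇒≤ (⊗-idʳ 1ℚ)))

      -- The function is an average of F - F(· + w - w′) over w, w′ in U⁺ ⊆ U′. This is the
      -- absorption hypothesis of `energy-close`.
      absorbed : N (op (gram ν) (f -ᶠ g)) ≤ ε′
      absorbed = ≤-trans (≡⇒≤ (N-cong eq)) (≤-trans (N-avg D⁺ (λ s′ n → E D⁺ (λ s → F n ⊝ F (n +ʳ (proj₁ s -ʳ proj₁ s′)))))
          (Mean.bound D⁺ (λ s′ → N-avg-bound D⁺ (λ s n → F n ⊝ F (n +ʳ (proj₁ s -ʳ proj₁ s′))) (λ s →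
            ≤-trans (≡⇒≤ (trans (N-flip F (shiftF (proj₁ s -ʳ proj₁ s′))) (N-cong (λ n → cong (λ z → F (n +ʳ z) ⊝ F n) (sym (C.*-identityˡ _))))))
              (F-close 1ʳ (zero , refl) (proj₁ s) (proj₁ s′) (U⁺⊆ _ (proj₂ s)) (U⁺⊆ _ (proj₂ s′)))))))
        where
        r⁺ = recip (density mean U⁺) pos⁺
        D⁺ = conditional mean U⁺ (proj₁ r⁺) (<⇒≤ (proj₁ (proj₂ r⁺))) (proj₂ (proj₂ r⁺))
        eq : ∀ n → op (gram ν) (f -ᶠ g) n ≡ E D⁺ (λ s′ → E D⁺ (λ s → F n ⊝ F (n +ʳ (proj₁ s -ʳ proj₁ s′))))
        eq n = trans (op-- (gram ν) f g n) (trans (cong (F n ⊝_) (op-comm (gram ν) (gram ν⁺) f n))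
          (trans (cong (_⊝ op (gram ν⁺) F n) (sym (Mean.one (gram ν⁺) (F n)))) (sym (Mean.sub (gram ν⁺) (λ _ → F n) (λ u → F (n +ʳ u))))))

      module Stop (gap : energyOf A U⁺ pos⁺ ≤ energyOf A U pos ⊕ θ) where
        g-near-F : N (g -ᶠ F) ≤ θ ⊕ (θ ⊕ θ)
        g-near-F = ≤-trans (energy-close ν ν⁺ f s₂ θ ε′ Nf≤1 s₂≥0 s₂θ≡1 (<⇒≤ θ-pos) absorbed) (⊕-mono (⊝-≤ gap) (⊕-mono below₁ ≤-refl))

        close-of : ∀ z → N (shiftF z -ᶠ F) ≤ θ → Close g F ω z
        close-of z le = ≤-trans (N-tri (λ n → g (n +ʳ z)) (shiftF z) F (≤-trans (≡⇒≤ (translate z (λ n → square (g n ⊝ F n)))) g-near-F) le)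
          (≤-trans (≡⇒≤ (roth-ω ω)) (≤-trans (⊗-monoˡ ω (<⇒≤ ω-pos) (inv-≤1 1)) (≡⇒≤ (⊗-idʳ ω))))

        Near : ℕ → R → Set
        Near i z = N (shiftF z -ᶠ F) ≤ absorbConst i ⊗ ε′

        near-step : ∀ i z α w w′ → Mult α → U′ w ≡ true → U′ w′ ≡ true → Near i z → Near (suc i) (z +ʳ α *ʳ (w -ʳ w′))
        near-step i z α w w′ mα e e′ near = ≤-trans (N-tri (shiftF (z +ʳ a)) (shiftF a) F
            (≤-trans (≡⇒≤ (trans (N-cong (λ n → cong (λ u → F u ⊝ F (n +ʳ a)) (r n z a))) (translate a (λ n → square (F (n +ʳ z) ⊝ F n))))) near)
            (F-close α mα w w′ e e′)) (≡⇒≤ (absorb-next (absorbConst i) ε′))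
          where
          a : R
          a = α *ʳ (w -ʳ w′)
          r : ∀ n z a → n +ʳ (z +ʳ a) ≡ (n +ʳ a) +ʳ z
          r = solve 3 (λ n z a → n :+ (z :+ a) := (n :+ a) :+ z) refl

        near-0 : Near 0 0ʳ
        near-0 = ≤-trans (≡⇒≤ (trans (M.cng (λ n → trans (cong (λ u → square (F u ⊝ F n)) (C.+-identityʳ n)) (zero-square (F n)))) (M.one 0ℚ))) (⊗-nonneg ≤-refl ε′≥0)

        single : ∀ α w w′ → Mult α → U′ w ≡ true → U′ w′ ≡ true → Near 1 (α *ʳ (w -ʳ w′))
        single α w w′ mα e e′ = subst (Near 1) (C.+-identityˡ _) (near-step 0 0ʳ α w w′ mα e e′ near-0)

        mean-F : E mean F ≡ density mean A
        mean-F = trans (fubini mean (gram ν) (λ n u → f (n +ʳ u))) (trans (Mean.cng (gram ν) (λ u → translate u f)) (Mean.one (gram ν) _))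

        -- State with j variables still to be placed: `ys` are the offsets already placed, all
        -- L²-close, and `z` is the offset of the solved variable, reached from 0 by i elementary
        -- displacements. The initial displacement v counts as one of them.
        Partial : ℕ → List R → R → Set
        Partial j ys z = Σ ℕ λ i → i ℕ.+ j ≡ 2 ℕ.+ k × List.length ys ℕ.+ j ≡ 2 ℕ.+ k × AllClose g F ω ys × Near i z

        leaf : ∀ ys z → Partial 0 ys z → b₀ ≤ E mean (prodAt g (z ∷ ys))
        leaf ys z (i , i+j , len , closes , near) = ≤-trans (≡⇒≤ (sym b₀-eq)) (≤-trans (⊝-anti main-term error-term) counted)
          where
          len′ : List.length (z ∷ ys) ≡ 3 ℕ.+ k
          len′ = cong suc (trans (sym (ℕP.+-identityʳ _)) len)
          b₀-eq : pδ ⊝ nat (3 ℕ.+ k) ⊗ (t ⊕ t) ≡ b₀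
          b₀-eq = roth-t pδ (nat (3 ℕ.+ k)) (inv (2 ℕ.+ k)) (nat-inv (2 ℕ.+ k))
          main-term : pδ ≤ E mean (λ n → power (F n) (List.length (z ∷ ys)))
          main-term = ≤-trans (power-mono (3 ℕ.+ k) (<⇒≤ 0<δ₀) (≤-trans δ≤A (≡⇒≤ (sym mean-F)))) (≤-trans (power-mean mean F (2 ℕ.+ k) (proj₁ FI))
              (≡⇒≤ (cong (λ l → E mean (λ n → power (F n) l)) (sym len′))))
          error-term : nat (List.length (z ∷ ys)) ⊗ (s ⊗ ω ⊕ t) ≤ nat (3 ℕ.+ k) ⊗ (t ⊕ t)
          error-term = ≡⇒≤ (cong₂ (λ l a → nat l ⊗ (a ⊕ t)) len′ sω≡t)
          z-close : Close g F ω z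
          z-close = close-of z (≤-trans (subst (λ i → Near i z) (trans (sym (ℕP.+-identityʳ i)) i+j) near) below₂)
          counted : E mean (λ n → power (F n) (List.length (z ∷ ys))) ⊝ nat (List.length (z ∷ ys)) ⊗ (s ⊗ ω ⊕ t) ≤ E mean (prodAt g (z ∷ ys))
          counted = product-lower g F s t ω gI FI s≥0 (<⇒≤ t-pos) st≡1 (z ∷ ys) (z-close ∷ closes)

        module At (v w w′ : R) (v≡ : v ≡ w -ʳ w′) (e : U′ w ≡ true) (e′ : U′ w′ ≡ true) where
          -- Taking w′ itself as the base makes every admissible x a difference (x + w′) - w′ of
          -- elements of U′, hence an almost period.
          open Restricted U′ w′ g gI

          step : ∀ j ys z α x → Mult α → U′ (x +ʳ w′) ≡ true → Partial (suc j) ys z → Partial j (x ∷ ys) (z +ʳ α *ʳ x)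
          step j ys z α x mα ex (i , i+j , len , closes , near) = suc i , trans (sym (ℕP.+-suc i j)) i+j , trans (sym (ℕP.+-suc _ j)) len ,
            (close-of x (≤-trans (subst (Near 1) (trans (C.*-identityˡ _) (r x w′)) (single 1ʳ (x +ʳ w′) w′ (zero , refl) ex e′)) below₃) ∷ closes) ,
            subst (λ a → Near (suc i) (z +ʳ α *ʳ a)) (r x w′) (near-step i z α (x +ʳ w′) w′ mα ex e′ near)
            where
            r : ∀ x a → (x +ʳ a) -ʳ a ≡ x
            r = solve 2 (λ x a → (x :+ a) :+ :- a := x) refl

          start : Partial (1 ℕ.+ k) (0ʳ ∷ []) v
          start = 1 , refl , refl , (close-of 0ʳ (≤-trans near-0 (≤-trans (≡⇒≤ (⊗-zeroˡ ε′)) (<⇒≤ θ-pos))) ∷ []) ,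
            subst (Near 1) (trans (C.*-identityˡ _) (sym v≡)) (single 1ʳ w w′ (zero , refl) e e′)

          lower : ∀ (βs : Vec R (2 ℕ.+ k)) → (∀ i → Mult (Vec.lookup βs i)) → total βs ≡ 1ʳ → P ≤ form g βs v
          lower (α ∷ βs) ms sum = ≤-trans (local-lower Partial Mult ρ′ b₀ (<⇒≤ b₀-pos) (<⇒≤ 0<ρ′) ρ′≤U′ leaf step βs (ms ∘ suc) α (0ʳ ∷ []) v sum start)
            (M.mono (λ n → ≤-trans (≡⇒≤ (cong (_⊗ local βs n (v +ʳ α *ʳ n)) (trans (⊗-idʳ _) (cong g (C.+-identityʳ n))))) (⊗-monoˡ (g n) (proj₁ gI n) (local≤form βs n _))))

          bound : c ≤ form f (αs Vec.++ α₁ ∷ α₂ ∷ []) v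
          bound = ≤-trans (≡⇒≤ (sym (roth-τ P (nat (3 ℕ.+ k)) (inv (2 ℕ.+ k)) (nat-inv (2 ℕ.+ k))))) (≤-trans (⊝-mono _ (counted (ℕP.+-comm k 2) (αs Vec.++ α₁ ∷ α₂ ∷ []) lookup-++ sum≡1)) (≤-from-⊝ (smoothing v)))
            where
            counted : ∀ {l} → l ≡ 2 ℕ.+ k → (βs : Vec R l) → (∀ i → Mult (Vec.lookup βs i)) → total βs ≡ 1ʳ → P ≤ form g βs v
            counted refl = lower

        -- A positive correlation exhibits v as a difference of two elements of U′, where the form
        -- is at least c; correlations never exceed 1, and for the other v the left side is at most
        -- 0.
        conclusion : Conclusion K αs α₁ α₂ A c ρ′
        conclusion = U′ , ρ′≤U′ , at
          where
          at : ∀ v → c ⊗ correlation U′ v ≤ form f (αs Vec.++ α₁ ∷ α₂ ∷ []) v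
          at v = either (correlation U′ v ℚ.≤? 0ℚ)
            (λ p → ≤-trans (⊗-monoˡ c (<⇒≤ 0<c) p) (≤-trans (≡⇒≤ (⊗-zeroʳ c)) (proj₁ (In-form (αs Vec.++ α₁ ∷ α₂ ∷ []) fI) v)))
            (λ ¬p → ≤-trans (⊗-monoˡ c (<⇒≤ 0<c) (M.bound (λ x → ≤-trans (⊗-mono (indicator-nonneg (U′ x)) 0≤1 (indicator-≤1 (U′ x)) (indicator-≤1 (U′ (x +ʳ v)))) (≡⇒≤ (⊗-idʳ 1ℚ)))))
              (≤-trans (≡⇒≤ (⊗-idʳ c)) (popular ¬p)))
            where
            r : ∀ v x → v ≡ (x +ʳ v) -ʳ x
            r = solve 2 (λ v x → v := (x :+ v) :+ :- x) refl
            popular : ¬ (correlation U′ v ≤ 0ℚ) → c ≤ form f (αs Vec.++ α₁ ∷ α₂ ∷ []) v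
            popular ¬p = At.bound v (x +ʳ v) x (r v x) (proj₂ both) (proj₁ both)
              where
              wit : ∃[ x ] (U′ x ∧ U′ (x +ʳ v) ≡ true)
              wit = positive-witness mean picks (λ x → U′ x ∧ U′ (x +ʳ v)) (subst (0ℚ <_) (M.cng (λ x → indicator-∧ (U′ x) (U′ (x +ʳ v)))) (ℚP.≰⇒> ¬p))
              x : R
              x = proj₁ wit
              both : U′ x ≡ true × U′ (x +ʳ v) ≡ true
              both = ∧-true (U′ x) (proj₂ wit)

  RothFrom : ℕ → (ρ : ℚ) → 0ℚ < ρ → Set₁
  RothFrom j ρ 0<ρ = Σ ℚ λ c → Σ ℚ λ δ₁ → 0ℚ < c × 0ℚ < δ₁ × (∀ K αs α₁ α₂ → RingAverages.Unit K α₁ → RingAverages.Unit K α₂ →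
    RingAverages.total K (αs Vec.++ α₁ ∷ α₂ ∷ []) ≡ FinRing.1ʳ K → ∀ A → δ₀ ≤ density (FinRing.mean K) A → ∀ U (ρ≤U : ρ ≤ density (FinRing.mean K) U) →
    1ℚ ≤ Setup.energyOf K A U (ℚP.<-≤-trans 0<ρ ρ≤U) ⊕ nat j ⊗ θ → Conclusion K αs α₁ α₂ A c δ₁)

  -- as for `chain`: the energy increases by θ at each stage that does not conclude
  rothChain : ∀ j ρ 0<ρ → RothFrom j ρ 0<ρ
  rothChain zero ρ 0<ρ = S.c , S.ρ′ , S.0<c , S.0<ρ′ , λ K αs α₁ α₂ u₁ u₂ sum A δ≤A U ρ≤U en →
      let module W = S.Within K αs α₁ α₂ u₁ u₂ sum A δ≤A U ρ≤U in
      W.Stop.conclusion (≤-trans (≤-trans (RingAverages.op-contract K W.ν⁺ W.f) W.Nf≤1) (≤-trans en (⊕-mono ≤-refl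
        (≤-trans (≡⇒≤ (trans (cong (_⊗ θ) nat-0) (⊗-zeroˡ θ))) (<⇒≤ θ-pos)))))
    where module S = Stage ρ 0<ρ
  rothChain (suc j) ρ 0<ρ = S.c ℚ.⊓ c₁ , S.ρ′ ℚ.⊓ δ₁ , ⊓-pos S.0<c (proj₁ (proj₂ (proj₂ rest))) , ⊓-pos S.0<ρ′ (proj₁ (proj₂ (proj₂ (proj₂ rest)))) ,
      λ K αs α₁ α₂ u₁ u₂ sum A δ≤A U ρ≤U en → go K αs α₁ α₂ u₁ u₂ sum A δ≤A U ρ≤U en
    where
    module S = Stage ρ 0<ρ
    rest = rothChain j S.ρ⁺ S.0<ρ⁺
    c₁ = proj₁ rest
    δ₁ = proj₁ (proj₂ rest)
    ⊓-pos : ∀ {a b} → 0ℚ < a → 0ℚ < b → 0ℚ < a ℚ.⊓ b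
    ⊓-pos {a} {b} p q with ℚP.⊓-sel a b
    ... | inj₁ e = subst (0ℚ <_) (sym e) p
    ... | inj₂ e = subst (0ℚ <_) (sym e) q
    module _ (K : FinRing) (αs : Vec (FinRing.R K) k) (α₁ α₂ : FinRing.R K) (u₁ : RingAverages.Unit K α₁) (u₂ : RingAverages.Unit K α₂)
             (sum : RingAverages.total K (αs Vec.++ α₁ ∷ α₂ ∷ []) ≡ FinRing.1ʳ K) (A : FinRing.R K → Bool) (δ≤A : δ₀ ≤ density (FinRing.mean K) A)
             (U : FinRing.R K → Bool) (ρ≤U : ρ ≤ density (FinRing.mean K) U) where
      open Setup K
      module W = S.Within K αs α₁ α₂ u₁ u₂ sum A δ≤A U ρ≤U
      weaken : ∀ {c c′ δ δ′} → c′ ≤ c → δ′ ≤ δ → Conclusion K αs α₁ α₂ A c δ → Conclusion K αs α₁ α₂ A c′ δ′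
      weaken c≤ δ≤ (F , d , h) = F , ≤-trans δ≤ d , λ v → ≤-trans (⊗-monoʳ (correlation F v) (Mean.nonneg mean (λ x → ⊗-nonneg (indicator-nonneg (F x)) (indicator-nonneg (F (x +ʳ v))))) c≤) (h v)
      go : 1ℚ ≤ energyOf A U W.pos ⊕ nat (suc j) ⊗ θ → Conclusion K αs α₁ α₂ A (S.c ℚ.⊓ c₁) (S.ρ′ ℚ.⊓ δ₁)
      go en = either (energyOf A W.U⁺ W.pos⁺ ℚ.≤? (energyOf A U W.pos ⊕ θ))
        (λ gap → weaken (ℚP.p⊓q≤p S.c c₁) (ℚP.p⊓q≤p S.ρ′ δ₁) (W.Stop.conclusion gap))
        (λ ¬gap → weaken (ℚP.p⊓q≤q S.c c₁) (ℚP.p⊓q≤q S.ρ′ δ₁)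
              (proj₂ (proj₂ (proj₂ (proj₂ rest))) K αs α₁ α₂ u₁ u₂ sum A δ≤A W.U⁺ W.ρ⁺≤U⁺ (energy′ ¬gap)))
        where
        a = energyOf A U W.pos
        energy′ : ¬ (energyOf A W.U⁺ W.pos⁺ ≤ a ⊕ θ) → 1ℚ ≤ energyOf A W.U⁺ W.pos⁺ ⊕ nat j ⊗ θ
        energy′ ¬gap = ≤-trans en (≤-trans (≡⇒≤ (trans (cong (λ z → a ⊕ z ⊗ θ) (nat-suc j)) (trans (cong (a ⊕_) (trans (⊗-distribʳ θ 1ℚ (nat j)) (cong (_⊕ nat j ⊗ θ) (⊗-idˡ θ)))) (sym (⊕-assoc a θ (nat j ⊗ θ))))))
            (⊕-mono (<⇒≤ (ℚP.≰⇒> ¬gap)) ≤-refl))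

-- Dense sets in finite rings contain, for v in a popular difference set, many solutions of n₀ = v + Σ αᵢnᵢ (Σ αᵢ = 1).
rothRing : ∀ k δ₀ (0<δ₀ : 0ℚ < δ₀) → Σ ℚ λ c → Σ ℚ λ δ₁ → 0ℚ < c × 0ℚ < δ₁ × (∀ K αs α₁ α₂ → RingAverages.Unit K α₁ → RingAverages.Unit K α₂ →
    RingAverages.total K (αs Vec.++ α₁ ∷ α₂ ∷ []) ≡ FinRing.1ʳ K → ∀ A → δ₀ ≤ density (FinRing.mean K) A → Roth.Conclusion k δ₀ 0<δ₀ K αs α₁ α₂ A c δ₁)
rothRing k δ₀ 0<δ₀ = proj₁ ch , proj₁ (proj₂ ch) , proj₁ (proj₂ (proj₂ ch)) , proj₁ (proj₂ (proj₂ (proj₂ ch))) ,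
  λ K αs α₁ α₂ u₁ u₂ sum A δ≤A → proj₂ (proj₂ (proj₂ (proj₂ ch))) K αs α₁ α₂ u₁ u₂ sum A δ≤A (λ _ → true) (≡⇒≤ (sym (Mean.one (FinRing.mean K) 1ℚ)))
    (≤-trans enough (≤-⊕ˡ (RingAverages.N-nonneg K _)))
  where
  open Roth k δ₀ 0<δ₀
  ar = archimedean s₂
  j = proj₁ ar
  ch = rothChain j 1ℚ 0<1
  enough : 1ℚ ≤ nat j ⊗ θ
  enough = ≤-trans (≡⇒≤ (sym s₂θ≡1)) (⊗-monoʳ θ (<⇒≤ θ-pos) (proj₂ ar))

-- Selections of variables and colourings

module _ (K : FinRing) where
  open RingCounting K
  private module M = Mean mean

  lastTwo : ∀ {k} → Vec R (2 ℕ.+ k) → Vec R k × R × R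
  lastTwo {zero} (a ∷ b ∷ []) = [] , a , b
  lastTwo {suc k} (x ∷ xs) = let ys , a , b = lastTwo xs in x ∷ ys , a , b

  rejoin : ∀ {k} → Vec R (2 ℕ.+ k) → Vec R (k ℕ.+ 2)
  rejoin xs = let ys , a , b = lastTwo xs in ys Vec.++ a ∷ b ∷ []

  form-rejoin : ∀ {k} g (xs : Vec R (2 ℕ.+ k)) v → form g (rejoin xs) v ≡ form g xs v
  form-rejoin {zero} g (a ∷ b ∷ []) v = refl
  form-rejoin {suc k} g (x ∷ xs) v = M.cng (λ n → cong (g n ⊗_) (form-rejoin g xs (v +ʳ x *ʳ n)))

  total-rejoin : ∀ {k} (xs : Vec R (2 ℕ.+ k)) → total (rejoin xs) ≡ total xs
  total-rejoin {zero} (a ∷ b ∷ []) = refl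
  total-rejoin {suc k} (x ∷ xs) = cong (x +ʳ_) (total-rejoin xs)

  lastTwo-all : ∀ {k} (P : R → Set) (xs : Vec R (2 ℕ.+ k)) → All P xs → P (proj₁ (proj₂ (lastTwo xs))) × P (proj₂ (proj₂ (lastTwo xs)))
  lastTwo-all {zero} P (a ∷ b ∷ []) (pa ∷ pb ∷ []) = pa , pb
  lastTwo-all {suc k} P (x ∷ xs) (_ ∷ ps) = lastTwo-all P xs ps

  corr : (R → Bool) → R → ℚ
  corr F v = E mean (λ x → indicator (F x) ⊗ indicator (F (x +ʳ v)))

  corr-In : ∀ F → In[0,1] (corr F)
  corr-In F = (λ v → M.nonneg (λ x → ⊗-nonneg (indicator-nonneg (F x)) (indicator-nonneg (F (x +ʳ v))))) ,
    (λ v → M.bound (λ x → ≤-trans (⊗-mono (indicator-nonneg (F x)) 0≤1 (indicator-≤1 (F x)) (indicator-≤1 (F (x +ʳ v)))) (≡⇒≤ (⊗-idʳ 1ℚ))))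

Popular : (k : ℕ) (c δ₁ δ₀ : ℚ) → Set₁
Popular k c δ₁ δ₀ = ∀ K (αs : Vec (FinRing.R K) (suc k)) → All (RingAverages.Unit K) αs → RingAverages.total K αs ≡ FinRing.1ʳ K →
  ∀ A → δ₀ ≤ density (FinRing.mean K) A → Σ (FinRing.R K → Bool) λ F → δ₁ ≤ density (FinRing.mean K) F ×
    (∀ v → c ⊗ corr K F v ≤ RingAverages.form K (indicator ∘ A) αs v)

popular : ∀ k δ₀ → 0ℚ < δ₀ → Σ ℚ λ c → Σ ℚ λ δ₁ → 0ℚ < c × 0ℚ < δ₁ × Popular k c δ₁ δ₀
-- With a single variable the multiplier is 1, so the form is the correlation of A itself.
popular zero δ₀ 0<δ₀ = 1ℚ , δ₀ , 0<1 , 0<δ₀ , λ { K (α ∷ []) _ sum A δ≤A → A , δ≤A , λ v →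
  ≡⇒≤ (trans (⊗-idˡ _) (Mean.cng (FinRing.mean K) (λ x → cong (λ z → indicator (A x) ⊗ indicator (A z)) (arg K α x v sum)))) }
  where
  arg : ∀ K α x v → RingAverages.total K (α ∷ []) ≡ FinRing.1ʳ K → FinRing._+ʳ_ K x v ≡ FinRing._+ʳ_ K v (FinRing._*ʳ_ K α x)
  arg K α x v sum = trans (C.+-comm x v) (cong (v +ʳ_) (sym (trans (cong (_*ʳ x) (trans (sym (C.+-identityʳ α)) sum)) (C.*-identityˡ x))))
    where
    open FinRing K
    module C = IsCommutativeRing isCR
popular (suc k) δ₀ 0<δ₀ = proj₁ rr , proj₁ (proj₂ rr) , proj₁ (proj₂ (proj₂ rr)) , proj₁ (proj₂ (proj₂ (proj₂ rr))) , λ K αs units sum A δ≤A →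
    let ys , a , b = lastTwo K αs
        ua , ub = lastTwo-all K (RingAverages.Unit K) αs units
        F , dense , h = proj₂ (proj₂ (proj₂ (proj₂ rr))) K ys a b ua ub (trans (total-rejoin K αs) sum) A δ≤A
    in F , dense , λ v → ≤-trans (h v) (≡⇒≤ (form-rejoin K (indicator ∘ A) αs v))
  where rr = rothRing k δ₀ 0<δ₀

-- Order-preserving choices of t positions among m, encoded as data so that vectors, homomorphisms
-- and product averages restrict along them by recursion.
data Sel : ℕ → ℕ → Set where
  done : Sel 0 0
  skip : ∀ {m t} → Sel m t → Sel (suc m) t
  take : ∀ {m t} → Sel m t → Sel (suc m) (suc t)

select : ∀ {A : Set} {m t} → Sel m t → Vec A m → Vec A t
select done [] = []
select (skip σ) (x ∷ xs) = select σ xs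
select (take σ) (x ∷ xs) = x ∷ select σ xs

allSel : ∀ m t → List (Sel m t)
allSel zero zero = done ∷ []
allSel zero (suc t) = []
allSel (suc m) zero = List.map skip (allSel m zero)
allSel (suc m) (suc t) = List.map skip (allSel m (suc t)) List.++ List.map take (allSel m t)

∈-allSel : ∀ {m t} (σ : Sel m t) → σ ∈ allSel m t
∈-allSel done = here refl
∈-allSel {t = zero} (skip σ) = Mem.∈-map⁺ skip (∈-allSel σ)
∈-allSel {t = suc t} (skip σ) = Mem.∈-++⁺ˡ (Mem.∈-map⁺ skip (∈-allSel σ))
∈-allSel {suc m} {suc t} (take σ) = Mem.∈-++⁺ʳ (List.map skip (allSel m (suc t))) (Mem.∈-map⁺ take (∈-allSel σ))

compose : ∀ {l m t} → Sel l m → Sel m t → Sel l t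
compose done done = done
compose (skip σ) τ = skip (compose σ τ)
compose (take σ) (skip τ) = skip (compose σ τ)
compose (take σ) (take τ) = take (compose σ τ)

select-compose : ∀ {A : Set} {l m t} (σ : Sel l m) (τ : Sel m t) (xs : Vec A l) → select (compose σ τ) xs ≡ select τ (select σ xs)
select-compose done done [] = refl
select-compose (skip σ) τ (x ∷ xs) = select-compose σ τ xs
select-compose (take σ) (skip τ) (x ∷ xs) = select-compose σ τ xs
select-compose (take σ) (take τ) (x ∷ xs) = cong (x ∷_) (select-compose σ τ xs)

select-map : ∀ {A B : Set} {m t} (f : A → B) (σ : Sel m t) xs → select σ (Vec.map f xs) ≡ Vec.map f (select σ xs)
select-map f done [] = refl
select-map f (skip σ) (x ∷ xs) = select-map f σ xs
select-map f (take σ) (x ∷ xs) = cong (f x ∷_) (select-map f σ xs)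

select-All : ∀ {A : Set} {P : A → Set} {m t} (σ : Sel m t) {xs : Vec A m} → All P xs → All P (select σ xs)
select-All done [] = []
select-All (skip σ) (p ∷ ps) = select-All σ ps
select-All (take σ) (p ∷ ps) = p ∷ select-All σ ps

select-zip : ∀ {m t} (σ : Sel m t) (us vs : Vec ℤ m) → select σ (Vec.zipWith ℤ._+_ us vs) ≡ Vec.zipWith ℤ._+_ (select σ us) (select σ vs)
select-zip done [] [] = refl
select-zip (skip σ) (u ∷ us) (v ∷ vs) = select-zip σ us vs
select-zip (take σ) (u ∷ us) (v ∷ vs) = cong (u ℤ.+ v ∷_) (select-zip σ us vs)

select-replicate : ∀ {A : Set} {m t} (σ : Sel m t) (a : A) → select σ (replicate m a) ≡ replicate t a
select-replicate done a = refl
select-replicate (skip σ) a = select-replicate σ a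
select-replicate (take σ) a = cong (a ∷_) (select-replicate σ a)

select-marginal : ∀ {A : Set} (μ : Mean A) {m t} (σ : Sel m t) (g : Vec A t → ℚ) → E (vecMean μ m) (g ∘ select σ) ≡ E (vecMean μ t) g
select-marginal μ done g = refl
select-marginal μ (skip σ) g = trans (Mean.one μ _) (select-marginal μ σ g)
select-marginal μ (take σ) g = Mean.cng μ (λ a → select-marginal μ σ (g ∘ (a ∷_)))

someSel : ∀ {t n} → t ℕ.≤ n → Sel n t
someSel {zero} {zero} _ = done
someSel {zero} {suc n} _ = skip (someSel ℕ.z≤n)
someSel {suc t} {suc n} (ℕ.s≤s p) = take (someSel p)

separate : ∀ (P : ℕ → Bool) a b {n} (z : Vec ℕ n) → a ℕ.+ b ℕ.≤ n →
  (Σ (Sel n a) λ σ → All (λ x → P x ≡ true) (select σ z)) ⊎ (Σ (Sel n b) λ σ → All (λ x → P x ≡ false) (select σ z))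
separate P zero b z le = inj₁ (someSel ℕ.z≤n , empty (select (someSel ℕ.z≤n) z))
  where
  empty : ∀ {Q : ℕ → Set} (v : Vec ℕ 0) → All Q v
  empty [] = []
separate P (suc a) zero z le = inj₂ (someSel ℕ.z≤n , empty (select (someSel ℕ.z≤n) z))
  where
  empty : ∀ {Q : ℕ → Set} (v : Vec ℕ 0) → All Q v
  empty [] = []
separate P (suc a) (suc b) (x ∷ z) (ℕ.s≤s le) with P x in eq
... | true = Data.Sum.map (λ { (σ , h) → take σ , eq ∷ h }) (λ { (σ , h) → skip σ , h }) (separate P a (suc b) z le)
... | false = Data.Sum.map (λ { (σ , h) → skip σ , h }) (λ { (σ , h) → take σ , eq ∷ h })
      (separate P (suc a) b z (ℕP.≤-trans (ℕP.≤-reflexive (sym (ℕP.+-suc a b))) le))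

pigeonhole : ∀ r t (C : Fin (suc r) → ℕ → Bool) {n} (z : Vec ℕ n) → suc r ℕ.* t ℕ.≤ n → All (λ x → ∃[ k ] C k x ≡ true) z →
  ∃[ k ] Σ (Sel n t) λ σ → All (λ x → C k x ≡ true) (select σ z)
pigeonhole zero t C z le cov = zero , σ , All.map (λ { (zero , e) → e }) (select-All σ cov)
  where
  σ = someSel (ℕP.≤-trans (ℕP.m≤m+n t (0 ℕ.* t)) le)
pigeonhole (suc r) t C z le cov with separate (C zero) t (suc r ℕ.* t) z le
... | inj₁ (σ , h) = zero , σ , h
... | inj₂ (σ , h) with pigeonhole r t (C ∘ suc) (select σ z) ℕP.≤-refl (All.map uncoloured (All.zip (select-All σ cov , h)))
  where
  uncoloured : ∀ {x} → (∃[ k ] C k x ≡ true) × (C zero x ≡ false) → ∃[ k ] C (suc k) x ≡ true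
  uncoloured ((zero , e) , e′) with () ← trans (sym e) e′
  uncoloured ((suc k , e) , e′) = k , e
... | k , τ , h′ = suc k , compose σ τ , subst (All _) (sym (select-compose σ τ z)) h′

allB-true : ∀ {n} (f : ℕ → Bool) (z : Vec ℕ n) → All (λ x → f x ≡ true) z → allB f z ≡ true
allB-true f [] [] = refl
allB-true f (x ∷ z) (p ∷ ps) = cong₂ _∧_ p (allB-true f z ps)

sumOver prodOver : ∀ {I : Set} → List I → (I → ℚ) → ℚ
sumOver [] f = 0ℚ
sumOver (i ∷ is) f = f i ⊕ sumOver is f
prodOver [] f = 1ℚ
prodOver (i ∷ is) f = f i ⊗ prodOver is f

sumOver-nonneg : ∀ {I : Set} (is : List I) f → (∀ i → 0ℚ ≤ f i) → 0ℚ ≤ sumOver is f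
sumOver-nonneg [] f h = ≤-refl
sumOver-nonneg (i ∷ is) f h = ⊕-nonneg (h i) (sumOver-nonneg is f h)

prodOver-unit : ∀ {I : Set} (is : List I) f → (∀ i → 0ℚ ≤ f i) → (∀ i → f i ≤ 1ℚ) → 0ℚ ≤ prodOver is f × prodOver is f ≤ 1ℚ
prodOver-unit [] f p q = 0≤1 , ≤-refl
prodOver-unit (i ∷ is) f p q = let a , b = prodOver-unit is f p q in
  ⊗-nonneg (p i) a , ≤-trans (⊗-mono (p i) 0≤1 (q i) b) (≡⇒≤ (⊗-idʳ 1ℚ))

-- A product of numbers in [0, 1] is at most each of its factors. The good index may change from
-- point to point, whereas the sum on the right does not mention it and can be averaged.
product≤sum : ∀ {I : Set} (is : List I) x y → (∀ i → 0ℚ ≤ x i) → (∀ i → x i ≤ 1ℚ) → (∀ i → 0ℚ ≤ y i) → ∀ {j} → j ∈ is → x j ≤ y j → prodOver is x ≤ sumOver is y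
product≤sum (i ∷ is) x y p q r (here refl) le = ≤-trans (⊗-monoˡ (x i) (p i) (proj₂ (prodOver-unit is x p q))) (≤-trans (≡⇒≤ (⊗-idʳ (x i)))
  (≤-trans le (≤-⊕ʳ (sumOver-nonneg is y r))))
product≤sum (i ∷ is) x y p q r (there j∈) le = ≤-trans (⊗-monoʳ _ (proj₁ (prodOver-unit is x p q)) (q i)) (≤-trans (≡⇒≤ (⊗-idˡ _))
  (≤-trans (product≤sum is x y p q r j∈ le) (≤-⊕ˡ (r i))))

E-sumOver : ∀ {A I : Set} (m : Mean A) (is : List I) (f : I → A → ℚ) → E m (λ a → sumOver is (λ i → f i a)) ≡ sumOver is (λ i → E m (f i))
E-sumOver m [] f = Mean.one m 0ℚ
E-sumOver m (i ∷ is) f = trans (Mean.add m _ _) (cong (E m (f i) ⊕_) (E-sumOver m is f))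

large-summand : ∀ {I : Set} (is : List I) f x → 0ℚ < x → x ≤ sumOver is f → ∃[ i ] x ≤ nat (List.length is) ⊗ f i
large-summand [] f x 0<x le = ⊥-elim (ℚP.<-irrefl refl (ℚP.<-≤-trans 0<x le))
large-summand (i ∷ is) f x 0<x le = let j , h = best i is in j , ≤-trans le (h)
  where
  best : ∀ i is → ∃[ j ] (sumOver (i ∷ is) f ≤ nat (List.length (i ∷ is)) ⊗ f j)
  best i [] = i , ≡⇒≤ (trans (⊕-idʳ (f i)) (sym (trans (cong (_⊗ f i) nat-1) (⊗-idˡ (f i)))))
  best i (i′ ∷ is) with best i′ is
  ... | j , h with f i ℚ.≤? f j
  ... | yes p = j , ≤-trans (⊕-mono p h) (≡⇒≤ (sym (trans (cong (_⊗ f j) (nat-suc (List.length (i′ ∷ is)))) (trans (⊗-distribʳ (f j) 1ℚ _) (cong (_⊕ nat (List.length (i′ ∷ is)) ⊗ f j) (⊗-idˡ (f j)))))))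
  ... | no ¬p = i , ≤-trans (⊕-mono ≤-refl (≤-trans h (⊗-monoˡ _ (nat-nonneg (List.length (i′ ∷ is))) (<⇒≤ (ℚP.≰⇒> ¬p))))) (≡⇒≤ (sym (trans (cong (_⊗ f i) (nat-suc (List.length (i′ ∷ is)))) (trans (⊗-distribʳ (f i) 1ℚ _) (cong (_⊕ nat (List.length (i′ ∷ is)) ⊗ f i) (⊗-idˡ (f i)))))))

InRange : ℕ → ℕ → Set
InRange Z n = 1 ℕ.≤ n × n ℕ.≤ suc Z

interval-mono : ∀ Z {f g : ℕ → ℚ} → (∀ n → InRange Z n → f n ≤ g n) → E (interval Z) f ≤ E (interval Z) g
interval-mono Z h = Mean.mono (uniform Z) (λ i → h (suc (toℕ i)) (ℕ.s≤s ℕ.z≤n , FinP.toℕ<n i))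

interval-vec-mono : ∀ Z m {f g : Vec ℕ m → ℚ} → (∀ z → All (InRange Z) z → f z ≤ g z) → E (vecMean (interval Z) m) f ≤ E (vecMean (interval Z) m) g
interval-vec-mono Z zero h = h [] []
interval-vec-mono Z (suc m) {f} {g} h = interval-mono Z {λ n → E (vecMean (interval Z) m) (f ∘ (n ∷_))} {λ n → E (vecMean (interval Z) m) (g ∘ (n ∷_))}
  (λ n r → interval-vec-mono Z m (λ z rs → h (n ∷ z) (r ∷ rs)))

-- All integer variables act on each copy of the ring through its own homomorphism. Correlations on
-- a product multiply, so one application of recurrence controls all of them at the same z.
module Product (K : FinRing) (m : ℕ) {I : Set} (κ : I → Hom (vecG m) (RingAverages.additive K)) (F : I → FinRing.R K → Bool) where
  open RingCounting K
  private module M = Mean mean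

  Point : List I → Set
  Point [] = ⊤
  Point (i ∷ is) = R × Point is

  measure : ∀ is → Mean (Point is)
  measure [] = point tt
  measure (i ∷ is) = bind mean (λ x → push (x ,_) (measure is))

  system : List I → Sys (vecG m)
  system is = record { Y = Point is ; μ = measure is ; act = move is ; act-+ = move-+ is ; act-0 = move-0 is ; invariant = move-inv is }
    where
    move : ∀ is → Vec ℤ m → Point is → Point is
    move [] u y = tt
    move (i ∷ is) u (x , y) = x +ʳ κ i .fun u , move is u y
    module C = IsCommutativeRing isCR
    move-+ : ∀ is u v y → move is (Vec.zipWith ℤ._+_ u v) y ≡ move is u (move is v y)
    move-+ [] u v y = refl
    move-+ (i ∷ is) u v (x , y) = cong₂ _,_ (trans (cong (x +ʳ_) (trans (κ i .hom-+ u v) (C.+-comm _ _))) (sym (C.+-assoc x _ _))) (move-+ is u v y)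
    move-0 : ∀ is y → move is (replicate m (+ 0)) y ≡ y
    move-0 [] tt = refl
    move-0 (i ∷ is) (x , y) = cong₂ _,_ (trans (cong (x +ʳ_) (κ i .hom-0)) (C.+-identityʳ x)) (move-0 is y)
    move-inv : ∀ is u (f : Point is → ℚ) → E (measure is) (f ∘ move is u) ≡ E (measure is) f
    move-inv [] u f = refl
    move-inv (i ∷ is) u f = trans (M.cng (λ x → move-inv is u (λ y → f (x +ʳ κ i .fun u , y)))) (translate (κ i .fun u) (λ x → E (measure is) (λ y → f (x , y))))

  tensor : ∀ is → Point is → ℚ
  tensor [] _ = 1ℚ
  tensor (i ∷ is) (x , y) = indicator (F i x) ⊗ tensor is y

  tensor-nonneg : ∀ is y → 0ℚ ≤ tensor is y
  tensor-nonneg [] _ = 0≤1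
  tensor-nonneg (i ∷ is) (x , y) = ⊗-nonneg (indicator-nonneg (F i x)) (tensor-nonneg is y)

  tensor-≤1 : ∀ is y → tensor is y ≤ 1ℚ
  tensor-≤1 [] _ = ≤-refl
  tensor-≤1 (i ∷ is) (x , y) = ≤-trans (⊗-mono (indicator-nonneg (F i x)) 0≤1 (indicator-≤1 (F i x)) (tensor-≤1 is y)) (≡⇒≤ (⊗-idʳ 1ℚ))

  E-product : ∀ is i (a : R → ℚ) (b : Point is → ℚ) → E (measure (i ∷ is)) (λ p → a (proj₁ p) ⊗ b (proj₂ p)) ≡ E mean a ⊗ E (measure is) b
  E-product is i a b = trans (M.cng (λ x → Mean.scl (measure is) (a x) b)) (M.sclʳ _ a)

  tensor-mean : ∀ δ → 0ℚ ≤ δ → (∀ i → δ ≤ density mean (F i)) → ∀ is → power δ (List.length is) ≤ E (measure is) (tensor is)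
  tensor-mean δ 0≤δ h [] = ≤-refl
  tensor-mean δ 0≤δ h (i ∷ is) = ≤-trans (⊗-mono 0≤δ (Mean.nonneg (measure is) (tensor-nonneg is)) (h i) (tensor-mean δ 0≤δ h is))
    (≡⇒≤ (sym (E-product is i (indicator ∘ F i) (tensor is))))

  tensor-corr : ∀ is u → Theory.⟨_,_⟩ (vecG m) (system is) (tensor is) (tensor is ∘ Sys.act (system is) u) ≡ prodOver is (λ i → corr K (F i) (κ i .fun u))
  tensor-corr [] u = ⊗-idʳ 1ℚ
  tensor-corr (i ∷ is) u = trans (Mean.cng (measure (i ∷ is)) (λ p → interchange (indicator (F i (proj₁ p))) (tensor is (proj₂ p)) _ _))
    (trans (E-product is i (λ x → indicator (F i x) ⊗ indicator (F i (x +ʳ κ i .fun u))) (λ y → tensor is y ⊗ tensor is (Sys.act (system is) u y)))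
      (cong (corr K (F i) (κ i .fun u) ⊗_) (tensor-corr is u)))
    where
    opaque
      unfolding _⊕_
      interchange : ∀ a b c d → (a ⊗ b) ⊗ (c ⊗ d) ≡ (a ⊗ c) ⊗ (b ⊗ d)
      interchange = solve-∀ ℚ-ring

module _ (K : FinRing) where
  open RingCounting K
  private module C = IsCommutativeRing isCR

  linear : ∀ {t} → Vec R t → Vec ℤ t → R
  linear [] [] = 0ʳ
  linear (w ∷ ws) (u ∷ us) = w *ʳ red u +ʳ linear ws us

  linear-+ : ∀ {t} (ws : Vec R t) us vs → linear ws (Vec.zipWith ℤ._+_ us vs) ≡ linear ws us +ʳ linear ws vs
  linear-+ [] [] [] = sym (C.+-identityʳ 0ʳ)
  linear-+ (w ∷ ws) (u ∷ us) (v ∷ vs) = trans (cong₂ (λ a b → w *ʳ a +ʳ b) (red-+ u v) (linear-+ ws us vs)) (r w (red u) (red v) (linear ws us) (linear ws vs))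
    where
    r : ∀ w u v a b → w *ʳ (u +ʳ v) +ʳ (a +ʳ b) ≡ (w *ʳ u +ʳ a) +ʳ (w *ʳ v +ʳ b)
    r = solve 5 (λ w u v a b → w :* (u :+ v) :+ (a :+ b) := (w :* u :+ a) :+ (w :* v :+ b)) refl

  linear-0 : ∀ {t} (ws : Vec R t) → linear ws (replicate t (+ 0)) ≡ 0ʳ
  linear-0 [] = refl
  linear-0 (w ∷ ws) = trans (cong₂ (λ a b → w *ʳ a +ʳ b) red-0 (linear-0 ws)) (trans (C.+-identityʳ _) (C.zeroʳ w))

  selectHom : ∀ {m t} → Vec R t → Sel m t → Hom (vecG m) additive
  selectHom ws σ .fun u = linear ws (select σ u)
  selectHom ws σ .hom-+ u v = trans (cong (linear ws) (select-zip σ u v)) (linear-+ ws _ _)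
  selectHom ws σ .hom-0 = trans (cong (linear ws) (select-replicate σ (+ 0))) (linear-0 ws)

idHom : ∀ {G} → Hom G G
idHom .fun u = u
idHom .hom-+ u v = refl
idHom .hom-0 = refl

module _ (r t : ℕ) where
  variables : ℕ
  variables = suc r ℕ.* t

  choices : List (Fin (suc r) × Sel variables t)
  choices = List.cartesianProduct (List.allFin (suc r)) (allSel variables t)

  ∈-choices : ∀ k σ → (k , σ) ∈ choices
  ∈-choices k σ = Mem.∈-cartesianProduct⁺ (Mem.∈-allFin k) (∈-allSel σ)

-- Only the threshold depends on the polynomial; c precedes the polynomial, the ring and the sets.
-- The multipliers `ws` are arbitrary, so that the coefficients of L₂ and the inverse of λ(D) can be
-- folded into them.
ColourBound : (d k r t : ℕ) (δ₀ c : ℚ) → Set₁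
ColourBound d k r t δ₀ c = ∀ P → Solvable P d → Σ ℕ λ Z₀ → ∀ Z → Z₀ ℕ.≤ Z → ∀ K (αs : Vec (FinRing.R K) (suc k)) →
  All (RingAverages.Unit K) αs → RingAverages.total K αs ≡ FinRing.1ʳ K → ∀ (ws : Vec (FinRing.R K) t) (A : Fin (suc r) → FinRing.R K → Bool) →
  (∀ i → δ₀ ≤ density (FinRing.mean K) (A i)) → ∀ (C : Fin (suc r) → ℕ → Bool) → (∀ n → InRange Z n → ∃[ i ] C i n ≡ true) →
  ∃[ i ] c ≤ E (vecMean (interval Z) t) (λ z → indicator (allB (C i) z) ⊗
    RingAverages.form K (indicator ∘ A i) αs (linear K ws (Vec.map (λ z → polyEval P d (+ z)) z)))

-- If every colour had an exceptional set Aᵢ, recurrence in the product of all systems attached to (colour, selection) pairs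
-- would produce, by pigeonhole, a monochromatic selection that is good for its own colour.
colourBound : ∀ d k r t δ₀ → 0ℚ < δ₀ → Σ ℚ λ c → 0ℚ < c × ColourBound d k r t δ₀ c
colourBound d k r t δ₀ 0<δ₀ = c , 0<c , λ P sol → proj₁ (proj₂ (proj₂ mr) P sol) , main P sol
  where
  pp = popular k δ₀ 0<δ₀
  c₁ δ₁ : ℚ
  c₁ = proj₁ pp
  δ₁ = proj₁ (proj₂ pp)
  0<c₁ : 0ℚ < c₁
  0<c₁ = proj₁ (proj₂ (proj₂ pp))
  0<δ₁ : 0ℚ < δ₁
  0<δ₁ = proj₁ (proj₂ (proj₂ (proj₂ pp)))
  J : List (Fin (suc r) × Sel (variables r t) t)
  J = choices r t
  L : ℕ
  L = List.length J
  mr = multiRecurrence (variables r t) d (power δ₁ L) (power-pos L 0<δ₁)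
  ρ c : ℚ
  ρ = proj₁ mr
  0<ρ : 0ℚ < ρ
  0<ρ = proj₁ (proj₂ mr)
  c = c₁ ⊗ (ρ ⊗ inv L)
  0<c : 0ℚ < c
  0<c = ⊗-pos 0<c₁ (⊗-pos 0<ρ (inv-pos L))
  module _ (P : ℕ → ℤ) (sol : Solvable P d) (Z : ℕ) (Z₀≤Z : proj₁ (proj₂ (proj₂ mr) P sol) ℕ.≤ Z) (K : FinRing) (αs : Vec (FinRing.R K) (suc k))
           (units : All (RingAverages.Unit K) αs) (sum : RingAverages.total K αs ≡ FinRing.1ʳ K) (ws : Vec (FinRing.R K) t) (A : Fin (suc r) → FinRing.R K → Bool)
           (δ≤A : ∀ i → δ₀ ≤ density (FinRing.mean K) (A i)) (C : Fin (suc r) → ℕ → Bool) (cover : ∀ n → InRange Z n → ∃[ i ] C i n ≡ true) where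
    open RingCounting K
    pop : ∀ i → Σ (R → Bool) λ F → δ₁ ≤ density mean F × (∀ v → c₁ ⊗ corr K F v ≤ form (indicator ∘ A i) αs v)
    pop i = proj₂ (proj₂ (proj₂ (proj₂ pp))) K αs units sum (A i) (δ≤A i)
    F : Fin (suc r) × Sel (variables r t) t → R → Bool
    F j = proj₁ (pop (proj₁ j))
    κ : Fin (suc r) × Sel (variables r t) t → Hom (vecG (variables r t)) additive
    κ (i , σ) = selectHom K ws σ
    open Product K (variables r t) κ F
    values : ∀ {n} → Vec ℕ n → Vec ℤ n
    values = Vec.map (λ z → polyEval P d (+ z))
    x y : Fin (suc r) × Sel (variables r t) t → Vec ℕ (variables r t) → ℚ
    x j z = corr K (F j) (κ j .fun (values z))
    y j z = indicator (allB (C (proj₁ j)) (select (proj₂ j) z)) ⊗ x j z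
    x≥0 : ∀ j z → 0ℚ ≤ x j z
    x≥0 j z = proj₁ (corr-In K (F j)) _
    G : Fin (suc r) → Vec ℕ t → ℚ
    G i z = indicator (allB (C i) z) ⊗ corr K (proj₁ (pop i)) (linear K ws (values z))
    recurrent : ρ ≤ E (vecMean (interval Z) (variables r t)) (λ z → prodOver J (λ j → x j z))
    recurrent = ≤-trans (proj₂ (proj₂ (proj₂ mr) P sol) Z Z₀≤Z (vecG (variables r t)) (system J) idHom (tensor J) (tensor-nonneg J) (tensor-≤1 J)
        (tensor-mean δ₁ (<⇒≤ 0<δ₁) (λ j → proj₁ (proj₂ (pop (proj₁ j)))) J))
      (≡⇒≤ (Mean.cng (vecMean (interval Z) (variables r t)) (λ z → tensor-corr J (values z))))
    bounded : ∀ z → All (InRange Z) z → prodOver J (λ j → x j z) ≤ sumOver J (λ j → y j z)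
    bounded z rs = product≤sum J (λ j → x j z) (λ j → y j z) (λ j → x≥0 j z) (λ j → proj₂ (corr-In K (F j)) _)
        (λ j → ⊗-nonneg (indicator-nonneg _) (x≥0 j z)) (∈-choices r t i σ)
        (≡⇒≤ (sym (trans (cong (λ b → indicator b ⊗ x (i , σ) z) (allB-true (C i) (select σ z) mono)) (⊗-idˡ _))))
      where
      pg = pigeonhole r t C z ℕP.≤-refl (All.map (λ {n} → cover n) rs)
      i = proj₁ pg
      σ = proj₁ (proj₂ pg)
      mono = proj₂ (proj₂ pg)
    E-y : ∀ j → E (vecMean (interval Z) (variables r t)) (y j) ≡ E (vecMean (interval Z) t) (G (proj₁ j))
    E-y (i , σ) = trans (Mean.cng (vecMean (interval Z) (variables r t)) (λ z → cong (λ v → indicator (allB (C i) (select σ z)) ⊗ corr K (proj₁ (pop i)) (linear K ws v)) (select-map _ σ z)))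
      (select-marginal (interval Z) σ (G i))
    large : ∃[ j ] ρ ≤ nat L ⊗ E (vecMean (interval Z) (variables r t)) (y j)
    large = large-summand J _ ρ 0<ρ (≤-trans recurrent (≤-trans (interval-vec-mono Z (variables r t) bounded) (≡⇒≤ (E-sumOver (vecMean (interval Z) (variables r t)) J y))))
    main : ∃[ i ] c ≤ E (vecMean (interval Z) t) (λ z → indicator (allB (C i) z) ⊗ form (indicator ∘ A i) αs (linear K ws (values z)))
    main = i , ≤-trans (⊗-monoˡ c₁ (<⇒≤ 0<c₁) lower) (≤-trans (≡⇒≤ (sym (Mean.scl (vecMean (interval Z) t) c₁ (G i))))
        (Mean.mono (vecMean (interval Z) t) (λ z → ≤-trans (≡⇒≤ (⊗-left-comm c₁ _ _)) (⊗-monoˡ _ (indicator-nonneg (allB (C i) z)) (proj₂ (proj₂ (pop i)) _)))))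
      where
      j = proj₁ large
      i = proj₁ j
      g : ℚ
      g = E (vecMean (interval Z) t) (G i)
      g≥0 : 0ℚ ≤ g
      g≥0 = Mean.nonneg (vecMean (interval Z) t) (λ z → ⊗-nonneg (indicator-nonneg (allB (C i) z)) (proj₁ (corr-In K (proj₁ (pop i))) _))
      lower : ρ ⊗ inv L ≤ g
      lower = ≤-trans (⊗-monoʳ (inv L) (inv-nonneg L) (≤-trans (proj₂ large) (≤-trans (≡⇒≤ (cong (nat L ⊗_) (E-y j))) (⊗-monoʳ g g≥0 (nat-mono (ℕP.n≤1+n L))))))
        (≡⇒≤ (trans (⊗-comm _ _) (trans (sym (⊗-assoc _ _ _)) (trans (cong (_⊗ g) (trans (⊗-comm _ _) (nat-inv L))) (⊗-idˡ g)))))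

-- Roots of the auxiliary polynomial

infix 4 _∣ᶻ_
_∣ᶻ_ : ℕ → ℤ → Set
n ∣ᶻ x = + n ℤS.∣ x

∣ᶻ-trans : ∀ {m n x} → m ℕD.∣ n → n ∣ᶻ x → m ∣ᶻ x
∣ᶻ-trans {m} {n} d e = ℤS.∣-trans {+ m} {+ n} (ℤS.∣ᵤ⇒∣ {+ m} {+ n} d) e

eval-congruent : ∀ P (n x y : ℤ) → n ℤS.∣ (x ℤ.- y) → n ℤS.∣ (eval P x ℤ.- eval P y)
eval-congruent [] n x y h = ℤS.∣ᵤ⇒∣ {n} {+ 0} (ℕD._∣0 ℤ.∣ n ∣)
eval-congruent (a ∷ P) n x y h = subst (n ℤS.∣_) (l a x y (eval P x) (eval P y))
  (ℤS.∣m∣n⇒∣m+n (ℤS.∣n⇒∣m*n x (eval-congruent P n x y h)) (ℤS.∣m⇒∣m*n (eval P y) h))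
  where
  l : ∀ a x y p q → x ℤ.* (p ℤ.- q) ℤ.+ (x ℤ.- y) ℤ.* q ≡ (a ℤ.+ x ℤ.* p) ℤ.- (a ℤ.+ y ℤ.* q)
  l = solve-∀ ℤ-ring

prime-coprime : ∀ {p} M → Prime p → ¬ (p ℕD.∣ M) → ℕCop.Coprime p M
prime-coprime M pr ∤ (d∣p , d∣M) with prime⇒irreducible pr d∣p
... | inj₁ e = e
... | inj₂ refl = ⊥-elim (∤ d∣M)

coprime-power : ∀ {p} M → Prime p → ¬ (p ℕD.∣ M) → ∀ l → ℕCop.Coprime (p ℕ.^ l) M
coprime-power M pr ∤ zero = ℕCop.1-coprimeTo M
coprime-power {p} M pr ∤ (suc l) {d} (d∣ , d∣M) = coprime-power M pr ∤ l (ℕCop.coprime-divisor cop d∣ , d∣M)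
  where
  cop : ℕCop.Coprime d p
  cop (e∣d , e∣p) = prime-coprime M pr ∤ (e∣p , ℕD.∣-trans e∣d d∣M)

∣-product : ∀ {m n x} → ℕCop.Coprime m n → m ∣ᶻ x → n ∣ᶻ x → (m ℕ.* n) ∣ᶻ x
∣-product {m} {n} {x} cop m∣ n∣ = ℤS.∣ᵤ⇒∣ {+ (m ℕ.* n)} {x} (go (ℤS.∣⇒∣ᵤ m∣) (ℤS.∣⇒∣ᵤ n∣))
  where
  go : m ℕD.∣ ℤ.∣ x ∣ → n ℕD.∣ ℤ.∣ x ∣ → (m ℕ.* n) ℕD.∣ ℤ.∣ x ∣
  go (ℕD.divides c eq) n∣x with ℕCop.coprime-divisor {n} {m} (ℕCop.sym cop) (subst (n ℕD.∣_) (trans eq (ℕP.*-comm c m)) n∣x)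
  ... | ℕD.divides c′ eq′ = ℕD.divides c′ (trans eq (trans (cong (ℕ._* m) eq′) (trans (ℕP.*-assoc c′ n m) (cong (c′ ℕ.*_) (ℕP.*-comm n m)))))

Splits : ℕ → ℕ → Set
Splits p N = Σ ℕ λ k → Σ ℕ λ M → N ≡ p ℕ.^ k ℕ.* M × ¬ (p ℕD.∣ M)

split-prime : ∀ {p} → Prime p → ∀ N → 1 ℕ.≤ N → Splits p N
split-prime {p} pr = <-rec (λ N → 1 ℕ.≤ N → Splits p N) step
  where
  1<p : 1 ℕ.< p
  1<p = ℕ.nonTrivial⇒n>1 p ⦃ prime⇒nonTrivial pr ⦄
  step : ∀ N → (∀ {m} → m ℕ.< N → 1 ℕ.≤ m → Splits p m) → 1 ℕ.≤ N → Splits p N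
  step N rec 1≤N with p ℕD.∣? N
  ... | no ∤ = 0 , N , sym (ℕP.+-identityʳ N) , ∤
  ... | yes (ℕD.divides zero refl) with () ← 1≤N
  ... | yes (ℕD.divides m@(suc _) refl) with rec (ℕP.m<m*n m p 1<p) (ℕ.s≤s ℕ.z≤n)
  ... | k , M , eq , ∤ = suc k , M , trans (cong (ℕ._* p) eq) (l (p ℕ.^ k) M p) , ∤
    where
    l : ∀ a m p → a ℕ.* m ℕ.* p ≡ p ℕ.* a ℕ.* m
    l = ℕR.solve-∀

power∣⇒≤ : ∀ {p} → Prime p → ∀ l k M → ¬ (p ℕD.∣ M) → p ℕ.^ l ℕD.∣ p ℕ.^ k ℕ.* M → l ℕ.≤ k
power∣⇒≤ pr zero k M ∤ d = ℕ.z≤n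
power∣⇒≤ {p} pr (suc l) zero M ∤ d = ⊥-elim (∤ (ℕD.∣-trans (ℕD.m∣m*n (p ℕ.^ l)) (subst (p ℕ.^ suc l ℕD.∣_) (ℕP.+-identityʳ M) d)))
power∣⇒≤ {p} pr (suc l) (suc k) M ∤ d = ℕ.s≤s (power∣⇒≤ pr l k M ∤ (ℕD.*-cancelˡ-∣ p ⦃ prime⇒nonZero pr ⦄ (subst (p ℕ.^ suc l ℕD.∣_) (ℕP.*-assoc p (p ℕ.^ k) M) d)))

inverse-mod-prime : ∀ {p} M → Prime p → ¬ (p ℕD.∣ M) → ∃[ u ] ∃[ v ] (+ M ℤ.* u ≡ + 1 ℤ.+ v ℤ.* + p)
inverse-mod-prime {p} M pr ∤ with ℕCop.coprime-Bézout (prime-coprime M pr ∤)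
... | Bézout.Identity.-+ x y eq = + y , + x , trans (ℤP.*-comm (+ M) (+ y)) (trans (sym (ℤP.pos-* y M)) (trans (cong +_ (sym eq)) (cong (λ t → + 1 ℤ.+ t) (ℤP.pos-* x p))))
... | Bézout.Identity.+- x y eq = ℤ.- (+ y) , ℤ.- (+ x) , trans (l (+ M) (+ y) (+ x) (+ p)) (trans (cong (λ t → + 1 ℤ.+ (ℤ.- (+ x)) ℤ.* + p ℤ.+ (t ℤ.- (+ 1 ℤ.+ + y ℤ.* + M))) e) (l′ (+ 1 ℤ.+ (ℤ.- (+ x)) ℤ.* + p) (+ 1 ℤ.+ + y ℤ.* + M)))
  where
  e : + x ℤ.* + p ≡ + 1 ℤ.+ + y ℤ.* + M
  e = trans (sym (ℤP.pos-* x p)) (trans (cong +_ (sym eq)) (cong (λ t → + 1 ℤ.+ t) (ℤP.pos-* y M)))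
  l : ∀ m y x p → m ℤ.* (ℤ.- y) ≡ + 1 ℤ.+ (ℤ.- x) ℤ.* p ℤ.+ (x ℤ.* p ℤ.- (+ 1 ℤ.+ y ℤ.* m))
  l = solve-∀ ℤ-ring
  l′ : ∀ a b → a ℤ.+ (b ℤ.- b) ≡ a
  l′ = solve-∀ ℤ-ring

module Roots (P : Poly) (z : ℕ → ℕ → ℤ) (padic : ∀ p → Prime p → IsPAdic p (z p)) (vanish : ∀ p → Prime p → VanishesAt p P (z p)) where

  -- The integer w imitates all the p-adic roots at once, to the precision visible in N. Quantifying
  -- over all prime powers dividing N avoids computing valuations.
  Agrees : ℕ → ℤ → Set
  Agrees N w = ∀ p → Prime p → ∀ k → p ℕ.^ k ℕD.∣ N → (p ℕ.^ k) ∣ᶻ (w ℤ.- z p k)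

  power-∣ : ∀ p {l k} → l ℕ.≤ k → p ℕ.^ l ℕD.∣ p ℕ.^ k
  power-∣ p {l} {k} l≤k = subst (λ n → p ℕ.^ l ℕD.∣ p ℕ.^ n) (ℕP.m+[n∸m]≡n l≤k) (subst (p ℕ.^ l ℕD.∣_) (sym (ℕP.^-distribˡ-+-* p l (k ℕ.∸ l))) (ℕD.m∣m*n _))

  compatible : ∀ p → Prime p → ∀ l j → (p ℕ.^ l) ∣ᶻ (z p (j ℕ.+ l) ℤ.- z p l)
  compatible p pr l zero = subst ((p ℕ.^ l) ∣ᶻ_) (sym (ℤP.+-inverseʳ (z p l))) (ℤS.∣ᵤ⇒∣ {+ (p ℕ.^ l)} {+ 0} (ℕD._∣0 (p ℕ.^ l)))
  compatible p pr l (suc j) = subst ((p ℕ.^ l) ∣ᶻ_) (r (z p (suc j ℕ.+ l)) (z p (j ℕ.+ l)) (z p l))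
    (ℤS.∣m∣n⇒∣m+n (∣ᶻ-trans (power-∣ p (ℕP.m≤n+m l j)) (ℤS.∣ᵤ⇒∣ {+ (p ℕ.^ (j ℕ.+ l))} {z p (suc (j ℕ.+ l)) ℤ.- z p (j ℕ.+ l)} (padic p pr (j ℕ.+ l)))) (compatible p pr l j))
    where
    r : ∀ a b c → (a ℤ.- b) ℤ.+ (b ℤ.- c) ≡ a ℤ.- c
    r = solve-∀ ℤ-ring

  lower-level : ∀ p → Prime p → ∀ {l k w} → l ℕ.≤ k → (p ℕ.^ k) ∣ᶻ (w ℤ.- z p k) → (p ℕ.^ l) ∣ᶻ (w ℤ.- z p l)
  lower-level p pr {l} {k} {w} l≤k h = subst ((p ℕ.^ l) ∣ᶻ_) (r w (z p k) (z p l))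
    (ℤS.∣m∣n⇒∣m+n (∣ᶻ-trans (power-∣ p l≤k) h) (subst (λ n → (p ℕ.^ l) ∣ᶻ (z p n ℤ.- z p l)) (ℕP.m∸n+n≡m l≤k) (compatible p pr l (k ℕ.∸ l))))
    where
    r : ∀ a b c → (a ℤ.- b) ℤ.+ (b ℤ.- c) ≡ a ℤ.- c
    r = solve-∀ ℤ-ring

  opaque
    -- Write N = p^k·M with p not dividing M, and w - z_p ≡ a·p^k modulo p^(k+1). Subtracting N·a·u,
    -- where Mu ≡ 1 modulo p, corrects the next p-adic digit; any other prime sees a change
    -- divisible by N.
    extend : ∀ N w → 1 ℕ.≤ N → Agrees N w → ∀ p → Prime p → ∃[ j ] Agrees (p ℕ.* N) (w ℤ.+ + N ℤ.* j)
    extend N w 1≤N ag p pr with split-prime pr N 1≤N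
    ... | k , M , N≡ , p∤M with inverse-mod-prime M pr p∤M | ∣-level
      where
      r : ∀ a b c → (a ℤ.- b) ℤ.- (c ℤ.- b) ≡ a ℤ.- c
      r = solve-∀ ℤ-ring
      ∣-level : (p ℕ.^ k) ∣ᶻ (w ℤ.- z p (suc k))
      ∣-level = subst ((p ℕ.^ k) ∣ᶻ_) (r w (z p k) (z p (suc k))) (ℤS.∣m∣n⇒∣m-n (ag p pr k (subst (p ℕ.^ k ℕD.∣_) (sym N≡) (ℕD.m∣m*n M))) (ℤS.∣ᵤ⇒∣ {+ (p ℕ.^ k)} {z p (suc k) ℤ.- z p k} (padic p pr k)))
    ... | u , v , Mu≡ | ℤS.divides a wa≡ = j , agrees
      where
      j : ℤ
      j = ℤ.- (a ℤ.* u)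
      w′ : ℤ
      w′ = w ℤ.+ + N ℤ.* j
      N≡ᶻ : + N ≡ + (p ℕ.^ k) ℤ.* + M
      N≡ᶻ = trans (cong +_ N≡) (ℤP.pos-* (p ℕ.^ k) M)
      top : (p ℕ.^ suc k) ∣ᶻ (w′ ℤ.- z p (suc k))
      top = ℤS.divides (ℤ.- (a ℤ.* v)) (trans (l₁ w (z p (suc k)) (+ N) a u) (trans (cong₂ (λ s t → s ℤ.- t ℤ.* (a ℤ.* u)) wa≡ N≡ᶻ)
        (trans (l₂ a (+ (p ℕ.^ k)) (+ M) u) (trans (cong (λ t → a ℤ.* + (p ℕ.^ k) ℤ.* (+ 1 ℤ.- t)) Mu≡)
          (trans (l₃ a (+ (p ℕ.^ k)) v (+ p)) (cong (λ t → ℤ.- (a ℤ.* v) ℤ.* t) (sym (ℤP.pos-* p (p ℕ.^ k)))))))))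
        where
        l₁ : ∀ w z n a u → (w ℤ.+ n ℤ.* (ℤ.- (a ℤ.* u))) ℤ.- z ≡ (w ℤ.- z) ℤ.- n ℤ.* (a ℤ.* u)
        l₁ = solve-∀ ℤ-ring
        l₂ : ∀ a q m u → a ℤ.* q ℤ.- (q ℤ.* m) ℤ.* (a ℤ.* u) ≡ a ℤ.* q ℤ.* (+ 1 ℤ.- m ℤ.* u)
        l₂ = solve-∀ ℤ-ring
        l₃ : ∀ a q v p → a ℤ.* q ℤ.* (+ 1 ℤ.- (+ 1 ℤ.+ v ℤ.* p)) ≡ ℤ.- (a ℤ.* v) ℤ.* (p ℤ.* q)
        l₃ = solve-∀ ℤ-ring
      agrees : Agrees (p ℕ.* N) w′
      agrees q qr l q∣ with q ℕ.≟ p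
      ... | yes refl = lower-level q qr {l} {suc k} {w′} (power∣⇒≤ qr l (suc k) M p∤M (subst (q ℕ.^ l ℕD.∣_) (trans (cong (q ℕ.*_) N≡) (sym (ℕP.*-assoc q (q ℕ.^ k) M))) q∣)) top
      ... | no q≢p = subst ((q ℕ.^ l) ∣ᶻ_) (l₁ w (z q l) (+ N ℤ.* j)) (ℤS.∣m∣n⇒∣m+n (ag q qr l q∣N) (ℤS.∣m⇒∣m*n {+ (q ℕ.^ l)} {+ N} j (ℤS.∣ᵤ⇒∣ {+ (q ℕ.^ l)} {+ N} q∣N)))
        where
        l₁ : ∀ w z x → (w ℤ.- z) ℤ.+ x ≡ (w ℤ.+ x) ℤ.- z
        l₁ = solve-∀ ℤ-ring
        q∤p : ¬ (q ℕD.∣ p)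
        q∤p d with prime⇒irreducible pr d
        ... | inj₁ refl = ℕP.<-irrefl refl (ℕ.nonTrivial⇒n>1 1 ⦃ prime⇒nonTrivial qr ⦄)
        ... | inj₂ e = q≢p e
        q∣N : q ℕ.^ l ℕD.∣ N
        q∣N = ℕCop.coprime-divisor (coprime-power p qr q∤p l) q∣

  -- If p^k is the exact power of p in n, agreement modulo p^(k+1) gives p^(k+1) dividing P(w′),
  -- since z_p is a root. The part of n prime to p survives because w′ ≡ w modulo n.
  step : ∀ D n w → 1 ℕ.≤ D → 1 ℕ.≤ n → Agrees (D ℕ.* n) w → n ∣ᶻ eval P w → ∀ p → Prime p →
    ∃[ w′ ] (D ∣ᶻ (w′ ℤ.- w) × Agrees (D ℕ.* (p ℕ.* n)) w′ × (p ℕ.* n) ∣ᶻ eval P w′)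
  step D n w 1≤D 1≤n ag n∣ p pr = w′ , D∣ , ag″ , subst (_∣ᶻ eval P w′) (trans (ℕP.*-assoc p (p ℕ.^ k) M) (cong (p ℕ.*_) (sym n≡))) (∣-product (coprime-power M pr p∤M (suc k)) top∣ M∣)
    where
    ex : ∃[ j ] Agrees (p ℕ.* (D ℕ.* n)) (w ℤ.+ + (D ℕ.* n) ℤ.* j)
    ex = extend (D ℕ.* n) w (ℕP.*-mono-≤ 1≤D 1≤n) ag p pr
    sp : Splits p n
    sp = split-prime pr n 1≤n
    j : ℤ
    j = proj₁ ex
    k M : ℕ
    k = proj₁ sp
    M = proj₁ (proj₂ sp)
    n≡ : n ≡ p ℕ.^ k ℕ.* M
    n≡ = proj₁ (proj₂ (proj₂ sp))
    p∤M : ¬ (p ℕD.∣ M)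
    p∤M = proj₂ (proj₂ (proj₂ sp))
    w′ : ℤ
    w′ = w ℤ.+ + (D ℕ.* n) ℤ.* j
    diff : w′ ℤ.- w ≡ + (D ℕ.* n) ℤ.* j
    diff = l w (+ (D ℕ.* n) ℤ.* j)
      where
      l : ∀ w x → (w ℤ.+ x) ℤ.- w ≡ x
      l = solve-∀ ℤ-ring
    Dn∣ : (D ℕ.* n) ∣ᶻ (w′ ℤ.- w)
    Dn∣ = subst ((D ℕ.* n) ∣ᶻ_) (sym diff) (ℤS.∣m⇒∣m*n {+ (D ℕ.* n)} {+ (D ℕ.* n)} j (ℤS.∣-refl {+ (D ℕ.* n)}))
    D∣ : D ∣ᶻ (w′ ℤ.- w)
    D∣ = ∣ᶻ-trans (ℕD.m∣m*n n) Dn∣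
    ag″ : Agrees (D ℕ.* (p ℕ.* n)) w′
    ag″ = subst (λ N → Agrees N w′) (l p D n) (proj₂ ex)
      where
      l : ∀ p D n → p ℕ.* (D ℕ.* n) ≡ D ℕ.* (p ℕ.* n)
      l = ℕR.solve-∀
    n∣′ : n ∣ᶻ eval P w′
    n∣′ = subst (n ∣ᶻ_) (l (eval P w′) (eval P w)) (ℤS.∣m∣n⇒∣m+n (eval-congruent P (+ n) w′ w (∣ᶻ-trans (ℕD.n∣m*n D) Dn∣)) n∣)
      where
      l : ∀ a b → (a ℤ.- b) ℤ.+ b ≡ a
      l = solve-∀ ℤ-ring
    M∣ : M ∣ᶻ eval P w′
    M∣ = ∣ᶻ-trans (subst (M ℕD.∣_) (sym n≡) (ℕD.n∣m*n (p ℕ.^ k))) n∣′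
    pk∣ : p ℕ.^ suc k ℕD.∣ D ℕ.* (p ℕ.* n)
    pk∣ = ℕD.∣-trans (subst (p ℕ.^ suc k ℕD.∣_) (trans (ℕP.*-assoc p (p ℕ.^ k) M) (cong (p ℕ.*_) (sym n≡))) (ℕD.m∣m*n M)) (ℕD.n∣m*n D)
    top∣ : (p ℕ.^ suc k) ∣ᶻ eval P w′
    top∣ = subst ((p ℕ.^ suc k) ∣ᶻ_) (l (eval P w′) (eval P (z p (suc k))))
      (ℤS.∣m∣n⇒∣m+n (eval-congruent P (+ (p ℕ.^ suc k)) w′ (z p (suc k)) (ag″ p pr (suc k) pk∣)) (ℤS.∣ᵤ⇒∣ {+ (p ℕ.^ suc k)} {eval P (z p (suc k))} (vanish p pr (suc k))))
      where
      l : ∀ a b → (a ℤ.- b) ℤ.+ b ≡ a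
      l = solve-∀ ℤ-ring

  -- The prime factors of n are added one at a time. Agreement is carried modulo D times the current
  -- divisor, which keeps w ≡ r modulo D, so w has the form r + Dx.
  root-mod : ∀ D r → 1 ℕ.≤ D → Agrees D r → ∀ n → 1 ℕ.≤ n → ∃[ w ] (D ∣ᶻ (w ℤ.- r) × n ∣ᶻ eval P w)
  root-mod D r 1≤D ag n 1≤n = let w , D∣ , _ , n∣ = go factors factorsPrime in w , D∣ , subst (_∣ᶻ eval P w) (sym isFactorisation) n∣
    where
    open PrimeFactorisation (factorise n ⦃ ℕ.>-nonZero 1≤n ⦄)
    positive : ∀ ps → LAll.All Prime ps → 1 ℕ.≤ product ps
    positive [] _ = ℕP.≤-refl
    positive (p ∷ ps) (pr LAll.∷ prs) = ℕP.*-mono-≤ (ℕ.>-nonZero⁻¹ p ⦃ prime⇒nonZero pr ⦄) (positive ps prs)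
    go : ∀ ps → LAll.All Prime ps → ∃[ w ] (D ∣ᶻ (w ℤ.- r) × Agrees (D ℕ.* product ps) w × product ps ∣ᶻ eval P w)
    go [] _ = r , subst (D ∣ᶻ_) (sym (ℤP.+-inverseʳ r)) (ℤS.∣ᵤ⇒∣ {+ D} {+ 0} (ℕD._∣0 D)) , subst (λ N → Agrees N r) (sym (ℕP.*-identityʳ D)) ag , ℤS.∣ᵤ⇒∣ {+ 1} {eval P r} (ℕD.1∣ ℤ.∣ eval P r ∣)
    go (p ∷ ps) (pr LAll.∷ prs) = w′ , subst (D ∣ᶻ_) (l w′ w r) (ℤS.∣m∣n⇒∣m+n {+ D} {w′ ℤ.- w} {w ℤ.- r} (proj₁ (proj₂ nx)) (proj₁ (proj₂ pv))) , proj₂ (proj₂ nx)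
      where
      pv : ∃[ w ] (D ∣ᶻ (w ℤ.- r) × Agrees (D ℕ.* product ps) w × product ps ∣ᶻ eval P w)
      pv = go ps prs
      w : ℤ
      w = proj₁ pv
      nx : ∃[ w′ ] (D ∣ᶻ (w′ ℤ.- w) × Agrees (D ℕ.* (p ℕ.* product ps)) w′ × (p ℕ.* product ps) ∣ᶻ eval P w′)
      nx = step D (product ps) w 1≤D (positive ps prs) (proj₁ (proj₂ (proj₂ pv))) (proj₂ (proj₂ (proj₂ pv))) p pr
      w′ : ℤ
      w′ = proj₁ nx
      l : ∀ a b c → (a ℤ.- b) ℤ.+ (b ℤ.- c) ≡ a ℤ.- c
      l = solve-∀ ℤ-ring

-- Each division by q > 1 strictly lowers the number, so fuel of at least n does not run out.
ord-bound : ∀ {q} → 1 ℕ.< q → ∀ f n l → 1 ℕ.≤ n → n ℕ.≤ f → q ℕ.^ l ℕD.∣ n → l ℕ.≤ ordF f q n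
ord-bound _ f n zero _ _ _ = ℕ.z≤n
ord-bound {suc zero} (ℕ.s≤s ())
ord-bound {suc (suc q)} 1<q (suc f) (suc n) (suc l) _ (ℕ.s≤s n≤f) d with suc (suc q) ℕD.∣? suc n
... | no ∤ = ⊥-elim (∤ (ℕD.∣-trans (ℕD.m∣m*n (suc (suc q) ℕ.^ l)) d))
... | yes (ℕD.divides m eq) = ℕ.s≤s (subst (λ x → l ℕ.≤ ordF f (suc (suc q)) x) (sym quotient) (ord-bound 1<q f m l 1≤m m≤f
    (ℕD.*-cancelˡ-∣ (suc (suc q)) (subst (suc (suc q) ℕ.^ suc l ℕD.∣_) (trans eq (ℕP.*-comm m _)) d))))
  where
  quotient : suc n ℕDM./ suc (suc q) ≡ m
  quotient = trans (cong (ℕDM._/ suc (suc q)) eq) (ℕDM.m*n/n≡m m (suc (suc q)))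
  1≤m : 1 ℕ.≤ m
  1≤m = positive-factor m eq
    where
    positive-factor : ∀ m {n k} → suc n ≡ m ℕ.* k → 1 ℕ.≤ m
    positive-factor (suc m) _ = ℕ.s≤s ℕ.z≤n
  m≤f : m ℕ.≤ f
  m≤f = ℕP.≤-trans (ℕP.≤-pred (subst (suc m ℕ.≤_) (sym eq) (ℕP.m<m*n m (suc (suc q)) ⦃ ℕ.>-nonZero 1≤m ⦄ 1<q))) n≤f

-- Horner's scheme: coefficients of a + (r + Dx)·C(x) are computed from those of C. Vanishing beyond
-- the degree is recorded because it makes the new top coefficient D times the old one.
shiftedCoefficients : ∀ n P → List.length P ≡ suc n → (r D : ℤ) → Σ (ℕ → ℤ) λ c →
  (∀ l → n ℕ.< l → c l ≡ + 0) × (∀ x → polyEval c n x ≡ eval P (r ℤ.+ D ℤ.* x)) ×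
  (∃[ a ] (List.last P ≡ just a × c n ≡ a ℤ.* D ℤ.^ n))
shiftedCoefficients zero (a ∷ []) refl r D = c , (λ { (suc l) _ → refl }) , (λ x → l₁ a (r ℤ.+ D ℤ.* x)) , a , refl , sym (ℤP.*-identityʳ a)
  where
  c : ℕ → ℤ
  c zero = a
  c (suc l) = + 0
  l₁ : ∀ a y → a ≡ a ℤ.+ y ℤ.* + 0
  l₁ = solve-∀ ℤ-ring
shiftedCoefficients (suc n) (a ∷ P@(b ∷ P′)) eq r D = q , vanishing , evaluation , top , proj₁ leading , topEq
  where
  IH = shiftedCoefficients n P (ℕP.suc-injective eq) r D
  c : ℕ → ℤ
  c = proj₁ IH
  c-zero : ∀ l → n ℕ.< l → c l ≡ + 0
  c-zero = proj₁ (proj₂ IH)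
  c-eval : ∀ x → polyEval c n x ≡ eval P (r ℤ.+ D ℤ.* x)
  c-eval = proj₁ (proj₂ (proj₂ IH))
  top : ℤ
  top = proj₁ (proj₂ (proj₂ (proj₂ IH)))
  leading : List.last P ≡ just top × c n ≡ top ℤ.* D ℤ.^ n
  leading = proj₂ (proj₂ (proj₂ (proj₂ IH)))
  q : ℕ → ℤ
  q zero = a ℤ.+ r ℤ.* c 0
  q (suc l) = r ℤ.* c (suc l) ℤ.+ D ℤ.* c l
  multiply : ∀ m x → polyEval q m x ℤ.+ D ℤ.* c m ℤ.* x ℤ.^ suc m ≡ a ℤ.+ (r ℤ.+ D ℤ.* x) ℤ.* polyEval c m x
  multiply zero x = l₁ a r D (c 0) x
    where
    l₁ : ∀ a r d c x → a ℤ.+ r ℤ.* c ℤ.+ d ℤ.* c ℤ.* (x ℤ.* + 1) ≡ a ℤ.+ (r ℤ.+ d ℤ.* x) ℤ.* c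
    l₁ = solve-∀ ℤ-ring
  multiply (suc m) x = trans (l₁ (polyEval q m x) r (c (suc m)) D (c m) (x ℤ.^ suc m) x)
    (trans (cong (λ t → t ℤ.+ (r ℤ.+ D ℤ.* x) ℤ.* (c (suc m) ℤ.* x ℤ.^ suc m)) (multiply m x)) (l₂ a (r ℤ.+ D ℤ.* x) (polyEval c m x) (c (suc m) ℤ.* x ℤ.^ suc m)))
    where
    l₁ : ∀ p r c′ d c y x → p ℤ.+ (r ℤ.* c′ ℤ.+ d ℤ.* c) ℤ.* y ℤ.+ d ℤ.* c′ ℤ.* (x ℤ.* y) ≡ p ℤ.+ d ℤ.* c ℤ.* y ℤ.+ (r ℤ.+ d ℤ.* x) ℤ.* (c′ ℤ.* y)
    l₁ = solve-∀ ℤ-ring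
    l₂ : ∀ a s p q → (a ℤ.+ s ℤ.* p) ℤ.+ s ℤ.* q ≡ a ℤ.+ s ℤ.* (p ℤ.+ q)
    l₂ = solve-∀ ℤ-ring
  beyond : c (suc n) ≡ + 0
  beyond = c-zero (suc n) ℕP.≤-refl
  topCoefficient : q (suc n) ≡ D ℤ.* c n
  topCoefficient = trans (cong (λ t → r ℤ.* t ℤ.+ D ℤ.* c n) beyond) (l r (D ℤ.* c n))
    where
    l : ∀ r x → r ℤ.* + 0 ℤ.+ x ≡ x
    l = solve-∀ ℤ-ring
  evaluation : ∀ x → polyEval q (suc n) x ≡ a ℤ.+ (r ℤ.+ D ℤ.* x) ℤ.* eval P (r ℤ.+ D ℤ.* x)
  evaluation x = trans (cong (λ t → polyEval q n x ℤ.+ t ℤ.* x ℤ.^ suc n) topCoefficient) (trans (multiply n x) (cong (λ t → a ℤ.+ (r ℤ.+ D ℤ.* x) ℤ.* t) (c-eval x)))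
  vanishing : ∀ l → suc n ℕ.< l → q l ≡ + 0
  vanishing (suc l) (ℕ.s≤s n<l) = trans (cong₂ (λ s t → r ℤ.* s ℤ.+ D ℤ.* t) (c-zero (suc l) (ℕP.m<n⇒m<1+n n<l)) (c-zero l n<l)) (l₀ r D)
    where
    l₀ : ∀ r d → r ℤ.* + 0 ℤ.+ d ℤ.* + 0 ≡ + 0
    l₀ = solve-∀ ℤ-ring
  topEq : q (suc n) ≡ top ℤ.* D ℤ.^ suc n
  topEq = trans topCoefficient (trans (cong (λ t → D ℤ.* t) (proj₂ leading)) (l D top (D ℤ.^ n)))
    where
    l : ∀ d t x → d ℤ.* (t ℤ.* x) ≡ t ℤ.* (d ℤ.* x)
    l = solve-∀ ℤ-ring

power-congruent : ∀ x Q t l → ∃[ g ] ((x ℤ.+ Q ℤ.* t) ℤ.^ l ≡ x ℤ.^ l ℤ.+ Q ℤ.* g)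
power-congruent x Q t zero = + 0 , l Q
  where
  l : ∀ q → + 1 ≡ + 1 ℤ.+ q ℤ.* + 0
  l = solve-∀ ℤ-ring
power-congruent x Q t (suc l) = x ℤ.* g ℤ.+ t ℤ.* (x ℤ.+ Q ℤ.* t) ℤ.^ l ,
    trans (cong (λ s → (x ℤ.+ Q ℤ.* t) ℤ.* s) eq) (trans (l₁ x Q t (x ℤ.^ l) g) (cong (λ s → x ℤ.* x ℤ.^ l ℤ.+ Q ℤ.* (x ℤ.* g ℤ.+ t ℤ.* s)) (sym eq)))
  where
  IH = power-congruent x Q t l
  g : ℤ
  g = proj₁ IH
  eq : (x ℤ.+ Q ℤ.* t) ℤ.^ l ≡ x ℤ.^ l ℤ.+ Q ℤ.* g
  eq = proj₂ IH
  l₁ : ∀ x q t y g → (x ℤ.+ q ℤ.* t) ℤ.* (y ℤ.+ q ℤ.* g) ≡ x ℤ.* y ℤ.+ q ℤ.* (x ℤ.* g ℤ.+ t ℤ.* (y ℤ.+ q ℤ.* g))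
  l₁ = solve-∀ ℤ-ring

comb-cong : ∀ c e g n → (∀ l → l ℕ.< n → e l ≡ g l) → comb c e n ≡ comb c g n
comb-cong c e g zero h = refl
comb-cong c e g (suc n) h = cong₂ (λ s t → s ℤ.+ c (suc n) ℤ.* t) (comb-cong c e g n (λ l l<n → h l (ℕP.m<n⇒m<1+n l<n))) (h n ℕP.≤-refl)

increment : ℕ → ℤ → (ℕ → ℤ) → ℕ → ℤ
increment d m g l with l ℕP.≟ d
... | yes _ = g l ℤ.+ m
... | no _ = g l

increment-below : ∀ d m g l → l ℕ.< d → increment d m g l ≡ g l
increment-below d m g l l<d with l ℕP.≟ d
... | yes refl = ⊥-elim (ℕP.<-irrefl refl l<d)
... | no _ = refl

increment-at : ∀ d m g → increment d m g d ≡ g d ℤ.+ m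
increment-at d m g with d ℕP.≟ d
... | yes _ = refl
... | no ne = ⊥-elim (ne refl)

-- a root modulo Q·c_d of the polynomial gives solvability modulo Q
solvable-of-roots : ∀ c d → (∀ n → 1 ℕ.≤ n → ∃[ x ] (n ∣ᶻ polyEval c (suc d) x)) → c (suc d) ≢ + 0 → Solvable c (suc d)
solvable-of-roots c d roots c≢0 Q 1≤Q = y , e , ℕ.s≤s ℕ.z≤n , ℤDM.n%ℕd<d (x ℤ.- + 1) Q , value
  where
  instance
    Q≢0 : ℕ.NonZero Q
    Q≢0 = ℕ.>-nonZero 1≤Q
  cd : ℤ
  cd = c (suc d)
  1≤∣cd∣ : 1 ℕ.≤ ℤ.∣ cd ∣
  1≤∣cd∣ = ℕP.n≢0⇒n>0 (λ eq → c≢0 (ℤP.∣i∣≡0⇒i≡0 eq))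
  rt : ∃[ x ] ((Q ℕ.* ℤ.∣ cd ∣) ∣ᶻ polyEval c (suc d) x)
  rt = roots (Q ℕ.* ℤ.∣ cd ∣) (ℕP.*-mono-≤ 1≤Q 1≤∣cd∣)
  x : ℤ
  x = proj₁ rt
  cd∣ : (+ Q ℤ.* cd) ℤS.∣ polyEval c (suc d) x
  cd∣ = ℤS.∣ᵤ⇒∣ {+ Q ℤ.* cd} {polyEval c (suc d) x} (subst (ℕD._∣ ℤ.∣ polyEval c (suc d) x ∣) (sym (ℤP.abs-* (+ Q) cd)) (ℤS.∣⇒∣ᵤ (proj₂ rt)))
  m : ℤ
  m = ℤS._∣_.quotient cd∣
  rem : ℕ
  rem = (x ℤ.- + 1) ℤDM.%ℕ Q
  quo : ℤ
  quo = (x ℤ.- + 1) ℤDM./ℕ Q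
  y : ℕ
  -- Reducing x - 1 and adding 1 puts the representative in [1, Q] instead of [0, Q).
  y = suc rem
  y-eq : + y ≡ x ℤ.+ + Q ℤ.* (ℤ.- quo)
  y-eq = trans (cong (λ t → + 1 ℤ.+ t) (sym (l₁ (+ rem) quo (+ Q)))) (trans (cong (λ t → + 1 ℤ.+ (t ℤ.- quo ℤ.* + Q)) (sym (ℤDM.a≡a%ℕn+[a/ℕn]*n (x ℤ.- + 1) Q))) (l₂ x quo (+ Q)))
    where
    l₁ : ∀ r q n → (r ℤ.+ q ℤ.* n) ℤ.- q ℤ.* n ≡ r
    l₁ = solve-∀ ℤ-ring
    l₂ : ∀ x q n → + 1 ℤ.+ ((x ℤ.- + 1) ℤ.- q ℤ.* n) ≡ x ℤ.+ n ℤ.* (ℤ.- q)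
    l₂ = solve-∀ ℤ-ring
  g : ℕ → ℤ
  g l = proj₁ (power-congruent x (+ Q) (ℤ.- quo) (suc l))
  e : ℕ → ℤ
  -- The value at x is m·Q·c_{d+1}, a multiple of the last generator of the lattice, so m is added
  -- to the last coordinate.
  e = increment d m g
  value : polyEval c (suc d) (+ y) ≡ + Q ℤ.* comb c e (suc d)
  value = trans (polyEval-difference c (suc d) x (+ y) (+ Q) g (λ l → trans (cong (ℤ._^ suc l) y-eq) (proj₂ (power-congruent x (+ Q) (ℤ.- quo) (suc l)))))
    (trans (cong (λ t → t ℤ.+ + Q ℤ.* comb c g (suc d)) (ℤS._∣_.equality cd∣)) (trans (l₁ m (+ Q) cd (comb c g d) (g d))
      (cong (λ t → + Q ℤ.* t) (sym (cong₂ (λ s t → s ℤ.+ cd ℤ.* t) (comb-cong c e g d (increment-below d m g)) (increment-at d m g))))))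
    where
    l₁ : ∀ m q c s g → m ℤ.* (q ℤ.* c) ℤ.+ q ℤ.* (s ℤ.+ c ℤ.* g) ≡ q ℤ.* (s ℤ.+ c ℤ.* (g ℤ.+ m))
    l₁ = solve-∀ ℤ-ring

agrees-of-IsRD : ∀ P z m D r → IsRootChoice P z m → 1 ℕ.≤ D → IsRD z D r → ∀ p → Prime p → ∀ k → p ℕ.^ k ℕD.∣ D → (p ℕ.^ k) ∣ᶻ (r ℤ.- z p k)
agrees-of-IsRD P z m D r rc 1≤D (_ , _ , h) p pr k d = Roots.lower-level P z (λ p pr → proj₁ (rc p pr)) (λ p pr → proj₁ (proj₂ (rc p pr))) p pr {k} {ord p D} {r}
  (ord-bound (ℕ.nonTrivial⇒n>1 p ⦃ prime⇒nonTrivial pr ⦄) D D k 1≤D ℕP.≤-refl d) (ℤS.∣ᵤ⇒∣ {+ (p ℕ.^ ord p D)} {r ℤ.- z p (ord p D)} (h p pr))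

-- the auxiliary polynomial, up to the factor λ(D)
auxiliary : ∀ P d → HasDegree P (suc d) → ∀ z m → IsRootChoice P z m → ∀ D → 1 ℕ.≤ D → ∀ r → IsRD z D r →
  Σ (ℕ → ℤ) λ c → (∀ x → polyEval c (suc d) x ≡ eval P (r ℤ.+ + D ℤ.* x)) × Solvable c (suc d)
auxiliary P d (len , lead) z m rc D 1≤D r rd = c , c-eval , solvable-of-roots c d roots top≢0
  where
  sc = shiftedCoefficients (suc d) P len r (+ D)
  c : ℕ → ℤ
  c = proj₁ sc
  c-eval : ∀ x → polyEval c (suc d) x ≡ eval P (r ℤ.+ + D ℤ.* x)
  c-eval = proj₁ (proj₂ (proj₂ sc))
  a : ℤ
  a = proj₁ (proj₂ (proj₂ (proj₂ sc)))
  a≢0 : a ≢ + 0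
  a≢0 = lead a (proj₁ (proj₂ (proj₂ (proj₂ (proj₂ sc)))))
  top≢0 : c (suc d) ≢ + 0
  top≢0 e with ℤP.i*j≡0⇒i≡0∨j≡0 a (trans (sym (proj₂ (proj₂ (proj₂ (proj₂ (proj₂ sc)))))) e)
  ... | inj₁ a≡0 = a≢0 a≡0
  ... | inj₂ D^≡0 = ℕP.<⇒≢ (ℕP.m^n>0 D ⦃ ℕ.>-nonZero 1≤D ⦄ (suc d)) (sym (ℤP.+-injective (trans (pos-^ D (suc d)) D^≡0)))
  roots : ∀ n → 1 ℕ.≤ n → ∃[ x ] (n ∣ᶻ polyEval c (suc d) x)
  roots n 1≤n = q , subst (n ∣ᶻ_) (trans (cong (eval P) w-eq) (sym (c-eval q))) (proj₂ (proj₂ rt))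
    where
    rt : ∃[ w ] (D ∣ᶻ (w ℤ.- r) × n ∣ᶻ eval P w)
    rt = Roots.root-mod P z (λ p pr → proj₁ (rc p pr)) (λ p pr → proj₁ (proj₂ (rc p pr))) D r 1≤D (agrees-of-IsRD P z m D r rc 1≤D rd) n 1≤n
    w : ℤ
    w = proj₁ rt
    q : ℤ
    q = ℤS._∣_.quotient (proj₁ (proj₂ rt))
    w-eq : w ≡ r ℤ.+ + D ℤ.* q
    w-eq = trans (l w r) (trans (cong (λ t → r ℤ.+ t) (ℤS._∣_.equality (proj₁ (proj₂ rt)))) (cong (λ t → r ℤ.+ t) (ℤP.*-comm q (+ D))))
      where
      l : ∀ w r → w ≡ r ℤ.+ (w ℤ.- r)
      l = solve-∀ ℤ-ring

-- Residue rings

⊕-commutativeMonoid : CommutativeMonoid 0ℓ 0ℓ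
⊕-commutativeMonoid = record
  { _≈_ = _≡_ ; _∙_ = _⊕_ ; ε = 0ℚ
  ; isCommutativeMonoid = record
    { isMonoid = record
      { isSemigroup = record
        { isMagma = record { isEquivalence = record { refl = refl ; sym = sym ; trans = trans } ; ∙-cong = cong₂ _⊕_ }
        ; assoc = ⊕-assoc }
      ; identity = ⊕-idˡ , ⊕-idʳ }
    ; comm = ⊕-comm } }

∑-permute : ∀ n (f : Fin n → ℚ) (σ τ : Fin n → Fin n) → (∀ i → σ (τ i) ≡ i) → (∀ i → τ (σ i) ≡ i) → ∑ n (f ∘ σ) ≡ ∑ n f
∑-permute n f σ τ στ τσ = trans (∑-sum n (f ∘ σ)) (trans (sym (S.sum-permute f (Perm.permutation σ τ στ τσ))) (sym (∑-sum n f)))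
  where
  module S = MonoidSum ⊕-commutativeMonoid
  ∑-sum : ∀ n (f : Fin n → ℚ) → ∑ n f ≡ S.sum f
  ∑-sum zero f = refl
  ∑-sum (suc n) f = cong (f zero ⊕_) (∑-sum n (f ∘ suc))

small-multiple : ∀ {m x} → m ∣ᶻ x → ℤ.∣ x ∣ ℕ.< m → x ≡ + 0
small-multiple {m} {x} d lt = ℤP.∣i∣≡0⇒i≡0 (go (ℤS.∣⇒∣ᵤ d) lt)
  where
  go : ∀ {n} → m ℕD.∣ n → n ℕ.< m → n ≡ 0
  go {zero} _ _ = refl
  go {suc n} d lt = ⊥-elim (ℕP.<⇒≱ lt (ℕD.∣⇒≤ d))

module Residues (M′ : ℕ) where
  private
    M : ℕ
    M = suc M′

  rep : Fin M → ℤ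
  rep x = + toℕ x

  opaque
    reduce : ℤ → Fin M
    reduce a = Fin.fromℕ< (ℤDM.n%ℕd<d a M)

    rep-reduce : ∀ a → M ∣ᶻ (a ℤ.- rep (reduce a))
    rep-reduce a = subst (λ n → M ∣ᶻ (a ℤ.- + n)) (sym (FinP.toℕ-fromℕ< (ℤDM.n%ℕd<d a M)))
      (ℤS.divides (a ℤDM./ℕ M) (trans (cong (λ t → t ℤ.- + (a ℤDM.%ℕ M)) (ℤDM.a≡a%ℕn+[a/ℕn]*n a M)) (l (+ (a ℤDM.%ℕ M)) _)))
      where
      l : ∀ r x → (r ℤ.+ x) ℤ.- r ≡ x
      l = solve-∀ ℤ-ring

  rep-injective : ∀ {x y} → M ∣ᶻ (rep x ℤ.- rep y) → x ≡ y
  rep-injective {x} {y} d = FinP.toℕ-injective (ℤP.+-injective (ℤP.i-j≡0⇒i≡j (rep x) (rep y) (small-multiple d (distance (FinP.toℕ<n x) (FinP.toℕ<n y)))))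
    where
    distance : ∀ {a b n} → a ℕ.< n → b ℕ.< n → ℤ.∣ + a ℤ.- + b ∣ ℕ.< n
    distance {a} {b} a<n b<n = ℕP.≤-<-trans (ℕP.≤-reflexive (cong ℤ.∣_∣ (ℤP.m-n≡m⊖n a b))) (ℕP.≤-<-trans (ℤP.∣m⊝n∣≤m⊔n a b) (ℕP.⊔-pres-<m a<n b<n))

  reduce-cong : ∀ {a b} → M ∣ᶻ (a ℤ.- b) → reduce a ≡ reduce b
  reduce-cong {a} {b} d = rep-injective (subst (M ∣ᶻ_) (l a b (rep (reduce a)) (rep (reduce b)))
    (ℤS.∣m∣n⇒∣m-n {+ M} {a ℤ.- b} {(a ℤ.- rep (reduce a)) ℤ.- (b ℤ.- rep (reduce b))} d
      (ℤS.∣m∣n⇒∣m-n {+ M} {a ℤ.- rep (reduce a)} {b ℤ.- rep (reduce b)} (rep-reduce a) (rep-reduce b))))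
    where
    l : ∀ a b x y → (a ℤ.- b) ℤ.- ((a ℤ.- x) ℤ.- (b ℤ.- y)) ≡ x ℤ.- y
    l = solve-∀ ℤ-ring

  reduce-injective : ∀ {a b} → reduce a ≡ reduce b → M ∣ᶻ (a ℤ.- b)
  reduce-injective {a} {b} e = subst (M ∣ᶻ_) (trans (cong (λ x → (a ℤ.- rep (reduce a)) ℤ.- (b ℤ.- rep x)) (sym e)) (l a b (rep (reduce a))))
    (ℤS.∣m∣n⇒∣m-n {+ M} {a ℤ.- rep (reduce a)} {b ℤ.- rep (reduce b)} (rep-reduce a) (rep-reduce b))
    where
    l : ∀ a b x → (a ℤ.- x) ℤ.- (b ℤ.- x) ≡ a ℤ.- b
    l = solve-∀ ℤ-ring

  reduce-rep : ∀ x → reduce (rep x) ≡ x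
  reduce-rep x = rep-injective (subst (M ∣ᶻ_) (l (rep x) (rep (reduce (rep x)))) (ℤS.∣m⇒∣-m {+ M} {rep x ℤ.- rep (reduce (rep x))} (rep-reduce (rep x))))
    where
    l : ∀ x y → ℤ.- (x ℤ.- y) ≡ y ℤ.- x
    l = solve-∀ ℤ-ring

  infixl 6 _+ᶠ_
  infixl 7 _*ᶠ_
  _+ᶠ_ _*ᶠ_ : Fin M → Fin M → Fin M
  x +ᶠ y = reduce (rep x ℤ.+ rep y)
  x *ᶠ y = reduce (rep x ℤ.* rep y)

  -ᶠ_ : Fin M → Fin M
  -ᶠ x = reduce (ℤ.- rep x)

  reduce-+ : ∀ a b → reduce (a ℤ.+ b) ≡ reduce a +ᶠ reduce b
  reduce-+ a b = reduce-cong (subst (M ∣ᶻ_) (l a b (rep (reduce a)) (rep (reduce b)))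
    (ℤS.∣m∣n⇒∣m+n {+ M} {a ℤ.- rep (reduce a)} {b ℤ.- rep (reduce b)} (rep-reduce a) (rep-reduce b)))
    where
    l : ∀ a b x y → (a ℤ.- x) ℤ.+ (b ℤ.- y) ≡ (a ℤ.+ b) ℤ.- (x ℤ.+ y)
    l = solve-∀ ℤ-ring

  reduce-* : ∀ a b → reduce (a ℤ.* b) ≡ reduce a *ᶠ reduce b
  reduce-* a b = reduce-cong (subst (M ∣ᶻ_) (l a b (rep (reduce a)) (rep (reduce b)))
    (ℤS.∣m∣n⇒∣m+n {+ M} {(a ℤ.- rep (reduce a)) ℤ.* b} {rep (reduce a) ℤ.* (b ℤ.- rep (reduce b))}
      (ℤS.∣m⇒∣m*n {+ M} {a ℤ.- rep (reduce a)} b (rep-reduce a)) (ℤS.∣n⇒∣m*n {+ M} (rep (reduce a)) {b ℤ.- rep (reduce b)} (rep-reduce b))))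
    where
    l : ∀ a b x y → (a ℤ.- x) ℤ.* b ℤ.+ x ℤ.* (b ℤ.- y) ≡ a ℤ.* b ℤ.- x ℤ.* y
    l = solve-∀ ℤ-ring

  reduce-neg : ∀ a → reduce (ℤ.- a) ≡ -ᶠ reduce a
  reduce-neg a = reduce-cong (subst (M ∣ᶻ_) (l a (rep (reduce a))) (ℤS.∣m⇒∣-m {+ M} {a ℤ.- rep (reduce a)} (rep-reduce a)))
    where
    l : ∀ a x → ℤ.- (a ℤ.- x) ≡ ℤ.- a ℤ.- (ℤ.- x)
    l = solve-∀ ℤ-ring

  -- This and the other ring laws descend from ℤ: `reduce` respects the operations, and `reduce-rep`
  -- shows that it is onto.
  +ᶠ-assoc : ∀ x y z → x +ᶠ y +ᶠ z ≡ x +ᶠ (y +ᶠ z)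
  +ᶠ-assoc x y z = trans (cong (x +ᶠ y +ᶠ_) (sym (reduce-rep z))) (trans (sym (reduce-+ (rep x ℤ.+ rep y) (rep z)))
    (trans (cong reduce (ℤP.+-assoc (rep x) (rep y) (rep z))) (trans (reduce-+ (rep x) (rep y ℤ.+ rep z)) (cong (_+ᶠ (y +ᶠ z)) (reduce-rep x)))))

  *ᶠ-assoc : ∀ x y z → x *ᶠ y *ᶠ z ≡ x *ᶠ (y *ᶠ z)
  *ᶠ-assoc x y z = trans (cong (x *ᶠ y *ᶠ_) (sym (reduce-rep z))) (trans (sym (reduce-* (rep x ℤ.* rep y) (rep z)))
    (trans (cong reduce (ℤP.*-assoc (rep x) (rep y) (rep z))) (trans (reduce-* (rep x) (rep y ℤ.* rep z)) (cong (_*ᶠ (y *ᶠ z)) (reduce-rep x)))))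

  +ᶠ-comm : ∀ x y → x +ᶠ y ≡ y +ᶠ x
  +ᶠ-comm x y = cong reduce (ℤP.+-comm (rep x) (rep y))

  *ᶠ-comm : ∀ x y → x *ᶠ y ≡ y *ᶠ x
  *ᶠ-comm x y = cong reduce (ℤP.*-comm (rep x) (rep y))

  +ᶠ-identityˡ : ∀ x → reduce (+ 0) +ᶠ x ≡ x
  +ᶠ-identityˡ x = trans (cong (reduce (+ 0) +ᶠ_) (sym (reduce-rep x))) (trans (sym (reduce-+ (+ 0) (rep x))) (trans (cong reduce (ℤP.+-identityˡ (rep x))) (reduce-rep x)))

  *ᶠ-identityˡ : ∀ x → reduce (+ 1) *ᶠ x ≡ x
  *ᶠ-identityˡ x = trans (cong (reduce (+ 1) *ᶠ_) (sym (reduce-rep x))) (trans (sym (reduce-* (+ 1) (rep x))) (trans (cong reduce (ℤP.*-identityˡ (rep x))) (reduce-rep x)))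

  +ᶠ-inverseˡ : ∀ x → -ᶠ x +ᶠ x ≡ reduce (+ 0)
  +ᶠ-inverseˡ x = trans (cong (-ᶠ x +ᶠ_) (sym (reduce-rep x))) (trans (sym (reduce-+ (ℤ.- rep x) (rep x))) (cong reduce (ℤP.+-inverseˡ (rep x))))

  *ᶠ-distribʳ : ∀ x y z → (y +ᶠ z) *ᶠ x ≡ y *ᶠ x +ᶠ z *ᶠ x
  *ᶠ-distribʳ x y z = trans (cong ((y +ᶠ z) *ᶠ_) (sym (reduce-rep x))) (trans (sym (reduce-* (rep y ℤ.+ rep z) (rep x)))
    (trans (cong reduce (ℤP.*-distribʳ-+ (rep x) (rep y) (rep z))) (reduce-+ (rep y ℤ.* rep x) (rep z ℤ.* rep x))))

  isCommutativeRing : IsCommutativeRing _≡_ _+ᶠ_ _*ᶠ_ -ᶠ_ (reduce (+ 0)) (reduce (+ 1))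
  isCommutativeRing = record
    { isRing = record
      { +-isAbelianGroup = record
        { isGroup = record
          { isMonoid = record
            { isSemigroup = record
              { isMagma = record { isEquivalence = record { refl = refl ; sym = sym ; trans = trans } ; ∙-cong = cong₂ _+ᶠ_ }
              ; assoc = +ᶠ-assoc }
            ; identity = +ᶠ-identityˡ , λ x → trans (+ᶠ-comm x _) (+ᶠ-identityˡ x) }
          ; inverse = +ᶠ-inverseˡ , λ x → trans (+ᶠ-comm x _) (+ᶠ-inverseˡ x)
          ; ⁻¹-cong = cong -ᶠ_ }
        ; comm = +ᶠ-comm }
      ; *-cong = cong₂ _*ᶠ_
      ; *-assoc = *ᶠ-assoc
      ; *-identity = *ᶠ-identityˡ , λ x → trans (*ᶠ-comm x _) (*ᶠ-identityˡ x)
      ; distrib = (λ x y z → trans (*ᶠ-comm x _) (trans (*ᶠ-distribʳ x y z) (cong₂ _+ᶠ_ (*ᶠ-comm y x) (*ᶠ-comm z x)))) , *ᶠ-distribʳ }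
    ; *-comm = *ᶠ-comm }

  translate-uniform : ∀ a (f : Fin M → ℚ) → E (uniform M′) (λ x → f (x +ᶠ a)) ≡ E (uniform M′) f
  translate-uniform a f = trans (E-uniform M′ _) (trans (cong (inv M′ ⊗_) (∑-permute M f (_+ᶠ a) (_+ᶠ (-ᶠ a)) minus-plus plus-minus)) (sym (E-uniform M′ f)))
    where
    minus-plus : ∀ x → x +ᶠ (-ᶠ a) +ᶠ a ≡ x
    minus-plus x = trans (+ᶠ-assoc x _ a) (trans (cong (x +ᶠ_) (+ᶠ-inverseˡ a)) (trans (+ᶠ-comm x _) (+ᶠ-identityˡ x)))
    plus-minus : ∀ x → x +ᶠ a +ᶠ (-ᶠ a) ≡ x
    plus-minus x = trans (+ᶠ-assoc x a _) (trans (cong (x +ᶠ_) (trans (+ᶠ-comm a _) (+ᶠ-inverseˡ a))) (trans (+ᶠ-comm x _) (+ᶠ-identityˡ x)))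

  residueRing : FinRing
  residueRing = record
    { R = Fin M ; _+ʳ_ = _+ᶠ_ ; _*ʳ_ = _*ᶠ_ ; -ʳ_ = -ᶠ_ ; 0ʳ = reduce (+ 0) ; 1ʳ = reduce (+ 1)
    ; isCR = isCommutativeRing
    ; red = reduce ; red-+ = reduce-+ ; red-* = reduce-* ; red-neg = reduce-neg ; red-0 = refl ; red-1 = refl
    ; mean = uniform M′ ; translate = translate-uniform ; picks = picks-uniform M′ }

-- Counting solutions

sumOver-cong : ∀ {I : Set} (is : List I) {f g} → (∀ i → f i ≡ g i) → sumOver is f ≡ sumOver is g
sumOver-cong [] h = refl
sumOver-cong (i ∷ is) h = cong₂ _⊕_ (h i) (sumOver-cong is h)

sumOver-++ : ∀ {I : Set} (is js : List I) f → sumOver (is List.++ js) f ≡ sumOver is f ⊕ sumOver js f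
sumOver-++ [] js f = sym (⊕-idˡ _)
sumOver-++ (i ∷ is) js f = trans (cong (f i ⊕_) (sumOver-++ is js f)) (sym (⊕-assoc (f i) _ _))

sumOver-map : ∀ {I J : Set} (h : I → J) is f → sumOver (List.map h is) f ≡ sumOver is (f ∘ h)
sumOver-map h [] f = refl
sumOver-map h (i ∷ is) f = cong (f (h i) ⊕_) (sumOver-map h is f)

sumOver-concatMap : ∀ {I J : Set} (h : I → List J) is f → sumOver (List.concatMap h is) f ≡ sumOver is (λ i → sumOver (h i) f)
sumOver-concatMap h [] f = refl
sumOver-concatMap h (i ∷ is) f = trans (sumOver-++ (h i) _ f) (cong (sumOver (h i) f ⊕_) (sumOver-concatMap h is f))

sumOver-product : ∀ {I J : Set} (is : List I) (js : List J) f → sumOver (List.cartesianProduct is js) f ≡ sumOver is (λ i → sumOver js (λ j → f (i , j)))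
sumOver-product [] js f = refl
sumOver-product (i ∷ is) js f = trans (sumOver-++ (List.map (i ,_) js) _ f) (cong₂ _⊕_ (sumOver-map (i ,_) js f) (sumOver-product is js f))

count-sum : ∀ {I : Set} (b : I → Bool) is → nat (countB b is) ≡ sumOver is (indicator ∘ b)
count-sum b [] = nat-0
count-sum b (i ∷ is) = go (b i) (countB b is) (count-sum b is)
  where
  go : ∀ β n {x} → nat n ≡ x → nat (if β then suc n else n) ≡ indicator β ⊕ x
  go true n e = trans (nat-suc n) (cong (1ℚ ⊕_) e)
  go false n e = trans e (sym (⊕-idˡ _))

sumOver-applyUpTo : ∀ n (g : ℕ → ℕ) f → sumOver (List.applyUpTo g n) f ≡ ∑ n (λ i → f (g (toℕ i)))
sumOver-applyUpTo zero g f = refl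
sumOver-applyUpTo (suc n) g f = cong (f (g 0) ⊕_) (sumOver-applyUpTo n (g ∘ suc) f)

∑-uniform : ∀ n f → ∑ (suc n) f ≡ nat (suc n) ⊗ E (uniform n) f
∑-uniform n f = sym (trans (cong (nat (suc n) ⊗_) (E-uniform n f)) (trans (sym (⊗-assoc _ _ _)) (trans (cong (_⊗ ∑ (suc n) f) (nat-inv n)) (⊗-idˡ _))))

sumOver-range : ∀ n f → sumOver (range (suc n)) f ≡ nat (suc n) ⊗ E (interval n) f
sumOver-range n f = trans (sumOver-applyUpTo (suc n) suc f) (∑-uniform n (f ∘ suc ∘ toℕ))

sumOver-vecs : ∀ n m f → sumOver (vecs (range (suc n)) m) f ≡ nat (suc n ℕ.^ m) ⊗ E (vecMean (interval n) m) f
sumOver-vecs n zero f = trans (⊕-idʳ (f [])) (sym (trans (cong (_⊗ f []) nat-1) (⊗-idˡ (f []))))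
sumOver-vecs n (suc m) f = trans (sumOver-concatMap (λ a → List.map (a ∷_) (vecs (range (suc n)) m)) (range (suc n)) f)
  (trans (sumOver-cong (range (suc n)) (λ a → trans (sumOver-map (a ∷_) (vecs (range (suc n)) m) f) (sumOver-vecs n m (λ v → f (a ∷ v)))))
    (trans (sumOver-range n (λ a → nat (suc n ℕ.^ m) ⊗ E (vecMean (interval n) m) (λ v → f (a ∷ v))))
      (trans (cong (nat (suc n) ⊗_) (Mean.scl (interval n) (nat (suc n ℕ.^ m)) (λ a → E (vecMean (interval n) m) (λ v → f (a ∷ v)))))
        (trans (sym (⊗-assoc (nat (suc n)) (nat (suc n ℕ.^ m)) _)) (cong (_⊗ E (vecMean (interval n) (suc m)) f) (sym (nat-* (suc n) (suc n ℕ.^ m))))))))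

∑-truncate : ∀ m j (f : ℕ → ℚ) → (∀ n → m ℕ.≤ n → f n ≡ 0ℚ) → ∑ (m ℕ.+ j) (f ∘ toℕ) ≡ ∑ m (f ∘ toℕ)
∑-truncate zero j f h = trans (∑-cong j {f ∘ toℕ} {λ _ → 0ℚ} (λ i → h (toℕ i) ℕ.z≤n)) (∑-zero j)
∑-truncate (suc m) j f h = cong (f 0 ⊕_) (∑-truncate m j (f ∘ suc) (λ n m≤n → h (suc n) (ℕ.s≤s m≤n)))

point≤sum : ∀ N′ (f : ℕ → ℚ) → (∀ n → 0ℚ ≤ f n) → ∀ n → InRange N′ n → f n ≤ nat (suc N′) ⊗ E (interval N′) f
point≤sum N′ f f≥0 (suc n) (_ , ℕ.s≤s n≤N) = ≤-trans (go (suc N′) (f ∘ suc) (λ m → f≥0 (suc m)) n (ℕ.s≤s n≤N)) (≡⇒≤ (∑-uniform N′ (f ∘ suc ∘ toℕ)))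
  where
  go : ∀ m (f : ℕ → ℚ) → (∀ n → 0ℚ ≤ f n) → ∀ n → n ℕ.< m → f n ≤ ∑ m (f ∘ toℕ)
  go (suc m) f f≥0 zero _ = ≤-⊕ʳ (∑-nonneg m (λ i → f≥0 (suc (toℕ i))))
  go (suc m) f f≥0 (suc n) (ℕ.s≤s n<m) = ≤-trans (go m (f ∘ suc) (f≥0 ∘ suc) n n<m) (≤-⊕ˡ (f≥0 0))

SupportedOn : ℕ → (ℕ → Bool) → Set
SupportedOn N A = ∀ n → A n ≡ true → 1 ℕ.≤ n × n ℕ.≤ N

-- sets of integers in [1, N′+1] viewed inside ℤ/(M′+1)
module Lift (M′ N′ : ℕ) (N≤M′ : suc N′ ℕ.≤ M′) (A : ℕ → Bool) (supp : SupportedOn (suc N′) A) where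
  open Residues M′
  open RingAverages residueRing

  outside : ∀ n → ¬ (1 ℕ.≤ n × n ℕ.≤ suc N′) → indicator (A n) ≡ 0ℚ
  outside n ∉ = go (A n) refl
    where
    go : ∀ b → A n ≡ b → indicator b ≡ 0ℚ
    go true e = ⊥-elim (∉ (supp n e))
    go false e = refl

  lifted : R → ℚ
  lifted x = indicator (A (toℕ x))

  -- The residue 0 and those above N′ + 1 carry no mass, because the set lies in [1, N′+1] and this
  -- interval fits below the modulus.
  lifted-sum : ∀ h → nat (suc M′) ⊗ E mean (λ x → lifted x ⊗ h x) ≡ nat (suc N′) ⊗ E (interval N′) (λ a → indicator (A a) ⊗ h (reduce (+ a)))
  lifted-sum h = trans (sym (∑-uniform M′ (λ x → lifted x ⊗ h x))) (trans (∑-cong (suc M′) (λ x → cong (lifted x ⊗_) (cong h (sym (reduce-rep x)))))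
      (trans (cong (_⊕ ∑ M′ (f ∘ suc ∘ toℕ)) (trans (cong (_⊗ h (reduce (+ 0))) (outside 0 (λ { (() , _) }))) (⊗-zeroˡ _)))
        (trans (⊕-idˡ _) (trans (cong (λ m → ∑ m (f ∘ suc ∘ toℕ)) (sym (ℕP.m+[n∸m]≡n N≤M′)))
          (trans (∑-truncate (suc N′) (M′ ℕ.∸ suc N′) (f ∘ suc) (λ n N≤n → trans (cong (_⊗ h (reduce (+ suc n))) (outside (suc n) (λ p → ℕP.<⇒≱ (proj₂ p) N≤n))) (⊗-zeroˡ _)))
            (∑-uniform N′ (f ∘ suc ∘ toℕ)))))))
    where
    f : ℕ → ℚ
    f a = indicator (A a) ⊗ h (reduce (+ a))

  lifted-card : nat (suc M′) ⊗ density mean (A ∘ toℕ) ≡ nat (countB A (range (suc N′)))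
  lifted-card = trans (cong (nat (suc M′) ⊗_) (Mean.cng mean (λ x → sym (⊗-idʳ (lifted x))))) (trans (lifted-sum (λ _ → 1ℚ))
    (trans (cong (nat (suc N′) ⊗_) (Mean.cng (interval N′) (λ a → ⊗-idʳ (indicator (A a))))) (sym (trans (count-sum A (range (suc N′))) (sumOver-range N′ (indicator ∘ A))))))

  lifted-form : ∀ {k} (αs : Vec R k) v → nat (suc M′ ℕ.^ k) ⊗ form lifted αs v ≡
    nat (suc N′ ℕ.^ k) ⊗ E (vecMean (interval N′) k) (λ n → indicator (allB A n) ⊗ lifted (v +ʳ linear residueRing αs (Vec.map +_ n)))
  lifted-form [] v = cong (nat 1 ⊗_) (sym (trans (⊗-idˡ _) (cong lifted (C.+-identityʳ v))))
    where module C = IsCommutativeRing isCR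
  lifted-form {suc k} (α ∷ αs) v = trans (cong (_⊗ form lifted (α ∷ αs) v) (nat-* (suc M′) (suc M′ ℕ.^ k)))
      (trans (shuffle (nat (suc M′)) (nat (suc M′ ℕ.^ k)) _) (trans (cong (nat (suc M′ ℕ.^ k) ⊗_) (lifted-sum (λ x → form lifted αs (v +ʳ α *ʳ x))))
        (trans (⊗-left-comm _ (nat (suc N′)) _) (trans (cong (nat (suc N′) ⊗_) (trans (sym (Mean.scl (interval N′) (nat (suc M′ ℕ.^ k)) (λ a → indicator (A a) ⊗ form lifted αs (v +ʳ α *ʳ red (+ a)))))
          (trans (Mean.cng (interval N′) (λ a → trans (⊗-left-comm _ (indicator (A a)) _) (trans (cong (indicator (A a) ⊗_) (lifted-form αs (v +ʳ α *ʳ red (+ a)))) (trans (⊗-left-comm (indicator (A a)) _ _)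
              (cong (nat (suc N′ ℕ.^ k) ⊗_) (collect a))))))
            (Mean.scl (interval N′) (nat (suc N′ ℕ.^ k)) (λ a → E (vecMean (interval N′) k) (λ n → G (a ∷ n)))))))
          (trans (sym (⊗-assoc (nat (suc N′)) _ _)) (cong (_⊗ E (vecMean (interval N′) (suc k)) G) (sym (nat-* (suc N′) (suc N′ ℕ.^ k)))))))))
    where
    module C = IsCommutativeRing isCR
    G : Vec ℕ (suc k) → ℚ
    G n = indicator (allB A n) ⊗ lifted (v +ʳ linear residueRing (α ∷ αs) (Vec.map +_ n))
    shuffle : ∀ x y z → (x ⊗ y) ⊗ z ≡ y ⊗ (x ⊗ z)
    shuffle x y z = trans (⊗-assoc x y z) (⊗-left-comm x y z)
    collect : ∀ a → indicator (A a) ⊗ E (vecMean (interval N′) k) (λ n → indicator (allB A n) ⊗ lifted ((v +ʳ α *ʳ red (+ a)) +ʳ linear residueRing αs (Vec.map +_ n)))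
      ≡ E (vecMean (interval N′) k) (λ n → G (a ∷ n))
    collect a = trans (sym (Mean.scl (vecMean (interval N′) k) (indicator (A a)) _)) (Mean.cng (vecMean (interval N′) k) (λ n →
      trans (sym (⊗-assoc (indicator (A a)) (indicator (allB A n)) _)) (cong₂ _⊗_ (indicator-∧ (A a) (allB A n)) (cong lifted (C.+-assoc v (α *ʳ red (+ a)) (linear residueRing αs (Vec.map +_ n)))))))

solution-sum : ∀ N′ Z′ s t (b : Vec ℕ s × Vec ℕ t → Bool) →
  nat (countB b (List.cartesianProduct (vecs (range (suc N′)) s) (vecs (range (suc Z′)) t))) ≡
  nat (suc Z′ ℕ.^ t) ⊗ E (vecMean (interval Z′) t) (λ z → nat (suc N′ ℕ.^ s) ⊗ E (vecMean (interval N′) s) (λ n → indicator (b (n , z))))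
solution-sum N′ Z′ s t b = trans (count-sum b (List.cartesianProduct (vecs (range (suc N′)) s) (vecs (range (suc Z′)) t))) (trans (sumOver-product (vecs (range (suc N′)) s) (vecs (range (suc Z′)) t) (indicator ∘ b))
  (trans (sumOver-cong (vecs (range (suc N′)) s) (λ n → sumOver-vecs Z′ t (λ z → indicator (b (n , z))))) (trans (sumOver-vecs N′ s _)
    (trans (cong (nat (suc N′ ℕ.^ s) ⊗_) (trans (Mean.scl (vecMean (interval N′) s) (nat (suc Z′ ℕ.^ t)) _) (cong (nat (suc Z′ ℕ.^ t) ⊗_) (fubini (vecMean (interval N′) s) (vecMean (interval Z′) t) (λ n z → indicator (b (n , z)))))))
      (trans (⊗-left-comm _ _ _) (cong (nat (suc Z′ ℕ.^ t) ⊗_) (sym (Mean.scl (vecMean (interval Z′) t) (nat (suc N′ ℕ.^ s)) _))))))))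

weight : ∀ {n} → Vec ℤ n → ℕ
weight [] = 0
weight (b ∷ bs) = ℤ.∣ b ∣ ℕ.+ weight bs

linForm-bound : ∀ {n} (bs xs : Vec ℤ n) N → All (λ x → ℤ.∣ x ∣ ℕ.≤ N) xs → ℤ.∣ linForm bs xs ∣ ℕ.≤ weight bs ℕ.* N
linForm-bound [] [] N [] = ℕ.z≤n
linForm-bound (b ∷ bs) (x ∷ xs) N (x≤ ∷ xs≤) = ℕP.≤-trans (ℤP.∣i+j∣≤∣i∣+∣j∣ (b ℤ.* x) (linForm bs xs))
  (ℕP.≤-trans (ℕP.+-mono-≤ (ℕP.≤-trans (ℕP.≤-reflexive (ℤP.abs-* b x)) (ℕP.*-monoʳ-≤ ℤ.∣ b ∣ x≤)) (linForm-bound bs xs N xs≤))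
    (ℕP.≤-reflexive (sym (ℕP.*-distribʳ-+ N ℤ.∣ b ∣ (weight bs)))))

three-true : ∀ a b c {x} → 0ℚ ≤ x → (a ≡ true → b ≡ true → c ≡ true → 1ℚ ≤ x) → indicator a ⊗ (indicator b ⊗ indicator c) ≤ x
three-true true true true p h = ≤-trans (≡⇒≤ (trans (⊗-idˡ _) (⊗-idˡ _))) (h refl refl refl)
three-true true true false p h = ≤-trans (≡⇒≤ (trans (⊗-idˡ _) (⊗-idˡ _))) p
three-true true false c p h = ≤-trans (≡⇒≤ (trans (⊗-idˡ _) (⊗-zeroˡ _))) p
three-true false b c p h = ≤-trans (≡⇒≤ (⊗-zeroˡ _)) p

All-map : ∀ {A B : Set} {P : A → Set} {Q : B → Set} (f : A → B) → (∀ x → P x → Q (f x)) → ∀ {n} {xs : Vec A n} → All P xs → All Q (Vec.map f xs)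
All-map f h [] = []
All-map f h (p ∷ ps) = h _ p ∷ All-map f h ps

-- solutions in ℤ/(M′+1) of the congruence are solutions of the equation once the modulus exceeds both sides
module Transfer (M′ N′ Z′ : ℕ) (N≤M′ : suc N′ ℕ.≤ M′) {k t : ℕ} (b : ℤ) (bs : Vec ℤ k) (L₂ : Vec ℤ t)
  (large : (weight (b ∷ bs) ℕ.+ weight L₂) ℕ.* suc N′ ℕ.≤ M′)
  (b⁻¹ ℓ⁻¹ ℓ : ℤ) (PD Q : ℤ → ℤ)
  (b-unit : Residues.reduce M′ (b ℤ.* b⁻¹) ≡ Residues.reduce M′ (+ 1)) (ℓ-unit : Residues.reduce M′ (ℓ ℤ.* ℓ⁻¹) ≡ Residues.reduce M′ (+ 1))
  (units : All (λ β → Σ ℤ λ y → Residues.reduce M′ (β ℤ.* y) ≡ Residues.reduce M′ (+ 1)) bs)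
  (balanced : linForm (b ∷ bs) (replicate (suc k) (+ 1)) ≡ + 0)
  (Q-PD : ∀ x → Q x ≡ ℓ ℤ.* PD x) (PD≤N : ∀ z → InRange Z′ z → ℤ.∣ PD (+ z) ∣ ℕ.≤ suc N′) where
  open Residues M′
  open RingAverages residueRing
  private module C = IsCommutativeRing isCR

  γ : R
  γ = red b⁻¹

  b-inverse : red b *ʳ γ ≡ 1ʳ
  b-inverse = trans (sym (red-* b b⁻¹)) b-unit

  ℓ-inverse : red ℓ *ʳ red ℓ⁻¹ ≡ 1ʳ
  ℓ-inverse = trans (sym (red-* ℓ ℓ⁻¹)) ℓ-unit

  -- Solving for the first variable gives n₀ = γ·L₂(P_D(z)) - Σ γβᵢnᵢ with γ the inverse of b.
  -- Recurrence sees Q = ℓ·P_D, so the constants also contain the inverse of ℓ.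
  coefficient constant : ℤ → R
  coefficient β = -ʳ (γ *ʳ red β)
  constant β = γ *ʳ (red ℓ⁻¹ *ʳ red β)

  αs : Vec R k
  αs = Vec.map coefficient bs

  ws : Vec R t
  ws = Vec.map constant L₂

  αs-units : All Unit αs
  αs-units = All-map coefficient unit units
    where
    unit : ∀ β → (Σ ℤ λ y → reduce (β ℤ.* y) ≡ reduce (+ 1)) → Unit (coefficient β)
    unit β (y , e) = -ʳ (red b *ʳ red y) , trans (l γ (red β) (red b) (red y)) (trans (cong₂ _*ʳ_ b-inverse (trans (sym (red-* β y)) e)) (C.*-identityˡ 1ʳ))
      where
      l : ∀ g β b y → (-ʳ (g *ʳ β)) *ʳ (-ʳ (b *ʳ y)) ≡ (b *ʳ g) *ʳ (β *ʳ y)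
      l = solve 4 (λ g β b y → (:- (g :* β)) :* (:- (b :* y)) := (b :* g) :* (β :* y)) refl

  linear-αs : ∀ {n} (βs xs : Vec ℤ n) → linear residueRing (Vec.map coefficient βs) xs ≡ -ʳ (γ *ʳ red (linForm βs xs))
  linear-αs [] [] = sym (trans (cong (λ u → -ʳ (γ *ʳ u)) red-0) (l γ))
    where
    l : ∀ g → -ʳ (g *ʳ 0ʳ) ≡ 0ʳ
    l g = trans (cong -ʳ_ (C.zeroʳ g)) (trans (sym (C.+-identityʳ (-ʳ 0ʳ))) (C.-‿inverseˡ 0ʳ))
  linear-αs (β ∷ βs) (x ∷ xs) = trans (cong (coefficient β *ʳ red x +ʳ_) (linear-αs βs xs)) (trans (l γ (red β) (red x) (red (linForm βs xs)))
    (cong (λ u → -ʳ (γ *ʳ u)) (sym (trans (red-+ (β ℤ.* x) (linForm βs xs)) (cong (_+ʳ red (linForm βs xs)) (red-* β x))))))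
    where
    l : ∀ g β x r → (-ʳ (g *ʳ β)) *ʳ x +ʳ -ʳ (g *ʳ r) ≡ -ʳ (g *ʳ (β *ʳ x +ʳ r))
    l = solve 4 (λ g β x r → (:- (g :* β)) :* x :+ :- (g :* r) := :- (g :* (β :* x :+ r))) refl

  total-linear : ∀ {n} (βs : Vec R n) → total βs ≡ linear residueRing βs (replicate n (+ 1))
  total-linear [] = refl
  total-linear (β ∷ βs) = cong₂ _+ʳ_ (sym (trans (cong (β *ʳ_) red-1) (C.*-identityʳ β))) (total-linear βs)

  αs-total : total αs ≡ 1ʳ
  αs-total = trans (total-linear αs) (trans (linear-αs bs (replicate k (+ 1))) (trans (cong (λ u → -ʳ (γ *ʳ red u)) rest)
    (trans (cong (λ u → -ʳ (γ *ʳ u)) (red-neg b)) (trans (l γ (red b)) b-inverse))))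
    where
    rest : linForm bs (replicate k (+ 1)) ≡ ℤ.- b
    rest = trans (m b (linForm bs (replicate k (+ 1)))) (trans (cong (λ u → u ℤ.- b) balanced) (ℤP.+-identityˡ (ℤ.- b)))
      where
      m : ∀ b x → x ≡ (b ℤ.* + 1 ℤ.+ x) ℤ.- b
      m = solve-∀ ℤ-ring
    l : ∀ g b → -ʳ (g *ʳ (-ʳ b)) ≡ b *ʳ g
    l = solve 2 (λ g b → :- (g :* (:- b)) := b :* g) refl

  linear-ws : ∀ {n} (βs : Vec ℤ n) (zs : Vec ℕ n) → linear residueRing (Vec.map constant βs) (Vec.map (λ z → Q (+ z)) zs) ≡ γ *ʳ red (linForm βs (Vec.map (λ z → PD (+ z)) zs))
  linear-ws [] [] = sym (trans (cong (γ *ʳ_) red-0) (C.zeroʳ γ))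
  linear-ws (β ∷ βs) (z ∷ zs) = trans (cong₂ (λ u v → constant β *ʳ u +ʳ v) (trans (cong red (Q-PD (+ z))) (red-* ℓ (PD (+ z)))) (linear-ws βs zs))
    (trans (l γ (red ℓ⁻¹) (red β) (red ℓ) (red (PD (+ z))) (red (linForm βs (Vec.map (λ z → PD (+ z)) zs))))
      (trans (cong (λ u → γ *ʳ (u *ʳ (red β *ʳ red (PD (+ z))) +ʳ red (linForm βs (Vec.map (λ z → PD (+ z)) zs)))) ℓ-inverse)
        (cong (γ *ʳ_) (sym (trans (red-+ (β ℤ.* PD (+ z)) _) (cong (_+ʳ red (linForm βs (Vec.map (λ z → PD (+ z)) zs))) (trans (red-* β (PD (+ z))) (sym (C.*-identityˡ _)))))))))
    where
    l : ∀ g i β l p r → (g *ʳ (i *ʳ β)) *ʳ (l *ʳ p) +ʳ g *ʳ r ≡ g *ʳ ((l *ʳ i) *ʳ (β *ʳ p) +ʳ r)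
    l = solve 6 (λ g i β l p r → (g :* (i :* β)) :* (l :* p) :+ g :* r := g :* ((l :* i) :* (β :* p) :+ r)) refl

  base : Vec ℕ t → R
  base z = linear residueRing ws (Vec.map (λ z → Q (+ z)) z)

  completion : Vec ℕ k → Vec ℕ t → R
  completion n z = base z +ʳ linear residueRing αs (Vec.map +_ n)

  rhs : Vec ℕ t → ℤ
  rhs z = linForm L₂ (Vec.map (λ z → PD (+ z)) z)

  completion-congruent : ∀ n z → reduce (linForm (b ∷ bs) (Vec.map +_ (toℕ (completion n z) ∷ n))) ≡ reduce (rhs z)
  completion-congruent n z = trans (red-+ (b ℤ.* rep u) rest) (trans (cong (_+ʳ red rest) (trans (red-* b (rep u)) (cong (red b *ʳ_) (trans (reduce-rep u)
      (cong₂ _+ʳ_ (linear-ws L₂ z) (linear-αs bs (Vec.map +_ n)))))))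
      (trans (l (red b) γ (red (rhs z)) (red rest)) (trans (cong (λ e → e *ʳ red (rhs z) +ʳ (-ʳ (e *ʳ red rest) +ʳ red rest)) b-inverse) (trans
        (cong₂ _+ʳ_ (C.*-identityˡ _) (trans (cong (λ e → -ʳ e +ʳ red rest) (C.*-identityˡ _)) (C.-‿inverseˡ (red rest)))) (C.+-identityʳ _)))))
    where
    u : R
    u = completion n z
    rest : ℤ
    rest = linForm bs (Vec.map +_ n)
    l : ∀ b g p r → b *ʳ (g *ʳ p +ʳ -ʳ (g *ʳ r)) +ʳ r ≡ (b *ʳ g) *ʳ p +ʳ (-ʳ ((b *ʳ g) *ʳ r) +ʳ r)
    l = solve 4 (λ b g p r → b :* (g :* p :+ :- (g :* r)) :+ r := (b :* g) :* p :+ (:- ((b :* g) :* r) :+ r)) refl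

  completion-solves : ∀ n z → All (InRange N′) n → All (InRange Z′) z → InRange N′ (toℕ (completion n z)) →
    linForm (b ∷ bs) (Vec.map +_ (toℕ (completion n z) ∷ n)) ≡ rhs z
  completion-solves n z ns zs u≤N = ℤP.i-j≡0⇒i≡j lhs (rhs z) (small-multiple (reduce-injective (completion-congruent n z)) (ℕ.s≤s
      (ℕP.≤-trans (ℤP.∣i-j∣≤∣i∣+∣j∣ lhs (rhs z)) (ℕP.≤-trans (ℕP.+-mono-≤
        (linForm-bound (b ∷ bs) _ (suc N′) (All-map +_ (λ _ → proj₂) (u≤N ∷ ns))) (linForm-bound L₂ _ (suc N′) (All-map (λ z → PD (+ z)) PD≤N zs)))
        (ℕP.≤-trans (ℕP.≤-reflexive (sym (ℕP.*-distribʳ-+ (suc N′) (weight (b ∷ bs)) (weight L₂)))) large)))))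
    where
    lhs : ℤ
    lhs = linForm (b ∷ bs) (Vec.map +_ (toℕ (completion n z) ∷ n))

  module _ (A C : ℕ → Bool) (supp : SupportedOn (suc N′) A) (c : ℚ) (0≤c : 0ℚ ≤ c) where
    open Lift M′ N′ N≤M′ A supp using (lifted; lifted-form)

    solves : Vec ℕ (suc k) × Vec ℕ t → Bool
    solves nz = allB A (proj₁ nz) ∧ allB C (proj₂ nz) ∧ does (linForm (b ∷ bs) (Vec.map +_ (proj₁ nz)) ℤ.≟ linForm L₂ (Vec.map (λ z → PD (+ z)) (proj₂ nz)))

    -- Given n and z, the residue n₀ is determined. If it lies in A it is an integer in range that
    -- solves the equation, and so contributes at least one term to the sum over n₀.
    few : ∀ n z → All (InRange N′) n → All (InRange Z′) z →
      indicator (allB C z) ⊗ (indicator (allB A n) ⊗ lifted (completion n z)) ≤ nat (suc N′) ⊗ E (interval N′) (λ n₀ → indicator (solves (n₀ ∷ n , z)))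
    few n z ns zs = three-true (allB C z) (allB A n) (A (toℕ (completion n z)))
      (⊗-nonneg (nat-nonneg (suc N′)) (Mean.nonneg (interval N′) (λ n₀ → indicator-nonneg (solves (n₀ ∷ n , z)))))
      (λ cz an au → ≤-trans (≡⇒≤ (cong indicator (sym (holds cz an au)))) (point≤sum N′ (λ n₀ → indicator (solves (n₀ ∷ n , z))) (λ n₀ → indicator-nonneg (solves (n₀ ∷ n , z)))
        (toℕ (completion n z)) (supp (toℕ (completion n z)) au)))
      where
      holds : allB C z ≡ true → allB A n ≡ true → A (toℕ (completion n z)) ≡ true → solves (toℕ (completion n z) ∷ n , z) ≡ true
      holds cz an au = cong₂ _∧_ (cong₂ _∧_ au an) (cong₂ _∧_ cz (dec-true (_ ℤ.≟ _) (completion-solves n z ns zs (supp (toℕ (completion n z)) au))))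

    fibre : ∀ z → All (InRange Z′) z → nat (suc M′ ℕ.^ k) ⊗ (indicator (allB C z) ⊗ form lifted αs (base z)) ≤
      nat (suc N′ ℕ.^ suc k) ⊗ E (vecMean (interval N′) (suc k)) (λ n → indicator (solves (n , z)))
    fibre z zs = ≤-trans (≡⇒≤ (trans (⊗-left-comm _ (indicator (allB C z)) _) (trans (cong (indicator (allB C z) ⊗_) (lifted-form αs (base z)))
          (trans (⊗-left-comm (indicator (allB C z)) _ _) (cong (nat (suc N′ ℕ.^ k) ⊗_) (sym (Mean.scl (vecMean (interval N′) k) (indicator (allB C z)) (λ n → indicator (allB A n) ⊗ lifted (completion n z)))))))))
      (≤-trans (⊗-monoˡ (nat (suc N′ ℕ.^ k)) (nat-nonneg (suc N′ ℕ.^ k)) (interval-vec-mono N′ k (λ n ns → few n z ns zs)))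
        (≡⇒≤ (trans (cong (nat (suc N′ ℕ.^ k) ⊗_) (trans (Mean.scl (vecMean (interval N′) k) (nat (suc N′)) (λ n → E (interval N′) (λ n₀ → indicator (solves (n₀ ∷ n , z)))))
            (cong (nat (suc N′) ⊗_) (fubini (vecMean (interval N′) k) (interval N′) (λ n n₀ → indicator (solves (n₀ ∷ n , z)))))))
          (trans (⊗-left-comm _ _ _) (trans (sym (⊗-assoc _ _ _)) (cong (_⊗ E (vecMean (interval N′) (suc k)) (λ n → indicator (solves (n , z)))) (sym (nat-* (suc N′) (suc N′ ℕ.^ k)))))))))

    -- The form averages over the k free variables, that is s - 1 of the s, which produces the
    -- exponent of N. Passing from (M′+1)^k down to (N′+1)^k keeps a lower bound.
    many-solutions : c ≤ E (vecMean (interval Z′) t) (λ z → indicator (allB C z) ⊗ form lifted αs (base z)) →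
      c ⊗ (nat (suc N′ ℕ.^ k) ⊗ nat (suc Z′ ℕ.^ t)) ≤ nat (solCount (b ∷ bs) L₂ PD (+ suc N′) (suc Z′) A C)
    many-solutions h = ≤-trans (≡⇒≤ (trans (⊗-left-comm c _ _) (trans (cong (nat (suc N′ ℕ.^ k) ⊗_) (⊗-comm c _)) (⊗-left-comm _ _ c))))
      (≤-trans (⊗-monoˡ (nat (suc Z′ ℕ.^ t)) (nat-nonneg (suc Z′ ℕ.^ t)) (≤-trans (⊗-mono (nat-nonneg (suc N′ ℕ.^ k)) (≤-trans 0≤c h) (nat-mono (ℕP.^-monoˡ-≤ k (ℕP.≤-trans N≤M′ (ℕP.n≤1+n M′)))) h)
          (≤-trans (≡⇒≤ (sym (Mean.scl (vecMean (interval Z′) t) (nat (suc M′ ℕ.^ k)) (λ z → indicator (allB C z) ⊗ form lifted αs (base z))))) (interval-vec-mono Z′ t fibre))))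
        (≡⇒≤ (sym (solution-sum N′ Z′ (suc k) t solves))))

-- Size of the auxiliary values, and the modulus

evalℚ-int : ∀ P w → evalℚ P (int w) ≡ int (eval P w)
evalℚ-int [] w = sym int-0
evalℚ-int (a ∷ P) w = trans (cong₂ (λ x y → x ℚ.+ int w ℚ.* y) (sym (int-≡ a)) (evalℚ-int P w))
  (trans (cong (int a ℚ.+_) (sym (⊗-≡ (int w) _))) (trans (sym (⊕-≡ (int a) _)) (trans (cong (int a ⊕_) (sym (int-* w (eval P w)))) (sym (int-+ a _)))))

int-cancel-< : ∀ {i j} → int i < int j → i ℤ.< j
int-cancel-< p = ℤP.≰⇒> (λ q → ℚP.<-irrefl refl (ℚP.<-≤-trans p (int-mono q)))

module _ (P : Poly) (increasing : Increasing P) where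
  increasing-eval : ∀ {x y} → + 1 ℤ.≤ x → x ℤ.< y → + 1 ℤ.≤ eval P x × eval P x ℤ.< eval P y
  increasing-eval {x} {y} 1≤x x<y = int-cancel-≤ (subst₂ _≤_ (sym int-1) (evalℚ-int P x) (proj₁ inc)) , int-cancel-< (subst₂ _<_ (evalℚ-int P x) (evalℚ-int P y) (proj₂ inc))
    where
    inc : 1ℚ ≤ evalℚ P (int x) × evalℚ P (int x) < evalℚ P (int y)
    inc = increasing (int x) (int y) (subst (_≤ int x) int-1 (int-mono 1≤x)) (int-mono-< x<y)

  eval-positive : ∀ {x} → + 1 ℤ.≤ x → + 1 ℤ.≤ eval P x
  eval-positive {x} 1≤x = proj₁ (increasing-eval 1≤x (ℤP.suc[i]≤j⇒i<j {x} ℤP.≤-refl))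

  eval-mono : ∀ {x y} → + 1 ℤ.≤ x → x ℤ.≤ y → eval P x ℤ.≤ eval P y
  eval-mono {x} {y} 1≤x x≤y with x ℤP.≟ y
  ... | yes refl = ℤP.≤-refl
  ... | no x≢y = ℤP.<⇒≤ (proj₂ (increasing-eval 1≤x (ℤP.≤∧≢⇒< x≤y x≢y)))

  eval-large : ∀ n → + suc n ℤ.≤ eval P (+ suc n)
  eval-large zero = eval-positive ℤP.≤-refl
  eval-large (suc n) = ℤP.≤-trans (ℤP.suc-mono (eval-large n)) (ℤP.i<j⇒suc[i]≤j (proj₂ (increasing-eval {+ suc n} {+ suc (suc n)} (ℤ.+≤+ (ℕ.s≤s ℕ.z≤n)) (ℤ.+<+ ℕP.≤-refl))))

norm : ∀ {n} → Vec ℤ n → ℕ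
norm [] = 1
norm (b ∷ bs) = ℤ.∣ b ∣ ℕ.* norm bs

norm-positive : ∀ {n} (bs : Vec ℤ n) → NonDegenerate bs → 1 ℕ.≤ norm bs
norm-positive [] nd = ℕP.≤-refl
norm-positive (b ∷ bs) nd = ℕP.*-mono-≤ (ℕP.n≢0⇒n>0 (λ e → nd zero (ℤP.∣i∣≡0⇒i≡0 e))) (norm-positive bs (nd ∘ suc))

divides-norm : ∀ {n} (bs : Vec ℤ n) → All (λ β → ℤ.∣ β ∣ ℕD.∣ norm bs) bs
divides-norm [] = []
divides-norm (b ∷ bs) = ℕD.m∣m*n (norm bs) ∷ All.map (λ d → ℕD.∣-trans d (ℕD.n∣m*n ℤ.∣ b ∣)) (divides-norm bs)

-- m = β·e gives β·(−e) ≡ 1 modulo m + 1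
divisor-unit : ∀ m β → ℤ.∣ β ∣ ℕD.∣ m → Σ ℤ λ y → Residues.reduce m (β ℤ.* y) ≡ Residues.reduce m (+ 1)
divisor-unit m β d with ℤS.∣ᵤ⇒∣ {β} {+ m} d
... | ℤS.divides e eq = ℤ.- e , Residues.reduce-cong m (ℤS.divides (ℤ.- + 1) (trans (l β e) (trans (cong (λ t → ℤ.- (+ 1 ℤ.+ t)) (sym eq)) (sym (ℤP.-1*i≡-i (+ suc m))))))
  where
  l : ∀ β e → β ℤ.* (ℤ.- e) ℤ.- + 1 ≡ ℤ.- (+ 1 ℤ.+ e ℤ.* β)
  l = solve-∀ ℤ-ring

-- The number m = ℓ·(1 + ⌊WN/ℓ⌋) is one less than the modulus to be used. Since ℓ ≤ N, that modulus
-- is at most (W+2)·N, so passing to residues costs only a bounded factor of density.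
modulus : ∀ ℓ W N → 1 ℕ.≤ ℓ → ℓ ℕ.≤ N → Σ ℕ λ m → W ℕ.* N ℕ.≤ m × suc m ℕ.≤ suc (suc W) ℕ.* N × ℓ ℕD.∣ m
modulus ℓ W N 1≤ℓ ℓ≤N = ℓ ℕ.+ q ℕ.* ℓ ,
    ℕP.≤-trans (ℕP.≤-reflexive (ℕDM.m≡m%n+[m/n]*n (W ℕ.* N) ℓ)) (ℕP.+-monoˡ-≤ (q ℕ.* ℓ) (ℕP.<⇒≤ (ℕDM.m%n<n (W ℕ.* N) ℓ))) ,
    ℕP.+-mono-≤ (ℕP.≤-trans 1≤ℓ ℓ≤N) (ℕP.+-mono-≤ ℓ≤N (ℕDM.m/n*n≤m (W ℕ.* N) ℓ)) ,
    ℕD.divides (suc q) refl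
  where
  instance
    ℓ≢0 : ℕ.NonZero ℓ
    ℓ≢0 = ℕ.>-nonZero 1≤ℓ
  q : ℕ
  q = W ℕ.* N ℕDM./ ℓ

-- Exhaustive search for exceptional sets

countB-cong : ∀ {I : Set} {f g : I → Bool} → (∀ i → f i ≡ g i) → ∀ is → countB f is ≡ countB g is
countB-cong h [] = refl
countB-cong {f = f} {g} h (i ∷ is) = cong₂ (λ b n → if b then suc n else n) (h i) (countB-cong h is)

allB-cong : ∀ {f g : ℕ → Bool} → (∀ n → f n ≡ g n) → ∀ {m} (v : Vec ℕ m) → allB f v ≡ allB g v
allB-cong h [] = refl
allB-cong h (n ∷ v) = cong₂ _∧_ (h n) (allB-cong h v)

decode : ∀ {n} → Vec Bool n → ℕ → Bool
decode [] _ = false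
decode (b ∷ v) zero = b
decode (b ∷ v) (suc n) = decode v n

encode : ∀ n → (ℕ → Bool) → Vec Bool n
encode zero A = []
encode (suc n) A = A 0 ∷ encode n (A ∘ suc)

decode-below : ∀ {n} (v : Vec Bool n) m → decode v m ≡ true → m ℕ.< n
decode-below (b ∷ v) zero e = ℕ.s≤s ℕ.z≤n
decode-below (b ∷ v) (suc m) e = ℕ.s≤s (decode-below v m e)

decode-encode : ∀ n A → (∀ m → A m ≡ true → m ℕ.< n) → ∀ m → decode (encode n A) m ≡ A m
decode-encode zero A h m = go (A m) refl
  where
  go : ∀ b → A m ≡ b → false ≡ A m
  go true e with () ← h m e
  go false e = sym e
decode-encode (suc n) A h zero = refl
decode-encode (suc n) A h (suc m) = decode-encode n (A ∘ suc) (λ l e → ℕP.≤-pred (h (suc l) e)) m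

setOf : ∀ {n} → Vec Bool n → ℕ → Bool
setOf v zero = false
setOf v (suc n) = decode v n

-- Subsets of [1, N] are coded by Boolean vectors, of which there are finitely many. The colour must
-- be fixed before A, and deciding over all codes replaces excluded middle; `ext` transfers the
-- result from codes to arbitrary predicates.
search : ∀ N (Q : (ℕ → Bool) → Set) → (∀ A → Dec (Q A)) → (∀ {A A′} → (∀ n → A n ≡ A′ n) → Q A → Q A′) →
  (∀ A → SupportedOn N A → Q A) ⊎ Σ (ℕ → Bool) λ A → SupportedOn N A × ¬ Q A
search N Q Q? ext with SubsetP.anySubset? {n = N} (λ v → ¬? (Q? (setOf v)))
... | yes (v , bad) = inj₂ (setOf v , (λ { (suc n) e → ℕ.s≤s ℕ.z≤n , decode-below v n e }) , bad)
... | no none = inj₁ (λ A supp → ext (recover A supp) (decidable-stable (Q? _) (λ ¬q → none (encode N (A ∘ suc) , ¬q))))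
  where
  recover : ∀ A → SupportedOn N A → ∀ n → setOf (encode N (A ∘ suc)) n ≡ A n
  recover A supp zero = go (A 0) refl
    where
    go : ∀ b → A 0 ≡ b → false ≡ A 0
    go true e with () ← proj₁ (supp 0 e)
    go false e = sym e
  recover A supp (suc n) = decode-encode N (A ∘ suc) (λ m e → proj₂ (supp (suc m) e)) n

choose : ∀ r {P Q : Fin r → Set} → (∀ i → P i ⊎ Q i) → (∃[ i ] P i) ⊎ (∀ i → Q i)
choose zero h = inj₂ (λ ())
choose (suc r) h with h zero | choose r (h ∘ suc)
... | inj₁ p | _ = inj₁ (zero , p)
... | inj₂ q | inj₁ (i , p) = inj₁ (suc i , p)
... | inj₂ q | inj₂ qs = inj₂ (λ { zero → q ; (suc i) → qs i })

positive-factor : ∀ l x → + 1 ℤ.≤ + l ℤ.* x → Σ ℕ λ n → x ≡ + suc n × 1 ℕ.≤ l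
positive-factor zero x h with ℤ.+≤+ () ← subst (+ 1 ℤ.≤_) (ℤP.*-zeroˡ x) h
positive-factor (suc l) (+ zero) h with ℤ.+≤+ () ← subst (+ 1 ℤ.≤_) (ℤP.*-zeroʳ (+ suc l)) h
positive-factor (suc l) (+ suc n) h = n , refl , ℕ.s≤s ℕ.z≤n
positive-factor (suc l) -[1+ n ] ()

eval-above : ∀ P → Increasing P → ∀ x → + 1 ℤ.≤ x → x ℤ.≤ eval P x
eval-above P inc (+ suc n) h = eval-large P inc n
eval-above P inc (+ zero) (ℤ.+≤+ ())

-- Because r_D > -D, the argument r_D + Dx is at least x for x ≥ 1. It therefore stays in the region
-- where P is positive and increasing.
shift-above : ∀ D rD → ℤ.- (+ suc D) ℤ.< rD → ∀ n → + suc n ℤ.≤ rD ℤ.+ + suc D ℤ.* + suc n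
shift-above D rD h n = subst (+ suc n ℤ.≤_) (l rD (+ D) (+ n)) (ℤP.≤-trans (ℤP.≤-reflexive (sym (ℤP.+-identityʳ (+ suc n))))
    (ℤP.+-monoʳ-≤ (+ suc n) (ℤP.+-mono-≤ excess (subst (+ 0 ℤ.≤_) (ℤP.pos-* D n) (ℤ.+≤+ ℕ.z≤n)))))
  where
  excess : + 0 ℤ.≤ rD ℤ.+ + D
  excess = subst (ℤ._≤ rD ℤ.+ + D) (trans (cong (λ x → x ℤ.+ + D) (suc-neg D)) (ℤP.+-inverseˡ (+ D))) (ℤP.+-monoˡ-≤ (+ D) (ℤP.i<j⇒suc[i]≤j h))
    where
    suc-neg : ∀ D → ℤ.suc (ℤ.- (+ suc D)) ≡ ℤ.- (+ D)
    suc-neg zero = refl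
    suc-neg (suc D) = refl
  l : ∀ r d n → (+ 1 ℤ.+ n) ℤ.+ ((r ℤ.+ d) ℤ.+ d ℤ.* n) ≡ r ℤ.+ (+ 1 ℤ.+ d) ℤ.* (+ 1 ℤ.+ n)
  l = solve-∀ ℤ-ring

nat-cancel : ∀ n {x y} → nat (suc n) ⊗ x ≤ nat (suc n) ⊗ y → x ≤ y
nat-cancel n {x} {y} h = subst₂ _≤_ (undo x) (undo y) (⊗-monoˡ (inv n) (inv-nonneg n) h)
  where
  undo : ∀ x → inv n ⊗ (nat (suc n) ⊗ x) ≡ x
  undo x = trans (sym (⊗-assoc _ _ _)) (trans (cong (_⊗ x) (trans (⊗-comm _ _) (nat-inv n))) (⊗-idˡ x))

implication-fails : ∀ {a b} {A : Set a} {B : Set b} → Dec A → ¬ (A → B) → A × ¬ B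
implication-fails (yes a) h = a , λ b → h (λ _ → b)
implication-fails (no ¬a) h = ⊥-elim (h (λ a → ⊥-elim (¬a a)))

module Assembly (r′ d k t : ℕ) (δ : ℚ) (P : Poly) (deg : HasDegree P (suc d)) (inc : Increasing P)
  (b : ℤ) (bs : Vec ℤ (suc k)) (nd : NonDegenerate (b ∷ bs)) (balanced : linForm (b ∷ bs) (replicate (suc (suc k)) (+ 1)) ≡ + 0) (L₂ : Vec ℤ t)
  (z : ℕ → ℕ → ℤ) (m : ℕ → ℕ) (roots : IsRootChoice P z m)
  (c : ℚ) (0≤c : 0ℚ ≤ c) (bound : ColourBound (suc d) k r′ t (δ ⊗ inv (suc (weight (b ∷ bs) ℕ.+ weight L₂))) c)
  (D : ℕ) (1≤D : 1 ℕ.≤ D) (rD : ℤ) (isRD : IsRD z D rD) (PD : ℤ → ℤ) (isPD : IsPD P m D rD PD) where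

  W ℓ : ℕ
  W = weight (b ∷ bs) ℕ.+ weight L₂
  ℓ = lam m D

  1≤W : 1 ℕ.≤ W
  1≤W = ℕP.≤-trans (ℕP.n≢0⇒n>0 (λ e → nd zero (ℤP.∣i∣≡0⇒i≡0 e))) (ℕP.≤-trans (ℕP.m≤m+n ℤ.∣ b ∣ (weight bs)) (ℕP.m≤m+n (weight (b ∷ bs)) (weight L₂)))

  aux : Σ (ℕ → ℤ) λ cs → (∀ x → polyEval cs (suc d) x ≡ eval P (rD ℤ.+ + D ℤ.* x)) × Solvable cs (suc d)
  aux = auxiliary P d deg z m roots D 1≤D rD isRD

  cs : ℕ → ℤ
  cs = proj₁ aux

  threshold : ℕ
  threshold = proj₁ (bound cs (proj₂ (proj₂ aux)))

  w : ℤ → ℤ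
  w x = rD ℤ.+ + D ℤ.* x

  w-above : ∀ n → + suc n ℤ.≤ w (+ suc n)
  w-above n = subst (λ D → + suc n ℤ.≤ rD ℤ.+ + D ℤ.* + suc n) D≡ (shift-above (ℕ.pred D) rD (subst (λ D → ℤ.- (+ D) ℤ.< rD) (sym D≡) (proj₁ isRD)) n)
    where
    D≡ : suc (ℕ.pred D) ≡ D
    D≡ = ℕP.suc-pred D ⦃ ℕ.>-nonZero 1≤D ⦄

  1≤w : ∀ n → + 1 ℤ.≤ w (+ suc n)
  1≤w n = ℤP.≤-trans (ℤ.+≤+ (ℕ.s≤s ℕ.z≤n)) (w-above n)

  PD-positive : ∀ n → Σ ℕ λ l → PD (+ suc n) ≡ + suc l × 1 ℕ.≤ ℓ
  PD-positive n = positive-factor ℓ (PD (+ suc n)) (subst (+ 1 ℤ.≤_) (sym (isPD (+ suc n))) (eval-positive P inc (1≤w n)))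

  ℓPD : ∀ n {l} → PD (+ suc n) ≡ + suc l → + (ℓ ℕ.* suc l) ≡ eval P (w (+ suc n))
  ℓPD n {l} e = trans (ℤP.pos-* ℓ (suc l)) (trans (cong (λ x → + ℓ ℤ.* x) (sym e)) (isPD (+ suc n)))

  module _ (Z′ N′ : ℕ) (PDZ : PD (+ suc Z′) ≡ + suc N′) (1≤ℓ : 1 ℕ.≤ ℓ) where
    PD≤N : ∀ x → InRange Z′ x → ℤ.∣ PD (+ x) ∣ ℕ.≤ suc N′
    PD≤N (suc n) (_ , n≤Z) with PD-positive n
    ... | l , e , _ = subst (λ x → ℤ.∣ x ∣ ℕ.≤ suc N′) (sym e) (ℕP.*-cancelˡ-≤ ℓ ⦃ ℕ.>-nonZero 1≤ℓ ⦄
      (ℤP.drop‿+≤+ (subst₂ ℤ._≤_ (sym (ℓPD n e)) (sym (ℓPD Z′ PDZ))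
        (eval-mono P inc (1≤w n) (ℤP.+-monoʳ-≤ rD (ℤP.*-monoˡ-≤-nonNeg (+ D) (ℤ.+≤+ n≤Z)))))))

    -- The chain Z ≤ w(Z) ≤ P(w(Z)) = λ(D)·N shows that N outgrows λ(D) times the product of the
    -- coefficients of L₁, as the choice of modulus requires.
    divisor≤N : ℓ ℕ.* (ℓ ℕ.* norm (b ∷ bs)) ℕ.≤ suc Z′ → ℓ ℕ.* norm (b ∷ bs) ℕ.≤ suc N′
    divisor≤N h = ℕP.*-cancelˡ-≤ ℓ ⦃ ℕ.>-nonZero 1≤ℓ ⦄ (ℕP.≤-trans h (ℤP.drop‿+≤+ (subst (+ suc Z′ ℤ.≤_) (sym (ℓPD Z′ PDZ))
      (ℤP.≤-trans (w-above Z′) (eval-above P inc _ (1≤w Z′))))))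

    module _ (threshold≤Z : threshold ℕ.≤ Z′) (ℓ≤N : ℓ ℕ.* norm (b ∷ bs) ℕ.≤ suc N′)
             (C : Fin (suc r′) → ℕ → Bool) (cover : IsCover (suc r′) (suc Z′) C) where
      Good : (i : Fin (suc r′)) (A : ℕ → Bool) → Set
      Good i A = δ ⊗ nat (suc N′) ≤ nat (countB A (range (suc N′))) →
        c ⊗ (nat (suc N′ ℕ.^ suc k) ⊗ nat (suc Z′ ℕ.^ t)) ≤ nat (solCount (b ∷ bs) L₂ PD (+ suc N′) (suc Z′) A (C i))

      good? : ∀ i A → Dec (Good i A)
      good? i A = (_ ℚ.≤? _) →-dec (_ ℚ.≤? _)

      good-cong : ∀ i {A A′} → (∀ n → A n ≡ A′ n) → Good i A → Good i A′
      good-cong i {A} {A′} h = subst₂ (λ x y → δ ⊗ nat (suc N′) ≤ nat x → c ⊗ (nat (suc N′ ℕ.^ suc k) ⊗ nat (suc Z′ ℕ.^ t)) ≤ nat y)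
        (countB-cong h (range (suc N′)))
        (countB-cong (λ nz → cong (λ β → β ∧ allB (C i) (proj₂ nz) ∧ does (linForm (b ∷ bs) (Vec.map +_ (proj₁ nz)) ℤ.≟ linForm L₂ (Vec.map (λ z → PD (+ z)) (proj₂ nz)))) (allB-cong h (proj₁ nz)))
          (List.cartesianProduct (vecs (range (suc N′)) (suc (suc k))) (vecs (range (suc Z′)) t)))

      md : Σ ℕ λ M′ → W ℕ.* suc N′ ℕ.≤ M′ × suc M′ ℕ.≤ suc (suc W) ℕ.* suc N′ × ℓ ℕ.* norm (b ∷ bs) ℕD.∣ M′
      md = modulus (ℓ ℕ.* norm (b ∷ bs)) W (suc N′) (ℕP.*-mono-≤ 1≤ℓ (norm-positive (b ∷ bs) nd)) ℓ≤N
      M′ : ℕ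
      M′ = proj₁ md
      N≤M′ : suc N′ ℕ.≤ M′
      N≤M′ = ℕP.≤-trans (ℕP.≤-reflexive (sym (ℕP.*-identityˡ (suc N′)))) (ℕP.≤-trans (ℕP.*-monoˡ-≤ (suc N′) 1≤W) (proj₁ (proj₂ md)))
      invertible : ∀ β → ℤ.∣ β ∣ ℕD.∣ ℓ ℕ.* norm (b ∷ bs) → Σ ℤ λ y → Residues.reduce M′ (β ℤ.* y) ≡ Residues.reduce M′ (+ 1)
      invertible β d = divisor-unit M′ β (ℕD.∣-trans d (proj₂ (proj₂ (proj₂ md))))
      ℓ-unit : Σ ℤ λ y → Residues.reduce M′ (+ ℓ ℤ.* y) ≡ Residues.reduce M′ (+ 1)
      ℓ-unit = invertible (+ ℓ) (ℕD.m∣m*n (norm (b ∷ bs)))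
      units : All (λ β → Σ ℤ λ y → Residues.reduce M′ (β ℤ.* y) ≡ Residues.reduce M′ (+ 1)) (b ∷ bs)
      units = All.map (λ {β} d → invertible β (ℕD.∣-trans d (ℕD.n∣m*n ℓ))) (divides-norm (b ∷ bs))

      open Transfer M′ N′ Z′ N≤M′ b bs L₂ (proj₁ (proj₂ md)) (proj₁ (All.head units)) (proj₁ ℓ-unit) (+ ℓ) PD (polyEval cs (suc d))
        (proj₂ (All.head units)) (proj₂ ℓ-unit) (All.tail units) balanced (λ x → trans (proj₁ (proj₂ aux) x) (sym (isPD x))) PD≤N

      dense : ∀ A → SupportedOn (suc N′) A → δ ⊗ nat (suc N′) ≤ nat (countB A (range (suc N′))) → 0ℚ ≤ δ → δ ⊗ inv (suc W) ≤ density (uniform M′) (A ∘ toℕ)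
      dense A supp h 0≤δ = nat-cancel M′ (≤-trans (⊗-monoʳ (δ ⊗ inv (suc W)) (⊗-nonneg 0≤δ (inv-nonneg (suc W))) (nat-mono (proj₁ (proj₂ (proj₂ md)))))
        (≤-trans (≡⇒≤ (trans (cong (_⊗ (δ ⊗ inv (suc W))) (nat-* (suc (suc W)) (suc N′))) (trans (shuffle (nat (suc (suc W))) (nat (suc N′)) δ (inv (suc W)))
          (trans (cong ((δ ⊗ nat (suc N′)) ⊗_) (nat-inv (suc W))) (⊗-idʳ _))))) (≤-trans h (≡⇒≤ (sym (Lift.lifted-card M′ N′ N≤M′ A supp))))))
        where
        shuffle : ∀ x y u v → (x ⊗ y) ⊗ (u ⊗ v) ≡ (u ⊗ y) ⊗ (x ⊗ v)
        shuffle x y u v = trans (⊗-assoc x y _) (trans (cong (x ⊗_) (trans (⊗-left-comm y u v) (sym (⊗-assoc u y v)))) (⊗-left-comm x (u ⊗ y) v))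

      good-colour : 0ℚ ≤ δ → ∃[ i ] ∀ A → SupportedOn (suc N′) A → Good i A
      good-colour 0≤δ with choose (suc r′) (λ i → search (suc N′) (Good i) (good? i) (good-cong i))
      ... | inj₁ found = found
      ... | inj₂ bad = ⊥-elim (proj₂ (failure (proj₁ ex)) (many-solutions (A (proj₁ ex)) (C (proj₁ ex)) (supp (proj₁ ex)) c 0≤c (proj₂ ex)))
        where
        A : Fin (suc r′) → ℕ → Bool
        A i = proj₁ (bad i)
        supp : ∀ i → SupportedOn (suc N′) (A i)
        supp i = proj₁ (proj₂ (bad i))
        failure : ∀ i → (δ ⊗ nat (suc N′) ≤ nat (countB (A i) (range (suc N′)))) ×
          ¬ (c ⊗ (nat (suc N′ ℕ.^ suc k) ⊗ nat (suc Z′ ℕ.^ t)) ≤ nat (solCount (b ∷ bs) L₂ PD (+ suc N′) (suc Z′) (A i) (C i)))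
        failure i = implication-fails (_ ℚ.≤? _) (proj₂ (proj₂ (bad i)))
        ex = proj₂ (bound cs (proj₂ (proj₂ aux))) Z′ threshold≤Z (Residues.residueRing M′) αs αs-units αs-total ws (λ i → A i ∘ toℕ)
          (λ i → dense (A i) (supp i) (proj₁ (failure i)) 0≤δ) C (λ n n∈ → proj₂ cover n (proj₁ n∈) (proj₂ n∈))

  Conclusion : (Z : ℕ) (N : ℤ) → (ℕ → Bool) → Set
  Conclusion Z N C = ∀ A → SubsetUpTo A N → δ ℚ.* (N ℚ./ 1) ≤ + card A N ℚ./ 1 →
    c ℚ.* ((N ℤ.^ suc k) ℤ.* (+ (Z ℕ.^ t)) ℚ./ 1) ≤ + solCount (b ∷ bs) L₂ PD N Z A C ℚ./ 1

  translate-conclusion : ∀ Z N′ C → (∀ A → SupportedOn (suc N′) A → δ ⊗ nat (suc N′) ≤ nat (countB A (range (suc N′))) →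
    c ⊗ (nat (suc N′ ℕ.^ suc k) ⊗ nat (Z ℕ.^ t)) ≤ nat (solCount (b ∷ bs) L₂ PD (+ suc N′) Z A C)) → Conclusion Z (+ suc N′) C
  translate-conclusion Z N′ C h A sub dns = subst₂ _≤_ left (int-≡ _) (h A (λ n e → proj₁ (sub n e) , ℤP.drop‿+≤+ (proj₂ (sub n e)))
      (subst₂ _≤_ (sym (trans (⊗-≡ δ _) (cong (δ ℚ.*_) (int-≡ _)))) (sym (int-≡ _)) dns))
    where
    left : c ⊗ (nat (suc N′ ℕ.^ suc k) ⊗ nat (Z ℕ.^ t)) ≡ c ℚ.* (((+ suc N′) ℤ.^ suc k) ℤ.* (+ (Z ℕ.^ t)) ℚ./ 1)
    left = trans (⊗-≡ c _) (cong (c ℚ.*_) (trans (sym (int-* (+ (suc N′ ℕ.^ suc k)) (+ (Z ℕ.^ t)))) (trans (cong (λ x → int (x ℤ.* (+ (Z ℕ.^ t)))) (pos-^ (suc N′) (suc k))) (int-≡ _))))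

  assembled : 0ℚ ≤ δ → ∃[ Z₀ ] ∀ Z → Z₀ ℕ.≤ Z → ∀ C → IsCover (suc r′) Z C → ∃[ i ] Conclusion Z (PD (+ Z)) (C i)
  -- The outer successor excludes Z = 0 and matches the averages over [1, Z′+1] with Z = Z′ + 1.
  assembled 0≤δ = suc (threshold ℕ.+ ℓ ℕ.* (ℓ ℕ.* norm (b ∷ bs))) , go
    where
    go : ∀ Z → suc (threshold ℕ.+ ℓ ℕ.* (ℓ ℕ.* norm (b ∷ bs))) ℕ.≤ Z → ∀ C → IsCover (suc r′) Z C → ∃[ i ] Conclusion Z (PD (+ Z)) (C i)
    go (suc Z′) (ℕ.s≤s large) C cover = proj₁ good , subst (λ N → Conclusion (suc Z′) N (C (proj₁ good))) (sym PDZ) (translate-conclusion (suc Z′) N′ (C (proj₁ good)) (proj₂ good))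
      where
      N′ : ℕ
      N′ = proj₁ (PD-positive Z′)
      PDZ : PD (+ suc Z′) ≡ + suc N′
      PDZ = proj₁ (proj₂ (PD-positive Z′))
      1≤ℓ : 1 ℕ.≤ ℓ
      1≤ℓ = proj₂ (proj₂ (PD-positive Z′))
      threshold≤Z : threshold ℕ.≤ Z′
      threshold≤Z = ℕP.≤-trans (ℕP.m≤m+n threshold _) large
      ℓ≤N : ℓ ℕ.* norm (b ∷ bs) ℕ.≤ suc N′
      ℓ≤N = divisor≤N Z′ N′ PDZ 1≤ℓ (ℕP.≤-trans (ℕP.m≤n+m _ threshold) (ℕP.≤-trans large (ℕP.n≤1+n Z′)))
      good : ∃[ i ] ∀ A → SupportedOn (suc N′) A → Good Z′ N′ PDZ 1≤ℓ threshold≤Z ℓ≤N C cover i A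
      good = good-colour Z′ N′ PDZ 1≤ℓ threshold≤Z ℓ≤N C cover 0≤δ

theorem3p8 : ∀ (r d : ℕ) → 1 ℕ.≤ r → 2 ℕ.≤ d →
    ∀ (δ : ℚ) → 0ℚ ℚ.< δ → δ ℚ.< 1ℚ →
    ∀ (P : Poly) → HasDegree P d → Intersective P → Increasing P →
    ∀ (s t : ℕ) → 1 ℕ.≤ s → S0Le d (s ℕ.+ t) →
    ∀ (L₁ : Vec ℤ s) → NonDegenerate L₁ → linForm L₁ (replicate s (+ 1)) ≡ + 0 →
    ∀ (L₂ : Vec ℤ t) → NonDegenerate L₂ →
    ∀ (z : ℕ → ℕ → ℤ) (m : ℕ → ℕ) → IsRootChoice P z m →
    Σ ℚ λ c → (0ℚ ℚ.< c) ×
    (∀ (D : ℕ) → 1 ℕ.≤ D →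
    ∀ (rD : ℤ) → IsRD z D rD →
    ∀ (PD : ℤ → ℤ) → IsPD P m D rD PD →
    ∃[ Z₀ ] ∀ (Z : ℕ) → Z₀ ℕ.≤ Z →
    ∀ (C : Fin r → ℕ → Bool) → IsCover r Z C →
    ∃[ k ] ∀ (A : ℕ → Bool) → SubsetUpTo A (PD (+ Z)) →
    δ ℚ.* (PD (+ Z) ℚ./ 1) ℚ.≤ (+ card A (PD (+ Z)) ℚ./ 1) →
    c ℚ.* ((PD (+ Z) ℤ.^ (s ℕ.∸ 1)) ℤ.* (+ (Z ℕ.^ t)) ℚ./ 1)
    ℚ.≤ (+ solCount L₁ L₂ PD (PD (+ Z)) Z A (C k) ℚ./ 1))
-- For s = 1 the condition L₁(1) = 0 forces the only coefficient to vanish, against non-degeneracy.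
theorem3p8 (suc r) (suc d) _ _ δ 0<δ _ P deg _ inc (suc zero) t _ _ (b ∷ []) nd balanced = ⊥-elim (nd zero (trans (l b) balanced))
  where
  l : ∀ b → b ≡ b ℤ.* + 1 ℤ.+ + 0
  l = solve-∀ ℤ-ring
theorem3p8 (suc r) (suc d) _ _ δ 0<δ _ P deg _ inc (suc (suc k)) t _ _ (b ∷ bs) nd balanced L₂ _ z m roots =
  -- The constant is fixed here, before D appears. The density is lowered to δ/(W+2), where W is the
  -- sum of the absolute values of all coefficients of both forms, because the modulus is at most
  -- (W+2)·N.
  let c , 0<c , bound = colourBound (suc d) k r t (δ ⊗ inv (suc (weight (b ∷ bs) ℕ.+ weight L₂))) (⊗-pos 0<δ (inv-pos _))
  in c , 0<c , λ D 1≤D rD isRD PD isPD → Assembly.assembled r d k t δ P deg inc b bs nd balanced L₂ z m roots c (<⇒≤ 0<c) bound D 1≤D rD isRD PD isPD (<⇒≤ 0<δ)
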